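{- Let $p$ be an odd prime and $n$ a positive integer with $p\mid n$, and let $\Gamma$ be a Cayley graph over $\mathbb{Z}_n\oplus\mathbb{Z}_p$. Then $\Gamma$ is distance-regular if and only if it is isomorphic to one of the following graphs: (i) the complete graph $K_{np}$; (ii) the complete multipartite graph $K_{t\times m}$ with $tm=np$ (the complement of the disjoint union of $t$ copies of $K_m$); (iii) the complete bipartite graph without a perfect matching $K_{\frac{np}{2},\frac{np}{2}}-\frac{np}{2}K_2$, where $n\equiv 2\pmod 4$; (iv) the graph $\mathrm{Cay}(\mathbb{Z}_p\oplus\mathbb{Z}_p,S)$ with $S=\bigcup_{i=1}^r H_i\setminus\{(0,0)\}$ for some $2\le r\le p-1$, where $H_1,\dots,H_r$ are pairwise distinct subgroups of $\mathbb{Z}_p\oplus\mathbb{Z}_p$ of order $p$. Moreover, the graph in (iv) is the line graph of a transversal design $TD(r,p)$, and it is a strongly regular graph with parameters $(p^2,\,r(p-1),\,p+r^2-3r,\,r^2-r)$.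
   Context: For a finite group $G$ and an inverse-closed subset $S\subseteq G\setminus\{e\}$, the Cayley graph $\mathrm{Cay}(G,S)$ has vertex set $G$, with $g,h$ adjacent iff $g^{ -1}h\in S$. A connected graph is distance-regular if for any two vertices $x,y$ at distance $i$, the numbers of neighbours of $y$ at distance $i-1$, $i$, $i+1$ from $x$ depend only on $i$. A strongly regular graph with parameters $(v,k,\lambda,\mu)$ is a $k$-regular graph on $v$ vertices in which adjacent vertices have $\lambda$ common neighbours and distinct non-adjacent vertices have $\mu$ common neighbours. A transversal design $TD(r,v)$ ($r\le v$) is a triple $(\mathcal P,\mathcal G,\mathcal L)$ where $\mathcal P$ is a set of $rv$ points, $\mathcal G$ is a partition of $\mathcal P$ into $r$ groups of size $v$, $\mathcal L$ is a family of $r$-subsets of $\mathcal P$ (lines), and two distinct points lie in a unique common line iff they lie in distinct groups; its line graph has the lines as vertices, two lines adjacent iff they share a point.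
   Formalization: In (ii) the formal statement requires t ≥ 2: for t = 1 the complement of a single K_{np} is the edgeless graph Cay(G,∅), which is disconnected and hence not distance-regular, so the equivalence fails there. -}

module Defs where

open import Data.Nat using (ℕ; zero; suc; _+_; _*_; _∸_; _≤_; _%_; NonZero)
open import Data.Nat.DivMod using (_mod_)
open import Data.Fin using (Fin; toℕ; remQuot) renaming (zero to fzero; suc to fsuc)
open import Data.Sum using (_⊎_)
open import Data.Fin.Properties using () renaming (_≟_ to _≟F_)
open import Data.Bool using (Bool; true; false; _∧_; _∨_; not; if_then_else_)
open import Data.Product using (Σ; ∃; _×_; _,_; proj₁; proj₂)
open import Relation.Nullary using (¬_; ⌊_⌋)
open import Relation.Binary.PropositionalEquality using (_≡_; _≢_)
open import Function.Bundles using (_↔_; Inverse)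

sumF : ∀ {N} → (Fin N → ℕ) → ℕ
sumF {zero}  f = 0
sumF {suc N} f = f fzero + sumF (λ i → f (fsuc i))

count : ∀ {N} → (Fin N → Bool) → ℕ
count f = sumF (λ i → if f i then 1 else 0)

anyF : ∀ {N} → (Fin N → Bool) → Bool
anyF {zero}  f = false
anyF {suc N} f = f fzero ∨ anyF (λ i → f (fsuc i))

countP : ∀ {a b} → (Fin a × Fin b → Bool) → ℕ
countP f = sumF (λ i → count (λ j → f (i , j)))

anyP : ∀ {a b} → (Fin a × Fin b → Bool) → Bool
anyP f = anyF (λ i → anyF (λ j → f (i , j)))

_==F_ : ∀ {N} → Fin N → Fin N → Bool
x ==F y = ⌊ x ≟F y ⌋

_==P_ : ∀ {a b} → Fin a × Fin b → Fin a × Fin b → Bool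
(x , y) ==P (x' , y') = (x ==F x') ∧ (y ==F y')

record Graph : Set where
  field
    N   : ℕ
    adj : Fin N → Fin N → Bool
open Graph public

Iso : Graph → Graph → Set
Iso G H = Σ (Fin (N G) ↔ Fin (N H)) λ f →
  ∀ x y → adj G x y ≡ adj H (Inverse.to f x) (Inverse.to f y)

module _ (G : Graph) where
  reach : ℕ → Fin (N G) → Fin (N G) → Bool
  reach zero    x y = x ==F y
  reach (suc k) x y = reach k x y ∨ anyF (λ z → reach k x z ∧ adj G z y)

  distIs : ℕ → Fin (N G) → Fin (N G) → Bool
  distIs zero    x y = reach zero x y
  distIs (suc d) x y = reach (suc d) x y ∧ not (reach d x y)

  Dist : Fin (N G) → Fin (N G) → ℕ → Set
  Dist x y d = distIs d x y ≡ true

  Connected : Set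
  Connected = ∀ x y → ∃ λ d → reach d x y ≡ true

  nbrsAt : Fin (N G) → Fin (N G) → ℕ → ℕ
  nbrsAt x y j = count (λ z → adj G y z ∧ distIs j x z)

  DistanceRegular : Set
  DistanceRegular = Connected ×
    (Σ (ℕ → ℕ) λ c → Σ (ℕ → ℕ) λ a → Σ (ℕ → ℕ) λ b →
      ∀ x y i → Dist x y i →
        ((∀ j → i ≡ suc j → nbrsAt x y j ≡ c i)
         × nbrsAt x y i ≡ a i
         × nbrsAt x y (suc i) ≡ b i))

  IsSimple : Set
  IsSimple = (∀ x → adj G x x ≡ false) × (∀ x y → adj G x y ≡ adj G y x)

  commonNbrs : Fin (N G) → Fin (N G) → ℕ
  commonNbrs x y = count (λ z → adj G x z ∧ adj G y z)

  StronglyRegular : ℕ → ℕ → ℕ → ℕ → Set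
  StronglyRegular v k l m =
    N G ≡ v × IsSimple
    × (∀ x → count (adj G x) ≡ k)
    × (∀ x y → x ≢ y → adj G x y ≡ true  → commonNbrs x y ≡ l)
    × (∀ x y → x ≢ y → adj G x y ≡ false → commonNbrs x y ≡ m)

Zsum : ℕ → ℕ → Set
Zsum a b = Fin a × Fin b

module _ (a b : ℕ) .{{_ : NonZero a}} .{{_ : NonZero b}} where
  zeroZ : Zsum a b
  zeroZ = (0 mod a , 0 mod b)

  negZ : Zsum a b → Zsum a b
  negZ (x , y) = ((a ∸ toℕ x) mod a , (b ∸ toℕ y) mod b)

  addZ : Zsum a b → Zsum a b → Zsum a b
  addZ (x , y) (x' , y') = ((toℕ x + toℕ x') mod a , (toℕ y + toℕ y') mod b)

  diffZ : Zsum a b → Zsum a b → Zsum a b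
  diffZ g h = addZ (negZ g) h

  InverseClosed : (Zsum a b → Bool) → Set
  InverseClosed S = ∀ g → S (negZ g) ≡ S g

  Cay : (Zsum a b → Bool) → Graph
  Cay S = record
    { N   = a * b
    ; adj = λ i j → S (diffZ (remQuot b i) (remQuot b j)) }

  SubgroupOfOrder : ℕ → (Zsum a b → Bool) → Set
  SubgroupOfOrder k H =
    H zeroZ ≡ true
    × (∀ g h → H g ≡ true → H h ≡ true → H (addZ g h) ≡ true)
    × (∀ g → H g ≡ true → H (negZ g) ≡ true)
    × countP H ≡ k

Complete : ℕ → Graph
Complete v = record { N = v ; adj = λ x y → not (x ==F y) }

-- complete multipartite graph K_{t×m}: vertex i ↦ (part, index) = remQuot m i
CompleteMultipartite : ℕ → ℕ → Graph
CompleteMultipartite t m = record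
  { N = t * m
  ; adj = λ x y → not (proj₁ (remQuot {t} m x) ==F proj₁ (remQuot {t} m y)) }

-- K_{m,m} minus a perfect matching: vertex i ↦ (side, index) = remQuot m i
CrownGraph : ℕ → Graph
CrownGraph m = record
  { N = 2 * m
  ; adj = λ x y →
      not (proj₁ (remQuot {2} m x) ==F proj₁ (remQuot {2} m y))
      ∧ not (proj₂ (remQuot {2} m x) ==F proj₂ (remQuot {2} m y)) }

unionMinusZero : (p : ℕ) .{{_ : NonZero p}} → ∀ {r} →
  (Fin r → Zsum p p → Bool) → Zsum p p → Bool
unionMinusZero p H g = anyF (λ i → H i g) ∧ not (g ==P zeroZ p p)

ItemIVData : (p : ℕ) .{{_ : NonZero p}} → (r : ℕ) → (Fin r → Zsum p p → Bool) → Set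
ItemIVData p r H =
  2 ≤ r × r ≤ p ∸ 1
  × (∀ i → SubgroupOfOrder p p p (H i))
  × (∀ i j → i ≢ j → ¬ (∀ g → H i g ≡ H j g))

-- Transversal designs TD(r,v): points are Fin r × Fin v, the groups being
-- the fibres of proj₁; lines form a finite family indexed by Fin L.

record TransversalDesign (r v : ℕ) : Set where
  field
    L        : ℕ
    line     : Fin L → Fin r × Fin v → Bool
    lineSize : ∀ l → countP (line l) ≡ r
    distinctGroups : ∀ x y → x ≢ y → proj₁ x ≢ proj₁ y →
      count (λ l → line l x ∧ line l y) ≡ 1
    sameGroup      : ∀ x y → x ≢ y → proj₁ x ≡ proj₁ y →
      count (λ l → line l x ∧ line l y) ≡ 0
open TransversalDesign public

LineGraph : ∀ {r v} → TransversalDesign r v → Graph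
LineGraph T = record
  { N = L T
  ; adj = λ l l' → not (l ==F l') ∧ anyP (λ x → line T l x ∧ line T l' x) }

InList : (n p : ℕ) .{{_ : NonZero p}} → Graph → Set
InList n p Γ =
  Iso Γ (Complete (n * p))
  ⊎ (∃ λ t → ∃ λ m → 2 ≤ t × t * m ≡ n * p × Iso Γ (CompleteMultipartite t m))
  ⊎ (n % 4 ≡ 2 × ∃ λ m → 2 * m ≡ n * p × Iso Γ (CrownGraph m))
  ⊎ (∃ λ r → Σ (Fin r → Zsum p p → Bool) λ H →
        ItemIVData p r H × Iso Γ (Cay p p (unionMinusZero p H)))

{-# OPTIONS --safe #-}

-- Let cl be the distance from 0 in a distance-regular Cayley graph over G = ℤₙ ⊕ ℤₚ. Functions depending
-- only on cl are closed under convolution. Hence, by Frobenius modulo a prime q, the number of x in a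
-- distance class with q x = y is, modulo q, a function of cl y. If q ∤ n this makes multiplication by q
-- permute the distance classes; if q ∣ n it shows that either the classes are nearly stable under the
-- q-torsion subgroup, or some whole class lies in the proper subgroup qG. A subgroup containing a whole
-- class makes the graph multipartite, bipartite or antipodal, and since G is not cyclic one has c₂ ≥ 2,
-- which together with edge counts eliminates the antipodal case. This leaves:
--   n even: q = 2 yields a multipartite graph or a crown graph;
--   n odd with a prime q ≠ p dividing n: multipartite;
--   n = pˢ, s ≥ 2: the multipliers 1 + i pˢ⁻¹ fix every class, so cl is constant on the cosets of
--     pˢ⁻¹G outside the kernel of multiplication by pˢ⁻¹, and counting the x with cl (x + g) ≠ cl x
--     forces a multipartite graph;
--   n = p: if all units fix the connection set, it is a union of lines. Otherwise some unit swaps the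
--     classes 1 and 2; then the diameter is 2, and counting the second moment of the class sizes on the
--     cosets of a line gives integers v + w = p with v² + w² = p (p + 1) / 2, which is impossible.
-- Conversely, labelling the cosets of each line Hᵢ by ℤₚ turns item (iv) into the line graph of a
-- transversal design, and counting common values of two labels gives its strongly regular parameters.
module Submission where

open import Defs hiding (L; line; N)
open import Algebra.Bundles using (CommutativeSemiring)
open import Data.Bool using (Bool; true; false; _∧_; _∨_; not; if_then_else_)
open import Data.Bool.Properties using (∧-comm; not-injective)
open import Data.Empty using (⊥; ⊥-elim)
open import Data.Fin as F using (Fin; toℕ; fromℕ<; remQuot; combine) renaming (zero to fzero; suc to fsuc)
open import Data.Fin.Properties as FP using (any?; all?; toℕ-injective; toℕ<n; toℕ-fromℕ<; remQuot-combine; combine-remQuot) renaming (_≟_ to _≟F_)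
open import Data.List using ([]; _∷_)
open import Data.List.Relation.Unary.All using (All; []; _∷_)
open import Data.Nat using (ℕ; zero; suc; _*_; _+_; _∸_; _^_; _%_; _/_; _≤_; _<_; z≤n; s≤s; NonZero; _≟_; _≤?_)
open import Data.Nat.Base using (_!; pred; nonTrivial⇒n>1; ≢-nonZero; ≢-nonZero⁻¹; >-nonZero; >-nonZero⁻¹)
open import Data.Nat.Combinatorics using (nCk≡n!/k![n-k]!; nCn≡1; k![n∸k]!∣n!) renaming (_C_ to _choose_)
open import Data.Nat.Coprimality as Cop using (Coprime)
open import Data.Nat.DivMod
open import Data.Nat.Divisibility
open import Data.Nat.GCD using (module Bézout)
open import Data.Nat.Induction using (<-rec)
import Data.Nat.ListAction as NL
open import Data.Nat.Primality
open import Data.Nat.Primality.Factorisation using (factorise; PrimeFactorisation)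
open import Data.Nat.Properties
open import Data.Nat.Solver using (module +-*-Solver)
open import Data.Product using (Σ; ∃; ∃₂; _×_; _,_; proj₁; proj₂)
open import Data.Sum using (_⊎_; inj₁; inj₂)
open import Data.Vec as V using (Vec; []; _∷_)
open import Data.Vec.N-ary using (N-ary; Eq; curryⁿ; curryⁿ-cong; _$ⁿ_)
open import Function using (_∘_; id; case_of_)
open import Function.Bundles using (_⇔_; _↔_; Inverse; mk⇔; mk↔ₛ′)
open import Relation.Binary using (tri<; tri≈; tri>)
open import Relation.Binary.PropositionalEquality using (_≡_; _≢_; refl; sym; trans; cong; cong₂; subst; subst₂; module ≡-Reasoning)
open import Relation.Nullary using (¬_; Dec; yes; no; ⌊_⌋; contradiction)
open import Relation.Nullary.Decidable using (_×-dec_; _→-dec_; _⊎-dec_; ¬?)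

-- Everything is counted in natural numbers: the semiring of natural-valued functions on G stands in
-- for the group algebra, and neither characters nor eigenvalues enter. Frobenius takes the place of
-- Schur's theorem on multipliers. For q ≠ p the q-torsion has at most q elements, so a fibre of
-- multiplication by q that meets the connection set in a multiple of q elements either misses it or
-- lies inside it; this is the origin of stability under torsion. A count that is not divisible by q
-- stays so over the whole class of y, hence that class consists of multiples of q. The prime p
-- itself is the obstacle: its torsion has p² elements and the dichotomy breaks down. When no other
-- prime divides n, the argument studies how individual multipliers move the classes instead.
-- Noncyclicity is not cosmetic. Cycles are distance-regular and even ones are antipodal, so c₂ ≥ 2
-- is needed to exclude them, and it comes from the exponent n being smaller than the order of G.
-- Odd order matters as well: there s is a multiple of 2s and no nonzero element is its own
-- negative.

⟦_⟧ : Bool → ℕ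
⟦ b ⟧ = if b then 1 else 0

infix 4 _∈_
_∈_ : {A : Set} → A → (A → Bool) → Set
x ∈ P = P x ≡ true

toYes : {P : Set} (d : Dec P) → P → ⌊ d ⌋ ≡ true
toYes (yes _) p = refl
toYes (no ¬p) p = contradiction p ¬p

fromYes : {P : Set} (d : Dec P) → ⌊ d ⌋ ≡ true → P
fromYes (yes p) _ = p

toNo : {P : Set} (d : Dec P) → ¬ P → ⌊ d ⌋ ≡ false
toNo (yes p) ¬p = contradiction p ¬p
toNo (no _)  ¬p = refl

fromNo : {P : Set} (d : Dec P) → ⌊ d ⌋ ≡ false → ¬ P
fromNo (no ¬p) _ = ¬p

true≢false : ∀ {b} → b ≡ true → b ≡ false → ⊥
true≢false refl ()

¬true⇒false : ∀ {b} → ¬ (b ≡ true) → b ≡ false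
¬true⇒false {true}  h = contradiction refl h
¬true⇒false {false} h = refl

∧-intro : ∀ {a b} → a ≡ true → b ≡ true → a ∧ b ≡ true
∧-intro refl refl = refl

∧-elim : ∀ {a b} → a ∧ b ≡ true → a ≡ true × b ≡ true
∧-elim {true} {true} _ = refl , refl

∨-elim : ∀ {a b} → a ∨ b ≡ true → a ≡ true ⊎ b ≡ true
∨-elim {true}  _ = inj₁ refl
∨-elim {false} e = inj₂ e

∨-introˡ : ∀ {a b} → a ≡ true → a ∨ b ≡ true
∨-introˡ refl = refl

∨-introʳ : ∀ {a b} → b ≡ true → a ∨ b ≡ true
∨-introʳ {true}  _ = refl
∨-introʳ {false} e = e

not-intro : ∀ {a} → a ≡ false → not a ≡ true
not-intro refl = refl

not-elim : ∀ {a} → not a ≡ true → a ≡ false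
not-elim {false} _ = refl

bool-ext : ∀ {a b} → (a ≡ true → b ≡ true) → (b ≡ true → a ≡ true) → a ≡ b
bool-ext {true}  {b}     f g = sym (f refl)
bool-ext {false} {true}  f g = g refl
bool-ext {false} {false} f g = refl

∈? : ∀ {A : Set} (P : A → Bool) x → Dec (x ∈ P)
∈? P x with P x
... | true  = yes refl
... | false = no λ ()

⟦⟧-mono : ∀ {a b} → (a ≡ true → b ≡ true) → ⟦ a ⟧ ≤ ⟦ b ⟧
⟦⟧-mono {true}  f rewrite f refl = ≤-refl
⟦⟧-mono {false} f = z≤n

⟦⟧-true : ∀ {a} → a ≡ true → ⟦ a ⟧ ≡ 1
⟦⟧-true refl = refl

⟦⟧-false : ∀ {a} → a ≡ false → ⟦ a ⟧ ≡ 0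
⟦⟧-false refl = refl

⟦⟧-pos : ∀ {a} → 1 ≤ ⟦ a ⟧ → a ≡ true
⟦⟧-pos {true} _ = refl

⟦⟧-∧ : ∀ a b → ⟦ a ∧ b ⟧ ≡ ⟦ a ⟧ * ⟦ b ⟧
⟦⟧-∧ true  b = sym (+-identityʳ ⟦ b ⟧)
⟦⟧-∧ false b = refl

*-pos : ∀ {a b} → 1 ≤ a * b → 1 ≤ a × 1 ≤ b
*-pos {zero}  ()
*-pos {suc a} {zero} h = contradiction h (<⇒≱ (s≤s (≤-reflexive (*-zeroʳ a))))
*-pos {suc a} {suc b} _ = s≤s z≤n , s≤s z≤n

==F-refl : ∀ {N} (x : Fin N) → (x ==F x) ≡ true
==F-refl x = toYes (x ≟F x) refl

==F-sound : ∀ {N} {x y : Fin N} → (x ==F y) ≡ true → x ≡ y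
==F-sound {x = x} {y} = fromYes (x ≟F y)

-- Finite sums and cardinalities

sumF-cong : ∀ {N} {f g : Fin N → ℕ} → (∀ x → f x ≡ g x) → sumF f ≡ sumF g
sumF-cong {zero}  h = refl
sumF-cong {suc N} h = cong₂ _+_ (h fzero) (sumF-cong (λ i → h (fsuc i)))

sumF-mono : ∀ {N} {f g : Fin N → ℕ} → (∀ x → f x ≤ g x) → sumF f ≤ sumF g
sumF-mono {zero}  h = z≤n
sumF-mono {suc N} h = +-mono-≤ (h fzero) (sumF-mono (λ i → h (fsuc i)))

sumF-mono-< : ∀ {N} {f g : Fin N → ℕ} → (∀ x → f x ≤ g x) → ∀ a → f a < g a → sumF f < sumF g
sumF-mono-< h fzero    l = +-mono-<-≤ l (sumF-mono (λ i → h (fsuc i)))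
sumF-mono-< h (fsuc a) l = +-mono-≤-< (h fzero) (sumF-mono-< (λ i → h (fsuc i)) a l)

sumF-0 : ∀ N → sumF {N} (λ _ → 0) ≡ 0
sumF-0 zero    = refl
sumF-0 (suc N) = sumF-0 N

sumF-const : ∀ N c → sumF {N} (λ _ → c) ≡ N * c
sumF-const zero    c = refl
sumF-const (suc N) c = cong (c +_) (sumF-const N c)

private
  +-interchange : ∀ a b c d → (a + b) + (c + d) ≡ (a + c) + (b + d)
  +-interchange = solve 4 (λ a b c d → (a :+ b) :+ (c :+ d) := (a :+ c) :+ (b :+ d)) refl
    where open +-*-Solver

sumF-+ : ∀ {N} (f g : Fin N → ℕ) → sumF (λ x → f x + g x) ≡ sumF f + sumF g
sumF-+ {zero}  f g = refl
sumF-+ {suc N} f g = trans (cong (f fzero + g fzero +_) (sumF-+ (f ∘ fsuc) (g ∘ fsuc)))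
  (+-interchange (f fzero) (g fzero) (sumF (f ∘ fsuc)) (sumF (g ∘ fsuc)))

sumF-*ˡ : ∀ {N} c (f : Fin N → ℕ) → sumF (λ x → c * f x) ≡ c * sumF f
sumF-*ˡ {zero}  c f = sym (*-zeroʳ c)
sumF-*ˡ {suc N} c f = trans (cong (c * f fzero +_) (sumF-*ˡ c (f ∘ fsuc)))
  (sym (*-distribˡ-+ c (f fzero) _))

sumF-*ʳ : ∀ {N} c (f : Fin N → ℕ) → sumF (λ x → f x * c) ≡ sumF f * c
sumF-*ʳ c f = trans (sumF-cong (λ x → *-comm (f x) c)) (trans (sumF-*ˡ c f) (*-comm c _))

sumF-swap : ∀ {M N} (f : Fin M → Fin N → ℕ) →
  sumF (λ x → sumF (λ y → f x y)) ≡ sumF (λ y → sumF (λ x → f x y))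
sumF-swap {zero}  {N} f = sym (sumF-0 N)
sumF-swap {suc M} f = trans (cong (sumF (f fzero) +_) (sumF-swap (f ∘ fsuc)))
  (sym (sumF-+ (f fzero) (λ y → sumF (λ x → f (fsuc x) y))))

term≤sumF : ∀ {N} (f : Fin N → ℕ) a → f a ≤ sumF f
term≤sumF f fzero    = m≤m+n _ _
term≤sumF f (fsuc a) = ≤-trans (term≤sumF (f ∘ fsuc) a) (m≤n+m _ _)

sumF-pos : ∀ {N} (f : Fin N → ℕ) → 1 ≤ sumF f → ∃ λ a → 1 ≤ f a
sumF-pos {suc N} f h with f fzero in eq
... | suc _ = fzero , subst (1 ≤_) (sym eq) (s≤s z≤n)
... | zero  = let (a , p) = sumF-pos (f ∘ fsuc) h in fsuc a , p

==F-suc : ∀ {N} (x y : Fin N) → (fsuc x ==F fsuc y) ≡ (x ==F y)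
==F-suc x y = bool-ext (λ e → toYes (x ≟F y) (FP.suc-injective (==F-sound e)))
                       (λ e → toYes (fsuc x ≟F fsuc y) (cong fsuc (==F-sound e)))

sumF-δ : ∀ {N} (f : Fin N → ℕ) a → sumF (λ x → ⟦ x ==F a ⟧ * f x) ≡ f a
sumF-δ {suc N} f fzero = begin
  (f fzero + 0) + sumF {N} (λ _ → 0) ≡⟨ cong₂ _+_ (+-identityʳ _) (sumF-0 N) ⟩
  f fzero + 0                        ≡⟨ +-identityʳ _ ⟩
  f fzero                            ∎
  where open ≡-Reasoning
sumF-δ {suc N} f (fsuc a) =
  trans (sumF-cong (λ x → cong (λ b → ⟦ b ⟧ * f (fsuc x)) (==F-suc x a))) (sumF-δ (f ∘ fsuc) a)

==F-sym : ∀ {N} (x y : Fin N) → (x ==F y) ≡ (y ==F x)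
==F-sym x y = bool-ext (λ e → toYes (y ≟F x) (sym (==F-sound e))) (λ e → toYes (x ≟F y) (sym (==F-sound e)))

sumF-reindex : ∀ {M N} (f : Fin M → Fin N) (g : Fin N → Fin M) →
  (∀ x → g (f x) ≡ x) → (∀ y → f (g y) ≡ y) → (h : Fin N → ℕ) → sumF (λ x → h (f x)) ≡ sumF h
sumF-reindex f g gf fg h = begin
  sumF (λ x → h (f x))                                ≡⟨ sumF-cong (λ x → sym (sumF-δ h (f x))) ⟩
  sumF (λ x → sumF (λ y → ⟦ y ==F f x ⟧ * h y))       ≡⟨ sumF-swap (λ x y → ⟦ y ==F f x ⟧ * h y) ⟩
  sumF (λ y → sumF (λ x → ⟦ y ==F f x ⟧ * h y))       ≡⟨ sumF-cong (λ y → sumF-cong (λ x → cong (λ b → ⟦ b ⟧ * h y) (eq x y))) ⟩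
  sumF (λ y → sumF (λ x → ⟦ x ==F g y ⟧ * h y))       ≡⟨ sumF-cong (λ y → sumF-δ (λ _ → h y) (g y)) ⟩
  sumF h                                              ∎
  where
  open ≡-Reasoning
  eq : ∀ x y → (y ==F f x) ≡ (x ==F g y)
  eq x y = bool-ext
    (λ e → toYes (x ≟F g y) (trans (sym (gf x)) (cong g (sym (==F-sound e)))))
    (λ e → toYes (y ≟F f x) (trans (sym (fg y)) (cong f (sym (==F-sound e)))))

count-cong : ∀ {N} {A B : Fin N → Bool} → (∀ x → A x ≡ B x) → count A ≡ count B
count-cong h = sumF-cong (λ x → cong ⟦_⟧ (h x))

count-mono : ∀ {N} {A B : Fin N → Bool} → (∀ x → x ∈ A → x ∈ B) → count A ≤ count B
count-mono h = sumF-mono (λ x → ⟦⟧-mono (h x))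

count-empty : ∀ {N} (A : Fin N → Bool) → (∀ x → ¬ (x ∈ A)) → count A ≡ 0
count-empty {N} A h = trans (sumF-cong (λ x → ⟦⟧-false (¬true⇒false (h x)))) (sumF-0 N)

abstract
  count-∃ : ∀ {N} (A : Fin N → Bool) → 1 ≤ count A → ∃ λ x → x ∈ A
  count-∃ A h = let (a , p) = sumF-pos _ h in a , ⟦⟧-pos p

count-pos : ∀ {N} (A : Fin N → Bool) a → a ∈ A → 1 ≤ count A
count-pos A a e = ≤-trans (≤-reflexive (sym (⟦⟧-true e))) (term≤sumF (λ x → ⟦ A x ⟧) a)

count-all : ∀ N → count {N} (λ _ → true) ≡ N
count-all N = trans (sumF-const N 1) (*-identityʳ N)

count-δ : ∀ {N} (a : Fin N) → count (_==F a) ≡ 1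
count-δ a = trans (sumF-cong (λ x → sym (*-identityʳ ⟦ x ==F a ⟧))) (sumF-δ (λ _ → 1) a)

count-unique : ∀ {N} (A : Fin N → Bool) → (∀ x y → x ∈ A → y ∈ A → x ≡ y) → count A ≤ 1
count-unique {N} A u with any? (∈? A)
... | yes (a , e) = ≤-trans (count-mono {B = _==F a} (λ x h → toYes (x ≟F a) (u x a h e))) (≤-reflexive (count-δ a))
... | no ¬e = ≤-trans (≤-reflexive (count-empty A (λ x h → ¬e (x , h)))) z≤n

count-unique≡1 : ∀ {N} (A : Fin N → Bool) a → a ∈ A → (∀ x → x ∈ A → x ≡ a) → count A ≡ 1
count-unique≡1 A a e u = ≤-antisym (count-unique A (λ x y p q → trans (u x p) (sym (u y q)))) (count-pos A a e)

private
  -- Splitting `A` over the values of `f` reduces a comparison of cardinalities to one for each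
  -- value: injectivity bounds a fibre by 1 from above, surjectivity bounds it from below.
  graph-sum : ∀ {M N} (A : Fin M → Bool) (f : Fin M → Fin N) →
    count A ≡ sumF (λ y → count (λ x → A x ∧ (f x ==F y)))
  graph-sum A f = trans (sumF-cong row) (sumF-swap (λ x y → ⟦ A x ∧ (f x ==F y) ⟧))
    where
    row : ∀ x → ⟦ A x ⟧ ≡ sumF (λ y → ⟦ A x ∧ (f x ==F y) ⟧)
    row x = sym (trans (sumF-cong (λ y → trans (⟦⟧-∧ (A x) _) (trans (*-comm ⟦ A x ⟧ _)
      (cong (λ b → ⟦ b ⟧ * ⟦ A x ⟧) (==F-sym (f x) y))))) (sumF-δ (λ _ → ⟦ A x ⟧) (f x)))

count-inj : ∀ {M N} {A : Fin M → Bool} {B : Fin N → Bool} (f : Fin M → Fin N) →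
  (∀ x → x ∈ A → f x ∈ B) → (∀ x y → x ∈ A → y ∈ A → f x ≡ f y → x ≡ y) → count A ≤ count B
count-inj {A = A} {B} f into inj = ≤-trans (≤-reflexive (graph-sum A f)) (sumF-mono col)
  where
  col : ∀ y → count (λ x → A x ∧ (f x ==F y)) ≤ ⟦ B y ⟧
  col y with B y in eq
  ... | true = count-unique _ (λ x x' h h' → let (p , q) = ∧-elim h ; (p' , q') = ∧-elim h' in
        inj x x' p p' (trans (==F-sound q) (sym (==F-sound q'))))
  ... | false = ≤-reflexive (count-empty _ (λ x h → let (p , q) = ∧-elim h in
        true≢false (subst (_∈ B) (==F-sound q) (into x p)) eq))

count-surj : ∀ {M N} {A : Fin M → Bool} {B : Fin N → Bool} (f : Fin M → Fin N) →
  (∀ y → y ∈ B → ∃ λ x → x ∈ A × f x ≡ y) → count B ≤ count A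
count-surj {A = A} {B} f onto = ≤-trans (sumF-mono col) (≤-reflexive (sym (graph-sum A f)))
  where
  col : ∀ y → ⟦ B y ⟧ ≤ count (λ x → A x ∧ (f x ==F y))
  col y with B y in eq
  ... | false = z≤n
  ... | true = let (x , p , q) = onto y eq in count-pos _ x (∧-intro p (toYes (f x ≟F y) q))

count-⊎ : ∀ {N} {A B C : Fin N → Bool} → (∀ x → x ∈ A → x ∈ C) → (∀ x → x ∈ B → x ∈ C) →
  (∀ x → x ∈ A → x ∈ B → ⊥) → count A + count B ≤ count C
count-⊎ {A = A} {B} {C} a b d = ≤-trans (≤-reflexive (sym (sumF-+ (λ x → ⟦ A x ⟧) (λ x → ⟦ B x ⟧)))) (sumF-mono pt)
  where
  pt : ∀ x → ⟦ A x ⟧ + ⟦ B x ⟧ ≤ ⟦ C x ⟧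
  pt x with A x in ea | B x in eb
  ... | true  | true  = ⊥-elim (d x ea eb)
  ... | true  | false = ≤-reflexive (sym (⟦⟧-true (a x ea)))
  ... | false | _     = ⟦⟧-mono (λ e → b x (trans eb e))

count-∪ : ∀ {N} {A B C : Fin N → Bool} → (∀ x → x ∈ C → x ∈ A ⊎ x ∈ B) → count C ≤ count A + count B
count-∪ {A = A} {B} {C} h = ≤-trans (sumF-mono pt) (≤-reflexive (sumF-+ (λ x → ⟦ A x ⟧) (λ x → ⟦ B x ⟧)))
  where
  pt : ∀ x → ⟦ C x ⟧ ≤ ⟦ A x ⟧ + ⟦ B x ⟧
  pt x with C x in ec
  ... | false = z≤n
  ... | true with h x ec
  ...   | inj₁ e = ≤-trans (≤-reflexive (sym (⟦⟧-true e))) (m≤m+n _ _)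
  ...   | inj₂ e = ≤-trans (≤-reflexive (sym (⟦⟧-true e))) (m≤n+m _ _)

-- An element of `B` outside `A` would make the sum for `B` strictly larger. This is how equalities
-- of counts are turned back into statements about single elements.
count-⊆-≥ : ∀ {N} {A B : Fin N → Bool} → (∀ x → x ∈ A → x ∈ B) → count B ≤ count A → ∀ x → x ∈ B → x ∈ A
count-⊆-≥ {A = A} {B} s le x e with A x in ea
... | true  = refl
... | false = contradiction le (<⇒≱ (sumF-mono-< (λ z → ⟦⟧-mono (s z)) x
  (subst₂ _<_ (sym (⟦⟧-false ea)) (sym (⟦⟧-true e)) ≤-refl)))

count-shift : ∀ {M N} (f : Fin M → Fin N) (g : Fin N → Fin M) →
  (∀ x → g (f x) ≡ x) → (∀ y → f (g y) ≡ y) → (A : Fin N → Bool) → count (λ x → A (f x)) ≡ count A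
count-shift f g p q A = sumF-reindex f g p q (λ x → ⟦ A x ⟧)

injective⇒onto : ∀ {N} (f : Fin N → Fin N) → (∀ x y → f x ≡ f y → x ≡ y) → ∀ y → ∃ λ x → f x ≡ y
injective⇒onto {N} f inj y with any? (λ x → f x ≟F y)
... | yes h = h
-- If `y` were missed, all of `Fin N` would inject into the complement of `y`, so that complement
-- would have to contain `y`.
... | no ¬h = ⊥-elim (¬h (y , ⊥-elim (true≢false y∈ (cong not (==F-refl y)))))
  where
  y∈ : not (y ==F y) ≡ true
  y∈ = count-⊆-≥ {A = λ x → not (x ==F y)} {B = λ _ → true} (λ _ _ → refl)
    (count-inj f (λ x _ → not-intro (toNo (f x ≟F y) (λ e → ¬h (x , e)))) (λ x x' _ _ → inj x x')) y refl

count-two : ∀ {N} (A : Fin N → Bool) {x y} → x ∈ A → y ∈ A → x ≢ y → 2 ≤ count A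
count-two A {x} {y} p q ne = ≤-trans (≤-reflexive (sym (cong₂ _+_ (count-δ x) (count-δ y))))
  (count-⊎ {A = _==F x} {B = _==F y} (λ z e → subst (_∈ A) (sym (==F-sound e)) p)
     (λ z e → subst (_∈ A) (sym (==F-sound e)) q) (λ z e e' → ne (trans (sym (==F-sound e)) (==F-sound e'))))

count-≥2 : ∀ {N} (A : Fin N → Bool) → 2 ≤ count A → ∀ a → ∃ λ x → x ∈ A × x ≢ a
count-≥2 A h a with any? (λ x → ∈? A x ×-dec ¬? (x ≟F a))
... | yes e = e
... | no ¬e = contradiction h (<⇒≱ (s≤s (≤-trans (count-mono {B = _==F a} sub) (≤-reflexive (count-δ a)))))
  where
  sub : ∀ x → x ∈ A → x ∈ (_==F a)
  sub x p with x ≟F a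
  ... | yes _ = refl
  ... | no ne = contradiction (x , p , ne) ¬e

least : (P : ℕ → Set) → (∀ n → Dec (P n)) → ∀ n → P n → ∃ λ m → P m × m ≤ n × (∀ k → k < m → ¬ P k)
least P P? zero h = 0 , h , z≤n , λ _ ()
least P P? (suc n) h with P? 0
... | yes p = 0 , p , z≤n , λ _ ()
... | no ¬p with least (P ∘ suc) (P? ∘ suc) n h
...   | m , pm , m≤n , l = suc m , pm , s≤s m≤n , λ { zero _ → ¬p ; (suc k) (s≤s k<m) → l k k<m }

-- Binomial coefficients and the Frobenius identity modulo a prime

prime∤! : ∀ {q} → Prime q → ∀ k → k < q → ¬ q ∣ k !
prime∤! pq zero    _ d = contradiction (∣⇒≤ d) (<⇒≱ (nonTrivial⇒n>1 _ {{prime⇒nonTrivial pq}}))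
prime∤! pq (suc k) k<q d with euclidsLemma (suc k) (k !) pq d
... | inj₁ e = contradiction (∣⇒≤ e) (<⇒≱ k<q)
... | inj₂ e = prime∤! pq k (<-trans (n<1+n k) k<q) e

-- `q` divides `q !`, which is the binomial coefficient times `k ! * (q ∸ k) !`, and both of these
-- factorials are products of positive numbers below `q`.
prime∣C : ∀ {q} → Prime q → ∀ k → 0 < k → k < q → q ∣ q choose k
prime∣C {q} pq k 0<k k<q with euclidsLemma (q choose k) (k ! * (q ∸ k) !) pq (subst (q ∣_) (sym eq) q∣q!)
  where
  instance
    _ = k !* (q ∸ k) !≢0
    _ = prime⇒nonZero pq
  eq : (q choose k) * (k ! * (q ∸ k) !) ≡ q !
  eq = trans (cong (_* (k ! * (q ∸ k) !)) (nCk≡n!/k![n-k]! (<⇒≤ k<q))) (m/n*n≡m (k![n∸k]!∣n! (<⇒≤ k<q)))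
  q∣q! : q ∣ q !
  q∣q! = subst (λ m → m ∣ m !) (suc-pred q) (m∣m*n (pred q !))
... | inj₁ d = d
... | inj₂ d with euclidsLemma (k !) ((q ∸ k) !) pq d
...   | inj₁ e = contradiction e (prime∤! pq k k<q)
...   | inj₂ e = contradiction e (prime∤! pq (q ∸ k) (∸-monoʳ-< 0<k (<⇒≤ k<q)))

module Frobenius {c ℓ} (R : CommutativeSemiring c ℓ) {q : ℕ} (pq : Prime q) where
  private module R = CommutativeSemiring R
  open R using (Carrier; _≈_; 0#; 1#; semiring; setoid) renaming (_+_ to _+ᴿ_; _*_ to _*ᴿ_; refl to ≈-refl; sym to ≈-sym; trans to ≈-trans)
  open import Algebra.Properties.CommutativeSemiring.Exp R using () renaming (_^_ to _^ᴿ_) public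
  open import Algebra.Properties.Semiring.Exp semiring using (^-congˡ)
  open import Algebra.Properties.Semiring.Mult semiring using (×-homo-+; ×-assocˡ; ×-congʳ; ×-congˡ; ×-homo-1) renaming (_×_ to _×ᴿ_) public
  open import Algebra.Properties.CommutativeMonoid.Mult R.+-commutativeMonoid using (×-distrib-+)
  open import Algebra.Properties.Semiring.Sum semiring using (sum; sum-init-last)
  import Algebra.Properties.CommutativeSemiring.Binomial R as Bin
  open import Relation.Binary.Reasoning.Setoid setoid

  private
    sum-divisible : ∀ {m} (t : Fin m → Carrier) → (∀ i → ∃ λ h → t i ≈ q ×ᴿ h) → ∃ λ h → sum t ≈ q ×ᴿ h
    sum-divisible {zero} t d = 0# , zeroes q
      where
      zeroes : ∀ k → 0# ≈ k ×ᴿ 0#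
      zeroes zero    = ≈-refl
      zeroes (suc k) = ≈-trans (zeroes k) (≈-sym (R.+-identityˡ _))
    sum-divisible {suc m} t d =
      let (h , e) = d fzero ; (h' , e') = sum-divisible (t ∘ fsuc) (d ∘ fsuc)
      in h +ᴿ h' , ≈-trans (R.+-cong e e') (≈-sym (×-distrib-+ h h' q))

  private
   -- The exponent is written `suc (suc m)` so that the binomial sum splits into first, middle and
   -- last terms; `q` remains a variable tied to it by an equation, so its primality is used as
   -- given. Without subtraction, congruence modulo `q` has to be an explicit summand `q ×ᴿ h` on
   -- one side.
   freshman′ : ∀ m → q ≡ suc (suc m) → ∀ x y →
    ∃ λ h → (x +ᴿ y) ^ᴿ suc (suc m) ≈ (x ^ᴿ suc (suc m) +ᴿ y ^ᴿ suc (suc m)) +ᴿ suc (suc m) ×ᴿ h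
   freshman′ m eq x y = h , (begin
      (x +ᴿ y) ^ᴿ suc (suc m)        ≈⟨ Bin.theorem (suc (suc m)) x y ⟩
      term fzero +ᴿ sum (term ∘ fsuc) ≈⟨ R.+-cong first (sum-init-last (term ∘ fsuc)) ⟩
      y ^ᴿ suc (suc m) +ᴿ (sum middle +ᴿ term (fsuc (F.fromℕ (suc m)))) ≈⟨ R.+-congˡ (R.+-cong (≈-trans he (×-congˡ eq)) last≈) ⟩
      y ^ᴿ suc (suc m) +ᴿ (suc (suc m) ×ᴿ h +ᴿ x ^ᴿ suc (suc m)) ≈⟨ R.+-congˡ (R.+-comm _ _) ⟩
      y ^ᴿ suc (suc m) +ᴿ (x ^ᴿ suc (suc m) +ᴿ suc (suc m) ×ᴿ h) ≈⟨ R.+-assoc _ _ _ ⟨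
      (y ^ᴿ suc (suc m) +ᴿ x ^ᴿ suc (suc m)) +ᴿ suc (suc m) ×ᴿ h ≈⟨ R.+-congʳ (R.+-comm _ _) ⟩
      (x ^ᴿ suc (suc m) +ᴿ y ^ᴿ suc (suc m)) +ᴿ suc (suc m) ×ᴿ h ∎)
    where
    term : Fin (suc (suc (suc m))) → Carrier
    term = Bin.binomialTerm x y (suc (suc m))
    middle : Fin (suc m) → Carrier
    middle i = term (fsuc (F.inject₁ i))
    divisible : ∀ i → ∃ λ h → middle i ≈ q ×ᴿ h
    divisible i with prime∣C pq (suc (toℕ (F.inject₁ i))) (s≤s z≤n)
                       (subst (_ <_) (sym eq) (s≤s (subst (_< suc m) (sym (FP.toℕ-inject₁ i)) (toℕ<n i))))
    ... | divides u e = u ×ᴿ b ,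
          ≈-trans (×-congˡ {b} (trans (trans (cong (_choose suc (toℕ (F.inject₁ i))) (sym eq)) e) (*-comm u q))) (≈-sym (×-assocˡ b q u))
      where b = Bin.binomial x y (suc (suc m)) (fsuc (F.inject₁ i))
    h = proj₁ (sum-divisible middle divisible)
    he = proj₂ (sum-divisible middle divisible)
    first : term fzero ≈ y ^ᴿ suc (suc m)
    first = ≈-trans (×-homo-1 _) (R.*-identityˡ _)
    last≈ : term (fsuc (F.fromℕ (suc m))) ≈ x ^ᴿ suc (suc m)
    last≈ = begin
      (suc (suc m) choose suc (toℕ (F.fromℕ (suc m)))) ×ᴿ Bin.binomial x y (suc (suc m)) (fsuc (F.fromℕ (suc m)))
        ≈⟨ ×-congˡ (trans (cong (λ k → suc (suc m) choose suc k) (FP.toℕ-fromℕ (suc m))) (nCn≡1 (suc (suc m)))) ⟩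
      1 ×ᴿ Bin.binomial x y (suc (suc m)) (fsuc (F.fromℕ (suc m))) ≈⟨ ×-homo-1 _ ⟩
      x ^ᴿ suc (toℕ (F.fromℕ (suc m))) *ᴿ y ^ᴿ (suc (suc m) ∸ suc (toℕ (F.fromℕ (suc m))))
        ≡⟨ cong (λ k → x ^ᴿ suc k *ᴿ y ^ᴿ (suc (suc m) ∸ suc k)) (FP.toℕ-fromℕ (suc m)) ⟩
      x ^ᴿ suc (suc m) *ᴿ y ^ᴿ (suc (suc m) ∸ suc (suc m))
        ≡⟨ cong (λ k → x ^ᴿ suc (suc m) *ᴿ y ^ᴿ k) (n∸n≡0 (suc (suc m))) ⟩
      x ^ᴿ suc (suc m) *ᴿ 1# ≈⟨ R.*-identityʳ _ ⟩
      x ^ᴿ suc (suc m) ∎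

  freshman : ∀ x y → ∃ λ h → (x +ᴿ y) ^ᴿ q ≈ (x ^ᴿ q +ᴿ y ^ᴿ q) +ᴿ q ×ᴿ h
  freshman x y = subst (λ k → ∃ λ h → (x +ᴿ y) ^ᴿ k ≈ (x ^ᴿ k +ᴿ y ^ᴿ k) +ᴿ k ×ᴿ h) (sym eq) (freshman′ (q ∸ 2) eq x y)
    where
    eq : q ≡ suc (suc (q ∸ 2))
    eq = sym (m+[n∸m]≡n (nonTrivial⇒n>1 q {{prime⇒nonTrivial pq}}))

  sum-^ : ∀ {m} (t : Fin m → Carrier) → ∃ λ h → sum t ^ᴿ q ≈ sum (λ i → t i ^ᴿ q) +ᴿ q ×ᴿ h
  sum-^ {zero} t = 0# , (begin
      0# ^ᴿ q         ≈⟨ 0^ q {{prime⇒nonZero pq}} ⟩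
      0#              ≈⟨ R.+-identityˡ 0# ⟨
      0# +ᴿ 0#        ≈⟨ R.+-congˡ (zeroes q) ⟩
      0# +ᴿ q ×ᴿ 0#   ∎)
    where
    zeroes : ∀ k → 0# ≈ k ×ᴿ 0#
    zeroes zero    = ≈-refl
    zeroes (suc k) = ≈-trans (zeroes k) (≈-sym (R.+-identityˡ _))
    0^ : ∀ k → .{{NonZero k}} → 0# ^ᴿ k ≈ 0#
    0^ (suc k) = R.zeroˡ _
  sum-^ {suc m} t =
    let (h , e) = sum-^ (t ∘ fsuc)
        (h' , e') = freshman (t fzero) (sum (t ∘ fsuc))
        a = t fzero ^ᴿ q
        b = sum (λ i → t (fsuc i) ^ᴿ q)
    in h +ᴿ h' , (begin
      (t fzero +ᴿ sum (t ∘ fsuc)) ^ᴿ q                  ≈⟨ e' ⟩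
      (a +ᴿ sum (t ∘ fsuc) ^ᴿ q) +ᴿ q ×ᴿ h'             ≈⟨ R.+-congʳ (R.+-congˡ e) ⟩
      (a +ᴿ (b +ᴿ q ×ᴿ h)) +ᴿ q ×ᴿ h'                   ≈⟨ R.+-congʳ (R.+-assoc a b _) ⟨
      ((a +ᴿ b) +ᴿ q ×ᴿ h) +ᴿ q ×ᴿ h'                   ≈⟨ R.+-assoc _ _ _ ⟩
      (a +ᴿ b) +ᴿ (q ×ᴿ h +ᴿ q ×ᴿ h')                   ≈⟨ R.+-congˡ (×-distrib-+ h h' q) ⟨
      (a +ᴿ b) +ᴿ q ×ᴿ (h +ᴿ h')                        ∎)

-- Finite abelian groups, a solver for their equations, and convolution

record FinAbelianGroup (N : ℕ) : Set where
  infixl 6 _⊕_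
  infix  8 ⊖_
  field
    _⊕_        : Fin N → Fin N → Fin N
    𝟘          : Fin N
    ⊖_         : Fin N → Fin N
    ⊕-assoc    : ∀ x y z → (x ⊕ y) ⊕ z ≡ x ⊕ (y ⊕ z)
    ⊕-comm     : ∀ x y → x ⊕ y ≡ y ⊕ x
    ⊕-identityˡ : ∀ x → 𝟘 ⊕ x ≡ x
    ⊕-inverseˡ : ∀ x → ⊖ x ⊕ x ≡ 𝟘

module GroupTheory {N : ℕ} (G : FinAbelianGroup N) where
  open FinAbelianGroup G public

  infixr 7 _·_
  _·_ : ℕ → Fin N → Fin N
  zero  · x = 𝟘
  suc k · x = x ⊕ k · x

  ⊕-identityʳ : ∀ x → x ⊕ 𝟘 ≡ x
  ⊕-identityʳ x = trans (⊕-comm x 𝟘) (⊕-identityˡ x)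

  ⊕-interchange : ∀ a b c d → (a ⊕ b) ⊕ (c ⊕ d) ≡ (a ⊕ c) ⊕ (b ⊕ d)
  ⊕-interchange a b c d = begin
    (a ⊕ b) ⊕ (c ⊕ d) ≡⟨ ⊕-assoc a b _ ⟩
    a ⊕ (b ⊕ (c ⊕ d)) ≡⟨ cong (a ⊕_) (⊕-assoc b c d) ⟨
    a ⊕ ((b ⊕ c) ⊕ d) ≡⟨ cong (λ u → a ⊕ (u ⊕ d)) (⊕-comm b c) ⟩
    a ⊕ ((c ⊕ b) ⊕ d) ≡⟨ cong (a ⊕_) (⊕-assoc c b d) ⟩
    a ⊕ (c ⊕ (b ⊕ d)) ≡⟨ ⊕-assoc a c _ ⟨
    (a ⊕ c) ⊕ (b ⊕ d) ∎
    where open ≡-Reasoning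

  ·-𝟘 : ∀ k → k · 𝟘 ≡ 𝟘
  ·-𝟘 zero    = refl
  ·-𝟘 (suc k) = trans (⊕-identityˡ _) (·-𝟘 k)

  ·-distribˡ : ∀ k x y → k · (x ⊕ y) ≡ k · x ⊕ k · y
  ·-distribˡ zero    x y = sym (⊕-identityˡ 𝟘)
  ·-distribˡ (suc k) x y = trans (cong ((x ⊕ y) ⊕_) (·-distribˡ k x y)) (⊕-interchange x y _ _)

  ·-distribʳ : ∀ j k x → (j + k) · x ≡ j · x ⊕ k · x
  ·-distribʳ zero    k x = sym (⊕-identityˡ _)
  ·-distribʳ (suc j) k x = trans (cong (x ⊕_) (·-distribʳ j k x)) (sym (⊕-assoc x _ _))

  ·-assoc : ∀ j k x → (j * k) · x ≡ j · (k · x)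
  ·-assoc zero    k x = refl
  ·-assoc (suc j) k x = trans (·-distribʳ k (j * k) x) (cong (k · x ⊕_) (·-assoc j k x))

  ·-comm : ∀ j k x → j · (k · x) ≡ k · (j · x)
  ·-comm j k x = trans (sym (·-assoc j k x)) (trans (cong (_· x) (*-comm j k)) (·-assoc k j x))

  1· : ∀ x → 1 · x ≡ x
  1· = ⊕-identityʳ

  ⊕-cancelʳ : ∀ z {x y} → x ⊕ z ≡ y ⊕ z → x ≡ y
  ⊕-cancelʳ z {x} {y} e = trans (sym (back x)) (trans (cong (_⊕ ⊖ z) e) (back y))
    where
    back : ∀ u → (u ⊕ z) ⊕ ⊖ z ≡ u
    back u = trans (⊕-assoc u z _) (trans (cong (u ⊕_) (trans (⊕-comm z _) (⊕-inverseˡ z))) (⊕-identityʳ u))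

  ⊕-cancelˡ : ∀ z {x y} → z ⊕ x ≡ z ⊕ y → x ≡ y
  ⊕-cancelˡ z {x} {y} e = ⊕-cancelʳ z (trans (⊕-comm x z) (trans e (⊕-comm z y)))

  module Solver where
    infixl 6 _:+_
    infix  8 :-_
    infixr 7 _:*_
    data Expr (m : ℕ) : Set where
      var  : Fin m → Expr m
      :0   : Expr m
      _:+_ : Expr m → Expr m → Expr m
      :-_  : Expr m → Expr m
      _:*_ : ℕ → Expr m → Expr m

    eval : ∀ {m} → Expr m → Vec (Fin N) m → Fin N
    eval (var i)   ρ = V.lookup ρ i
    eval :0        ρ = 𝟘
    eval (e :+ e') ρ = eval e ρ ⊕ eval e' ρ
    eval (:- e)    ρ = ⊖ eval e ρ
    eval (k :* e)  ρ = k · eval e ρ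

    Coeffs : ℕ → Set
    Coeffs = Vec ℕ

    unit : ∀ {m} → Fin m → Coeffs m
    unit fzero    = 1 ∷ V.replicate _ 0
    unit (fsuc i) = 0 ∷ unit i

    -- An expression denotes the difference of two combinations with natural coefficients.
    pos neg : ∀ {m} → Expr m → Coeffs m
    pos (var i)   = unit i
    pos :0        = V.replicate _ 0
    pos (e :+ e') = V.zipWith _+_ (pos e) (pos e')
    pos (:- e)    = neg e
    pos (k :* e)  = V.map (k *_) (pos e)
    neg (var i)   = V.replicate _ 0
    neg :0        = V.replicate _ 0
    neg (e :+ e') = V.zipWith _+_ (neg e) (neg e')
    neg (:- e)    = pos e
    neg (k :* e)  = V.map (k *_) (neg e)

    comb : ∀ {m} → Coeffs m → Vec (Fin N) m → Fin N
    comb []       []      = 𝟘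
    comb (k ∷ ks) (x ∷ ρ) = k · x ⊕ comb ks ρ

    comb-0 : ∀ {m} (ρ : Vec (Fin N) m) → comb (V.replicate _ 0) ρ ≡ 𝟘
    comb-0 []      = refl
    comb-0 (x ∷ ρ) = trans (⊕-identityˡ _) (comb-0 ρ)

    comb-+ : ∀ {m} (a b : Coeffs m) ρ → comb (V.zipWith _+_ a b) ρ ≡ comb a ρ ⊕ comb b ρ
    comb-+ []      []      []      = sym (⊕-identityˡ 𝟘)
    comb-+ (j ∷ a) (k ∷ b) (x ∷ ρ) = trans (cong₂ _⊕_ (·-distribʳ j k x) (comb-+ a b ρ)) (⊕-interchange _ _ _ _)

    comb-* : ∀ {m} k (a : Coeffs m) ρ → comb (V.map (k *_) a) ρ ≡ k · comb a ρ
    comb-* k []      []      = sym (·-𝟘 k)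
    comb-* k (j ∷ a) (x ∷ ρ) = trans (cong₂ _⊕_ (·-assoc k j x) (comb-* k a ρ)) (sym (·-distribˡ k _ _))

    comb-unit : ∀ {m} (i : Fin m) ρ → comb (unit i) ρ ≡ V.lookup ρ i
    comb-unit fzero    (x ∷ ρ) = trans (cong₂ _⊕_ (1· x) (comb-0 ρ)) (⊕-identityʳ x)
    comb-unit (fsuc i) (x ∷ ρ) = trans (⊕-identityˡ _) (comb-unit i ρ)

    sound : ∀ {m} (e : Expr m) ρ → eval e ρ ⊕ comb (neg e) ρ ≡ comb (pos e) ρ
    sound (var i) ρ = trans (cong₂ _⊕_ (sym (comb-unit i ρ)) (comb-0 ρ)) (⊕-identityʳ _)
    sound :0 ρ = ⊕-identityˡ _
    sound (e :+ e') ρ = trans (cong (eval e ρ ⊕ eval e' ρ ⊕_) (comb-+ (neg e) (neg e') ρ)) (trans (⊕-interchange _ _ _ _)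
      (trans (cong₂ _⊕_ (sound e ρ) (sound e' ρ)) (sym (comb-+ (pos e) (pos e') ρ))))
    sound (:- e) ρ = trans (cong (⊖ eval e ρ ⊕_) (sym (sound e ρ))) (trans (sym (⊕-assoc _ _ _))
      (trans (cong (_⊕ comb (neg e) ρ) (⊕-inverseˡ _)) (⊕-identityˡ _)))
    sound (k :* e) ρ = trans (cong (k · eval e ρ ⊕_) (comb-* k (neg e) ρ)) (trans (sym (·-distribˡ k _ _))
      (trans (cong (k ·_) (sound e ρ)) (sym (comb-* k (pos e) ρ))))

    -- Moving the negative parts to the opposite side leaves two vectors of natural coefficients to
    -- compare; for concrete expressions they agree by `refl`.
    prove : ∀ {m} (e e' : Expr m) → V.zipWith _+_ (pos e) (neg e') ≡ V.zipWith _+_ (pos e') (neg e) →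
      ∀ ρ → eval e ρ ≡ eval e' ρ
    prove e e' h ρ = ⊕-cancelʳ (comb (neg e) ρ ⊕ comb (neg e') ρ) (begin
      eval e ρ ⊕ (comb (neg e) ρ ⊕ comb (neg e') ρ)   ≡⟨ ⊕-assoc _ _ _ ⟨
      (eval e ρ ⊕ comb (neg e) ρ) ⊕ comb (neg e') ρ   ≡⟨ cong (_⊕ _) (sound e ρ) ⟩
      comb (pos e) ρ ⊕ comb (neg e') ρ                ≡⟨ comb-+ (pos e) (neg e') ρ ⟨
      comb (V.zipWith _+_ (pos e) (neg e')) ρ         ≡⟨ cong (λ v → comb v ρ) h ⟩
      comb (V.zipWith _+_ (pos e') (neg e)) ρ         ≡⟨ comb-+ (pos e') (neg e) ρ ⟩
      comb (pos e') ρ ⊕ comb (neg e) ρ                ≡⟨ cong (_⊕ _) (sound e' ρ) ⟨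
      (eval e' ρ ⊕ comb (neg e') ρ) ⊕ comb (neg e) ρ  ≡⟨ ⊕-assoc _ _ _ ⟩
      eval e' ρ ⊕ (comb (neg e') ρ ⊕ comb (neg e) ρ)  ≡⟨ cong (eval e' ρ ⊕_) (⊕-comm _ _) ⟩
      eval e' ρ ⊕ (comb (neg e) ρ ⊕ comb (neg e') ρ)  ∎)
      where open ≡-Reasoning

    close : ∀ {A : Set} m → N-ary m (Expr m) A → A
    close m f = f $ⁿ V.tabulate var

    infix 4 _:=_
    _:=_ : ∀ {m} → Expr m → Expr m → Expr m × Expr m
    _:=_ = _,_

    gsolve : ∀ m (f : N-ary m (Expr m) (Expr m × Expr m)) →
      let e = proj₁ (close m f) ; e' = proj₂ (close m f) in
      V.zipWith _+_ (pos e) (neg e') ≡ V.zipWith _+_ (pos e') (neg e) →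
      Eq m _≡_ (curryⁿ (eval e)) (curryⁿ (eval e'))
    gsolve m f h = curryⁿ-cong _≡_ _ _ (prove (proj₁ (close m f)) (proj₂ (close m f)) h)

  open Solver public using (_:+_; :-_; _:*_; :0; _:=_; gsolve)

  ⊖-involutive : ∀ x → ⊖ ⊖ x ≡ x
  ⊖-involutive = gsolve 1 (λ x → :- :- x := x) refl

  ⊖-𝟘 : ⊖ 𝟘 ≡ 𝟘
  ⊖-𝟘 = gsolve 0 (:- :0 := :0) refl

  ⊕-⊖ : ∀ x y → (x ⊕ y) ⊕ ⊖ y ≡ x
  ⊕-⊖ = gsolve 2 (λ x y → (x :+ y) :+ :- y := x) refl

  ⊖-⊕ : ∀ x y → (x ⊕ ⊖ y) ⊕ y ≡ x
  ⊖-⊕ = gsolve 2 (λ x y → (x :+ :- y) :+ y := x) refl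

  ⊖⊖ : ∀ x w → x ⊕ ⊖ (x ⊕ ⊖ w) ≡ w
  ⊖⊖ = gsolve 2 (λ x w → x :+ :- (x :+ :- w) := w) refl

  ⊕-inverseʳ : ∀ x → x ⊕ ⊖ x ≡ 𝟘
  ⊕-inverseʳ = gsolve 1 (λ x → x :+ :- x := :0) refl

  ·-⊖ : ∀ k x → k · (⊖ x) ≡ ⊖ (k · x)
  ·-⊖ k x = ⊕-cancelʳ (k · x) (trans (sym (·-distribˡ k (⊖ x) x))
    (trans (cong (k ·_) (⊕-inverseˡ x)) (trans (·-𝟘 k) (sym (⊕-inverseˡ _)))))

  ⊖≡𝟘⇒≡ : ∀ {x y} → x ⊕ ⊖ y ≡ 𝟘 → x ≡ y
  ⊖≡𝟘⇒≡ {x} {y} e = trans (sym (⊖-⊕ x y)) (trans (cong (_⊕ y) e) (⊕-identityˡ y))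

  sum-shift : ∀ g (h : Fin N → ℕ) → sumF (λ x → h (x ⊕ g)) ≡ sumF h
  sum-shift g h = sumF-reindex (_⊕ g) (_⊕ ⊖ g) (λ x → ⊕-⊖ x g) (λ x → ⊖-⊕ x g) h

  sum-reflect : ∀ g (h : Fin N → ℕ) → sumF (λ x → h (g ⊕ ⊖ x)) ≡ sumF h
  sum-reflect g h = sumF-reindex (λ x → g ⊕ ⊖ x) (λ x → g ⊕ ⊖ x) (⊖⊖ g) (⊖⊖ g) h

  conv : (Fin N → ℕ) → (Fin N → ℕ) → Fin N → ℕ
  conv f g x = sumF (λ w → f w * g (x ⊕ ⊖ w))

  δ : Fin N → Fin N → ℕ
  δ a x = ⟦ x ==F a ⟧

  conv-cong : ∀ {f f' g g'} → (∀ x → f x ≡ f' x) → (∀ x → g x ≡ g' x) → ∀ x → conv f g x ≡ conv f' g' x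
  conv-cong p q x = sumF-cong (λ w → cong₂ _*_ (p w) (q _))

  conv-comm : ∀ f g x → conv f g x ≡ conv g f x
  conv-comm f g x = trans (sym (sum-reflect x (λ w → f w * g (x ⊕ ⊖ w))))
    (sumF-cong (λ w → trans (cong (f (x ⊕ ⊖ w) *_) (cong g (⊖⊖ x w))) (*-comm (f (x ⊕ ⊖ w)) (g w))))

  conv-δ : ∀ a g x → conv (δ a) g x ≡ g (x ⊕ ⊖ a)
  conv-δ a g x = sumF-δ (λ w → g (x ⊕ ⊖ w)) a

  conv-assoc : ∀ f g h x → conv (conv f g) h x ≡ conv f (conv g h) x
  conv-assoc f g h x = begin
    sumF (λ w → conv f g w * h (x ⊕ ⊖ w))
      ≡⟨ sumF-cong (λ w → sym (sumF-*ʳ (h (x ⊕ ⊖ w)) (λ v → f v * g (w ⊕ ⊖ v)))) ⟩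
    sumF (λ w → sumF (λ v → f v * g (w ⊕ ⊖ v) * h (x ⊕ ⊖ w)))
      ≡⟨ sumF-swap (λ w v → f v * g (w ⊕ ⊖ v) * h (x ⊕ ⊖ w)) ⟩
    sumF (λ v → sumF (λ w → f v * g (w ⊕ ⊖ v) * h (x ⊕ ⊖ w)))
      ≡⟨ sumF-cong (λ v → trans (sym (sum-shift v (λ w → f v * g (w ⊕ ⊖ v) * h (x ⊕ ⊖ w))))
           (trans (sumF-cong (λ u → inner v u)) (sumF-*ˡ (f v) (λ u → g u * h ((x ⊕ ⊖ v) ⊕ ⊖ u))))) ⟩
    sumF (λ v → f v * conv g h (x ⊕ ⊖ v)) ∎
    where
    open ≡-Reasoning
    inner : ∀ v u → f v * g ((u ⊕ v) ⊕ ⊖ v) * h (x ⊕ ⊖ (u ⊕ v)) ≡ f v * (g u * h ((x ⊕ ⊖ v) ⊕ ⊖ u))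
    inner v u = trans (*-assoc (f v) _ _) (cong₂ (λ a b → f v * (g a * h b)) (⊕-⊖ u v)
      (gsolve 3 (λ x v u → x :+ :- (u :+ v) := (x :+ :- v) :+ :- u) refl x v u))

  conv-distribˡ : ∀ f g h x → conv f (λ y → g y + h y) x ≡ conv f g x + conv f h x
  conv-distribˡ f g h x = trans (sumF-cong (λ w → *-distribˡ-+ (f w) _ _))
    (sumF-+ (λ w → f w * g (x ⊕ ⊖ w)) (λ w → f w * h (x ⊕ ⊖ w)))

  conv-distribʳ : ∀ f g h x → conv (λ y → g y + h y) f x ≡ conv g f x + conv h f x
  conv-distribʳ f g h x = trans (conv-comm (λ y → g y + h y) f x) (trans (conv-distribˡ f g h x) (cong₂ _+_ (conv-comm f g x) (conv-comm f h x)))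

  conv-*ˡ : ∀ c f g x → conv (λ y → c * f y) g x ≡ c * conv f g x
  conv-*ˡ c f g x = trans (sumF-cong (λ w → *-assoc c (f w) _)) (sumF-*ˡ c (λ w → f w * g (x ⊕ ⊖ w)))

  conv-0ˡ : ∀ g x → conv (λ _ → 0) g x ≡ 0
  conv-0ˡ g x = sumF-0 N

  -- The group semiring of `G` over the naturals, with the point mass at `𝟘` as unit. It is
  -- commutative because `G` is, and this gives access to the binomial theorem.
  groupSemiring : CommutativeSemiring _ _
  groupSemiring = record
    { Carrier = Fin N → ℕ
    ; _≈_ = λ f g → ∀ x → f x ≡ g x
    ; _+_ = λ f g x → f x + g x
    ; _*_ = conv
    ; 0# = λ _ → 0
    ; 1# = δ 𝟘
    ; isCommutativeSemiring = record
      { isSemiring = record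
        { isSemiringWithoutAnnihilatingZero = record
          { +-isCommutativeMonoid = record
            { isMonoid = record
              { isSemigroup = record
                { isMagma = record
                  { isEquivalence = record { refl = λ _ → refl ; sym = λ p x → sym (p x) ; trans = λ p q x → trans (p x) (q x) }
                  ; ∙-cong = λ p q x → cong₂ _+_ (p x) (q x) }
                ; assoc = λ f g h x → +-assoc (f x) (g x) (h x) }
              ; identity = (λ f x → refl) , (λ f x → +-identityʳ (f x)) }
            ; comm = λ f g x → +-comm (f x) (g x) }
          ; *-cong = conv-cong
          ; *-assoc = conv-assoc
          ; *-identity = (λ f x → trans (conv-δ 𝟘 f x) (cong f (minus0 x)))
                       , (λ f x → trans (conv-comm f (δ 𝟘) x) (trans (conv-δ 𝟘 f x) (cong f (minus0 x))))
          ; distrib = conv-distribˡ , conv-distribʳ }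
        ; zero = conv-0ˡ , (λ f x → trans (conv-comm f _ x) (conv-0ˡ f x)) }
      ; *-comm = conv-comm } }
    where
    minus0 : ∀ x → x ⊕ ⊖ 𝟘 ≡ x
    minus0 = gsolve 1 (λ x → x :+ :- :0 := x) refl

  -- Frobenius modulo q in the group semiring: the q-th convolution power of a set A
  -- is congruent to the push-forward of A under multiplication by q.
  module _ {q : ℕ} (pq : Prime q) (A : Fin N → Bool) where
    private
      module Fr = Frobenius groupSemiring pq
      open import Algebra.Properties.Semiring.Sum (CommutativeSemiring.semiring groupSemiring) using (sum)

      power : (Fin N → ℕ) → ℕ → Fin N → ℕ
      power f k = f Fr.^ᴿ k

      sum-apply : ∀ {m} (t : Fin m → Fin N → ℕ) x → sum t x ≡ sumF (λ i → t i x)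
      sum-apply {zero}  t x = refl
      sum-apply {suc m} t x = cong (t fzero x +_) (sum-apply (t ∘ fsuc) x)

      ×-apply : ∀ k (h : Fin N → ℕ) x → (k Fr.×ᴿ h) x ≡ k * h x
      ×-apply zero    h x = refl
      ×-apply (suc k) h x = cong (h x +_) (×-apply k h x)

      power-cong : ∀ k {f g} → (∀ x → f x ≡ g x) → ∀ x → power f k x ≡ power g k x
      power-cong zero    e x = refl
      power-cong (suc k) e x = conv-cong e (power-cong k e) x

      power-δ : ∀ k a x → power (δ a) k x ≡ δ (k · a) x
      power-δ zero    a x = refl
      power-δ (suc k) a x = trans (conv-δ a (power (δ a) k) x) (trans (power-δ k a (x ⊕ ⊖ a)) (cong ⟦_⟧ (bool-ext to from)))
        where
        to : ((x ⊕ ⊖ a) ==F (k · a)) ≡ true → (x ==F (a ⊕ k · a)) ≡ true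
        to e = toYes (x ≟F _) (trans (sym (⊖-⊕ x a)) (trans (cong (_⊕ a) (==F-sound e)) (⊕-comm _ a)))
        from : (x ==F (a ⊕ k · a)) ≡ true → ((x ⊕ ⊖ a) ==F (k · a)) ≡ true
        from e = toYes (x ⊕ ⊖ a ≟F _) (trans (cong (_⊕ ⊖ a) (==F-sound e))
          (gsolve 2 (λ a b → (a :+ b) :+ :- a := b) refl a (k · a)))

      power-0 : ∀ k → .{{NonZero k}} → ∀ x → power (λ _ → 0) k x ≡ 0
      power-0 (suc k) x = conv-0ˡ (power (λ _ → 0) k) x

      piece : Fin N → Fin N → ℕ
      piece z x = ⟦ A z ⟧ * δ z x

      -- The coefficient of a piece is 0 or 1 and therefore equals its own `q`-th power; only the
      -- support moves, from `z` to `q · z`.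
      power-piece : ∀ z x → power (piece z) q x ≡ ⟦ A z ∧ ((q · z) ==F x) ⟧
      power-piece z x with A z
      ... | true  = trans (power-cong q (λ y → +-identityʳ (δ z y)) x) (trans (power-δ q z x) (cong ⟦_⟧ (==F-sym x (q · z))))
      ... | false = power-0 q {{prime⇒nonZero pq}} x

      pieces : ∀ x → ⟦ A x ⟧ ≡ sum piece x
      pieces x = sym (trans (sum-apply piece x) (trans (sumF-cong (λ z → trans (*-comm ⟦ A z ⟧ _)
        (cong (λ b → ⟦ b ⟧ * ⟦ A z ⟧) (==F-sym x z)))) (sumF-δ (λ z → ⟦ A z ⟧) x)))

    convPower : Fin N → ℕ
    convPower = power (λ x → ⟦ A x ⟧) q

    frobenius : ∃ λ h → ∀ y → convPower y ≡ count (λ x → A x ∧ ((q · x) ==F y)) + q * h y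
    frobenius = let (h , e) = Fr.sum-^ piece in h , λ y →
      trans (power-cong q pieces y) (trans (e y) (cong₂ _+_
        (trans (sum-apply (λ z → power (piece z) q) y) (sumF-cong (λ z → power-piece z y))) (×-apply q h y)))

    -- Powers are hidden outside this block. This principle carries a property that survives
    -- convolution, such as depending on the class alone, over to `convPower`.
    convPower-induct : (P : (Fin N → ℕ) → Set) → P (δ 𝟘) →
      (∀ f → P f → P (conv (λ x → ⟦ A x ⟧) f)) → P convPower
    convPower-induct P p0 step = go q
      where
      go : ∀ k → P (power (λ x → ⟦ A x ⟧) k)
      go zero    = p0
      go (suc k) = step _ (go k)

-- The distance norm and its convolution algebra

private module Pick where
  open +-*-Solver using (solve; con; _:+_; _:*_; _:=_)
  pick₀ : ∀ a b c → 0 ≡ (a * 0 + b * 0) + c * 0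
  pick₀ = solve 3 (λ a b c → con 0 := (a :* con 0 :+ b :* con 0) :+ c :* con 0) refl
  pick₁ : ∀ a b c → a ≡ (a * 1 + b * 0) + c * 0
  pick₁ = solve 3 (λ a b c → a := (a :* con 1 :+ b :* con 0) :+ c :* con 0) refl
  pick₂ : ∀ a b c → b ≡ (a * 0 + b * 1) + c * 0
  pick₂ = solve 3 (λ a b c → b := (a :* con 0 :+ b :* con 1) :+ c :* con 0) refl
  pick₃ : ∀ a b c → c ≡ (a * 0 + b * 0) + c * 1
  pick₃ = solve 3 (λ a b c → c := (a :* con 0 :+ b :* con 0) :+ c :* con 1) refl
  -- Here `v` will hold the values of the convolution of `𝟙 1` with `𝟙 (suc i)`. Its support meets
  -- only three consecutive classes, so it is a combination of three indicators.
  three : ∀ (v : ℕ → ℕ) i c → (1 ≤ v c → c ≡ i ⊎ c ≡ suc i ⊎ c ≡ suc (suc i)) →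
    v c ≡ (v i * ⟦ ⌊ c ≟ i ⌋ ⟧ + v (suc i) * ⟦ ⌊ c ≟ suc i ⌋ ⟧) + v (suc (suc i)) * ⟦ ⌊ c ≟ suc (suc i) ⌋ ⟧
  three v i c h with c ≟ i | c ≟ suc i | c ≟ suc (suc i)
  ... | yes refl | yes () | _
  ... | yes refl | no _ | yes ()
  ... | no _ | yes refl | yes ()
  ... | yes refl | no _ | no _ = pick₁ (v i) (v (suc i)) (v (suc (suc i)))
  ... | no _ | yes refl | no _ = pick₂ (v i) (v (suc i)) (v (suc (suc i)))

  ... | no _ | no _ | yes refl = pick₃ (v i) (v (suc i)) (v (suc (suc i)))

  ... | no a | no b | no d with v c
  ...   | zero = pick₀ (v i) (v (suc i)) (v (suc (suc i)))

  ...   | suc _ with h (s≤s z≤n)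
  ...     | inj₁ e        = contradiction e a
  ...     | inj₂ (inj₁ e) = contradiction e b
  ...     | inj₂ (inj₂ e) = contradiction e d
open Pick

module _ {N : ℕ} (G : FinAbelianGroup N) where
  open GroupTheory G

  -- cl x is the distance of x from 𝟘 in a distance-regular Cayley graph with
  -- connection set {s | cl s ≡ 1}.
  record RegularNorm : Set where
    field
      cl       : Fin N → ℕ
      cl-𝟘     : cl 𝟘 ≡ 0
      cl≡0     : ∀ x → cl x ≡ 0 → x ≡ 𝟘
      cl-⊖     : ∀ x → cl (⊖ x) ≡ cl x
      cl-⊕     : ∀ x y → cl (x ⊕ y) ≤ cl x + cl y
      geodesic : ∀ x i → cl x ≡ suc i → ∃₂ λ y s → cl y ≡ i × cl s ≡ 1 × x ≡ y ⊕ s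
      regular  : ∀ j x y → cl x ≡ cl y →
        count (λ s → ⌊ cl s ≟ 1 ⌋ ∧ ⌊ cl (x ⊕ s) ≟ j ⌋) ≡ count (λ s → ⌊ cl s ≟ 1 ⌋ ∧ ⌊ cl (y ⊕ s) ≟ j ⌋)

module NormTheory {N : ℕ} (G : FinAbelianGroup N) (norm : RegularNorm G) where
  open GroupTheory G public
  open RegularNorm norm public

  D : ℕ → Fin N → Bool
  D i x = ⌊ cl x ≟ i ⌋

  inD : ∀ {i x} → cl x ≡ i → x ∈ D i
  inD {i} {x} = toYes (cl x ≟ i)

  fromD : ∀ {i x} → x ∈ D i → cl x ≡ i
  fromD {i} {x} = fromYes (cl x ≟ i)

  nb : ℕ → Fin N → ℕ
  nb j x = count (λ s → D 1 s ∧ D j (x ⊕ s))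

  𝟙 : ℕ → Fin N → ℕ
  𝟙 i x = ⟦ D i x ⟧

  -- Read in the group semiring, the natural-valued functions of this kind are the elements with
  -- natural coefficients of the Bose-Mesner algebra of the graph.
  Class : {A : Set} → (Fin N → A) → Set
  Class f = ∀ x y → cl x ≡ cl y → f x ≡ f y

  cl-≤ : ∀ {x y z} → x ≡ y ⊕ z → cl x ≤ cl y + cl z
  cl-≤ {y = y} {z} refl = cl-⊕ y z

  D-class : ∀ i → Class (D i)
  D-class i x y e = cong (λ c → ⌊ c ≟ i ⌋) e

  D-⊖ : ∀ i x → D i (⊖ x) ≡ D i x
  D-⊖ i x = D-class i _ _ (cl-⊖ x)

  -- The class 1 is closed under negation, so subtracting a step and adding one give the same count.
  nb-conv : ∀ j x → conv (𝟙 1) (𝟙 j) x ≡ nb j x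
  nb-conv j x = trans (sym (sum-reflect 𝟘 (λ w → 𝟙 1 w * 𝟙 j (x ⊕ ⊖ w))))
    (sumF-cong (λ s → trans (cong₂ (λ a b → 𝟙 1 a * 𝟙 j b) (⊕-identityˡ (⊖ s)) (gsolve 2 (λ x s → x :+ :- (:0 :+ :- s) := x :+ s) refl x s))
      (trans (cong (λ b → ⟦ b ⟧ * 𝟙 j (x ⊕ s)) (D-⊖ 1 s)) (sym (⟦⟧-∧ (D 1 s) _)))))

  private
    cl-bound : ∃ λ B → ∀ x → cl x < B
    cl-bound = suc (sumF cl) , λ x → s≤s (term≤sumF cl x)

  class-values : ∀ {f : Fin N → ℕ} → Class f → ∃ λ (v : ℕ → ℕ) → ∀ x → f x ≡ v (cl x)
  class-values {f} fc = v , vx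
    where
    v : ℕ → ℕ
    v i with any? (λ z → cl z ≟ i)
    ... | yes (z , _) = f z
    ... | no _        = 0
    vx : ∀ x → f x ≡ v (cl x)
    vx x with any? (λ z → cl z ≟ cl x)
    ... | yes (z , e) = fc x z (sym e)
    ... | no ¬e       = contradiction (x , refl) ¬e

  private
    -- A function of the class is a combination of the indicators `𝟙 j`, so it is enough to convolve
    -- those with `g`. The bound on `cl` makes the combination finite.
    conv-class-basis : ∃ (λ B → ∀ x → cl x < B) → ∀ g → (∀ j → Class (conv (𝟙 j) g)) → ∀ f → Class f → Class (conv f g)
    conv-class-basis (Bound , cl<Bound) g gc f fc x y e = trans (expand x) (trans (sumF-cong {Bound} (λ j → cong (v (toℕ j) *_) (gc (toℕ j) x y e))) (sym (expand y)))
      where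
      v = proj₁ (class-values fc)
      value : ∀ w → f w ≡ sumF {Bound} (λ j → v (toℕ j) * 𝟙 (toℕ j) w)
      value w = sym (trans (sumF-cong term) (trans (sumF-δ (λ j → v (toℕ j)) (fromℕ< (cl<Bound w)))
                  (trans (cong v (toℕ-fromℕ< (cl<Bound w))) (sym (proj₂ (class-values fc) w)))))
        where
        term : ∀ j → v (toℕ j) * 𝟙 (toℕ j) w ≡ ⟦ j ==F fromℕ< (cl<Bound w) ⟧ * v (toℕ j)
        term j = trans (*-comm (v (toℕ j)) _) (cong (λ b → ⟦ b ⟧ * v (toℕ j)) (bool-ext
          (λ h → toYes (j ≟F _) (toℕ-injective (trans (sym (fromD h)) (sym (toℕ-fromℕ< (cl<Bound w))))))
          (λ h → inD (trans (sym (toℕ-fromℕ< (cl<Bound w))) (cong toℕ (sym (==F-sound h)))))))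
      expand : ∀ x → conv f g x ≡ sumF {Bound} (λ j → v (toℕ j) * conv (𝟙 (toℕ j)) g x)
      expand x = begin
        sumF (λ w → f w * g (x ⊕ ⊖ w))
          ≡⟨ sumF-cong (λ w → trans (cong (_* g (x ⊕ ⊖ w)) (value w)) (sym (sumF-*ʳ (g (x ⊕ ⊖ w)) (λ (j : Fin Bound) → v (toℕ j) * 𝟙 (toℕ j) w)))) ⟩
        sumF (λ w → sumF {Bound} (λ j → v (toℕ j) * 𝟙 (toℕ j) w * g (x ⊕ ⊖ w)))
          ≡⟨ sumF-swap (λ w (j : Fin Bound) → v (toℕ j) * 𝟙 (toℕ j) w * g (x ⊕ ⊖ w)) ⟩
        sumF {Bound} (λ j → sumF (λ w → v (toℕ j) * 𝟙 (toℕ j) w * g (x ⊕ ⊖ w)))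
          ≡⟨ sumF-cong {Bound} (λ j → trans (sumF-cong (λ w → *-assoc (v (toℕ j)) (𝟙 (toℕ j) w) _)) (sumF-*ˡ (v (toℕ j)) (λ w → 𝟙 (toℕ j) w * g (x ⊕ ⊖ w)))) ⟩
        sumF {Bound} (λ j → v (toℕ j) * conv (𝟙 (toℕ j)) g x) ∎
        where open ≡-Reasoning

    conv-S-class : ∀ f → Class f → Class (conv (𝟙 1) f)
    conv-S-class f fc x y e = trans (conv-comm (𝟙 1) f x) (trans (conv-class-basis cl-bound (𝟙 1) base f fc x y e) (conv-comm f (𝟙 1) y))
      where
      base : ∀ j → Class (conv (𝟙 j) (𝟙 1))
      base j x y e = trans (conv-comm (𝟙 j) (𝟙 1) x) (trans (nb-conv j x) (trans (regular j x y e) (trans (sym (nb-conv j y)) (conv-comm (𝟙 1) (𝟙 j) y))))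

    -- S · D_{i+1} is a combination of D_i, D_{i+1}, D_{i+2} in which D_{i+2} occurs,
    -- so convolution by D_{i+2} is expressed by the two preceding ones.
    next-step : ∀ g i → Class (conv (𝟙 i) g) → Class (conv (𝟙 (suc i)) g) → ∀ z → cl z ≡ suc (suc i) →
      ∀ (v : ℕ → ℕ) → (∀ x → conv (𝟙 1) (𝟙 (suc i)) x ≡ v (cl x)) → Class (conv (𝟙 (suc (suc i))) g)
    next-step g i Ci Ci+1 z ez v fv = λ x y e → *-cancelˡ-≡ (conv (𝟙 (suc (suc i))) g x) (conv (𝟙 (suc (suc i))) g y) (v (suc (suc i))) {{≢-nonZero (λ h → contradiction γ>0 (<⇒≱ (s≤s (≤-reflexive h))))}}
            (+-cancelˡ-≡ (v i * conv (𝟙 i) g x + v (suc i) * conv (𝟙 (suc i)) g x) (v (suc (suc i)) * conv (𝟙 (suc (suc i))) g x) (v (suc (suc i)) * conv (𝟙 (suc (suc i))) g y)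
              (trans (sym (total x)) (trans (convf x y e) (trans (total y)
                (cong₂ (λ a b → v i * a + v (suc i) * b + v (suc (suc i)) * conv (𝟙 (suc (suc i))) g y) (Ci y x (sym e)) (Ci+1 y x (sym e)))))))
      where
      f = conv (𝟙 1) (𝟙 (suc i))
      -- The coefficient of the new class must be positive to be cancelled; the last step of a
      -- geodesic to `z` supplies a nonzero term.
      γ>0 : 1 ≤ v (suc (suc i))
      γ>0 with geodesic z (suc i) ez
      ... | u , s , eu , es , refl = ≤-trans (≤-trans (≤-reflexive (sym (cong₂ _*_ (⟦⟧-true (inD es))
               (⟦⟧-true (inD (trans (cong cl (⊕-⊖ u s)) eu))))))
               (term≤sumF (λ w → 𝟙 1 w * 𝟙 (suc i) ((u ⊕ s) ⊕ ⊖ w)) s)) (≤-reflexive (trans (fv (u ⊕ s)) (cong v ez)))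
      f-near : ∀ w → 1 ≤ f w → cl w ≡ i ⊎ cl w ≡ suc i ⊎ cl w ≡ suc (suc i)
      f-near w h = near (cl w) lo hi
        where
        found = sumF-pos (λ u → 𝟙 1 u * 𝟙 (suc i) (w ⊕ ⊖ u)) h
        u = proj₁ found
        eu : cl u ≡ 1
        eu = fromD (⟦⟧-pos (proj₁ (*-pos (proj₂ found))))
        ewu : cl (w ⊕ ⊖ u) ≡ suc i
        ewu = fromD (⟦⟧-pos (proj₂ (*-pos {𝟙 1 u} (proj₂ found))))
        hi : cl w ≤ suc (suc i)
        hi = ≤-trans (cl-≤ (sym (⊖-⊕ w u))) (≤-reflexive (trans (cong₂ _+_ ewu eu) (+-comm (suc i) 1)))
        lo : suc i ≤ cl w + 1
        lo = ≤-trans (≤-reflexive (sym ewu)) (≤-trans (cl-⊕ w (⊖ u)) (≤-reflexive (cong (cl w +_) (trans (cl-⊖ u) eu))))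
        near : ∀ c → suc i ≤ c + 1 → c ≤ suc (suc i) → c ≡ i ⊎ c ≡ suc i ⊎ c ≡ suc (suc i)
        near c a b with <-cmp c (suc i)
        ... | tri≈ _ e _ = inj₂ (inj₁ e)
        ... | tri< l _ _ = inj₁ (≤-antisym (≤-pred l) (≤-pred (subst (suc i ≤_) (+-comm c 1) a)))
        ... | tri> _ _ l = inj₂ (inj₂ (≤-antisym b l))
      convf : Class (conv f g)
      convf x y e = trans (conv-assoc (𝟙 1) (𝟙 (suc i)) g x) (trans (conv-S-class (conv (𝟙 (suc i)) g) Ci+1 x y e) (sym (conv-assoc (𝟙 1) (𝟙 (suc i)) g y)))
      total : ∀ x → conv f g x ≡ (v i * conv (𝟙 i) g x + v (suc i) * conv (𝟙 (suc i)) g x) + v (suc (suc i)) * conv (𝟙 (suc (suc i))) g x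
      total x = begin
        conv f g x
          ≡⟨ conv-cong {g = g} (λ w → trans (fv w) (three v i (cl w) (λ h → f-near w (subst (1 ≤_) (sym (fv w)) h)))) (λ _ → refl) x ⟩
        conv (λ w → (v i * 𝟙 i w + v (suc i) * 𝟙 (suc i) w) + v (suc (suc i)) * 𝟙 (suc (suc i)) w) g x
          ≡⟨ conv-distribʳ g (λ w → v i * 𝟙 i w + v (suc i) * 𝟙 (suc i) w) (λ w → v (suc (suc i)) * 𝟙 (suc (suc i)) w) x ⟩
        conv (λ w → v i * 𝟙 i w + v (suc i) * 𝟙 (suc i) w) g x + conv (λ w → v (suc (suc i)) * 𝟙 (suc (suc i)) w) g x
          ≡⟨ cong₂ _+_ (trans (conv-distribʳ g (λ w → v i * 𝟙 i w) (λ w → v (suc i) * 𝟙 (suc i) w) x) (cong₂ _+_ (conv-*ˡ (v i) (𝟙 i) g x) (conv-*ˡ (v (suc i)) (𝟙 (suc i)) g x))) (conv-*ˡ (v (suc (suc i))) (𝟙 (suc (suc i))) g x) ⟩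
        (v i * conv (𝟙 i) g x + v (suc i) * conv (𝟙 (suc i)) g x) + v (suc (suc i)) * conv (𝟙 (suc (suc i))) g x ∎
        where open ≡-Reasoning

    next : ∀ g i → Class (conv (𝟙 i) g) → Class (conv (𝟙 (suc i)) g) → Class (conv (𝟙 (suc (suc i))) g)
    next g i Ci Ci+1 with any? (λ z → cl z ≟ suc (suc i))
    ... | no ¬z = λ x y e → trans (vanish x) (sym (vanish y))
      where
      vanish : ∀ x → conv (𝟙 (suc (suc i))) g x ≡ 0
      vanish x = trans (conv-cong {g = g} (λ w → ⟦⟧-false (toNo (cl w ≟ _) (λ e → ¬z (w , e)))) (λ _ → refl) x) (conv-0ˡ g x)
    ... | yes (z , ez) = next-step g i Ci Ci+1 z ez (proj₁ values) (proj₂ values)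
      where values = class-values (conv-S-class (𝟙 (suc i)) (λ x y e → cong ⟦_⟧ (D-class (suc i) x y e)))

    -- The recurrence looks back over two classes, so two consecutive ones are carried through the
    -- induction.
    conv-D-class : ∀ g → Class g → ∀ i → Class (conv (𝟙 i) g) × Class (conv (𝟙 (suc i)) g)
    conv-D-class g gc zero = zeroth , conv-S-class g gc
      where
      zeroth : Class (conv (𝟙 0) g)
      zeroth x y e = trans (at x) (trans (gc x y e) (sym (at y)))
        where
        𝟙0 : ∀ w → 𝟙 0 w ≡ δ 𝟘 w
        𝟙0 w = cong ⟦_⟧ (bool-ext (λ h → toYes (w ≟F 𝟘) (cl≡0 w (fromD h)))
                                  (λ h → inD (trans (cong cl (==F-sound h)) cl-𝟘)))
        at : ∀ x → conv (𝟙 0) g x ≡ g x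
        at x = trans (conv-cong {g = g} 𝟙0 (λ _ → refl) x) (trans (conv-δ 𝟘 g x) (cong g (gsolve 1 (λ x → x :+ :- :0 := x) refl x)))
    conv-D-class g gc (suc i) = proj₂ (conv-D-class g gc i) , next g i (proj₁ (conv-D-class g gc i)) (proj₂ (conv-D-class g gc i))

  -- This is the passage from a distance-regular graph to an association scheme: regularity speaks
  -- only of steps of length one, and the three-term recurrence extends it to all classes.
  conv-class : ∀ {f g} → Class f → Class g → Class (conv f g)
  conv-class {f} {g} fc gc = conv-class-basis cl-bound g (λ i → proj₁ (conv-D-class g gc i)) f fc

  count-conv-class : ∀ {A B : Fin N → Bool} → Class A → Class B → Class (λ z → count (λ w → A w ∧ B (z ⊕ ⊖ w)))
  count-conv-class {A} {B} ac bc x y e = trans (rw x) (trans (conv-class (λ x y e → cong ⟦_⟧ (ac x y e)) (λ x y e → cong ⟦_⟧ (bc x y e)) x y e) (sym (rw y)))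
    where
    rw : ∀ z → count (λ w → A w ∧ B (z ⊕ ⊖ w)) ≡ conv (λ w → ⟦ A w ⟧) (λ w → ⟦ B w ⟧) z
    rw z = sumF-cong (λ w → ⟦⟧-∧ (A w) _)

  abstract
    -- The number of ways to write an element as a sum of members of two fixed classes depends only
    -- on the class of the sum, so one splitting forces one for every element of that class.
    split-class : ∀ u v z → cl (u ⊕ v) ≡ cl z → ∃₂ λ u' v' → cl u' ≡ cl u × cl v' ≡ cl v × z ≡ u' ⊕ v'
    split-class u v z e =
      let c = count-conv-class {D (cl u)} {D (cl v)} (D-class _) (D-class _)
          (w , h) = count-∃ (λ w → D (cl u) w ∧ D (cl v) (z ⊕ ⊖ w)) (subst (1 ≤_) (c (u ⊕ v) z e)
            (count-pos (λ w → D (cl u) w ∧ D (cl v) ((u ⊕ v) ⊕ ⊖ w)) u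
              (∧-intro (inD refl) (inD (cong cl (gsolve 2 (λ u v → (u :+ v) :+ :- u := v) refl u v))))))
          (h₁ , h₂) = ∧-elim h
      in w , z ⊕ ⊖ w , fromD h₁ , fromD h₂ , gsolve 2 (λ z w → z := w :+ (z :+ :- w)) refl z w

    step-class : ∀ x y s → cl x ≡ cl y → cl s ≡ 1 → ∃ λ t → cl t ≡ 1 × cl (y ⊕ t) ≡ cl (x ⊕ s)
    step-class x y s e es =
      let (t , h) = count-∃ (λ t → D 1 t ∧ D (cl (x ⊕ s)) (y ⊕ t)) (subst (1 ≤_) (regular (cl (x ⊕ s)) x y e)
            (count-pos (λ t → D 1 t ∧ D (cl (x ⊕ s)) (x ⊕ t)) s (∧-intro (inD es) (inD refl))))
          (h₁ , h₂) = ∧-elim h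
      in t , fromD h₁ , fromD h₂

  -- By `frobenius` the count differs from `convPower` by a multiple of `q`, and `convPower` is an
  -- iterated convolution of functions of the class, hence one itself.
  fibre-mod : ∀ {q} .{{_ : NonZero q}} → Prime q → ∀ {A : Fin N → Bool} → Class A →
    Class (λ y → count (λ x → A x ∧ ((q · x) ==F y)) % q)
  fibre-mod {q} pq {A} ac x y e = begin
    fib x % q                 ≡⟨ [m+kn]%n≡m%n (fib x) (h x) q ⟨
    (fib x + h x * q) % q     ≡⟨ cong (λ t → (fib x + t) % q) (*-comm (h x) q) ⟩
    (fib x + q * h x) % q     ≡⟨ cong (_% q) (trans (sym (he x)) (trans (cc x y e) (he y))) ⟩
    (fib y + q * h y) % q     ≡⟨ cong (λ t → (fib y + t) % q) (*-comm q (h y)) ⟩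
    (fib y + h y * q) % q     ≡⟨ [m+kn]%n≡m%n (fib y) (h y) q ⟩
    fib y % q                 ∎
    where
    open ≡-Reasoning
    fib = λ y → count (λ x → A x ∧ ((q · x) ==F y))
    h = proj₁ (frobenius pq A)
    he = proj₂ (frobenius pq A)
    δ-class : Class (δ 𝟘)
    δ-class x y e = cong ⟦_⟧ (bool-ext (to e) (to (sym e)))
      where
      to : ∀ {x y} → cl x ≡ cl y → (x ==F 𝟘) ≡ true → (y ==F 𝟘) ≡ true
      to {x} {y} e h = toYes (y ≟F 𝟘) (cl≡0 y (trans (sym e) (trans (cong cl (==F-sound h)) cl-𝟘)))
    cc : Class (convPower pq A)
    cc = convPower-induct pq A (λ f → Class f) δ-class (λ f fc → conv-class (λ x y e → cong ⟦_⟧ (ac x y e)) fc)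

-- Edge counts, stabilisers of the connection set, and antipodes

*-reverse : ∀ a b c → a * b * c ≡ c * b * a
*-reverse = solve 3 (λ a b c → (a :* b) :* c := (c :* b) :* a) refl
  where open +-*-Solver

module Structure {N : ℕ} (G : FinAbelianGroup N) (norm : RegularNorm G) where
  open NormTheory G norm public

  -- The outcome "complete multipartite": being equal or non-adjacent is an equivalence relation.
  Multi : Set
  Multi = ∀ x y → cl x ≢ 1 → cl y ≢ 1 → cl (x ⊕ y) ≢ 1

  -- Antipodality in the usual sense: being at distance 0 or `d`, the diameter, is an equivalence
  -- relation. For `d` equal to 2 this would be the multipartite outcome, which explains the bound
  -- 3.
  Antipodal : ℕ → Set
  Antipodal d = 3 ≤ d × (∀ y → cl y ≤ d) ×
    (∀ x y → cl x ≡ 0 ⊎ cl x ≡ d → cl y ≡ 0 ⊎ cl y ≡ d → cl (x ⊕ y) ≡ 0 ⊎ cl (x ⊕ y) ≡ d)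

  cl≡1or2 : ∀ {x} → cl x ≤ 2 → x ≢ 𝟘 → cl x ≡ 1 ⊎ cl x ≡ 2
  cl≡1or2 {x} h ne with cl x in e
  ... | 0 = contradiction (cl≡0 x e) ne
  ... | 1 = inj₁ refl
  ... | 2 = inj₂ refl
  ... | suc (suc (suc _)) = contradiction h (<⇒≱ (s≤s (s≤s (s≤s z≤n))))

  cl≢1⇒2 : ∀ {x} → cl x ≤ 2 → x ≢ 𝟘 → cl x ≢ 1 → cl x ≡ 2
  cl≢1⇒2 h ne n1 with cl≡1or2 h ne
  ... | inj₁ e = contradiction e n1
  ... | inj₂ e = e

  cl>0⇒≢ : ∀ {x i} → cl x ≡ suc i → x ≢ 𝟘
  cl>0⇒≢ e refl = case trans (sym cl-𝟘) e of λ ()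

  ≢⇒cl>0 : ∀ {x} → x ≢ 𝟘 → ∃ λ i → cl x ≡ suc i
  ≢⇒cl>0 {x} ne with cl x in e
  ... | zero  = contradiction (cl≡0 x e) ne
  ... | suc i = i , refl

  sum≤2 : ∀ {s t} → cl s ≡ 1 → cl t ≡ 1 → cl (s ⊕ t) ≤ 2
  sum≤2 {s} {t} es et = ≤-trans (cl-⊕ s t) (≤-reflexive (cong₂ _+_ es et))

  diff≤2 : ∀ {s t} → cl s ≡ 1 → cl t ≡ 1 → cl (s ⊕ ⊖ t) ≤ 2
  diff≤2 {s} {t} es et = sum≤2 es (trans (cl-⊖ t) et)

  cl-diff : ∀ x y → cl (x ⊕ ⊖ y) ≡ cl (y ⊕ ⊖ x)
  cl-diff x y = trans (sym (cl-⊖ _)) (cong cl (gsolve 2 (λ x y → :- (x :+ :- y) := y :+ :- x) refl x y))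

  cl-rev : ∀ x y → cl x ≤ cl (x ⊕ y) + cl y
  cl-rev x y = ≤-trans (cl-≤ (sym (⊕-⊖ x y))) (≤-reflexive (cong (cl (x ⊕ y) +_) (cl-⊖ y)))

  cl-pred : ∀ {z y t i} → z ≡ y ⊕ t → cl z ≡ suc i → cl t ≡ 1 → i ≤ cl y
  cl-pred {z} {y} {t} {i} e ez et = ≤-pred (≤-trans (≤-reflexive (sym ez))
    (≤-trans (cl-≤ e) (≤-reflexive (trans (cong (cl y +_) et) (+-comm (cl y) 1)))))

  abstract
    descend : ∀ x i → i ≤ cl x → ∃ λ y → cl y ≡ i
    descend x i h with m≤n⇒∃[o]m+o≡n h
    ... | k , e = go k x (trans (sym e) (+-comm i k))
      where
      go : ∀ k x → cl x ≡ k + i → ∃ λ y → cl y ≡ i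
      go zero    x e = x , e
      go (suc k) x e = let (y , _ , ey , _) = geodesic x (k + i) e in go k y ey

  abstract
    generated : (P : Fin N → Set) → P 𝟘 → (∀ x y → P x → P y → P (x ⊕ y)) → (∀ s → cl s ≡ 1 → P s) → ∀ x → P x
    generated P p0 p+ ps x = go (cl x) x refl
      where
      go : ∀ i x → cl x ≡ i → P x
      go zero    x e = subst P (sym (cl≡0 x e)) p0
      go (suc i) x e = let (y , s , ey , es , eq) = geodesic x i e in subst P (sym eq) (p+ y s (go i y ey) (ps s es))

    closed-· : (P : Fin N → Set) → P 𝟘 → (∀ x y → P x → P y → P (x ⊕ y)) → ∀ k x → P x → P (k · x)
    closed-· P p0 p+ zero    x px = p0
    closed-· P p0 p+ (suc k) x px = p+ x (k · x) px (closed-· P p0 p+ k x px)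

    exists-S : ∀ {x} → x ≢ 𝟘 → ∃ λ s → cl s ≡ 1
    exists-S {x} ne = let (i , e) = ≢⇒cl>0 ne ; (_ , s , _ , es , _) = geodesic x i e in s , es

  nb-class : ∀ j {x y} → cl x ≡ cl y → nb j x ≡ nb j y
  nb-class j {x} {y} = regular j x y

  k : ℕ → ℕ
  k i = count (D i)

  abstract
    -- Both sides count the edges between the classes `i` and `j`; traversing an edge backwards
    -- replaces the step `s` by `⊖ s`.
    double-count : ∀ i j → sumF (λ x → 𝟙 i x * nb j x) ≡ sumF (λ x → 𝟙 j x * nb i x)
    double-count i j = begin
      sumF (λ x → 𝟙 i x * nb j x)                               ≡⟨ sumF-cong (row i j) ⟩
      sumF (λ x → sumF (λ s → 𝟙 i x * 𝟙 1 s * 𝟙 j (x ⊕ s)))     ≡⟨ sumF-swap (λ x s → 𝟙 i x * 𝟙 1 s * 𝟙 j (x ⊕ s)) ⟩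
      sumF (λ s → sumF (λ x → 𝟙 i x * 𝟙 1 s * 𝟙 j (x ⊕ s)))     ≡⟨ sumF-cong (λ s → sym (sum-shift (⊖ s) (λ x → 𝟙 i x * 𝟙 1 s * 𝟙 j (x ⊕ s)))) ⟩
      sumF (λ s → sumF (λ x → 𝟙 i (x ⊕ ⊖ s) * 𝟙 1 s * 𝟙 j ((x ⊕ ⊖ s) ⊕ s)))
        ≡⟨ sumF-cong (λ s → sumF-cong (λ x → rearrange s x)) ⟩
      sumF (λ s → sumF (λ x → 𝟙 j x * 𝟙 1 (⊖ s) * 𝟙 i (x ⊕ ⊖ s)))
        ≡⟨ sumF-reindex ⊖_ ⊖_ ⊖-involutive ⊖-involutive (λ s → sumF (λ x → 𝟙 j x * 𝟙 1 s * 𝟙 i (x ⊕ s))) ⟩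
      sumF (λ s → sumF (λ x → 𝟙 j x * 𝟙 1 s * 𝟙 i (x ⊕ s)))     ≡⟨ sumF-swap (λ s x → 𝟙 j x * 𝟙 1 s * 𝟙 i (x ⊕ s)) ⟩
      sumF (λ x → sumF (λ s → 𝟙 j x * 𝟙 1 s * 𝟙 i (x ⊕ s)))     ≡⟨ sumF-cong (row j i) ⟨
      sumF (λ x → 𝟙 j x * nb i x)                               ∎
      where
      open ≡-Reasoning
      row : ∀ i j x → 𝟙 i x * nb j x ≡ sumF (λ s → 𝟙 i x * 𝟙 1 s * 𝟙 j (x ⊕ s))
      row i j x = trans (sym (sumF-*ˡ (𝟙 i x) (λ s → ⟦ D 1 s ∧ D j (x ⊕ s) ⟧)))
        (sumF-cong (λ s → trans (cong (𝟙 i x *_) (⟦⟧-∧ (D 1 s) _)) (sym (*-assoc (𝟙 i x) (𝟙 1 s) _))))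
      rearrange : ∀ s x → 𝟙 i (x ⊕ ⊖ s) * 𝟙 1 s * 𝟙 j ((x ⊕ ⊖ s) ⊕ s) ≡ 𝟙 j x * 𝟙 1 (⊖ s) * 𝟙 i (x ⊕ ⊖ s)
      rearrange s x = trans (cong₂ (λ a b → 𝟙 i (x ⊕ ⊖ s) * ⟦ a ⟧ * 𝟙 j b) (sym (D-⊖ 1 s)) (⊖-⊕ x s))
        (*-reverse (𝟙 i (x ⊕ ⊖ s)) (𝟙 1 (⊖ s)) (𝟙 j x))

    edge-count : ∀ i j {x y} → cl x ≡ i → cl y ≡ j → k i * nb j x ≡ k j * nb i y
    edge-count i j {x} {y} ex ey = trans (sym (const i j ex)) (trans (double-count i j) (const j i ey))
      where
      const : ∀ i j {x} → cl x ≡ i → sumF (λ z → 𝟙 i z * nb j z) ≡ k i * nb j x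
      const i j {x} ex = trans (sumF-cong pt) (sumF-*ʳ (nb j x) (𝟙 i))
        where
        pt : ∀ z → 𝟙 i z * nb j z ≡ 𝟙 i z * nb j x
        pt z with cl z ≟ i
        ... | yes e = cong (1 *_) (nb-class j (trans e (sym ex)))
        ... | no _  = refl

    nb-sum≤ : ∀ i j x → i ≢ j → nb i x + nb j x ≤ k 1
    nb-sum≤ i j x ne = count-⊎ (λ s h → proj₁ (∧-elim h)) (λ s h → proj₁ (∧-elim h))
      (λ s h h' → ne (trans (sym (fromD (proj₂ (∧-elim {D 1 s} h)))) (fromD (proj₂ (∧-elim {D 1 s} h')))))

    -- A triangle at `𝟘` would write one element of class 1, and hence each of them, as a sum of two
    -- others. Substituting such a sum for the first step of a geodesic to `z` produces two elements
    -- of class 2 that differ by an element of class 1.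
    triangle-free : ∀ {z} → cl z ≡ 3 → (∀ u v → cl u ≡ 2 → cl v ≡ 2 → cl (u ⊕ ⊖ v) ≢ 1) →
      ∀ s v → cl s ≡ 1 → cl v ≡ 1 → cl (v ⊕ ⊖ s) ≢ 1
    triangle-free {z} ez a₂ s v es ev evs =
      let (w , t , ew , et , z≡) = geodesic z 2 ez
          (x , y , ex , ey , w≡) = geodesic w 1 ew
          (v' , w' , ev' , ew' , x≡) = split-class v (s ⊕ ⊖ v) x (trans (cong cl (gsolve 2 (λ s v → v :+ (s :+ :- v) := s) refl s v)) (trans es (sym ex)))
      in absurd w t x y v' w' ew et z≡ ex ey w≡ (trans ev' ev) (trans ew' (trans (cl-diff s v) evs)) x≡
      where
      absurd : ∀ w t x y v' w' → cl w ≡ 2 → cl t ≡ 1 → z ≡ w ⊕ t → cl x ≡ 1 → cl y ≡ 1 → w ≡ x ⊕ y →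
        cl v' ≡ 1 → cl w' ≡ 1 → x ≡ v' ⊕ w' → ⊥
      absurd w t x y v' w' ew et z≡ ex ey w≡ ev' ew' x≡ =
        a₂ ((v' ⊕ y) ⊕ t) (y ⊕ t) c4 c2 (trans (cong cl (gsolve 3 (λ v y t → ((v :+ y) :+ t) :+ :- (y :+ t) := v) refl v' y t)) ev')
        where
        z≡₁ : z ≡ (y ⊕ t) ⊕ x
        z≡₁ = trans z≡ (trans (cong (_⊕ t) w≡) (gsolve 3 (λ x y t → (x :+ y) :+ t := (y :+ t) :+ x) refl x y t))
        z≡₂ : z ≡ ((v' ⊕ y) ⊕ t) ⊕ w'
        z≡₂ = trans z≡₁ (trans (cong ((y ⊕ t) ⊕_) x≡) (gsolve 4 (λ v w y t → (y :+ t) :+ (v :+ w) := ((v :+ y) :+ t) :+ w) refl v' w' y t))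
        w-diff : w ⊕ ⊖ (v' ⊕ y) ≡ w'
        w-diff = trans (cong (_⊕ ⊖ (v' ⊕ y)) (trans w≡ (cong (_⊕ y) x≡))) (gsolve 3 (λ v w y → ((v :+ w) :+ y) :+ :- (v :+ y) := w) refl v' w' y)
        c2 : cl (y ⊕ t) ≡ 2
        c2 = ≤-antisym (sum≤2 ey et) (cl-pred z≡₁ ez ex)
        c3 : cl (v' ⊕ y) ≤ 1
        c3 with m≤n⇒m<n∨m≡n (sum≤2 ev' ey)
        ... | inj₁ l = ≤-pred l
        ... | inj₂ e = contradiction (trans (cong cl w-diff) ew') (a₂ w (v' ⊕ y) ew e)
        c4 : cl ((v' ⊕ y) ⊕ t) ≡ 2
        c4 = ≤-antisym (≤-trans (cl-⊕ (v' ⊕ y) t) (+-mono-≤ c3 (≤-reflexive et))) (cl-pred z≡₂ ez ew')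

    -- `e` cannot have class 1, so it has class 2, and `nb 1` attains its maximum `k 1` there. The
    -- same then holds throughout class 2: every member stabilises the connection set. This excludes
    -- class 3, so all non-neighbours of `𝟘` stabilise the connection set and cannot add up to a
    -- neighbour.
    stabilised-independent : ∀ {e} → e ≢ 𝟘 → (∀ s → cl s ≡ 1 → cl (s ⊕ e) ≡ 1) → Multi
    stabilised-independent {e} ne st x y nx ny h =
      contradiction (trans (sym (cong cl (gsolve 2 (λ x y → (:- (x :+ y) :+ x) :+ y := :0) refl x y)))
        (shift y ny _ (shift x nx _ (trans (cl-⊖ _) h)))) (λ e → case trans (sym cl-𝟘) e of λ ())
      where
      s : Fin N
      s = proj₁ (exists-S ne)
      es : cl s ≡ 1
      es = proj₂ (exists-S ne)
      n1 : cl e ≢ 1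
      n1 e1 = case trans (sym (st (⊖ e) (trans (cl-⊖ e) e1))) (trans (cong cl (⊕-inverseˡ e)) cl-𝟘) of λ ()
      e2 : cl e ≡ 2
      e2 = cl≢1⇒2 (≤-trans (≤-reflexive (cong cl (gsolve 2 (λ s e → e := (s :+ e) :+ :- s) refl s e))) (diff≤2 (st s es) es)) ne n1
      two : ∀ z → cl z ≡ 2 → ∀ t → cl t ≡ 1 → cl (t ⊕ z) ≡ 1
      two z ez t et = trans (cong cl (⊕-comm t z)) (fromD (proj₂ (∧-elim {D 1 t} (count-⊆-≥ {A = λ t → D 1 t ∧ D 1 (z ⊕ t)} {B = D 1}
        (λ _ h → proj₁ (∧-elim h)) full t (inD et)))))
        where
        full : k 1 ≤ nb 1 z
        full = ≤-trans (count-mono (λ s h → ∧-intro h (inD (trans (cong cl (⊕-comm e s)) (st s (fromD h)))))) (≤-reflexive (nb-class 1 (trans e2 (sym ez))))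
      shift : ∀ z → cl z ≢ 1 → ∀ t → cl t ≡ 1 → cl (t ⊕ z) ≡ 1
      shift z nz t et with cl z ≟ 0 | cl z ≟ 2
      ... | yes z0 | _ = trans (cong cl (trans (cong (t ⊕_) (cl≡0 z z0)) (⊕-identityʳ t))) et
      ... | no _ | yes z2 = two z z2 t et
      ... | no n0 | no n2 = let (y , ey) = descend z 3 (≤∧≢⇒< (≤∧≢⇒< (n≢0⇒n>0 n0) (λ e → nz (sym e))) (λ e → n2 (sym e)))
                                (u , s , eu , es , eq) = geodesic y 2 ey
                            in case trans (sym ey) (trans (cong cl (trans eq (⊕-comm u s))) (two u eu s es)) of λ ()

    -- No step from `e` reaches class 2. By regularity no step from any element of class 1 does, so
    -- the graph is complete.
    stabilised-clique : ∀ {e} → cl e ≡ 1 → (∀ s → cl s ≡ 1 → s ⊕ e ≡ 𝟘 ⊎ cl (s ⊕ e) ≡ 1) → Multi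
    stabilised-clique {e} e1 st x y nx ny h = case trans (sym h) (trans (cong cl (trans (cong₂ _⊕_ (small x nx) (small y ny)) (⊕-identityˡ 𝟘))) cl-𝟘) of λ ()
      where
      no2 : ∀ z → cl z ≢ 2
      no2 z ez with geodesic z 1 ez
      ... | u , s , eu , es , refl with step-class u e s (trans eu (sym e1)) es
      ...   | t , et , e' with st t et
      ...     | inj₁ q = case trans (sym ez) (trans (sym e') (trans (cong cl (trans (⊕-comm e t) q)) cl-𝟘)) of λ ()
      ...     | inj₂ q = case trans (sym ez) (trans (sym e') (trans (cong cl (⊕-comm e t)) q)) of λ ()
      small : ∀ z → cl z ≢ 1 → z ≡ 𝟘
      small z nz with cl z ≟ 0
      ... | yes e = cl≡0 z e
      ... | no n0 = let (y , ey) = descend z 2 (≤∧≢⇒< (n≢0⇒n>0 n0) (λ e → nz (sym e))) in contradiction ey (no2 y)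

  private
    squeeze : ∀ a k₁ k₂ c → 1 ≤ k₁ → k₁ ≤ suc a → suc c ≤ k₁ → k₂ ≤ k₁ → k₁ * a ≡ k₂ * c → c ≡ a
    squeeze a k₁ k₂ c p k≤a c<k k₂≤ eq = ≤-antisym (≤-pred (≤-trans c<k k≤a))
      (*-cancelˡ-≤ k₁ {{>-nonZero p}} (≤-trans (≤-reflexive eq) (*-monoˡ-≤ c k₂≤)))

  abstract
    -- The counting k₁b₁ = k₂c₂ forces c₂ = k₁ − 1 and b₂ = 1.
    antipode : ∀ {z} → cl z ≡ 3 → (∀ s v → cl s ≡ 1 → cl v ≡ 1 → cl (v ⊕ ⊖ s) ≢ 1) → k 2 ≤ k 1 → 3 ≤ k 1 →
      (∀ w → cl w ≡ 3 → w ≡ z) × (∀ w → cl (z ⊕ ⊖ w) ≡ 1 → cl w ≡ 2) × (∀ w → cl w ≡ 2 → cl (z ⊕ ⊖ w) ≡ 1)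
    antipode {z} ez a₁ k₂≤k₁ k₁≥3 = unique , nbr-in , in-nbr
      where
      g : ∃₂ λ y s → cl y ≡ 2 × cl s ≡ 1 × z ≡ y ⊕ s
      g = geodesic z 2 ez
      w₀ s₀ : Fin N
      w₀ = proj₁ g
      s₀ = proj₁ (proj₂ g)
      ew₀ : cl w₀ ≡ 2
      ew₀ = proj₁ (proj₂ (proj₂ g))
      es₀ : cl s₀ ≡ 1
      es₀ = proj₁ (proj₂ (proj₂ (proj₂ g)))
      z≡ : z ≡ w₀ ⊕ s₀
      z≡ = proj₂ (proj₂ (proj₂ (proj₂ g)))
      -- The neighbours of `𝟘` are pairwise non-adjacent, so every step from `s₀` except the one
      -- back to `𝟘` leads to class 2.
      b₁ : k 1 ≤ suc (nb 2 s₀)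
      b₁ = ≤-trans (count-∪ {A = λ t → D 1 t ∧ D 2 (s₀ ⊕ t)} {B = _==F (⊖ s₀)} cases) (≤-reflexive (trans (cong (nb 2 s₀ +_) (count-δ (⊖ s₀))) (+-comm _ 1)))
        where
        cases : ∀ t → t ∈ D 1 → t ∈ (λ t → D 1 t ∧ D 2 (s₀ ⊕ t)) ⊎ t ∈ (_==F (⊖ s₀))
        cases t h with t ≟F ⊖ s₀
        ... | yes _ = inj₂ refl
        ... | no ne = inj₁ (∧-intro h (inD (cl≢1⇒2 (sum≤2 es₀ (fromD h))
              (λ e → ne (⊕-cancelˡ s₀ (trans e (sym (⊕-inverseʳ s₀)))))
              (λ e → a₁ (⊖ t) s₀ (trans (cl-⊖ t) (fromD h)) es₀ (trans (cong cl (cong (s₀ ⊕_) (⊖-involutive t))) e)))))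
      w-nb : ∀ {w} → cl w ≡ 2 → nb 1 w + nb 3 w ≤ k 1
      w-nb {w} _ = nb-sum≤ 1 3 w (λ ())
      nb3>0 : ∀ {w} → cl w ≡ 2 → 1 ≤ nb 3 w
      nb3>0 {w} ew = ≤-trans (count-pos (λ t → D 1 t ∧ D 3 (w₀ ⊕ t)) s₀ (∧-intro (inD es₀) (inD (trans (cong cl (sym z≡)) ez))))
        (≤-reflexive (nb-class 3 (trans ew₀ (sym ew))))
      c₂ : nb 1 w₀ ≡ nb 2 s₀
      c₂ = squeeze (nb 2 s₀) (k 1) (k 2) (nb 1 w₀) (≤-trans (s≤s z≤n) k₁≥3) b₁
        (≤-trans (≤-reflexive (+-comm 1 _)) (≤-trans (+-monoʳ-≤ (nb 1 w₀) (nb3>0 ew₀)) (w-nb ew₀))) k₂≤k₁ (edge-count 1 2 es₀ ew₀)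
      c₂' : ∀ {w} → cl w ≡ 2 → nb 1 w ≡ nb 2 s₀
      c₂' ew = trans (nb-class 1 (trans ew (sym ew₀))) c₂
      nb3≤1 : ∀ {w} → cl w ≡ 2 → nb 3 w ≤ 1
      nb3≤1 {w} ew = +-cancelˡ-≤ (nb 2 s₀) _ _ (≤-trans (≤-reflexive (cong (_+ nb 3 w) (sym (c₂' ew)))) (≤-trans (w-nb ew) (≤-trans b₁ (≤-reflexive (+-comm 1 _)))))
      k≤ : k 1 ≤ k 2
      k≤ = *-cancelʳ-≤ (k 1) (k 2) (nb 2 s₀) {{>-nonZero (≤-trans (s≤s z≤n) (≤-pred (≤-trans k₁≥3 b₁)))}}
        (≤-reflexive (trans (edge-count 1 2 es₀ ew₀) (cong (k 2 *_) c₂)))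
      near : Fin N → Fin N → Bool
      near z' w = D 2 w ∧ D 1 (z' ⊕ ⊖ w)
      -- For a neighbour `w` of `z'` in class 2, each step `t` that takes `w` back to class 1 also
      -- takes `z'` to class 2, since `z' ⊕ t` is `w ⊕ t` followed by one step.
      c₃ : ∀ {z'} → cl z' ≡ 3 → nb 2 s₀ ≤ count (near z')
      c₃ {z'} ez' with geodesic z' 2 ez'
      ... | w , s , ew , es , refl = ≤-trans (≤-reflexive (sym (c₂' ew)))
            (count-inj {A = λ t → D 1 t ∧ D 1 (w ⊕ t)} {B = near (w ⊕ s)} ((w ⊕ s) ⊕_) into (λ _ _ _ _ → ⊕-cancelˡ (w ⊕ s)))
        where
        into : ∀ t → t ∈ (λ t → D 1 t ∧ D 1 (w ⊕ t)) → ((w ⊕ s) ⊕ t) ∈ near (w ⊕ s)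
        into t h = let (h₁ , h₂) = ∧-elim h in ∧-intro
          (inD (≤-antisym (≤-trans (≤-reflexive (cong cl (gsolve 3 (λ w s t → (w :+ s) :+ t := (w :+ t) :+ s) refl w s t))) (sum≤2 (fromD h₂) es))
            (≤-pred (≤-trans (≤-reflexive (sym ez')) (≤-trans (cl-rev (w ⊕ s) t) (≤-reflexive (trans (cong (cl ((w ⊕ s) ⊕ t) +_) (fromD h₁)) (+-comm _ 1))))))))
          (inD (trans (cong cl (gsolve 2 (λ z t → z :+ :- (z :+ t) := :- t) refl (w ⊕ s) t)) (trans (cl-⊖ t) (fromD h₁))))
      unique-step : ∀ {w t t'} → cl w ≡ 2 → cl t ≡ 1 → cl t' ≡ 1 → cl (w ⊕ t) ≡ 3 → cl (w ⊕ t') ≡ 3 → t ≡ t'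
      unique-step {w} {t} {t'} ew et et' e e' with t ≟F t'
      ... | yes q = q
      ... | no ne = contradiction (nb3≤1 ew) (<⇒≱ (count-two (λ t → D 1 t ∧ D 3 (w ⊕ t)) (∧-intro (inD et) (inD e)) (∧-intro (inD et') (inD e')) ne))
      to : ∀ z w → w ⊕ (z ⊕ ⊖ w) ≡ z
      to = gsolve 2 (λ z w → w :+ (z :+ :- w) := z) refl
      unique : ∀ z' → cl z' ≡ 3 → z' ≡ z
      unique z' ez' with z' ≟F z
      ... | yes q = q
      -- Because `nb 3` is at most 1 on class 2, distinct elements of class 3 have disjoint sets
      -- `near`. Two of them would give 2 (k₁ - 1) ≤ k₂ ≤ k₁, against 3 ≤ k₁.
      ... | no ne = contradiction (≤-trans (+-mono-≤ (c₃ ez') (c₃ ez)) (≤-trans (count-⊎ {A = near z'} {near z} {D 2} (λ _ h → proj₁ (∧-elim h)) (λ _ h → proj₁ (∧-elim h)) disjoint) (≤-trans k₂≤k₁ b₁)))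
              (<⇒≱ (≤-trans (≤-reflexive (cong suc (+-comm 1 (nb 2 s₀)))) (≤-trans (≤-reflexive (sym (+-suc _ 1))) (+-monoʳ-≤ (nb 2 s₀) (≤-pred (≤-trans k₁≥3 b₁))))))
        where
        disjoint : ∀ w → w ∈ near z' → w ∈ near z → ⊥
        disjoint w h h' = let (a , b) = ∧-elim {D 2 w} h ; (_ , b') = ∧-elim {D 2 w} h' in
          ne (⊕-cancelʳ (⊖ w) (unique-step (fromD a) (fromD b) (fromD b') (trans (cong cl (to z' w)) ez') (trans (cong cl (to z w)) ez)))
      in-nbr : ∀ w → cl w ≡ 2 → cl (z ⊕ ⊖ w) ≡ 1
      in-nbr w ew with count-∃ (λ t → D 1 t ∧ D 3 (w ⊕ t)) (nb3>0 ew)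
      ... | t , h = let (a , b) = ∧-elim {D 1 t} h in
            trans (cong cl (trans (cong (_⊕ ⊖ w) (sym (unique _ (fromD b)))) (gsolve 2 (λ w t → (w :+ t) :+ :- w := t) refl w t))) (fromD a)
      nbr-in : ∀ w → cl (z ⊕ ⊖ w) ≡ 1 → cl w ≡ 2
      nbr-in w h = fromD (count-⊆-≥ {A = D 2} {B = λ w → D 1 (z ⊕ ⊖ w)} (λ w h → inD (in-nbr w (fromD h)))
        (≤-trans (≤-reflexive (sum-reflect z (𝟙 1))) k≤) w (inD h))

-- Multipliers, noncyclicity and imprimitive graphs

product-coprime : ∀ n a b → Coprime (a * b) n → Coprime a n × Coprime b n
product-coprime n a b c = (λ { (d , e) → c (∣-trans d (m∣m*n b) , e) }) , (λ { (d , e) → c (∣-trans d (n∣m*n a) , e) })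

module Multipliers {N : ℕ} (G : FinAbelianGroup N) (norm : RegularNorm G)
  (n : ℕ) .{{n≢0 : NonZero n}} (exponent : ∀ x → GroupTheory._·_ G n x ≡ FinAbelianGroup.𝟘 G) where
  open Structure G norm public

  multiple-n : ∀ j x → (j * n) · x ≡ 𝟘
  multiple-n j x = trans (·-assoc j n x) (trans (cong (j ·_) (exponent x)) (·-𝟘 j))

  abstract
    inverse-multiplier : ∀ t → Coprime t n → ∃ λ t' → Coprime t' n × (∀ x → t' · (t · x) ≡ x)
    inverse-multiplier t c with Cop.coprime-Bézout c
    ... | Bézout.+- a b e = a , cop , λ x → begin
        a · (t · x)        ≡⟨ ·-assoc a t x ⟨
        (a * t) · x        ≡⟨ cong (_· x) e ⟨
        x ⊕ (b * n) · x    ≡⟨ cong (x ⊕_) (multiple-n b x) ⟩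
        x ⊕ 𝟘              ≡⟨ ⊕-identityʳ x ⟩
        x                  ∎
      where
      open ≡-Reasoning
      cop : Coprime a n
      cop {d} (p , q) = ∣1⇒≡1 (∣m+n∣m⇒∣n (subst (d ∣_) (trans (sym e) (+-comm 1 (b * n))) (∣-trans p (m∣m*n t))) (∣-trans q (n∣m*n b)))
    -- In this Bézout case `a * t` acts as negation, so its square is the identity and `a * t * a`
    -- inverts `t`.
    ... | Bézout.-+ a b e = a * t * a , cop , λ x → begin
        (a * t * a) · (t · x)       ≡⟨ ·-assoc (a * t) a (t · x) ⟩
        (a * t) · (a · (t · x))     ≡⟨ cong ((a * t) ·_) (·-assoc a t x) ⟨
        (a * t) · ((a * t) · x)     ≡⟨ cong ((a * t) ·_) (minus x) ⟩
        (a * t) · (⊖ x)             ≡⟨ minus (⊖ x) ⟩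
        ⊖ ⊖ x                       ≡⟨ ⊖-involutive x ⟩
        x                           ∎
      where
      open ≡-Reasoning
      minus : ∀ x → (a * t) · x ≡ ⊖ x
      minus x = ⊕-cancelˡ x (trans (cong (_· x) e) (trans (multiple-n b x) (sym (⊕-inverseʳ x))))
      cop : Coprime (a * t * a) n
      cop {d} (p , q) = ∣1⇒≡1 (∣m+n∣n⇒∣m′ d∣1+at (∣m+n∣m⇒∣n (subst (d ∣_) (trans (cong (a * t *_) (+-comm 1 (a * t))) (*-distribˡ-+ (a * t) (a * t) 1)) (∣-trans d∣1+at (n∣m*n (a * t))))
                        (subst (d ∣_) (*-assoc (a * t) a t) (∣-trans p (m∣m*n t)))))
        where
        d∣1+at : d ∣ 1 + a * t
        d∣1+at = subst (d ∣_) (sym e) (∣-trans q (n∣m*n b))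
        ∣m+n∣n⇒∣m′ : d ∣ 1 + a * t → d ∣ a * t * 1 → d ∣ 1
        ∣m+n∣n⇒∣m′ h h' = ∣m+n∣m⇒∣n (subst (d ∣_) (+-comm 1 (a * t)) h) (subst (d ∣_) (*-identityʳ (a * t)) h')

  multiplier-injective : ∀ {t} → Coprime t n → ∀ {x y} → t · x ≡ t · y → x ≡ y
  multiplier-injective {t} c {x} {y} e = let (t' , _ , i) = inverse-multiplier t c in
    trans (sym (i x)) (trans (cong (t' ·_) e) (i y))

  abstract
    -- The fibre over q · x is the single point x, so the class of q · x determines the class of x.
    prime-multiplier : ∀ {q} → Prime q → Coprime q n → ∀ x y → cl (q · x) ≡ cl (q · y) → cl x ≡ cl y
    prime-multiplier {q} pq c x y e = trans (sym (fromD (proj₁ found'))) (cong cl (multiplier-injective c (==F-sound (proj₂ found'))))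
      where
      instance
        q≢0 : NonZero q
        q≢0 = prime⇒nonZero pq
      fib : Fin N → ℕ
      fib z = count (λ w → D (cl x) w ∧ ((q · w) ==F z))
      1<q : 1 < q
      1<q = nonTrivial⇒n>1 q {{prime⇒nonTrivial pq}}
      fib-x : fib (q · x) ≡ 1
      fib-x = count-unique≡1 _ x (∧-intro (inD refl) (toYes (q · x ≟F _) refl))
        (λ w h → multiplier-injective c (==F-sound (proj₂ (∧-elim {D (cl x) w} h))))
      fib-y : fib (q · y) % q ≡ 1
      fib-y = trans (fibre-mod pq {D (cl x)} (D-class (cl x)) (q · y) (q · x) (sym e)) (trans (cong (_% q) fib-x) (m<n⇒m%n≡m 1<q))
      fib-pos : 1 ≤ fib (q · y)
      fib-pos with fib (q · y) in eq
      ... | suc _ = s≤s z≤n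
      ... | zero = case trans (sym (trans (cong (_% q) eq) (m<n⇒m%n≡m (<-trans (s≤s z≤n) 1<q)))) fib-y of λ ()
      found : ∃ λ w → w ∈ (λ w → D (cl x) w ∧ ((q · w) ==F (q · y)))
      found = count-∃ (λ w → D (cl x) w ∧ ((q · w) ==F (q · y))) fib-pos
      found' : proj₁ found ∈ D (cl x) × proj₁ found ∈ (λ w → (q · w) ==F (q · y))
      found' = ∧-elim {D (cl x) (proj₁ found)} (proj₂ found)

    private
      primes-multiplier : ∀ ts → All Prime ts → Coprime (NL.product ts) n →
        ∀ x y → cl (NL.product ts · x) ≡ cl (NL.product ts · y) → cl x ≡ cl y
      primes-multiplier [] [] c x y e = trans (cong cl (sym (1· x))) (trans e (cong cl (1· y)))
      primes-multiplier (q ∷ qs) (pq ∷ pqs) c x y e =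
        primes-multiplier qs pqs (proj₂ cc) x y (prime-multiplier pq (proj₁ cc) _ _
          (trans (cong cl (sym (·-assoc q _ x))) (trans e (cong cl (·-assoc q _ y)))))
        where
        cc : Coprime q n × Coprime (NL.product qs) n
        cc = product-coprime n q (NL.product qs) c

    multiplier-reflects : ∀ {t} → Coprime t n → ∀ x y → cl (t · x) ≡ cl (t · y) → cl x ≡ cl y
    -- Zero is coprime to `n` only when `n` is 1, and then the group is trivial.
    multiplier-reflects {zero} c x y e = cong cl (trans (trivial x) (sym (trivial y)))
      where
      trivial : ∀ x → x ≡ 𝟘
      trivial x = trans (sym (1· x)) (trans (cong (_· x) (sym (c (n ∣0 , ∣-refl)))) (exponent x))
    multiplier-reflects {t@(suc _)} c x y e with factorise t
    ... | record { factors = ts ; isFactorisation = eq ; factorsPrime = ps } =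
      primes-multiplier ts ps (subst (λ t → Coprime t n) eq c) x y (subst (λ t → cl (t · x) ≡ cl (t · y)) eq e)

    multiplier-class : ∀ {t} → Coprime t n → ∀ x y → cl x ≡ cl y → cl (t · x) ≡ cl (t · y)
    multiplier-class {t} c x y e = let (t' , c' , i) = inverse-multiplier t c in
      multiplier-reflects c' _ _ (trans (cong cl (i x)) (trans e (cong cl (sym (i y)))))

    halve : n % 2 ≡ 1 → ∀ s → suc (n / 2) · (s ⊕ s) ≡ s
    halve odd s = begin
      suc (n / 2) · (s ⊕ s)        ≡⟨ cong (suc (n / 2) ·_) (cong (s ⊕_) (sym (1· s))) ⟩
      suc (n / 2) · (2 · s)        ≡⟨ ·-assoc (suc (n / 2)) 2 s ⟨
      (2 + (n / 2) * 2) · s        ≡⟨ cong (λ t → (1 + t) · s) (trans (cong (_+ n / 2 * 2) (sym odd)) (sym (m≡m%n+[m/n]*n n 2))) ⟩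
      s ⊕ n · s                    ≡⟨ cong (s ⊕_) (exponent s) ⟩
      s ⊕ 𝟘                        ≡⟨ ⊕-identityʳ s ⟩
      s                            ∎
      where open ≡-Reasoning

  module Noncyclic (n<N : n < N) where
    abstract
      -- If the connection set consisted of `x` and `⊖ x`, connectedness would make every element a
      -- multiple of `x`; but `x` has at most `n` multiples and the group has more elements.
      noncyclic : ∀ x → ∃ λ y → cl y ≡ 1 × y ≢ x × y ≢ ⊖ x
      noncyclic x with any? (λ y → (cl y ≟ 1) ×-dec (¬? (y ≟F x) ×-dec ¬? (y ≟F ⊖ x)))
      ... | yes h = h
      ... | no ¬h = ⊥-elim (clash (FP.pigeonhole n<N (λ g → proj₁ (log g))))
        where
        -x : ⊖ x ≡ (n ∸ 1) · x
        -x = ⊕-cancelˡ x (trans (⊕-inverseʳ x) (sym (trans (cong (_· x) (m+[n∸m]≡n (>-nonZero⁻¹ n))) (exponent x))))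
        P : Fin N → Set
        P g = ∃ λ j → g ≡ j · x
        gens : ∀ s → cl s ≡ 1 → P s
        gens s es with s ≟F x | s ≟F ⊖ x
        ... | yes e | _ = 1 , trans e (sym (1· x))
        ... | no _  | yes e = n ∸ 1 , trans e -x
        ... | no a  | no b = contradiction (s , es , a , b) ¬h
        reduce : ∀ j → j · x ≡ (j % n) · x
        reduce j = trans (cong (_· x) (m≡m%n+[m/n]*n j n)) (trans (·-distribʳ (j % n) _ x) (trans (cong ((j % n) · x ⊕_) (multiple-n (j / n) x)) (⊕-identityʳ _)))
        log : ∀ g → ∃ λ (j : Fin n) → g ≡ toℕ j · x
        log g = let (j , e) = generated P (0 , refl) (λ { _ _ (i , refl) (j , refl) → i + j , sym (·-distribʳ i j x) }) gens g
                in fromℕ< (m%n<n j n) , trans e (trans (reduce j) (cong (_· x) (sym (toℕ-fromℕ< (m%n<n j n)))))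
        clash : (∃₂ λ i j → i F.< j × proj₁ (log i) ≡ proj₁ (log j)) → ⊥
        clash (i , j , i<j , e) = <⇒≢ i<j (cong toℕ (trans (proj₂ (log i)) (trans (cong (λ t → toℕ t · x) e) (sym (proj₂ (log j))))))

      -- This is c₂ ≥ 2. Interchanging the two steps gives a second path unless they coincide. For a
      -- repeated step `x`, take `y` from `noncyclic`. If `x ⊕ y` or `x ⊕ ⊖ y` has class 2, it has
      -- two paths, and their number depends only on the class; if both have class 1, they add up to
      -- `x ⊕ x`.
      two-paths : ∀ {z} → cl z ≡ 2 → 2 ≤ count (λ s → D 1 s ∧ D 1 (z ⊕ ⊖ s))
      two-paths {z} ez with geodesic z 1 ez
      ... | x , x' , ex , ex' , refl with x ≟F x'
      ...   | no ne = count-two _ {x} {x'} (∧-intro (inD ex) (inD (trans (cong cl (gsolve 2 (λ x y → (x :+ y) :+ :- x := y) refl x x')) ex')))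
                        (∧-intro (inD ex') (inD (trans (cong cl (⊕-⊖ x x')) ex))) ne
      ...   | yes refl with noncyclic x
      ...     | y , ey , y≢x , y≢-x = go (cl≡1or2 (sum≤2 ex ey) (λ e → y≢-x (⊕-cancelˡ x (trans e (sym (⊕-inverseʳ x))))))
                                         (cl≡1or2 (diff≤2 ex ey) (λ e → y≢x (sym (⊖≡𝟘⇒≡ e))))
        where
        distinct : ∀ {u v} → cl u ≡ 1 → cl v ≡ 1 → u ≢ v → cl (u ⊕ v) ≡ 2 → 2 ≤ count (λ s → D 1 s ∧ D 1 ((x ⊕ x) ⊕ ⊖ s))
        distinct {u} {v} eu ev ne euv = ≤-trans
          (count-two (λ s → D 1 s ∧ D 1 ((u ⊕ v) ⊕ ⊖ s)) {u} {v} (∧-intro (inD eu) (inD (trans (cong cl (gsolve 2 (λ x y → (x :+ y) :+ :- x := y) refl u v)) ev)))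
            (∧-intro (inD ev) (inD (trans (cong cl (⊕-⊖ u v)) eu))) ne)
          (≤-reflexive (count-conv-class {D 1} {D 1} (D-class 1) (D-class 1) (u ⊕ v) (x ⊕ x) (trans euv (sym ez))))
        y≢0 : y ≢ 𝟘
        y≢0 = cl>0⇒≢ ey
        go : cl (x ⊕ y) ≡ 1 ⊎ cl (x ⊕ y) ≡ 2 → cl (x ⊕ ⊖ y) ≡ 1 ⊎ cl (x ⊕ ⊖ y) ≡ 2 → 2 ≤ count (λ s → D 1 s ∧ D 1 ((x ⊕ x) ⊕ ⊖ s))
        go (inj₂ e) _ = distinct ex ey (λ e → y≢x (sym e)) e
        go (inj₁ _) (inj₂ e) = distinct ex (trans (cl-⊖ y) ey) (λ e → y≢-x (trans (sym (⊖-involutive y)) (cong ⊖_ (sym e)))) e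
        go (inj₁ e) (inj₁ e') = count-two _ {x ⊕ y} {x}
          (∧-intro (inD e) (inD (trans (cong cl (gsolve 2 (λ x y → (x :+ x) :+ :- (x :+ y) := x :+ :- y) refl x y)) e')))
          (∧-intro (inD ex) (inD (trans (cong cl (⊕-⊖ x x)) ex)))
          (λ q → y≢0 (⊕-cancelˡ x (trans q (sym (⊕-identityʳ x)))))

      -- Let j be the least positive class inside the core of M. If a point z at distance j + 1 exists, two
      -- geodesics from 𝟘 to z put a difference of norm at most 2 into the core, so j = 2; then the graph
      -- is triangle-free with halved part in the core, which is impossible in odd order.
      imprimitive : n % 2 ≡ 1 → (M : Fin N → Set) → (∀ x → Dec (M x)) → (∀ x y → M x → M y → M (x ⊕ y)) → (∀ x → M x → M (⊖ x)) →
        ∀ {g} → ¬ M g → ∀ {x} → x ≢ 𝟘 → (∀ z → cl z ≡ cl x → M z) → Multi ⊎ (Antipodal (cl x))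
      imprimitive odd M M? M+ M- {g} g∉ {x} x≢0 x∈ = outcome
        where
        -- The core of `M`: the elements whose entire class lies in `M`. It is closed under addition
        -- by `split-class`, hence a subgroup that is a union of classes, which `M` itself need not
        -- be.
        C : Fin N → Set
        C h = ∀ z → cl z ≡ cl h → M z
        C+ : ∀ u v → C u → C v → C (u ⊕ v)
        C+ u v cu cv z ez with split-class u v z (sym ez)
        ... | u' , v' , eu , ev , refl = M+ u' v' (cu u' eu) (cv v' ev)
        C- : ∀ u → C u → C (⊖ u)
        C- u cu z ez = subst M (⊖-involutive z) (M- _ (cu (⊖ z) (trans (cl-⊖ z) (trans ez (cl-⊖ u)))))
        M𝟘 : M 𝟘
        M𝟘 = subst M (⊕-inverseʳ x) (M+ x (⊖ x) (x∈ x refl) (M- x (x∈ x refl)))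
        C𝟘 : C 𝟘
        C𝟘 z ez = subst M (sym (cl≡0 z (trans ez cl-𝟘))) M𝟘
        P : ℕ → Set
        P i = ∀ z → cl z ≡ suc i → M z
        x-level : ∃ λ i → cl x ≡ suc i
        x-level = ≢⇒cl>0 x≢0
        min : ∃ λ m → P m × m ≤ proj₁ x-level × (∀ i → i < m → ¬ P i)
        min = least P (λ i → all? (λ z → (cl z ≟ suc i) →-dec M? z)) (proj₁ x-level) (λ z ez → x∈ z (trans ez (sym (proj₂ x-level))))
        j₀ : ℕ
        j₀ = proj₁ min
        Pj : P j₀
        Pj = proj₁ (proj₂ min)
        j₀≤ : suc j₀ ≤ cl x
        j₀≤ = ≤-trans (s≤s (proj₁ (proj₂ (proj₂ min)))) (≤-reflexive (sym (proj₂ x-level)))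
        CD : ∀ {h} → cl h ≡ suc j₀ → C h
        CD e z ez = Pj z (trans ez e)
        minimal : ∀ {h} → C h → h ≢ 𝟘 → suc j₀ ≤ cl h
        minimal {h} ch ne = let (i , e) = ≢⇒cl>0 ne in ≮⇒≥ (λ l → proj₂ (proj₂ (proj₂ min)) i
          (≤-pred (subst (_< suc j₀) e l)) (λ z ez → ch z (trans ez (sym e))))
        j₀≥1 : 1 ≤ j₀
        j₀≥1 with j₀ in eq
        ... | suc _ = s≤s z≤n
        ... | zero = contradiction (generated M M𝟘 M+ (λ s es → Pj s (trans es (cong suc (sym eq)))) g) g∉
        S∌ : ∀ {s} → C s → cl s ≢ 1
        S∌ cs e = <⇒≱ (s≤s j₀≥1) (≤-trans (minimal cs (cl>0⇒≢ e)) (≤-reflexive e))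
        outcome : Multi ⊎ Antipodal (cl x)
        outcome with any? (λ z → cl z ≟ suc (suc j₀))
        ... | yes (z , ez) = ⊥-elim (beyond (geodesic z (suc j₀) ez))
          where
          beyond : (∃₂ λ y s → cl y ≡ suc j₀ × cl s ≡ 1 × z ≡ y ⊕ s) → ⊥
          beyond (y , s' , ey , es' , z≡) with geodesic y j₀ ey
          -- Odd order enters here: `s` is a multiple of `s ⊕ s`, so the core would contain an
          -- element of class 1.
          ... | w , s , ew , es , refl = S∌ (subst C (halve odd s) (closed-· C C𝟘 C+ (suc (n / 2)) (s ⊕ s) double)) es
            where
            z≡' : z ≡ w ⊕ (s ⊕ s')
            z≡' = trans z≡ (⊕-assoc w s s')
            u2 : cl (s ⊕ s') ≡ 2
            u2 = ≤-antisym (sum≤2 es es') (+-cancelˡ-≤ j₀ _ _ (≤-trans (≤-reflexive (+-comm j₀ 2)) (≤-trans (≤-reflexive (sym ez))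
                   (≤-trans (cl-≤ z≡') (≤-reflexive (cong (_+ cl (s ⊕ s')) ew))))))
            paths : ∃ λ t → t ∈ (λ t → D 1 t ∧ D 1 ((s ⊕ s') ⊕ ⊖ t)) × t ≢ s
            paths = count-≥2 _ (two-paths u2) s
            s₁ : Fin N
            s₁ = proj₁ paths
            s₁≢s : s₁ ≢ s
            s₁≢s = proj₂ (proj₂ paths)
            es₁ : cl s₁ ≡ 1
            es₁ = fromD (proj₁ (∧-elim {D 1 s₁} (proj₁ (proj₂ paths))))
            es₂ : cl ((s ⊕ s') ⊕ ⊖ s₁) ≡ 1
            es₂ = fromD (proj₂ (∧-elim {D 1 s₁} (proj₁ (proj₂ paths))))
            back : ∀ t r → cl t ≡ 1 → cl r ≡ 1 → s ⊕ s' ≡ t ⊕ r → C (z ⊕ ⊖ t)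
            back t r et er e = CD (≤-antisym (≤-trans (cl-≤ eq) (≤-reflexive (trans (cong₂ _+_ ew er) (+-comm j₀ 1))))
              (≤-pred (≤-trans (≤-reflexive (sym ez)) (≤-trans (cl-rev z (⊖ t)) (≤-reflexive (trans (cong (cl (z ⊕ ⊖ t) +_) (trans (cl-⊖ t) et)) (+-comm _ 1)))))))
              where
              eq : z ⊕ ⊖ t ≡ w ⊕ r
              eq = trans (cong (_⊕ ⊖ t) (trans z≡' (cong (w ⊕_) e))) (gsolve 3 (λ w t r → (w :+ (t :+ r)) :+ :- t := w :+ r) refl w t r)
            diff : C (s₁ ⊕ ⊖ s)
            diff = subst C (gsolve 3 (λ z s t → (z :+ :- s) :+ :- (z :+ :- t) := t :+ :- s) refl z s s₁)
              (C+ _ _ (back s s' es es' refl) (C- _ (back s₁ _ es₁ es₂ (gsolve 2 (λ u t → u := t :+ (u :+ :- t)) refl (s ⊕ s') s₁))))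
            j₀≡1 : j₀ ≡ 1
            j₀≡1 = ≤-antisym (≤-pred (≤-trans (minimal diff (λ e → s₁≢s (⊖≡𝟘⇒≡ e))) (diff≤2 es₁ es))) j₀≥1
            D2C : ∀ {u} → cl u ≡ 2 → C u
            D2C e = CD (trans e (cong suc (sym j₀≡1)))
            a₁ : ∀ s v → cl s ≡ 1 → cl v ≡ 1 → cl (v ⊕ ⊖ s) ≢ 1
            a₁ = triangle-free (trans ez (cong (λ t → suc (suc t)) j₀≡1)) (λ u v eu ev → S∌ (C+ u (⊖ v) (D2C eu) (C- v (D2C ev))))
            double : C (s ⊕ s)
            double with s ⊕ s ≟F 𝟘
            ... | yes e = subst C (sym e) C𝟘
            ... | no ne = D2C (cl≢1⇒2 (sum≤2 es es) ne (λ e → a₁ (⊖ s) s (trans (cl-⊖ s) es) es (trans (cong cl (cong (s ⊕_) (⊖-involutive s))) e)))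
        ... | no none = at-top (m≤n⇒m<n∨m≡n j₀≥1)
          where
          top : ∀ y → cl y ≤ suc j₀
          top y = ≮⇒≥ (λ l → none (descend y (suc (suc j₀)) l))
          clx : cl x ≡ suc j₀
          clx = ≤-antisym (top x) j₀≤
          In : Fin N → Set
          In y = cl y ≡ 0 ⊎ cl y ≡ suc j₀
          toC : ∀ {y} → In y → C y
          toC {y} (inj₁ e) = subst C (sym (cl≡0 y e)) C𝟘
          toC (inj₂ e) = CD e
          fromC : ∀ {y} → C y → In y
          fromC {y} c with cl y ≟ 0
          ... | yes e = inj₁ e
          ... | no ne = inj₂ (≤-antisym (top y) (minimal c (λ { refl → ne cl-𝟘 })))
          -- The core consists of the classes 0 and `suc j₀`, the largest one. For diameter 2 these
          -- are the non-neighbours of `𝟘`, which makes the graph multipartite.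
          at-top : 1 < j₀ ⊎ 1 ≡ j₀ → Multi ⊎ Antipodal (cl x)
          at-top (inj₁ l) = inj₂ (subst Antipodal (sym clx) (s≤s l , top , λ y z iy iz → fromC (C+ y z (toC iy) (toC iz))))
          at-top (inj₂ e) = inj₁ λ y z ny nz → S∌ (C+ y z (toC (near y ny)) (toC (near z nz)))
            where
            near : ∀ y → cl y ≢ 1 → In y
            near y ny with cl y ≟ 0
            ... | yes e = inj₁ e
            ... | no n0 = inj₂ (trans (cl≢1⇒2 (≤-trans (top y) (≤-reflexive (cong suc (sym e)))) (λ { refl → n0 cl-𝟘 }) ny) (cong suc e))

-- Even exponent: doubling

count-three : ∀ {N} (A : Fin N → Bool) {x y z} → x ∈ A → y ∈ A → z ∈ A → x ≢ y → x ≢ z → y ≢ z → 3 ≤ count A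
count-three A {x} {y} {z} a b c xy xz yz = ≤-trans
  (+-mono-≤ (≤-reflexive (sym (count-δ x))) (count-two (λ w → A w ∧ not (w ==F x)) {y} {z}
    (∧-intro b (not-intro (toNo (y ≟F x) (λ e → xy (sym e))))) (∧-intro c (not-intro (toNo (z ≟F x) (λ e → xz (sym e))))) yz))
  (count-⊎ {A = _==F x} (λ w e → subst (_∈ A) (sym (==F-sound e)) a) (λ w h → proj₁ (∧-elim h))
    (λ w e h → true≢false e (not-elim (proj₂ (∧-elim {A w} h)))))

module CaseAnalysis {N : ℕ} (G : FinAbelianGroup N) (norm : RegularNorm G)
  (n : ℕ) .{{n≢0 : NonZero n}} (exponent : ∀ x → GroupTheory._·_ G n x ≡ FinAbelianGroup.𝟘 G) (n<N : n < N) where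
  open Multipliers G norm n exponent public
  open Noncyclic n<N public

  multi-diameter : Multi → ∀ x → cl x ≤ 2
  multi-diameter m x = ≮⇒≥ λ l → let (y , ey) = descend x 3 l ; (w , s , ew , es , eq) = geodesic y 2 ey in
    m y (⊖ w) (λ e → case trans (sym e) ey of λ ()) (λ e → case trans (sym e) (trans (cl-⊖ w) ew) of λ ())
      (trans (cong cl (trans (cong (_⊕ ⊖ w) eq) (gsolve 2 (λ w s → (w :+ s) :+ :- w := s) refl w s))) es)

  antipodal≢multi : ∀ {d y} → Antipodal d → cl y ≡ d → Multi → ⊥
  antipodal≢multi (3≤d , _) e m = <⇒≱ (s≤s (multi-diameter m _)) (≤-trans 3≤d (≤-reflexive (sym e)))

  -- z is the antipode of 𝟘 in a crown graph, and the classes 0 and 2 form one side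
  record CrownData : Set where
    field
      z        : Fin N
      cl-z     : cl z ≡ 3
      only-z   : ∀ w → cl w ≡ 3 → w ≡ z
      diameter : ∀ w → cl w ≤ 3
      z⊕z      : z ⊕ z ≡ 𝟘
      nbr-in   : ∀ w → cl (z ⊕ ⊖ w) ≡ 1 → cl w ≡ 2
      in-nbr   : ∀ w → cl w ≡ 2 → cl (z ⊕ ⊖ w) ≡ 1
      closed   : ∀ x y → cl x ≡ 0 ⊎ cl x ≡ 2 → cl y ≡ 0 ⊎ cl y ≡ 2 → cl (x ⊕ y) ≡ 0 ⊎ cl (x ⊕ y) ≡ 2
      z-odd    : ∀ x → 2 · x ≢ z

  fibre : ℕ → Fin N → ℕ
  fibre q y = count (λ x → D 1 x ∧ ((q · x) ==F y))

  fibre-∃ : ∀ {q y} → 1 ≤ fibre q y → ∃ λ x → cl x ≡ 1 × q · x ≡ y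
  fibre-∃ {q} {y} h = let (x , m) = count-∃ (λ x → D 1 x ∧ ((q · x) ==F y)) h ; (a , b) = ∧-elim {D 1 x} m in x , fromD a , ==F-sound b

  fibre-pos : ∀ q {x} → cl x ≡ 1 → 1 ≤ fibre q (q · x)
  fibre-pos q {x} e = count-pos (λ w → D 1 w ∧ ((q · w) ==F (q · x))) x (∧-intro (inD e) (toYes (q · x ≟F _) refl))

  -- A count that is nonzero modulo `q` remains so over the whole class, so none of these fibres is
  -- empty.
  nonzero-fibre : ∀ {q} .{{_ : NonZero q}} → Prime q → ∀ {y} → fibre q y % q ≢ 0 → ∀ y' → cl y' ≡ cl y → ∃ λ x → cl x ≡ 1 × q · x ≡ y'
  nonzero-fibre {q} pq {y} ne y' e with fibre q y' in eq
  ... | suc _ = fibre-∃ {q} (subst (1 ≤_) (sym eq) (s≤s z≤n))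
  ... | zero  = contradiction (trans (fibre-mod pq {D 1} (D-class 1) y y' (sym e)) (trans (cong (_% q) eq) (m<n⇒m%n≡m (>-nonZero⁻¹ q)))) ne

  -- By `noncyclic` there is a second element of class 1 besides `s` and `⊖ s`. At most one of the
  -- two is an involution, so the negative of the other one supplies the third element.
  degree≥3 : (∀ x y → 2 · x ≡ 𝟘 → 2 · y ≡ 𝟘 → x ≢ 𝟘 → y ≢ 𝟘 → x ≡ y) → ∀ {s} → cl s ≡ 1 → 3 ≤ k 1
  degree≥3 inv {s} es with noncyclic s
  ... | y , ey , y≢s , y≢-s with s ≟F ⊖ s
  ...   | no ne = count-three (D 1) (inD es) (inD (trans (cl-⊖ s) es)) (inD ey) ne (λ e → y≢s (sym e)) (λ e → y≢-s (sym e))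
  ...   | yes e = count-three (D 1) (inD ey) (inD (trans (cl-⊖ y) ey)) (inD es) ne y≢s (λ q → y≢-s (trans (sym (⊖-involutive y)) (cong ⊖_ q)))
    where
    dbl : ∀ {x} → x ≡ ⊖ x → 2 · x ≡ 𝟘
    dbl {x} e = trans (cong (x ⊕_) (1· x)) (trans (cong (x ⊕_) e) (⊕-inverseʳ x))
    ne : y ≢ ⊖ y
    ne e' = y≢s (inv y s (dbl e') (dbl e) (cl>0⇒≢ ey) (cl>0⇒≢ es))

  -- The fibres of doubling are the pairs `x`, `x ⊕ e`. If the connection set meets all of them
  -- evenly, except perhaps the one over `𝟘`, then adding `e` preserves it and a stabiliser lemma
  -- applies. An odd count makes a whole class consist of doubles of elements of class 1; `g`
  -- excludes class 1, so it is class 2. Without class 3 the non-neighbours of `𝟘` lie in the core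
  -- of the doubles; with class 3, doubling shows k₂ ≤ k₁ and `antipode` produces the crown.
  even-case : ∀ {e} → e ≢ 𝟘 → 2 · e ≡ 𝟘 → (∀ x → 2 · x ≡ 𝟘 → x ≡ 𝟘 ⊎ x ≡ e) → ∀ {g} → (∀ x → 2 · x ≢ g) → Multi ⊎ CrownData
  even-case {e} e≢0 2e tor {g} g∉ with any? (λ y → ¬? (y ≟F 𝟘) ×-dec ¬? (fibre 2 y % 2 ≟ 0))
  ... | no none = inj₁ stable
    where
    shift : ∀ s → cl s ≡ 1 → s ≢ e → cl (s ⊕ e) ≡ 1
    shift s es s≢e with fibre 2 (2 · s) % 2 ≟ 0
    ... | no ne = contradiction (2 · s , 2s≢0 , ne) none
      where
      2s≢0 : 2 · s ≢ 𝟘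
      2s≢0 q with tor s q
      ... | inj₁ s0 = cl>0⇒≢ es s0
      ... | inj₂ se = s≢e se
    ... | yes even with count-≥2 (λ x → D 1 x ∧ ((2 · x) ==F (2 · s))) (even⇒≥2 _ even (fibre-pos 2 es)) s
      where
      even⇒≥2 : ∀ m → m % 2 ≡ 0 → 1 ≤ m → 2 ≤ m
      even⇒≥2 (suc (suc m)) _ _ = s≤s (s≤s z≤n)
    ...   | x , h , x≢s with ∧-elim {D 1 x} h
    ...     | a , b with tor (x ⊕ ⊖ s) (trans (·-distribˡ 2 x (⊖ s)) (trans (cong₂ _⊕_ (==F-sound b) (·-⊖ 2 s)) (⊕-inverseʳ _)))
    ...       | inj₁ q = contradiction (⊖≡𝟘⇒≡ q) x≢s
    ...       | inj₂ q = trans (cong cl (trans (cong (s ⊕_) (sym q)) (gsolve 2 (λ s x → s :+ (x :+ :- s) := x) refl s x))) (fromD a)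
    stable : Multi
    stable with cl e ≟ 1
    ... | no n1 = stabilised-independent e≢0 (λ s es → shift s es (λ { refl → n1 es }))
    ... | yes e1 = stabilised-clique e1 clique
      where
      clique : ∀ s → cl s ≡ 1 → s ⊕ e ≡ 𝟘 ⊎ cl (s ⊕ e) ≡ 1
      clique s es with s ≟F e
      ... | yes refl = inj₁ (trans (cong (s ⊕_) (sym (1· s))) 2e)
      ... | no ne = inj₂ (shift s es ne)
  ... | yes (y , y≢0 , odd) = level (cl≡1or2 y≤2 y≢0)
    where
    half : ∀ y' → cl y' ≡ cl y → ∃ λ x → cl x ≡ 1 × 2 · x ≡ y'
    half = nonzero-fibre prime[2] odd
    y≤2 : cl y ≤ 2
    y≤2 with half y refl
    ... | x , ex , refl = ≤-trans (≤-reflexive (cong cl (cong (x ⊕_) (1· x)))) (sum≤2 ex ex)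
    M : Fin N → Set
    M z = ∃ λ x → 2 · x ≡ z
    M+ : ∀ u v → M u → M v → M (u ⊕ v)
    M+ _ _ (a , refl) (b , refl) = a ⊕ b , ·-distribˡ 2 a b
    S⊄M : ¬ (∀ s → cl s ≡ 1 → M s)
    S⊄M h = let (x , q) = generated M (𝟘 , ·-𝟘 2) M+ h g in g∉ x q
    C : Fin N → Set
    C h = ∀ z → cl z ≡ cl h → M z
    C+ : ∀ u v → C u → C v → C (u ⊕ v)
    C+ u v cu cv z ez with split-class u v z (sym ez)
    ... | u' , v' , eu , ev , refl = M+ u' v' (cu u' eu) (cv v' ev)
    C- : ∀ {u} → C u → C (⊖ u)
    C- {u} c z ez = c z (trans ez (cl-⊖ u))
    D2C : cl y ≡ 2 → ∀ {u} → cl u ≡ 2 → C u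
    D2C y2 eu z ez = let (x , _ , q) = half z (trans ez (trans eu (sym y2))) in x , q
    C0 : ∀ {u} → cl u ≡ 0 → C u
    C0 {u} e z ez = 𝟘 , trans (·-𝟘 2) (sym (cl≡0 z (trans ez e)))
    S∌ : ∀ {s} → C s → cl s ≢ 1
    S∌ c e = S⊄M (λ s es → c s (trans es (sym e)))
    level : cl y ≡ 1 ⊎ cl y ≡ 2 → Multi ⊎ CrownData
    level (inj₁ y1) = ⊥-elim (S⊄M (λ s es → let (x , _ , q) = half s (trans es (sym y1)) in x , q))
    level (inj₂ y2) with any? (λ z → cl z ≟ 3)
    ... | no no3 = inj₁ λ u v nu nv → S∌ (C+ u v (two u nu) (two v nv))
      where
      two : ∀ u → cl u ≢ 1 → C u
      two u nu with cl u ≟ 0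
      ... | yes u0 = C0 u0
      ... | no u≢0 = D2C y2 (cl≢1⇒2 (≮⇒≥ (λ l → no3 (descend u 3 l))) (λ { refl → u≢0 cl-𝟘 }) nu)
    ... | yes (z , ez) = inj₂ record
        { z = z ; cl-z = ez ; only-z = only ; diameter = diam ; z⊕z = z⊕z
        ; nbr-in = nbr-in ; in-nbr = in-nbr
        ; closed = λ x y ix iy → fromC (C+ x y (toC ix) (toC iy))
        ; z-odd = λ x q → Cz∉ (λ w ew → x , trans q (sym (only w (trans ew ez)))) }
      where
      k₂≤k₁ : k 2 ≤ k 1
      k₂≤k₁ = count-surj (2 ·_) (λ w h → let (x , ex , q) = half w (trans (fromD h) (sym y2)) in x , inD ex , q)
      involution : ∀ x y → 2 · x ≡ 𝟘 → 2 · y ≡ 𝟘 → x ≢ 𝟘 → y ≢ 𝟘 → x ≡ y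
      involution x y hx hy nx ny with tor x hx | tor y hy
      ... | inj₁ a | _ = contradiction a nx
      ... | inj₂ _ | inj₁ b = contradiction b ny
      ... | inj₂ a | inj₂ b = trans a (sym b)
      X = antipode ez (triangle-free ez (λ u v eu ev → S∌ (C+ u (⊖ v) (D2C y2 eu) (C- (D2C y2 ev))))) k₂≤k₁
            (degree≥3 involution (proj₂ (exists-S e≢0)))
      only = proj₁ X
      nbr-in = proj₁ (proj₂ X)
      in-nbr = proj₂ (proj₂ X)
      z⊕z : z ⊕ z ≡ 𝟘
      z⊕z = trans (cong (z ⊕_) (sym (only (⊖ z) (trans (cl-⊖ z) ez)))) (⊕-inverseʳ z)
      -- `z` is the only element of class 3, so an element of class 4 would be a neighbour of `z`,
      -- and all of those have class 2.
      diam : ∀ w → cl w ≤ 3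
      diam w = ≮⇒≥ λ l → let (v , ev) = descend w 4 l ; (u , s , eu , es , eq) = geodesic v 3 ev in
        case trans (sym ev) (nbr-in v (trans (cong cl (trans (cong (λ t → z ⊕ ⊖ t) (trans eq (cong (_⊕ s) (only u eu))))
          (gsolve 2 (λ z s → z :+ :- (z :+ s) := :- s) refl z s))) (trans (cl-⊖ s) es))) of λ ()
      Cz∉ : ¬ C z
      Cz∉ c = let (w , ew) = descend z 2 (≤-trans (s≤s (s≤s z≤n)) (≤-reflexive (sym ez))) in
        S∌ (C+ z (⊖ w) c (C- (D2C y2 ew))) (in-nbr w ew)
      toC : ∀ {x} → cl x ≡ 0 ⊎ cl x ≡ 2 → C x
      toC (inj₁ e) = C0 e
      toC (inj₂ e) = D2C y2 e
      fromC : ∀ {x} → C x → cl x ≡ 0 ⊎ cl x ≡ 2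
      fromC {x} c with m≤n⇒m<n∨m≡n (diam x)
      ... | inj₂ e = contradiction (subst C (only x e) c) Cz∉
      ... | inj₁ l with x ≟F 𝟘
      ...   | yes refl = inj₁ cl-𝟘
      ...   | no ne = inj₂ (cl≢1⇒2 (≤-pred l) ne (S∌ c))

-- Odd exponent with a prime factor other than p

private module Bounds where
  count-contradiction : ∀ k s c q → s + q ≤ k → s + 1 ≤ q → k ≤ s + c → c + c ≤ k → ⊥
  count-contradiction k s c q h₁ h₂ h₃ h₄ = <⇒≱ (≤-trans (≤-reflexive (+-comm 1 (s + s))) (≤-trans (≤-reflexive (+-assoc s s 1)) (≤-trans (+-monoʳ-≤ s h₂) h₁)))
    (+-cancelʳ-≤ k k (s + s) (≤-trans (+-mono-≤ h₃ h₃) (≤-trans (≤-reflexive (solve 2 (λ s c → (s :+ c) :+ (s :+ c) := (s :+ s) :+ (c :+ c)) refl s c)) (+-monoʳ-≤ (s + s) h₄))))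
    where open +-*-Solver using (solve; _:+_; _:=_)
open Bounds

module MixedCase {N : ℕ} (G : FinAbelianGroup N) (norm : RegularNorm G)
  (n : ℕ) .{{n≢0 : NonZero n}} (exponent : ∀ x → GroupTheory._·_ G n x ≡ FinAbelianGroup.𝟘 G) (n<N : n < N)
  (odd : n % 2 ≡ 1) where
  open CaseAnalysis G norm n exponent n<N public

  no-involution : ∀ {x} → x ⊕ x ≡ 𝟘 → x ≡ 𝟘
  no-involution {x} e = trans (sym (halve odd x)) (trans (cong (suc (n / 2) ·_) e) (·-𝟘 (suc (n / 2))))

  coprime-torsion : ∀ {p q} → Coprime q p → ∀ x → p · x ≡ 𝟘 → ∃ λ z → q · z ≡ x
  coprime-torsion {p} {q} c x px with Cop.coprime-Bézout c
  ... | Bézout.+- a b e = a · x , (begin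
      q · (a · x)        ≡⟨ ·-comm q a x ⟩
      a · (q · x)        ≡⟨ ·-assoc a q x ⟨
      (a * q) · x        ≡⟨ cong (_· x) e ⟨
      x ⊕ (b * p) · x    ≡⟨ cong (x ⊕_) (trans (·-assoc b p x) (trans (cong (b ·_) px) (·-𝟘 b))) ⟩
      x ⊕ 𝟘              ≡⟨ ⊕-identityʳ x ⟩
      x                  ∎)
    where open ≡-Reasoning
  ... | Bézout.-+ a b e = ⊖ (a · x) , (begin
      q · (⊖ (a · x))    ≡⟨ ·-⊖ q (a · x) ⟩
      ⊖ (q · (a · x))    ≡⟨ cong ⊖_ (trans (·-comm q a x) (sym (·-assoc a q x))) ⟩
      ⊖ ((a * q) · x)    ≡⟨ ⊕-cancelˡ ((a * q) · x) (trans (⊕-inverseʳ _) (trans (sym zero-sum) (⊕-comm x _))) ⟩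
      x                  ∎)
    where
    open ≡-Reasoning
    zero-sum : x ⊕ (a * q) · x ≡ 𝟘
    zero-sum = trans (cong (_· x) e) (trans (·-assoc b p x) (trans (cong (b ·_) px) (·-𝟘 b)))

  coprime-kernel : ∀ {p q} → Coprime q p → ∀ x → p · x ≡ 𝟘 → q · x ≡ 𝟘 → x ≡ 𝟘
  coprime-kernel {p} {q} c x px qx with Cop.coprime-Bézout c
  ... | Bézout.+- a b e = trans (sym (⊕-identityʳ x)) (trans (cong (x ⊕_) (sym (trans (·-assoc b p x) (trans (cong (b ·_) px) (·-𝟘 b)))))
          (trans (cong (_· x) e) (trans (·-assoc a q x) (trans (cong (a ·_) qx) (·-𝟘 a)))))
  ... | Bézout.-+ a b e = trans (sym (⊕-identityʳ x)) (trans (cong (x ⊕_) (sym (trans (·-assoc a q x) (trans (cong (a ·_) qx) (·-𝟘 a)))))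
          (trans (cong (_· x) e) (trans (·-assoc b p x) (trans (cong (b ·_) px) (·-𝟘 b)))))

  imprimitive-multiples : ∀ q {g} → (∀ x → q · x ≢ g) → ∀ {x} → x ≢ 𝟘 → (∀ z → cl z ≡ cl x → ∃ λ w → q · w ≡ z) → Multi ⊎ Antipodal (cl x)
  imprimitive-multiples q g∉ = imprimitive odd (λ z → ∃ λ w → q · w ≡ z) (λ z → any? (λ w → q · w ≟F z))
    (λ { _ _ (a , refl) (b , refl) → a ⊕ b , ·-distribˡ q a b }) (λ { _ (a , refl) → ⊖ a , ·-⊖ q a }) (λ { (x , e) → g∉ x e })

  -- In ℤₙ ⊕ ℤₚ with n = q r, the elements `e₀`, `g` and `c₁` will be (r, 0), (1, 0) and (0, 1).
  -- Isolating these properties keeps coordinates out of the argument.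
  module _ {p q : ℕ} (pp : Prime p) (pq : Prime q) (cqp : Coprime q p)
    {e₀ : Fin N} (qe₀ : q · e₀ ≡ 𝟘) (e₀≢0 : e₀ ≢ 𝟘)
    (torsion : ∀ x → q · x ≡ 𝟘 → ∃ λ (j : Fin q) → x ≡ toℕ j · e₀)
    (order : ∀ (i j : Fin q) → toℕ i · e₀ ≡ toℕ j · e₀ → i ≡ j)
    (transitive : ∀ e e' → q · e ≡ 𝟘 → q · e' ≡ 𝟘 → e ≢ 𝟘 → e' ≢ 𝟘 → ∃ λ t → Coprime t n × t · e ≡ e')
    {g : Fin N} (g∉ : ∀ x → q · x ≢ g)
    {c₁ : Fin N} (pc₁ : p · c₁ ≡ 𝟘) (c₁≢0 : c₁ ≢ 𝟘) (c₁∉ : ∀ x → p · x ≢ c₁) where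
    private
      instance
        _ = prime⇒nonZero pp
        _ = prime⇒nonZero pq

      E : Fin N → Bool
      E x = ⌊ q · x ≟F 𝟘 ⌋

      E≤q : count E ≤ q
      E≤q = ≤-trans (count-surj {A = λ (_ : Fin q) → true} (λ j → toℕ j · e₀)
        (λ x h → let (j , e) = torsion x (fromYes (q · x ≟F 𝟘) h) in j , refl , sym e)) (≤-reflexive (count-all q))

      E-multiple : ∀ j → q · (j · e₀) ≡ 𝟘
      E-multiple j = trans (·-comm q j e₀) (trans (cong (j ·_) qe₀) (·-𝟘 j))

      E-⊕ : ∀ {x y} → q · x ≡ 𝟘 → q · y ≡ 𝟘 → q · (x ⊕ y) ≡ 𝟘
      E-⊕ {x} {y} a b = trans (·-distribˡ q x y) (trans (cong₂ _⊕_ a b) (⊕-identityˡ 𝟘))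

      coset-size : ∀ x (A : Fin N → Bool) → (∀ e → q · e ≡ 𝟘 → x ⊕ e ∈ A) → q ≤ count A
      coset-size x A h = ≤-trans (≤-reflexive (sym (count-all q)))
        (count-inj {A = λ _ → true} (λ j → x ⊕ toℕ j · e₀) (λ j _ → h _ (E-multiple (toℕ j))) (λ i j _ _ e → order i j (⊕-cancelˡ x e)))

      -- The fibre of multiplication by `q` through `x` is a coset of the torsion and has at most
      -- `q` elements. It meets the connection set in a positive multiple of `q`, hence lies inside.
      coset : ∀ {x} → cl x ≡ 1 → fibre q (q · x) % q ≡ 0 → ∀ e → q · e ≡ 𝟘 → cl (x ⊕ e) ≡ 1
      coset {x} ex h e qe = fromD (proj₁ (∧-elim {D 1 (x ⊕ e)} (count-⊆-≥ {A = λ w → D 1 w ∧ ((q · w) ==F (q · x))} {B = λ w → (q · w) ==F (q · x)}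
        (λ w m → proj₂ (∧-elim {D 1 w} m)) size (x ⊕ e)
        (toYes (_ ≟F _) (trans (·-distribˡ q x e) (trans (cong (q · x ⊕_) qe) (⊕-identityʳ _)))))))
        where
        size : count (λ w → (q · w) ==F (q · x)) ≤ fibre q (q · x)
        size = ≤-trans (≤-trans (count-inj {B = E} (_⊕ ⊖ x) (λ w m → toYes (_ ≟F 𝟘)
            (trans (·-distribˡ q w (⊖ x)) (trans (cong₂ _⊕_ (==F-sound m) (·-⊖ q x)) (⊕-inverseʳ _)))) (λ _ _ _ _ → ⊕-cancelʳ (⊖ x))) E≤q)
          (∣⇒≤ {{>-nonZero (fibre-pos q ex)}} (m%n≡0⇒n∣m _ q h))

      outside : ∃ λ x → cl x ≡ 1 × q · x ≢ 𝟘
      outside with any? (λ x → (cl x ≟ 1) ×-dec ¬? (q · x ≟F 𝟘))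
      ... | yes h = h
      ... | no ¬h = contradiction (coprime-kernel cqp c₁ pc₁ (generated (λ x → q · x ≡ 𝟘) (·-𝟘 q) (λ _ _ → E-⊕) gens c₁)) c₁≢0
        where
        gens : ∀ s → cl s ≡ 1 → q · s ≡ 𝟘
        gens s es with q · s ≟F 𝟘
        ... | yes z = z
        ... | no nz = contradiction (s , es , nz) ¬h

      -- The stabiliser lemmas cover everything except torsion `e` of class 1 coexisting with
      -- nonzero torsion `e'` of class 2. A unit takes `e` to `e'`, so k₁ ≤ k₂. A torsion coset
      -- consists of common neighbours, so c₂ ≥ q; the steps from `e` to class 2 are nonzero
      -- torsion, so b₁ < q. This violates k₁ b₁ = k₂ c₂.
      stable-case : (∀ s → cl s ≡ 1 → q · s ≢ 𝟘 → ∀ e → q · e ≡ 𝟘 → cl (s ⊕ e) ≡ 1) → Multi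
      stable-case st with any? (λ e → (q · e ≟F 𝟘) ×-dec (cl e ≟ 1))
      ... | no none = stabilised-independent e₀≢0 (λ s es → st s es (λ z → none (s , z , es)) e₀ qe₀)
      ... | yes (e , qe , e1) with any? (λ e' → (q · e' ≟F 𝟘) ×-dec (¬? (e' ≟F 𝟘) ×-dec ¬? (cl e' ≟ 1)))
      ...   | no all = stabilised-clique e1 clique
        where
        clique : ∀ s → cl s ≡ 1 → s ⊕ e ≡ 𝟘 ⊎ cl (s ⊕ e) ≡ 1
        clique s es with q · s ≟F 𝟘
        ... | no nz = inj₂ (st s es nz e qe)
        ... | yes z with s ⊕ e ≟F 𝟘 | cl (s ⊕ e) ≟ 1
        ...   | yes a | _ = inj₁ a
        ...   | no _  | yes b = inj₂ b
        ...   | no a  | no b = contradiction (s ⊕ e , E-⊕ z qe , a , b) all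
      ...   | yes (e' , qe' , e'≢0 , e'≢1) = ⊥-elim (<⇒≱ strict (≤-trans (*-mono-≤ k₁≤k₂ c₂) (≤-reflexive (sym (edge-count 1 2 e1 e'2)))))
        where
        x = proj₁ outside
        ex = proj₁ (proj₂ outside)
        x∉ = proj₂ (proj₂ outside)
        e'2 : cl e' ≡ 2
        e'2 = cl≢1⇒2 (≤-trans (≤-reflexive (cong cl (gsolve 2 (λ x e → e := (x :+ e) :+ :- x) refl x e'))) (diff≤2 (st x ex x∉ e' qe') ex)) e'≢0 e'≢1
        tr = transitive e e' qe qe' (cl>0⇒≢ e1) e'≢0
        t = proj₁ tr
        k₁≤k₂ : k 1 ≤ k 2
        k₁≤k₂ = count-inj (t ·_) (λ s h → inD (trans (multiplier-class (proj₁ (proj₂ tr)) s e (trans (fromD h) (sym e1))) (trans (cong cl (proj₂ (proj₂ tr))) e'2)))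
          (λ _ _ _ _ → multiplier-injective (proj₁ (proj₂ tr)))
        c₂ : q ≤ nb 1 e'
        c₂ = coset-size x (λ s → D 1 s ∧ D 1 (e' ⊕ s)) (λ u qu → ∧-intro (inD (st x ex x∉ u qu))
          (inD (trans (cong cl (gsolve 3 (λ e x u → e :+ (x :+ u) := x :+ (e :+ u)) refl e' x u)) (st x ex x∉ (e' ⊕ u) (E-⊕ qe' qu)))))
        b₁ : nb 2 e + 1 ≤ q
        b₁ = ≤-trans (≤-reflexive (cong (nb 2 e +_) (sym (count-δ 𝟘)))) (≤-trans (count-⊎ {B = _==F 𝟘} {C = E} in-E
          (λ w h → toYes (_ ≟F 𝟘) (trans (cong (q ·_) (==F-sound h)) (·-𝟘 q)))
          (λ w h h' → cl>0⇒≢ (fromD (proj₁ (∧-elim {D 1 w} h))) (==F-sound h'))) E≤q)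
          where
          in-E : ∀ s → s ∈ (λ s → D 1 s ∧ D 2 (e ⊕ s)) → s ∈ E
          in-E s h with q · s ≟F 𝟘
          ... | yes _ = refl
          ... | no nz = case trans (sym (fromD (proj₂ (∧-elim {D 1 s} h)))) (trans (cong cl (⊕-comm e s)) (st s (fromD (proj₁ (∧-elim h))) nz e qe)) of λ ()
        strict : k 1 * nb 2 e < k 1 * q
        strict = *-monoʳ-< (k 1) {{>-nonZero (count-pos (D 1) e (inD e1))}} (≤-trans (≤-reflexive (+-comm 1 _)) b₁)

      module Anti {d : ℕ} (anti : Antipodal d) (d∃ : ∃ λ y → cl y ≡ d) (level : ∀ {s} → cl s ≡ 1 → q · s ≢ 𝟘 → fibre q (q · s) % q ≢ 0 → Multi ⊎ Antipodal (cl (q · s)))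
        {x₀ : Fin N} (ex₀ : cl x₀ ≡ 1) (qx₀≢0 : q · x₀ ≢ 𝟘) (qx₀ : cl (q · x₀) ≡ d) where
        H : Fin N → Set
        H x = cl x ≡ 0 ⊎ cl x ≡ d

        H? : ∀ x → Dec (H x)
        H? x = (cl x ≟ 0) ⊎-dec (cl x ≟ d)

        3≤d = proj₁ anti
        top = proj₁ (proj₂ anti)
        H-⊕ = proj₂ (proj₂ anti)

        not-multi : Multi → ⊥
        not-multi = antipodal≢multi anti (proj₂ d∃)

        H-𝟘 : H 𝟘
        H-𝟘 = inj₁ cl-𝟘

        H-⊖ : ∀ {x} → H x → H (⊖ x)
        H-⊖ {x} (inj₁ e) = inj₁ (trans (cl-⊖ x) e)
        H-⊖ {x} (inj₂ e) = inj₂ (trans (cl-⊖ x) e)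

        H-· : ∀ j {x} → H x → H (j · x)
        H-· j {x} = closed-· H H-𝟘 H-⊕ j x

        H-small : ∀ {x} → H x → cl x ≤ 2 → x ≡ 𝟘
        H-small {x} (inj₁ e) _ = cl≡0 x e
        H-small (inj₂ e) h = contradiction (≤-trans 3≤d (≤-trans (≤-reflexive (sym e)) h)) (<⇒≱ ≤-refl)

        H-nonzero : ∀ {x} → H x → x ≢ 𝟘 → cl x ≡ d
        H-nonzero {x} (inj₁ e) ne = contradiction (cl≡0 x e) ne
        H-nonzero (inj₂ e) _ = e

        S∌H : ∀ {s} → H s → cl s ≢ 1
        S∌H h e = cl>0⇒≢ e (H-small h (≤-trans (≤-reflexive e) (s≤s z≤n)))

        same-top : ∀ {x} → Antipodal (cl x) → cl x ≡ d
        same-top {x} a = ≤-antisym (top x) (≤-trans (≤-reflexive (sym (proj₂ d∃))) (proj₁ (proj₂ a) (proj₁ d∃)))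

        -- If the count over `q · s` were nonzero modulo `q`, the class of `q · s` would be
        -- antipodal as well, hence equal to the diameter `d`, and `q · s` would lie in `H`.
        dichotomy : ∀ s → cl s ≡ 1 → ¬ H (q · s) → ∀ e → q · e ≡ 𝟘 → cl (s ⊕ e) ≡ 1
        dichotomy s es nh with q · s ≟F 𝟘
        ... | yes z = contradiction (subst H (sym z) H-𝟘) nh
        ... | no nz with fibre q (q · s) % q ≟ 0
        ...   | yes h = coset es h
        ...   | no ne with level es nz ne
        ...     | inj₁ m = ⊥-elim (not-multi m)
        ...     | inj₂ a = contradiction (inj₂ (same-top a)) nh

        -- Then `H` contains all multiples of `q` and with them the `p`-torsion. Elements of class 1
        -- with the same `p`-multiple differ by an element of `H` of norm at most 2, so they
        -- coincide. A fibre of size 1 puts the antipodal class inside the multiples of `p`, but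
        -- that class contains `c₁`.
        all-in-H : (∀ s → cl s ≡ 1 → H (q · s)) → ⊥
        all-in-H h = contra (imprimitive-multiples p c₁∉ {p · x₀} px₀≢0 (nonzero-fibre′))
          where
          qH : ∀ x → H (q · x)
          qH = generated (λ x → H (q · x)) (subst H (sym (·-𝟘 q)) H-𝟘) (λ x y a b → subst H (sym (·-distribˡ q x y)) (H-⊕ _ _ a b)) h
          torsion-H : ∀ x → p · x ≡ 𝟘 → H x
          torsion-H x px = let (z , e) = coprime-torsion cqp x px in subst H e (qH z)
          px₀≢0 : p · x₀ ≢ 𝟘
          px₀≢0 e = S∌H (torsion-H x₀ e) ex₀
          fib1 : fibre p (p · x₀) ≡ 1
          fib1 = count-unique≡1 _ x₀ (∧-intro (inD ex₀) (toYes (p · x₀ ≟F _) refl)) (λ w m → ⊖≡𝟘⇒≡ (H-small (torsion-H _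
            (trans (·-distribˡ p w (⊖ x₀)) (trans (cong₂ _⊕_ (==F-sound (proj₂ (∧-elim {D 1 w} m))) (·-⊖ p x₀)) (⊕-inverseʳ _))))
              (diff≤2 (fromD (proj₁ (∧-elim m))) ex₀)))
          nonzero-fibre′ : ∀ z → cl z ≡ cl (p · x₀) → ∃ λ w → p · w ≡ z
          nonzero-fibre′ z ez = let (w , _ , e) = nonzero-fibre pp {p · x₀} (λ z → case trans (sym (trans (cong (_% p) fib1) (m<n⇒m%n≡m (nonTrivial⇒n>1 p {{prime⇒nonTrivial pp}})))) z of λ ()) z ez in w , e
          contra : Multi ⊎ Antipodal (cl (p · x₀)) → ⊥
          contra (inj₁ m) = not-multi m
          contra (inj₂ a) = let (w , e) = nonzero-fibre′ c₁ (trans (H-nonzero (torsion-H c₁ pc₁) c₁≢0) (sym (same-top a))) in c₁∉ w e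

        -- The torsion meets `H` trivially, so an element with `q`-multiple in `H` is the sum of a
        -- part in `H` and a torsion part. Let `B` be the set of such elements of class 1: fewer
        -- than `q`, and at least `q` more exist outside it. Every other element of class 1 absorbs
        -- torsion, so k₁ is at most the size of `B` plus c₂. Splitting `x₀` yields two elements of
        -- class 2 that show 2 c₂ ≤ k₁, which is too small.
        not-all : ∀ {x₁} → cl x₁ ≡ 1 → ¬ H (q · x₁) → ⊥
        not-all {x₁} ex₁ nh = count-contradiction (k 1) (count B) (nb 1 e') q sizes B+1≤q k₁≤ twice
          where
          coset₁ : ∀ e → q · e ≡ 𝟘 → cl (x₁ ⊕ e) ≡ 1
          coset₁ = dichotomy x₁ ex₁ nh
          E-small : ∀ e → q · e ≡ 𝟘 → cl e ≤ 2
          E-small e qe = ≤-trans (≤-reflexive (cong cl (gsolve 2 (λ x e → e := (x :+ e) :+ :- x) refl x₁ e))) (diff≤2 (coset₁ e qe) ex₁)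
          E∩H : ∀ {h} → H h → q · h ≡ 𝟘 → h ≡ 𝟘
          E∩H hh qh = H-small hh (E-small _ qh)
          -- Multiplication by `q` on `H`, extended by the identity to the whole group so that
          -- injectivity yields surjectivity.
          f : Fin N → Fin N
          f x with H? x
          ... | yes _ = q · x
          ... | no _  = x
          f-injective : ∀ x y → f x ≡ f y → x ≡ y
          f-injective x y e with H? x | H? y
          ... | yes a | yes b = ⊖≡𝟘⇒≡ (E∩H (H-⊕ _ _ a (H-⊖ b)) (trans (·-distribˡ q x (⊖ y)) (trans (cong₂ _⊕_ e (·-⊖ q y)) (⊕-inverseʳ _))))
          ... | yes a | no b = contradiction (subst H e (H-· q a)) b
          ... | no a | yes b = contradiction (subst H (sym e) (H-· q b)) a
          ... | no _ | no _ = e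
          H-root : ∀ t → H t → ∃ λ h → H h × q · h ≡ t
          H-root t ht with injective⇒onto f f-injective t
          ... | x , e with H? x
          ...   | yes a = x , a , e
          ...   | no b = contradiction (subst H (sym e) ht) b
          -- the H-component of an element of E_q ⊕ H (junk elsewhere)
          h′ : Fin N → Fin N
          h′ s with H? (q · s)
          ... | yes a = proj₁ (H-root _ a)
          ... | no _  = 𝟘
          h′-spec : ∀ s → H (q · s) → H (h′ s) × q · h′ s ≡ q · s
          h′-spec s hs with H? (q · s)
          ... | yes a = proj₂ (H-root _ a)
          ... | no b = contradiction hs b
          η : Fin N → Fin N
          η s = s ⊕ ⊖ h′ s
          η-E : ∀ s → H (q · s) → q · η s ≡ 𝟘
          η-E s hs = trans (·-distribˡ q s _) (trans (cong (q · s ⊕_) (trans (·-⊖ q _) (cong ⊖_ (proj₂ (h′-spec s hs))))) (⊕-inverseʳ _))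
          B : Fin N → Bool
          B s = D 1 s ∧ ⌊ H? (q · s) ⌋
          B-elim : ∀ {s} → s ∈ B → cl s ≡ 1 × H (q · s)
          B-elim {s} h = let (a , b) = ∧-elim {D 1 s} h in fromD a , fromYes (H? (q · s)) b
          B+1≤q : count B + 1 ≤ q
          B+1≤q = ≤-trans (+-monoˡ-≤ 1 (count-inj {B = λ w → E w ∧ not (w ==F 𝟘)} η into inj))
            (≤-trans (≤-reflexive (cong (count (λ w → E w ∧ not (w ==F 𝟘)) +_) (sym (count-δ 𝟘)))) (≤-trans (count-⊎ {A = λ w → E w ∧ not (w ==F 𝟘)} {_==F 𝟘} {E} (λ w h → proj₁ (∧-elim h))
              (λ w h → toYes (_ ≟F 𝟘) (trans (cong (q ·_) (==F-sound h)) (·-𝟘 q))) (λ w h h' → true≢false h' (not-elim (proj₂ (∧-elim {E w} h))))) E≤q))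
            where
            into : ∀ s → s ∈ B → η s ∈ (λ w → E w ∧ not (w ==F 𝟘))
            into s m = let (es , hs) = B-elim m in ∧-intro (toYes (_ ≟F 𝟘) (η-E s hs))
              (not-intro (toNo (η s ≟F 𝟘) (λ e → S∌H (subst H (sym (⊖≡𝟘⇒≡ e)) (proj₁ (h′-spec s hs))) es)))
            inj : ∀ s s' → s ∈ B → s' ∈ B → η s ≡ η s' → s ≡ s'
            inj s s' m m' e = let (es , hs) = B-elim m ; (es' , hs') = B-elim m' in
              ⊖≡𝟘⇒≡ (H-small (subst H (eq s s' (h′ s) (h′ s') e) (H-⊕ _ _ (proj₁ (h′-spec s hs)) (H-⊖ (proj₁ (h′-spec s' hs'))))) (diff≤2 es es'))
              where
              eq : ∀ s s' h h' → s ⊕ ⊖ h ≡ s' ⊕ ⊖ h' → h ⊕ ⊖ h' ≡ s ⊕ ⊖ s'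
              eq s s' h h' e = trans (gsolve 4 (λ s s' h h' → h :+ :- h' := (:- (s :+ :- h) :+ (s' :+ :- h')) :+ (s :+ :- s')) refl s s' h h')
                (trans (cong (λ u → (⊖ u ⊕ (s' ⊕ ⊖ h')) ⊕ (s ⊕ ⊖ s')) e) (trans (cong (_⊕ (s ⊕ ⊖ s')) (⊕-inverseˡ _)) (⊕-identityˡ _)))
          sizes : count B + q ≤ k 1
          sizes = ≤-trans (+-monoʳ-≤ (count B) (coset-size x₁ (λ w → D 1 w ∧ ((q · w) ==F (q · x₁))) (λ e qe → ∧-intro (inD (coset₁ e qe))
              (toYes (_ ≟F _) (trans (·-distribˡ q x₁ e) (trans (cong (q · x₁ ⊕_) qe) (⊕-identityʳ _)))))))
            (count-⊎ (λ s h → proj₁ (∧-elim h)) (λ s h → proj₁ (∧-elim h)) (λ s m m' → nh (subst H (==F-sound (proj₂ (∧-elim {D 1 s} m'))) (proj₂ (B-elim m)))))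
          Hqx₀ : H (q · x₀)
          Hqx₀ = inj₂ qx₀
          h' = h′ x₀
          Hh' = proj₁ (h′-spec x₀ Hqx₀)
          e' = η x₀
          qe' = η-E x₀ Hqx₀
          h'≢0 : h' ≢ 𝟘
          h'≢0 z = qx₀≢0 (trans (sym (proj₂ (h′-spec x₀ Hqx₀))) (trans (cong (q ·_) z) (·-𝟘 q)))
          clh' : cl h' ≡ d
          clh' = H-nonzero Hh' h'≢0
          d≤ : d ≤ 1 + cl e'
          d≤ = ≤-trans (≤-reflexive (sym clh')) (≤-trans (cl-≤ (gsolve 2 (λ x h → h := x :+ :- (x :+ :- h)) refl x₀ h')) (≤-reflexive (cong₂ _+_ ex₀ (cl-⊖ e'))))
          e'2 : cl e' ≡ 2
          e'2 = ≤-antisym (E-small e' qe') (≤-pred (≤-trans 3≤d d≤))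
          d≡3 : d ≡ 3
          d≡3 = ≤-antisym (≤-trans d≤ (≤-reflexive (cong suc e'2))) 3≤d
          e'∉H : ¬ H e'
          e'∉H h = cl>0⇒≢ e'2 (E∩H h qe')
          e″ = e' ⊕ ⊖ h'
          e″∉H : ¬ H e″
          e″∉H h = e'∉H (subst H (⊖-⊕ e' h') (H-⊕ _ _ h Hh'))
          -- Class 3 is `d` and belongs to `H`. Class 1 would make `h' ⊕ h'`, the difference of `x₀`
          -- and `e″`, an element of `H` of norm at most 2, hence `h'` zero by odd order.
          e″2 : cl e″ ≡ 2
          e″2 = cl≢1⇒2 (≤-pred (≤∧≢⇒< (≤-trans (top e″) (≤-reflexive d≡3)) (λ e → e″∉H (inj₂ (trans e (sym d≡3))))))
            (λ z → e″∉H (subst H (sym z) H-𝟘))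
            (λ e → h'≢0 (no-involution (trans (gsolve 2 (λ x h → h :+ h := x :+ :- ((x :+ :- h) :+ :- h)) refl x₀ h')
              (H-small (subst H (gsolve 2 (λ x h → h :+ h := x :+ :- ((x :+ :- h) :+ :- h)) refl x₀ h') (H-⊕ _ _ Hh' Hh')) (diff≤2 ex₀ e)))))
          k₁≤ : k 1 ≤ count B + nb 1 e'
          k₁≤ = count-∪ cases
            where
            cases : ∀ s → s ∈ D 1 → s ∈ B ⊎ s ∈ (λ s → D 1 s ∧ D 1 (e' ⊕ s))
            cases s h = split (H? (q · s))
              where
              split : Dec (H (q · s)) → s ∈ B ⊎ s ∈ (λ s → D 1 s ∧ D 1 (e' ⊕ s))
              split (yes hs) = inj₁ (∧-intro h (toYes (H? (q · s)) hs))
              split (no ns) = inj₂ (∧-intro h (inD (trans (cong cl (⊕-comm e' s)) (dichotomy s (fromD h) ns e' qe'))))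
          twice : nb 1 e' + nb 1 e' ≤ k 1
          twice = ≤-trans (≤-reflexive (cong (nb 1 e' +_) (nb-class 1 (trans e'2 (sym e″2)))))
            (count-⊎ (λ s h → proj₁ (∧-elim h)) (λ s h → proj₁ (∧-elim h)) (λ s m m' → h'≢0 (H-small Hh'
              (≤-trans (≤-reflexive (cong cl (gsolve 3 (λ e h s → h := (e :+ s) :+ :- ((e :+ :- h) :+ s)) refl e' h' s)))
                (diff≤2 (fromD (proj₂ (∧-elim {D 1 s} m))) (fromD (proj₂ (∧-elim {D 1 s} m'))))))))

    mixed-case : Multi
    mixed-case with any? (λ y → ¬? (y ≟F 𝟘) ×-dec ¬? (fibre q y % q ≟ 0))
    ... | no none = stable-case (λ s es nz → coset es (zero-fibre s nz))
      where
      zero-fibre : ∀ s → q · s ≢ 𝟘 → fibre q (q · s) % q ≡ 0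
      zero-fibre s nz with fibre q (q · s) % q ≟ 0
      ... | yes z = z
      ... | no ne = contradiction (q · s , nz , ne) none
    ... | yes (y , y≢0 , ny) = finish (level y y≢0 ny)
      where
      level : ∀ y → y ≢ 𝟘 → fibre q y % q ≢ 0 → Multi ⊎ Antipodal (cl y)
      level y y≢0 ny = imprimitive-multiples q g∉ y≢0 (λ z ez → let (w , _ , e) = nonzero-fibre pq {y} ny z ez in w , e)
      finish : Multi ⊎ Antipodal (cl y) → Multi
      finish (inj₁ m) = m
      finish (inj₂ a) with nonzero-fibre pq {y} ny y refl
      ... | x₀ , ex₀ , refl with all? (λ s → (cl s ≟ 1) →-dec Anti.H? a (y , refl) (λ {s} _ → level (q · s)) ex₀ y≢0 refl (q · s))
      ...   | yes h = ⊥-elim (Anti.all-in-H a (y , refl) (λ {s} _ → level (q · s)) ex₀ y≢0 refl h)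
      ...   | no ¬h with FP.¬∀⟶∃¬ N _ (λ s → (cl s ≟ 1) →-dec Anti.H? a (y , refl) (λ {s} _ → level (q · s)) ex₀ y≢0 refl (q · s)) ¬h
      ...     | x₁ , bad with cl x₁ ≟ 1
      ...       | yes ex₁ = ⊥-elim (Anti.not-all a (y , refl) (λ {s} _ → level (q · s)) ex₀ y≢0 refl ex₁ (λ h → bad (λ _ → h)))
      ...       | no nx₁ = contradiction (λ e → contradiction e nx₁) bad

-- Exponent pˢ with s ≥ 2

count≤ : ∀ {N} (A : Fin N → Bool) → count A ≤ N
count≤ {N} A = ≤-trans (count-mono {A = A} {B = λ _ → true} (λ _ _ → refl)) (≤-reflexive (count-all N))

private module PowerBounds where
  open +-*-Solver using (solve; _:+_; _:*_; _:=_; con)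
  halves : ∀ a b ν → ν ≤ a + a → ν ≤ b + b → a + b ≤ ν → a + a ≡ ν × a + b ≡ ν
  halves a b ν h₁ h₂ h₃ = ≤-antisym (≤-trans (+-monoʳ-≤ a a≤b) h₃) h₁ , ≤-antisym h₃ (≤-trans h₁ (+-monoʳ-≤ a a≤b))
    where
    a≤b : a ≤ b
    a≤b = +-cancelʳ-≤ b a b (≤-trans h₃ h₂)

  size-contradiction : ∀ p n e → 3 ≤ p → 1 ≤ n → p * (p * e) ≤ n * p → n + n ≤ (e + e) + (e + e) → ⊥
  size-contradiction p n e p≥3 n≥1 h₁ h₂ = <⇒≱ small (≤-trans (*-monoˡ-≤ e p≥3) pe≤n)
    where
    pe≤n : p * e ≤ n
    pe≤n = *-cancelˡ-≤ p {{>-nonZero (≤-trans (s≤s z≤n) p≥3)}} (≤-trans h₁ (≤-reflexive (*-comm n p)))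
    n≤2e : n ≤ e + e
    n≤2e = *-cancelˡ-≤ 2 (≤-trans (≤-reflexive (cong (n +_) (+-identityʳ n))) (≤-trans h₂ (≤-reflexive (cong (e + e +_) (sym (+-identityʳ (e + e)))))))
    e≥1 : 1 ≤ e
    e≥1 = pos e n≤2e
      where
      pos : ∀ e → n ≤ e + e → 1 ≤ e
      pos zero    h = ≤-trans n≥1 h
      pos (suc _) _ = s≤s z≤n
    small : n < 3 * e
    small = ≤-trans (s≤s n≤2e) (≤-trans (+-monoˡ-≤ (e + e) e≥1) (≤-reflexive (solve 1 (λ e → e :+ (e :+ e) := con 3 :* e) refl e)))
open PowerBounds

module PrimePowerCase {N : ℕ} (G : FinAbelianGroup N) (norm : RegularNorm G)
  (n : ℕ) .{{n≢0 : NonZero n}} (exponent : ∀ x → GroupTheory._·_ G n x ≡ FinAbelianGroup.𝟘 G) (n<N : n < N)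
  (odd : n % 2 ≡ 1) where
  open MixedCase G norm n exponent n<N odd public

  -- The separation hypothesis makes the translates of `A` by the values of `f` disjoint, so their
  -- sizes add up inside the union.
  translates : ∀ {p} (A : Fin N → Bool) (f : Fin p → Fin N) →
    (∀ i j x → x ∈ A → x ⊕ (f i ⊕ ⊖ f j) ∈ A → i ≡ j) → p * count A ≤ count (λ z → ⌊ any? (λ i → ∈? A (z ⊕ ⊖ f i)) ⌋)
  translates {p} A f sep = ≤-trans (≤-reflexive (trans (sym (sumF-const p (count A)))
      (trans (sumF-cong (λ i → sym (sum-shift (⊖ f i) (λ x → ⟦ A x ⟧)))) (sumF-swap (λ i z → ⟦ A (z ⊕ ⊖ f i) ⟧))))) (sumF-mono col)
    where
    col : ∀ z → count (λ i → A (z ⊕ ⊖ f i)) ≤ ⟦ ⌊ any? (λ i → ∈? A (z ⊕ ⊖ f i)) ⌋ ⟧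
    col z with any? (λ i → ∈? A (z ⊕ ⊖ f i))
    ... | yes _ = count-unique _ (λ i j h h' → sep i j _ h (subst (_∈ A) (gsolve 3 (λ z a b → z :+ :- b := (z :+ :- a) :+ (a :+ :- b)) refl z (f i) (f j)) h'))
    ... | no ne = ≤-reflexive (count-empty _ (λ i h → ne (i , h)))

  agree : Fin N → ℕ
  agree g = count (λ x → ⌊ cl (x ⊕ g) ≟ cl x ⌋)

  Nc : Fin N → ℕ
  Nc g = count (λ x → not ⌊ cl (x ⊕ g) ≟ cl x ⌋)

  abstract
    agree+Nc : ∀ g → agree g + Nc g ≡ N
    agree+Nc g = trans (sym (sumF-+ (λ x → ⟦ ⌊ cl (x ⊕ g) ≟ cl x ⌋ ⟧) (λ x → ⟦ not ⌊ cl (x ⊕ g) ≟ cl x ⌋ ⟧)))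
      (trans (sumF-cong (λ x → comp ⌊ cl (x ⊕ g) ≟ cl x ⌋)) (count-all N))
      where
      comp : ∀ b → ⟦ b ⟧ + ⟦ not b ⟧ ≡ 1
      comp true  = refl
      comp false = refl

    -- Splitting by the common value of `cl` writes `agree` as a sum of intersection numbers of each
    -- class with itself.
    agree-class : ∀ x y → cl x ≡ cl y → agree x ≡ agree y
    agree-class x y e = trans (expand x) (trans (sumF-cong {suc (sumF cl)} (λ i → count-conv-class {D (toℕ i)} {D (toℕ i)} (D-class (toℕ i)) (D-class (toℕ i)) x y e)) (sym (expand y)))
      where
      bound : ∀ w → cl w < suc (sumF cl)
      bound w = s≤s (term≤sumF cl w)
      expand : ∀ g → agree g ≡ sumF {suc (sumF cl)} (λ i → count (λ w → D (toℕ i) w ∧ D (toℕ i) (g ⊕ ⊖ w)))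
      expand g = begin
        agree g
          ≡⟨ sumF-reindex ⊖_ ⊖_ ⊖-involutive ⊖-involutive (λ x → ⟦ ⌊ cl (x ⊕ g) ≟ cl x ⌋ ⟧) ⟨
        sumF (λ w → ⟦ ⌊ cl (⊖ w ⊕ g) ≟ cl (⊖ w) ⌋ ⟧)
          ≡⟨ sumF-cong pt ⟩
        sumF (λ w → sumF {suc (sumF cl)} (λ i → ⟦ D (toℕ i) w ∧ D (toℕ i) (g ⊕ ⊖ w) ⟧))
          ≡⟨ sumF-swap (λ w (i : Fin (suc (sumF cl))) → ⟦ D (toℕ i) w ∧ D (toℕ i) (g ⊕ ⊖ w) ⟧) ⟩
        sumF {suc (sumF cl)} (λ i → count (λ w → D (toℕ i) w ∧ D (toℕ i) (g ⊕ ⊖ w))) ∎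
        where
        open ≡-Reasoning
        pt : ∀ w → ⟦ ⌊ cl (⊖ w ⊕ g) ≟ cl (⊖ w) ⌋ ⟧ ≡ sumF {suc (sumF cl)} (λ i → ⟦ D (toℕ i) w ∧ D (toℕ i) (g ⊕ ⊖ w) ⟧)
        pt w = sym (trans (sumF-cong {suc (sumF cl)} term) (trans (sumF-δ (λ i → ⟦ D (toℕ i) (g ⊕ ⊖ w) ⟧) (fromℕ< (bound w)))
          (cong ⟦_⟧ (bool-ext
            (λ h → toYes (_ ≟ _) (trans (cong cl (⊕-comm (⊖ w) g)) (trans (fromD h) (trans (toℕ-fromℕ< (bound w)) (sym (cl-⊖ w))))))
            (λ h → inD (trans (cong cl (⊕-comm g (⊖ w))) (trans (fromYes (_ ≟ _) h) (trans (cl-⊖ w) (sym (toℕ-fromℕ< (bound w)))))))))))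
          where
          term : ∀ i → ⟦ D (toℕ i) w ∧ D (toℕ i) (g ⊕ ⊖ w) ⟧ ≡ ⟦ i ==F fromℕ< (bound w) ⟧ * ⟦ D (toℕ i) (g ⊕ ⊖ w) ⟧
          term i = trans (⟦⟧-∧ (D (toℕ i) w) _) (cong (λ b → ⟦ b ⟧ * ⟦ D (toℕ i) (g ⊕ ⊖ w) ⟧) (bool-ext
            (λ h → toYes (i ≟F _) (toℕ-injective (trans (sym (fromD h)) (sym (toℕ-fromℕ< (bound w))))))
            (λ h → inD (trans (sym (toℕ-fromℕ< (bound w))) (cong toℕ (sym (==F-sound h)))))))

    Nc-class : ∀ x y → cl x ≡ cl y → Nc x ≡ Nc y
    Nc-class x y e = +-cancelˡ-≡ (agree x) (Nc x) (Nc y) (trans (agree+Nc x) (trans (sym (agree+Nc y)) (cong (_+ Nc y) (agree-class y x (sym e)))))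

    Nc-multiplier : ∀ {t} → Coprime t n → ∀ g → Nc (t · g) ≡ Nc g
    Nc-multiplier {t} c g = trans (sym (sumF-reindex (t ·_) (t' ·_) inv inv′ (λ x → ⟦ not ⌊ cl (x ⊕ t · g) ≟ cl x ⌋ ⟧)))
      (sumF-cong (λ x → cong (λ b → ⟦ not b ⟧) (bool-ext
        (λ h → toYes (_ ≟ _) (multiplier-reflects c _ _ (trans (cong cl (·-distribˡ t x g)) (fromYes (_ ≟ _) h))))
        (λ h → toYes (_ ≟ _) (trans (cong cl (sym (·-distribˡ t x g))) (multiplier-class c _ _ (fromYes (_ ≟ _) h)))))))
      where
      t' : ℕ
      t' = proj₁ (inverse-multiplier t c)
      inv : ∀ x → t' · (t · x) ≡ x
      inv = proj₂ (proj₂ (inverse-multiplier t c))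
      inv′ : ∀ x → t · (t' · x) ≡ x
      inv′ x = trans (·-comm t t' x) (inv x)

  Multi? : Dec Multi
  Multi? = all? (λ x → all? (λ y → ¬? (cl x ≟ 1) →-dec (¬? (cl y ≟ 1) →-dec ¬? (cl (x ⊕ y) ≟ 1))))

  module _ {p m : ℕ} (p≥3 : 3 ≤ p) (n≡ : n ≡ p * m) (p∣m : p ∣ m) (N≡ : N ≡ n * p)
    (τ-coprime : ∀ i → Coprime (1 + i * m) n) (2-coprime : Coprime 2 n)
    (outside : ∃ λ x → m · x ≢ 𝟘)
    (line : ∀ x w → m · x ≢ 𝟘 → ∃ λ i → m · w ≡ i · (m · x))
    (line-order : ∀ x → m · x ≢ 𝟘 → ∀ (i j : Fin p) → toℕ i · (m · x) ≡ toℕ j · (m · x) → i ≡ j)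
    (line-unit : ∀ x w → m · x ≢ 𝟘 → m · w ≢ 𝟘 → ∃ λ t → Coprime t n × t · (m · x) ≡ m · w)
    (full-order : ∀ x → m · x ≢ 𝟘 → ∀ (i j : Fin n) → toℕ i · x ≡ toℕ j · x → i ≡ j) where
    private
      -- Its square vanishes because `p ∣ m`. Therefore `1 + i * m` acts as `x ⊕ i · ψ x`, and
      -- composing such multipliers adds their indices. The kernel of `ψ` appears as Ω in the names
      -- below.
      ψ : Fin N → Fin N
      ψ x = m · x

      ψψ : ∀ x → ψ (ψ x) ≡ 𝟘
      ψψ x = let divides r e = p∣m in trans (sym (·-assoc m m x)) (trans (cong (_· x) (trans (cong (_* m) e) (trans (*-assoc r p m) (cong (r *_) (sym n≡))))) (multiple-n r x))

      pψ : ∀ i x → (i * p) · ψ x ≡ 𝟘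
      pψ i x = trans (sym (·-assoc (i * p) m x)) (trans (cong (_· x) (trans (*-assoc i p m) (cong (i *_) (sym n≡)))) (multiple-n i x))

      τ-apply : ∀ i x → (1 + i * m) · x ≡ x ⊕ i · ψ x
      τ-apply i x = cong (x ⊕_) (·-assoc i m x)

      ψ-⊕ : ∀ x y → ψ (x ⊕ y) ≡ ψ x ⊕ ψ y
      ψ-⊕ = ·-distribˡ m

      ψ-shift : ∀ x i w → ψ (x ⊕ i · ψ w) ≡ ψ x
      ψ-shift x i w = trans (ψ-⊕ x (i · ψ w)) (trans (cong (ψ x ⊕_) (trans (·-comm m i (ψ w)) (trans (cong (i ·_) (ψψ w)) (·-𝟘 i)))) (⊕-identityʳ _))

      τ-compose : ∀ i j x → (1 + i * m) · ((1 + j * m) · x) ≡ (1 + (j + i) * m) · x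
      τ-compose i j x = begin
        (1 + i * m) · ((1 + j * m) · x)     ≡⟨ cong ((1 + i * m) ·_) (τ-apply j x) ⟩
        (1 + i * m) · (x ⊕ j · ψ x)         ≡⟨ τ-apply i (x ⊕ j · ψ x) ⟩
        (x ⊕ j · ψ x) ⊕ i · ψ (x ⊕ j · ψ x) ≡⟨ cong (λ u → (x ⊕ j · ψ x) ⊕ i · u) (ψ-shift x j x) ⟩
        (x ⊕ j · ψ x) ⊕ i · ψ x             ≡⟨ ⊕-assoc x _ _ ⟩
        x ⊕ (j · ψ x ⊕ i · ψ x)             ≡⟨ cong (x ⊕_) (·-distribʳ j i (ψ x)) ⟨
        x ⊕ (j + i) · ψ x                   ≡⟨ τ-apply (j + i) x ⟨
        (1 + (j + i) * m) · x               ∎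
        where open ≡-Reasoning

      instance
        p≢0 : NonZero p
        p≢0 = >-nonZero (≤-trans (s≤s z≤n) p≥3)

      τ-reduce : ∀ i x → (1 + i * m) · x ≡ (1 + (i % p) * m) · x
      τ-reduce i x = trans (τ-apply i x) (trans (cong (x ⊕_) (trans (cong (_· ψ x) (m≡m%n+[m/n]*n i p))
        (trans (·-distribʳ (i % p) _ (ψ x)) (trans (cong ((i % p) · ψ x ⊕_) (pψ (i / p) x)) (⊕-identityʳ _))))) (sym (τ-apply (i % p) x)))

      ⊖-as-multiple : ∀ x → (n ∸ 1) · x ≡ ⊖ x
      ⊖-as-multiple x = ⊕-cancelˡ x (trans (trans (cong (_· x) (m+[n∸m]≡n (>-nonZero⁻¹ n))) (exponent x)) (sym (⊕-inverseʳ x)))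

    -- If some τ = 1 + m moves the class S, the union U of the τ-translates of S is stable under
    -- im ψ, which makes the graph antipodal with im ψ inside the antipodal class.
    moving : ∀ {s} → cl s ≡ 1 → cl ((1 + 1 * m) · s) ≢ 1 → Multi
    moving {s} es moved = finish (imprimitive odd M M? M+ M- {s} s∉M ψs≢0 (M-class (ψ s) M-ψs))
      where
      U? : ∀ x → Dec (∃ λ (i : Fin p) → cl x ≡ cl ((1 + toℕ i * m) · s))
      U? x = any? (λ i → cl x ≟ cl ((1 + toℕ i * m) · s))
      U : Fin N → Bool
      U x = ⌊ U? x ⌋
      U-intro : ∀ {x} i → cl x ≡ cl ((1 + i * m) · s) → x ∈ U
      U-intro {x} i e = toYes (U? x) (fromℕ< (m%n<n i p) , trans e (trans (cong cl (τ-reduce i s)) (cong (λ j → cl ((1 + j * m) · s)) (sym (toℕ-fromℕ< (m%n<n i p))))))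
      U-class : Class U
      U-class x y e = bool-ext (to x y e) (to y x (sym e))
        where
        to : ∀ x y → cl x ≡ cl y → x ∈ U → y ∈ U
        to x y e h = let (i , q) = fromYes (U? x) h in toYes (U? y) (i , trans (sym e) q)
      U∉Ω : ∀ x → x ∈ U → ψ x ≢ 𝟘
      U∉Ω x h z = let (i , q) = fromYes (U? x) h in moved (trans (multiplier-reflects (τ-coprime (toℕ i)) _ _ (begin
          cl ((1 + toℕ i * m) · ((1 + 1 * m) · s))   ≡⟨ cong cl (·-comm (1 + toℕ i * m) (1 + 1 * m) s) ⟩
          cl ((1 + 1 * m) · ((1 + toℕ i * m) · s))   ≡⟨ multiplier-class (τ-coprime 1) _ _ (sym q) ⟩
          cl ((1 + 1 * m) · x)                       ≡⟨ cong cl (trans (τ-apply 1 x) (trans (cong (λ u → x ⊕ 1 · u) z) (trans (cong (x ⊕_) (·-𝟘 1)) (⊕-identityʳ x)))) ⟩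
          cl x                                       ≡⟨ q ⟩
          cl ((1 + toℕ i * m) · s)                   ∎)) es)
        where open ≡-Reasoning
      U-C : ∀ x w → x ∈ U → x ⊕ ψ w ∈ U
      U-C x w h = let (i , q) = fromYes (U? x) h ; (j , e) = line x w (U∉Ω x h) in
        U-intro (toℕ i + j) (trans (cong cl (trans (cong (x ⊕_) e) (sym (τ-apply j x))))
          (trans (multiplier-class (τ-coprime j) x _ q) (cong cl (τ-compose j (toℕ i) s))))
      s∈U : s ∈ U
      s∈U = U-intro 0 (cong cl (sym (1· s)))
      -- The stabiliser of `U`. As `U` is a union of classes, the size of its intersection with a
      -- translate depends only on the class of the translation, so `M` is a union of classes too.
      M : Fin N → Set
      M g = ∀ w → w ∈ U → w ⊕ ⊖ g ∈ U
      M? : ∀ g → Dec (M g)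
      M? g = all? (λ w → ∈? U w →-dec ∈? U (w ⊕ ⊖ g))
      M+ : ∀ g h → M g → M h → M (g ⊕ h)
      M+ g h mg mh w wu = subst (_∈ U) (gsolve 3 (λ w g h → (w :+ :- g) :+ :- h := w :+ :- (g :+ h)) refl w g h) (mh _ (mg w wu))
      M𝟘 : M 𝟘
      M𝟘 w h = subst (_∈ U) (gsolve 1 (λ w → w := w :+ :- :0) refl w) h
      M- : ∀ g → M g → M (⊖ g)
      M- g mg = subst M (⊖-as-multiple g) (closed-· M M𝟘 M+ (n ∸ 1) g mg)
      U⁻ : Fin N → Bool
      U⁻ w = U (⊖ w)
      minus : ∀ w g → ⊖ (g ⊕ ⊖ w) ≡ w ⊕ ⊖ g
      minus = gsolve 2 (λ w g → :- (g :+ :- w) := w :+ :- g) refl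
      M-class : ∀ g → M g → ∀ z → cl z ≡ cl g → M z
      M-class g mg z e w h = subst (_∈ U) (minus w z) (proj₂ (∧-elim {U w} (count-⊆-≥ {A = λ w → U w ∧ U⁻ (z ⊕ ⊖ w)} {B = U} (λ _ h → proj₁ (∧-elim h))
        (≤-trans (count-mono (λ w h → ∧-intro h (subst (_∈ U) (sym (minus w g)) (mg w h))))
          (≤-reflexive (count-conv-class {U} {U⁻} U-class (λ x y e → U-class _ _ (trans (cl-⊖ x) (trans e (sym (cl-⊖ y))))) g z (sym e)))) w h)))
      s∉M : ¬ M s
      s∉M h = U∉Ω (s ⊕ ⊖ s) (h s s∈U) (trans (cong ψ (⊕-inverseʳ s)) (·-𝟘 m))
      ψs≢0 : ψ s ≢ 𝟘
      ψs≢0 = U∉Ω s s∈U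
      M-ψs : M (ψ s)
      M-ψs w h = subst (_∈ U) (cong (w ⊕_) (·-⊖ m s)) (U-C w (⊖ s) h)
      finish : Multi ⊎ Antipodal (cl (ψ s)) → Multi
      finish (inj₁ mu) = mu
      -- `ψ s` and its double are antipodal to `𝟘`, so `s ⊕ ψ s` and `s ⊕ (ψ s ⊕ ψ s)` both have
      -- norm `d ∸ 1`. They are the images of `s` and `s ⊕ ψ s` under `1 + m`, which reflects
      -- classes; so `s` would have norm `d ∸ 1`, at least 2.
      finish (inj₂ (3≤d , top , closed)) = contradiction (multiplier-reflects (τ-coprime 1) s (s ⊕ ψ s) (trans (cong cl τs) (trans (trans (level (ψ s) refl) (sym (level (ψ s ⊕ ψ s) cl2))) (cong cl (sym τss)))))
          (λ e → <⇒≢ (∸-monoˡ-≤ 1 3≤d) (trans (sym es) (trans e (level (ψ s) refl))))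
        where
        d : ℕ
        d = cl (ψ s)
        τs : (1 + 1 * m) · s ≡ s ⊕ ψ s
        τs = trans (τ-apply 1 s) (cong (s ⊕_) (1· (ψ s)))
        τss : (1 + 1 * m) · (s ⊕ ψ s) ≡ s ⊕ (ψ s ⊕ ψ s)
        τss = trans (τ-apply 1 (s ⊕ ψ s)) (trans (cong ((s ⊕ ψ s) ⊕_) (trans (1· _) (trans (cong ψ (cong (s ⊕_) (sym (1· (ψ s))))) (ψ-shift s 1 s)))) (⊕-assoc s _ _))
        cl2 : cl (ψ s ⊕ ψ s) ≡ d
        cl2 with closed (ψ s) (ψ s) (inj₂ refl) (inj₂ refl)
        ... | inj₂ e = e
        ... | inj₁ e = contradiction (no-involution (cl≡0 _ e)) ψs≢0
        level : ∀ c → cl c ≡ d → cl (s ⊕ c) ≡ d ∸ 1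
        level c ec = ≤-antisym (≤-pred (≤-trans (≤∧≢⇒< (top (s ⊕ c)) not-d) (≤-reflexive (sym (m+[n∸m]≡n (≤-trans (s≤s z≤n) 3≤d))))))
            (∸-monoˡ-≤ 1 (≤-trans (≤-reflexive (sym ec)) (≤-trans (cl-≤ (gsolve 2 (λ s c → c := :- s :+ (s :+ c)) refl s c)) (≤-reflexive (cong (_+ cl (s ⊕ c)) (trans (cl-⊖ s) es))))))
          where
          small : cl s ≡ 0 ⊎ cl s ≡ d → ⊥
          small (inj₁ e) = case trans (sym es) e of λ ()
          small (inj₂ e) = <⇒≢ (≤-trans (s≤s (s≤s z≤n)) 3≤d) (trans (sym es) e)
          not-d : cl (s ⊕ c) ≢ d
          not-d e = small (subst (λ u → cl u ≡ 0 ⊎ cl u ≡ d) (⊕-⊖ s c) (closed (s ⊕ c) (⊖ c) (inj₂ e) (inj₂ (trans (cl-⊖ c) ec))))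

    module Fixed (fixed : ∀ s → cl s ≡ 1 → cl ((1 + 1 * m) · s) ≡ 1) (nm : ¬ Multi) where
      τ-S : ∀ i s → cl s ≡ 1 → cl ((1 + i * m) · s) ≡ 1
      τ-S zero    s es = trans (cong cl (1· s)) es
      τ-S (suc i) s es = trans (cong cl (trans (cong (λ k → (1 + k * m) · s) (+-comm 1 i)) (sym (τ-compose 1 i s)))) (fixed _ (τ-S i s es))

      τ-≤ : ∀ i k x → cl x ≡ k → cl ((1 + i * m) · x) ≤ k
      τ-≤ i zero x e = ≤-reflexive (trans (cong cl (trans (cong ((1 + i * m) ·_) (cl≡0 x e)) (·-𝟘 (1 + i * m)))) cl-𝟘)
      τ-≤ i (suc k) x e = let (y , s , ey , es , eq) = geodesic x k e in
        ≤-trans (cl-≤ (trans (cong ((1 + i * m) ·_) eq) (·-distribˡ (1 + i * m) y s)))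
          (≤-trans (+-mono-≤ (τ-≤ i k y ey) (≤-reflexive (τ-S i s es))) (≤-reflexive (+-comm k 1)))

      τ-cl : ∀ i x → cl ((1 + i * m) · x) ≡ cl x
      τ-cl i x = ≤-antisym (τ-≤ i (cl x) x refl) (≤-trans (≤-reflexive (cong cl (sym back))) (τ-≤ ((p ∸ 1) * i) _ _ refl))
        where
        back : (1 + ((p ∸ 1) * i) * m) · ((1 + i * m) · x) ≡ x
        back = trans (τ-compose ((p ∸ 1) * i) i x) (trans (cong (λ k → (1 + k * m) · x) (trans (cong (_* i) (m+[n∸m]≡n (≤-trans (s≤s z≤n) p≥3))) (*-comm p i)))
          (trans (τ-apply (i * p) x) (trans (cong (x ⊕_) (pψ i x)) (⊕-identityʳ x))))

      -- For `x` outside the kernel, the multiples of `ψ x` fill the image of `ψ`, so adding `ψ w`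
      -- to `x` is the action of one of the multipliers `1 + i * m`.
      C-shift : ∀ x w → ψ x ≢ 𝟘 → cl (x ⊕ ψ w) ≡ cl x
      C-shift x w nx = let (i , e) = line x w nx in trans (cong cl (trans (cong (x ⊕_) e) (sym (τ-apply i x)))) (τ-cl i x)

      x₁ : Fin N
      x₁ = proj₁ outside
      c : Fin N
      c = ψ x₁
      c≢0 : c ≢ 𝟘
      c≢0 = proj₂ outside

      abstract
        S-outside : ∃ λ s → cl s ≡ 1 × ψ s ≢ 𝟘
        S-outside with any? (λ s → (cl s ≟ 1) ×-dec ¬? (ψ s ≟F 𝟘))
        ... | yes h = h
        ... | no ¬h = contradiction (generated (λ x → ψ x ≡ 𝟘) (·-𝟘 m) (λ x y a b → trans (ψ-⊕ x y) (trans (cong₂ _⊕_ a b) (⊕-identityˡ 𝟘))) gens x₁) c≢0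
          where
          gens : ∀ s → cl s ≡ 1 → ψ s ≡ 𝟘
          gens s es with ψ s ≟F 𝟘
          ... | yes z = z
          ... | no nz = contradiction (s , es , nz) ¬h

      c≤2 : cl c ≤ 2
      c≤2 = let (s , es , ns) = S-outside in
        ≤-trans (≤-reflexive (cong cl (gsolve 2 (λ s c → c := (s :+ c) :+ :- s) refl s c))) (diff≤2 (trans (C-shift s x₁ ns) es) es)

      abstract
        -- A class inside a proper subgroup would be antipodal, since `Multi` is excluded, and
        -- antipodal classes have norm at least 3.
        no-subgroup : (M : Fin N → Set) → (∀ x → Dec (M x)) → (∀ x y → M x → M y → M (x ⊕ y)) → (∀ x → M x → M (⊖ x)) →
          ∀ {g} → ¬ M g → ∀ {x} → x ≢ 𝟘 → cl x ≤ 2 → ∃ λ z → cl z ≡ cl x × ¬ M z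
        no-subgroup M M? M+ M- {g} g∉ {x} nx x≤2 with any? (λ z → (cl z ≟ cl x) ×-dec ¬? (M? z))
        ... | yes h = h
        ... | no none = ⊥-elim (absurd (imprimitive odd M M? M+ M- g∉ nx inM))
          where
          inM : ∀ z → cl z ≡ cl x → M z
          inM z e with M? z
          ... | yes h = h
          ... | no h = contradiction (z , e , h) none
          absurd : Multi ⊎ Antipodal (cl x) → ⊥
          absurd (inj₁ mu) = nm mu
          absurd (inj₂ (3≤ , _)) = <⇒≱ 3≤ x≤2

        Ω-no-subgroup : ∀ {x} → x ≢ 𝟘 → cl x ≤ 2 → ∃ λ z → cl z ≡ cl x × ψ z ≢ 𝟘
        Ω-no-subgroup = no-subgroup (λ x → ψ x ≡ 𝟘) (λ x → ψ x ≟F 𝟘) (λ x y a b → trans (ψ-⊕ x y) (trans (cong₂ _⊕_ a b) (⊕-identityˡ 𝟘)))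
          (λ x a → trans (·-⊖ m x) (trans (cong ⊖_ a) ⊖-𝟘)) {x₁} c≢0

      ν : ℕ
      ν = Nc c

      Nc-C : ∀ w → ψ w ≢ 𝟘 → Nc (ψ w) ≡ ν
      Nc-C w nw = let (t , ct , e) = line-unit x₁ w c≢0 nw in trans (cong Nc (sym e)) (Nc-multiplier ct c)

      E : Fin N → Fin N → Bool
      E y x = ⌊ ψ x ≟F 𝟘 ⌋ ∧ not ⌊ cl (x ⊕ y) ≟ cl x ⌋

      E-elim : ∀ {y x} → x ∈ E y → ψ x ≡ 𝟘 × cl (x ⊕ y) ≢ cl x
      E-elim {y} {x} h = let (a , b) = ∧-elim {⌊ ψ x ≟F 𝟘 ⌋} h in fromYes (_ ≟F _) a , fromNo (_ ≟ _) (not-elim b)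

      E-intro : ∀ {y x} → ψ x ≡ 𝟘 → cl (x ⊕ y) ≢ cl x → x ∈ E y
      E-intro a b = ∧-intro (toYes (_ ≟F _) a) (not-intro (toNo (_ ≟ _) b))

      ψ-Ω : ∀ {x y} → ψ x ≡ 𝟘 → ψ (x ⊕ y) ≡ ψ y
      ψ-Ω {x} {y} e = trans (ψ-⊕ x y) (trans (cong (_⊕ ψ y) e) (⊕-identityˡ _))

      -- By `C-shift` the change happens at `x` in the kernel. If `y` altered the norm neither at
      -- `x` nor at `x ⊕ ψ w`, the detour through `x ⊕ y`, outside the kernel where `ψ w` alters
      -- nothing, would equate the two norms.
      change-cover : ∀ {y} → ψ y ≢ 𝟘 → ∀ w x → cl (x ⊕ ψ w) ≢ cl x → x ∈ E y ⊎ x ⊕ ψ w ∈ E y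
      change-cover {y} ny w x ne = go (ψ x ≟F 𝟘) (cl (x ⊕ y) ≟ cl x)
        where
        go : Dec (ψ x ≡ 𝟘) → Dec (cl (x ⊕ y) ≡ cl x) → x ∈ E y ⊎ x ⊕ ψ w ∈ E y
        go (no nx)  _       = contradiction (C-shift x w nx) ne
        go (yes xΩ) (no h)  = inj₁ (E-intro xΩ h)
        go (yes xΩ) (yes h) = inj₂ (E-intro (trans (cong ψ (cong (x ⊕_) (sym (1· (ψ w))))) (trans (ψ-shift x 1 w) xΩ))
                (λ q → ne (trans (sym q) (trans (cong cl (gsolve 3 (λ x c y → (x :+ c) :+ y := (x :+ y) :+ c) refl x (ψ w) y))
                  (trans (C-shift (x ⊕ y) w (λ z → ny (trans (sym (ψ-Ω xΩ)) z))) h)))))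

      count-shifted : ∀ g (A : Fin N → Bool) → count (λ x → A (x ⊕ g)) ≡ count A
      count-shifted g A = sum-shift g (λ x → ⟦ A x ⟧)

      ν≤ : ∀ {y} → ψ y ≢ 𝟘 → ν ≤ count (E y) + count (E y)
      ν≤ {y} ny = ≤-trans (count-∪ {A = E y} {B = λ x → E y (x ⊕ c)} (λ x h → change-cover ny x₁ x (fromNo (_ ≟ _) (not-elim h))))
        (≤-reflexive (cong (count (E y) +_) (count-shifted c (E y))))

      module Partner {y : Fin N} (ny : ψ y ≢ 𝟘) (νy : Nc y ≡ ν) where
        n-y : ψ (⊖ y) ≢ 𝟘
        n-y z = ny (trans (sym (⊖-involutive _)) (trans (cong ⊖_ (trans (sym (·-⊖ m y)) z)) ⊖-𝟘))

        E⁻ : Fin N → Bool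
        E⁻ x = E (⊖ y) (x ⊕ y)

        change : Fin N → Bool
        change x = not ⌊ cl (x ⊕ y) ≟ cl x ⌋

        E⊆ : ∀ x → x ∈ E y → x ∈ change
        E⊆ x h = proj₂ (∧-elim {⌊ ψ x ≟F 𝟘 ⌋} h)

        E⁻⊆ : ∀ x → x ∈ E⁻ → x ∈ change
        E⁻⊆ x h = not-intro (toNo (_ ≟ _) (λ e → proj₂ (E-elim h) (trans (cong cl (⊕-⊖ x y)) (sym e))))

        E-disjoint : ∀ x → x ∈ E y → x ∈ E⁻ → ⊥
        E-disjoint x h h' = ny (trans (sym (ψ-Ω (proj₁ (E-elim h)))) (proj₁ (E-elim h')))

        abstract
          -- The changes under `y` that start in the kernel and those that end in it form disjoint
          -- sets. Each has at least ν / 2 elements, by `ν≤` for `y` and for `⊖ y`, while there are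
          -- only ν changes in all. So each is exactly half, and no further change is left over.
          sizes : count (E y) + count (E y) ≡ ν × count (E y) + count E⁻ ≡ ν
          sizes = halves (count (E y)) (count E⁻) ν (ν≤ ny) (≤-trans (ν≤ n-y) (≤-reflexive (sym (cong₂ _+_ (count-shifted y (E (⊖ y))) (count-shifted y (E (⊖ y)))))))
            (≤-trans (count-⊎ {C = change} E⊆ E⁻⊆ E-disjoint) (≤-reflexive νy))

          constant-outside : ∀ x → ψ x ≢ 𝟘 → ψ (x ⊕ y) ≢ 𝟘 → cl (x ⊕ y) ≡ cl x
          constant-outside x nx nxy with cl (x ⊕ y) ≟ cl x in eq
          ... | yes e = e
          ... | no ne = ⊥-elim (absurd (∨-elim (count-⊆-≥ {A = W} {B = change} W⊆ W-size x (not-intro (toNo (_ ≟ _) ne)))))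
            where
            W : Fin N → Bool
            W x = E y x ∨ E⁻ x
            W⊆ : ∀ x → x ∈ W → x ∈ change
            W⊆ x h with ∨-elim {E y x} h
            ... | inj₁ a = E⊆ x a
            ... | inj₂ b = E⁻⊆ x b
            W-size : count change ≤ count W
            W-size = ≤-trans (≤-reflexive (trans νy (sym (proj₂ sizes)))) (count-⊎ {A = E y} {B = E⁻} {C = W} (λ x a → ∨-introˡ a) (λ x b → ∨-introʳ {E y x} b) E-disjoint)
            absurd : x ∈ E y ⊎ x ∈ E⁻ → ⊥
            absurd (inj₁ h) = nx (proj₁ (E-elim h))
            absurd (inj₂ h) = nxy (proj₁ (E-elim h))

          -- Otherwise `x` would be covered twice by `change-cover`, so the changes under `ψ w`
          -- would number fewer than twice `count (E y)`, which is ν.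
          coset-sparse : ∀ w → ψ w ≢ 𝟘 → ∀ x → x ∈ E y → x ⊕ ψ w ∈ E y → ⊥
          coset-sparse w nw x h h' = <⇒≱ smaller (≤-trans (≤-reflexive (trans (proj₁ sizes) (sym (Nc-C w nw)))) cover)
            where
            E∖ : Fin N → Bool
            E∖ z = E y z ∧ not (z ==F x)
            E∖< : count E∖ + 1 ≤ count (E y)
            E∖< = ≤-trans (≤-reflexive (cong (count E∖ +_) (sym (count-δ x)))) (count-⊎ {B = _==F x} (λ z a → proj₁ (∧-elim a)) (λ z a → subst (_∈ E y) (sym (==F-sound a)) h)
              (λ z a b → true≢false b (not-elim (proj₂ (∧-elim {E y z} a)))))
            cover : Nc (ψ w) ≤ count E∖ + count (E y)
            cover = ≤-trans (count-∪ {A = E∖} {B = λ z → E y (z ⊕ ψ w)} cases) (≤-reflexive (cong (count E∖ +_) (count-shifted (ψ w) (E y))))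
              where
              cases : ∀ z → z ∈ (λ z → not ⌊ cl (z ⊕ ψ w) ≟ cl z ⌋) → z ∈ E∖ ⊎ z ∈ (λ z → E y (z ⊕ ψ w))
              cases z a with z ≟F x
              ... | yes e = inj₂ (subst (λ u → u ⊕ ψ w ∈ E y) (sym e) h')
              ... | no ne with change-cover ny w z (fromNo (_ ≟ _) (not-elim a))
              ...   | inj₁ b = inj₁ (∧-intro b refl)
              ...   | inj₂ b = inj₂ b
            smaller : count E∖ + count (E y) < count (E y) + count (E y)
            smaller = +-monoˡ-< (count (E y)) (≤-trans (≤-reflexive (+-comm 1 _)) E∖<)

      module Final {y : Fin N} (ny : ψ y ≢ 𝟘) (ey : cl y ≡ cl c) where
        open Partner ny (Nc-class y c ey)
        2y : Fin N
        2y = 2 · y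
        n2y : ψ 2y ≢ 𝟘
        n2y z = ny (no-involution (trans (cong (ψ y ⊕_) (sym (1· (ψ y)))) (trans (·-comm 2 m y) z)))
        module Double = Partner n2y (trans (Nc-multiplier 2-coprime y) (Nc-class y c ey))
        -- Translating `E y` along the image of `ψ` stays in the kernel and keeps the copies
        -- disjoint by `coset-sparse`; translating by multiples of `y` afterwards moves to different
        -- cosets of the kernel.
        E-size : p * (p * count (E y)) ≤ n * p
        E-size = ≤-trans (*-monoʳ-≤ p (translates (E y) (λ i → toℕ i · c) sep₁)) (≤-trans (translates B₁ (λ j → toℕ j · y) sep₂)
            (≤-trans (count≤ B₂) (≤-reflexive N≡)))
          where
          C-diff : ∀ i j → i · c ⊕ ⊖ (j · c) ≡ ψ (i · x₁ ⊕ ⊖ (j · x₁))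
          C-diff i j = sym (trans (ψ-⊕ (i · x₁) _) (cong₂ _⊕_ (·-comm m i x₁) (trans (·-⊖ m (j · x₁)) (cong ⊖_ (·-comm m j x₁)))))
          sep₁ : ∀ i j x → x ∈ E y → x ⊕ (toℕ i · c ⊕ ⊖ (toℕ j · c)) ∈ E y → i ≡ j
          sep₁ i j x h h' with i ≟F j
          ... | yes e = e
          ... | no ne = ⊥-elim (coset-sparse (toℕ i · x₁ ⊕ ⊖ (toℕ j · x₁))
                  (λ z → ne (line-order x₁ c≢0 i j (⊖≡𝟘⇒≡ (trans (C-diff (toℕ i) (toℕ j)) z)))) x h (subst (λ u → x ⊕ u ∈ E y) (C-diff (toℕ i) (toℕ j)) h'))
          B₁ : Fin N → Bool
          B₁ z = ⌊ any? (λ i → ∈? (E y) (z ⊕ ⊖ (toℕ i · c))) ⌋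
          B₂ : Fin N → Bool
          B₂ z = ⌊ any? (λ (j : Fin p) → ∈? B₁ (z ⊕ ⊖ (toℕ j · y))) ⌋
          B₁Ω : ∀ z → z ∈ B₁ → ψ z ≡ 𝟘
          B₁Ω z h = let (i , a) = fromYes (any? (λ i → ∈? (E y) (z ⊕ ⊖ (toℕ {p} i · c)))) h in
            trans (sym (ψ-shift z (toℕ i) (⊖ x₁))) (trans (cong (λ u → ψ (z ⊕ u)) (trans (cong (toℕ i ·_) (·-⊖ m x₁)) (·-⊖ (toℕ i) c))) (proj₁ (E-elim a)))
          sep₂ : ∀ i j x → x ∈ B₁ → x ⊕ (toℕ i · y ⊕ ⊖ (toℕ j · y)) ∈ B₁ → i ≡ j
          sep₂ i j x h h' = line-order y ny i j (⊖≡𝟘⇒≡ (trans (cong₂ _⊕_ (·-comm (toℕ i) m y) (trans (cong ⊖_ (·-comm (toℕ j) m y)) (sym (·-⊖ m (toℕ j · y)))))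
            (trans (sym (ψ-⊕ (toℕ i · y) _)) (trans (sym (ψ-Ω (B₁Ω x h))) (B₁Ω _ h')))))
        -- the norm corrected on Ω so as to become y-invariant
        cl′ : Fin N → ℕ
        cl′ x with ψ x ≟F 𝟘
        ... | yes _ = cl (x ⊕ y)
        ... | no _  = cl x
        cl′-out : ∀ {x} → ψ x ≢ 𝟘 → cl′ x ≡ cl x
        cl′-out {x} e with ψ x ≟F 𝟘
        ... | yes h = contradiction h e
        ... | no _ = refl
        cl′-y : ∀ x → cl′ (x ⊕ y) ≡ cl′ x
        cl′-y x with ψ x ≟F 𝟘 | ψ (x ⊕ y) ≟F 𝟘
        ... | yes a | yes b = contradiction (trans (sym (ψ-Ω a)) b) ny
        ... | yes a | no b = refl
        -- Here the correction replaces the step by `y` into the kernel with the step by `2 · y`,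
        -- which ends outside again; `Double` says that such a step keeps the norm.
        ... | no a | yes b = trans (cong cl (trans (⊕-assoc x y y) (cong (x ⊕_) (cong (y ⊕_) (sym (1· y))))))
              (Double.constant-outside x a (λ z → ny (trans (sym (ψ-Ω b)) (trans (cong ψ (trans (⊕-assoc x y y) (cong (x ⊕_) (cong (y ⊕_) (sym (1· y)))))) z))))
        ... | no a | no b = constant-outside x a b
        cl′-· : ∀ i x → cl′ (x ⊕ i · y) ≡ cl′ x
        cl′-· zero    x = cong cl′ (⊕-identityʳ x)
        cl′-· (suc i) x = trans (cong cl′ (gsolve 3 (λ x y z → x :+ (y :+ z) := (x :+ z) :+ y) refl x y (i · y))) (trans (cl′-y _) (cl′-· i x))
        cl′-diff : ∀ x → cl′ x ≢ cl x → x ∈ E y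
        cl′-diff x ne with ψ x ≟F 𝟘
        ... | no _ = contradiction refl ne
        ... | yes a = ∧-intro refl (not-intro (toNo (_ ≟ _) ne))
        F : Fin N → Set
        F g = ∀ x → cl′ (x ⊕ g) ≡ cl′ x
        F? : ∀ g → Dec (F g)
        F? g = all? (λ x → cl′ (x ⊕ g) ≟ cl′ x)
        F+ : ∀ g h → F g → F h → F (g ⊕ h)
        F+ g h fg fh x = trans (cong cl′ (sym (⊕-assoc x g h))) (trans (fh _) (fg x))
        F- : ∀ g → F g → F (⊖ g)
        F- g fg x = trans (sym (fg (x ⊕ ⊖ g))) (cong cl′ (⊖-⊕ x g))
        -- If `cl′` were constant, all elements outside the kernel would have norm 1. A nonempty
        -- class 2 always has a member outside, so there would be none and the graph would be
        -- complete.
        F≠G : ∃ λ g → ¬ F g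
        F≠G with any? (λ g → ¬? (F? g))
        ... | yes h = h
        ... | no none = ⊥-elim (nm multi)
          where
          all-F : ∀ g → F g
          all-F g with F? g
          ... | yes h = h
          ... | no h = contradiction (g , h) none
          s : Fin N
          s = proj₁ S-outside
          out1 : ∀ x → ψ x ≢ 𝟘 → cl x ≡ 1
          out1 x nx = trans (sym (cl′-out nx)) (trans (cong cl′ (gsolve 2 (λ x s → x := s :+ (x :+ :- s)) refl x s)) (trans (all-F _ s)
            (trans (cl′-out (proj₂ (proj₂ S-outside))) (proj₁ (proj₂ S-outside)))))
          no2 : ∀ z → cl z ≢ 2
          no2 z ez = let (w , ew , nw) = Ω-no-subgroup (cl>0⇒≢ ez) (≤-reflexive ez) in case trans (sym (out1 w nw)) (trans ew ez) of λ ()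
          small : ∀ z → cl z ≢ 1 → z ≡ 𝟘
          small z nz with cl z ≟ 0
          ... | yes e = cl≡0 z e
          ... | no n0 = let (u , eu) = descend z 2 (≤∧≢⇒< (n≢0⇒n>0 n0) (λ e → nz (sym e))) in contradiction eu (no2 u)
          multi : Multi
          multi u v nu nv h = case trans (sym h) (trans (cong cl (trans (cong₂ _⊕_ (small u nu) (small v nv)) (⊕-identityˡ 𝟘))) cl-𝟘) of λ ()
        module Boundary {x₀ a : Fin N} (ex₀ : cl x₀ ≡ cl c) (na : cl′ (a ⊕ x₀) ≢ cl′ a) where
          V : Fin N → Bool
          V x = ⌊ cl′ x ≟ cl′ (a) ⌋
          V-· : ∀ i x → V (x ⊕ i · y) ≡ V x
          V-· i x = cong (λ k → ⌊ k ≟ cl′ (a) ⌋) (cl′-· i x)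
          A₁ A₂ : Fin N → Bool
          A₁ x = V x ∧ not (V (x ⊕ x₀))
          A₂ x = not (V x) ∧ V (x ⊕ x₀)
          big : (A : Fin N → Bool) → (∀ i x → A (x ⊕ i · y) ≡ A x) → ∀ a → a ∈ A → n ≤ count A
          big A inv a h = ≤-trans (≤-reflexive (sym (count-all n))) (count-inj {A = λ _ → true} (λ i → a ⊕ toℕ i · y) (λ i _ → trans (inv (toℕ i) a) h)
            (λ i j _ _ e → full-order y ny i j (⊕-cancelˡ a e)))
          swap-x₀ : ∀ i x → (x ⊕ i · y) ⊕ x₀ ≡ (x ⊕ x₀) ⊕ i · y
          swap-x₀ i x = gsolve 3 (λ x y z → (x :+ y) :+ z := (x :+ z) :+ y) refl x (i · y) x₀
          A₁-big : n ≤ count A₁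
          A₁-big = big A₁ (λ i x → cong₂ (λ a b → a ∧ not b) (V-· i x) (trans (cong V (swap-x₀ i x)) (V-· i (x ⊕ x₀)))) (a)
            (∧-intro (toYes (_ ≟ _) refl) (not-intro (toNo (_ ≟ _) (na))))
          A₁≡A₂ : count A₁ ≡ count A₂
          A₁≡A₂ = +-cancelˡ-≡ (count (λ x → V x ∧ V (x ⊕ x₀))) (count A₁) (count A₂) (trans (sym (sumF-+ (λ x → ⟦ V x ∧ V (x ⊕ x₀) ⟧) (λ x → ⟦ A₁ x ⟧)))
            (trans (sumF-cong (λ x → left (V x) (V (x ⊕ x₀)))) (trans (sym (count-shifted x₀ V)) (trans (sumF-cong (λ x → sym (right (V x) (V (x ⊕ x₀)))))
              (sumF-+ (λ x → ⟦ V x ∧ V (x ⊕ x₀) ⟧) (λ x → ⟦ A₂ x ⟧))))))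
            where
            left : ∀ a b → ⟦ a ∧ b ⟧ + ⟦ a ∧ not b ⟧ ≡ ⟦ a ⟧
            left true  true  = refl
            left true  false = refl
            left false _     = refl
            right : ∀ a b → ⟦ a ∧ b ⟧ + ⟦ not a ∧ b ⟧ ≡ ⟦ b ⟧
            right true  true  = refl
            right true  false = refl
            right false _     = refl
          -- Translation by `x₀` leaves the level set `V` as often as it enters it. Both sets of
          -- places are stable under `y`, which has order `n`, so `cl′` changes at least `2 n`
          -- times. On the other hand it changes at most where `cl` does, which is ν times, or where
          -- one of the two values has been corrected, at most `2 * count (E y)` places.
          changes : n + n ≤ (count (E y) + count (E y)) + (count (E y) + count (E y))
          changes = ≤-trans (+-mono-≤ A₁-big (≤-trans A₁-big (≤-reflexive A₁≡A₂))) (≤-trans (count-⊎ {A = A₁} {A₂} {change′} A₁⊆ A₂⊆ disjoint)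
            (≤-trans (count-∪ {A = λ x → not ⌊ cl (x ⊕ x₀) ≟ cl x ⌋} {B = λ x → E y x ∨ E y (x ⊕ x₀)} cases)
              (+-mono-≤ (≤-reflexive (trans (Nc-class x₀ c (ex₀)) (sym (proj₁ sizes))))
                (≤-trans (count-∪ {A = E y} {B = λ x → E y (x ⊕ x₀)} (λ x h → ∨-elim h)) (≤-reflexive (cong (count (E y) +_) (count-shifted x₀ (E y))))))))
            where
            change′ : Fin N → Bool
            change′ x = not ⌊ cl′ (x ⊕ x₀) ≟ cl′ x ⌋
            A₁⊆ : ∀ x → x ∈ A₁ → x ∈ change′
            A₁⊆ x h = let (a , b) = ∧-elim {V x} h in not-intro (toNo (_ ≟ _) (λ e → fromNo (_ ≟ _) (not-elim b) (trans e (fromYes (_ ≟ _) a))))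
            A₂⊆ : ∀ x → x ∈ A₂ → x ∈ change′
            A₂⊆ x h = let (a , b) = ∧-elim {not (V x)} h in not-intro (toNo (_ ≟ _) (λ e → fromNo (_ ≟ _) (not-elim a) (trans (sym e) (fromYes (_ ≟ _) b))))
            disjoint : ∀ x → x ∈ A₁ → x ∈ A₂ → ⊥
            disjoint x h h' = true≢false (proj₁ (∧-elim {V x} h)) (not-elim (proj₁ (∧-elim {not (V x)} h')))
            cases : ∀ x → x ∈ change′ → x ∈ (λ x → not ⌊ cl (x ⊕ x₀) ≟ cl x ⌋) ⊎ x ∈ (λ x → E y x ∨ E y (x ⊕ x₀))
            cases x h with cl′ x ≟ cl x | cl′ (x ⊕ x₀) ≟ cl (x ⊕ x₀)
            ... | no a | _ = inj₂ (∨-introˡ (cl′-diff x a))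
            ... | yes _ | no b = inj₂ (∨-introʳ {E y x} (cl′-diff (x ⊕ x₀) b))
            ... | yes a | yes b = inj₁ (not-intro (toNo (_ ≟ _) (λ e → fromNo (_ ≟ _) (not-elim h) (trans b (trans e (sym a))))))

        contradiction-final : ⊥
        contradiction-final =
          let (x₀ , ex₀ , nf) = no-subgroup F F? F+ F- (proj₂ F≠G) c≢0 c≤2
              (a , na) = FP.¬∀⟶∃¬ N (λ a → cl′ (a ⊕ x₀) ≡ cl′ a) (λ a → cl′ (a ⊕ x₀) ≟ cl′ a) nf
          in size-contradiction p n (count (E y)) p≥3 (>-nonZero⁻¹ n) E-size (Boundary.changes ex₀ na)

      contradiction-fixed : ⊥
      contradiction-fixed = let (y , ey , ny) = Ω-no-subgroup c≢0 c≤2 in Final.contradiction-final ny ey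

    prime-power-case : Multi
    prime-power-case with any? (λ s → (cl s ≟ 1) ×-dec ¬? (cl ((1 + 1 * m) · s) ≟ 1))
    ... | yes (s , es , ns) = moving es ns
    ... | no none with Multi?
    ...   | yes mu = mu
    ...   | no nm = ⊥-elim (Fixed.contradiction-fixed fixed nm)
      where
      fixed : ∀ s → cl s ≡ 1 → cl ((1 + 1 * m) · s) ≡ 1
      fixed s es with cl ((1 + 1 * m) · s) ≟ 1
      ... | yes e = e
      ... | no ne = contradiction (s , es , ne) none

-- The case n = p: lines and units in a plane of order p²

injective⇒onto′ : ∀ {M N} → M ≡ N → (f : Fin M → Fin N) → (∀ x y → f x ≡ f y → x ≡ y) → ∀ y → ∃ λ x → f x ≡ y
injective⇒onto′ refl = injective⇒onto

-- Linear algebra of lines in an elementary abelian group of order p².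
module Plane {N : ℕ} (G : FinAbelianGroup N) {p : ℕ} .{{p≢0 : NonZero p}} (pp : Prime p)
  (exponent : ∀ x → GroupTheory._·_ G p x ≡ FinAbelianGroup.𝟘 G) (N≡ : p * p ≡ N) where
  open GroupTheory G

  multiple-p : ∀ j x → (j * p) · x ≡ 𝟘
  multiple-p j x = trans (·-assoc j p x) (trans (cong (j ·_) (exponent x)) (·-𝟘 j))

  reduce : ∀ i x → i · x ≡ (i % p) · x
  reduce i x = trans (cong (_· x) (m≡m%n+[m/n]*n i p)) (trans (·-distribʳ (i % p) _ x) (trans (cong ((i % p) · x ⊕_) (multiple-p (i / p) x)) (⊕-identityʳ _)))

  coprime-of : ∀ i → i % p ≢ 0 → Coprime i p
  coprime-of i ne {d} (d∣i , d∣p) with prime⇒irreducible pp d∣p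
  ... | inj₁ e = e
  ... | inj₂ refl = contradiction (n∣m⇒m%n≡0 i d d∣i) ne

  Line : Fin N → Fin N → Set
  Line a x = ∃ λ (i : Fin p) → x ≡ toℕ i · a

  Line? : ∀ a x → Dec (Line a x)
  Line? a x = any? (λ i → x ≟F toℕ i · a)

  line-· : ∀ {a} i → Line a (i · a)
  line-· {a} i = fromℕ< (m%n<n i p) , trans (reduce i a) (cong (_· a) (sym (toℕ-fromℕ< (m%n<n i p))))

  line-⊕ : ∀ {a x y} → Line a x → Line a y → Line a (x ⊕ y)
  line-⊕ {a} (i , refl) (j , refl) = subst (Line a) (·-distribʳ (toℕ i) (toℕ j) a) (line-· (toℕ i + toℕ j))

  line-multiple : ∀ {a x} k → Line a x → Line a (k · x)
  line-multiple {a} k (i , refl) = subst (Line a) (·-assoc k (toℕ i) a) (line-· (k * toℕ i))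

  line-𝟘 : ∀ {a} → Line a 𝟘
  line-𝟘 = line-· 0

  line-⊖ : ∀ {a x} → Line a x → Line a (⊖ x)
  line-⊖ {a} {x} l = subst (Line a) (⊕-cancelˡ x (trans (trans (cong (_· x) (m+[n∸m]≡n (>-nonZero⁻¹ p))) (exponent x)) (sym (⊕-inverseʳ x)))) (line-multiple (p ∸ 1) l)

  private
    -- Natural Bézout coefficients invert only up to sign, which suffices because lines are closed
    -- under negation.
    inverse : ∀ i → i % p ≢ 0 → ∃ λ j → ∀ x → j · (i · x) ≡ x ⊎ j · (i · x) ≡ ⊖ x
    inverse i ne with Cop.coprime-Bézout (coprime-of i ne)
    ... | Bézout.+- a b e = a , λ x → inj₁ (trans (sym (·-assoc a i x)) (trans (cong (_· x) (sym e)) (trans (cong (x ⊕_) (multiple-p b x)) (⊕-identityʳ x))))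
    ... | Bézout.-+ a b e = a , λ x → inj₂ (⊕-cancelˡ x (trans (trans (cong (x ⊕_) (sym (·-assoc a i x))) (trans (cong (_· x) e) (multiple-p b x))) (sym (⊕-inverseʳ x))))

  divide : ∀ {a x} i → i % p ≢ 0 → Line a (i · x) → Line a x
  divide {a} {x} i ne l with inverse i ne
  ... | j , h with h x
  ...   | inj₁ e = subst (Line a) e (line-multiple j l)
  ...   | inj₂ e = subst (Line a) (trans (cong ⊖_ e) (⊖-involutive x)) (line-⊖ (line-multiple j l))

  private
    difference : ∀ {a x} i j → i ≤ j → Line a (i · x ⊕ ⊖ (j · x)) → ¬ Line a x → i % p ≡ j % p
    difference {a} {x} i j i≤j l n with (j ∸ i) % p ≟ 0
    ... | yes z = trans (sym ([m+kn]%n≡m%n i ((j ∸ i) / p) p)) (cong (_% p) (trans (cong (i +_) (sym (trans (m≡m%n+[m/n]*n (j ∸ i) p) (cong (_+ (j ∸ i) / p * p) z)))) (m+[n∸m]≡n i≤j)))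
    ... | no ne = contradiction (divide (j ∸ i) ne (subst (Line a) eq (line-⊖ l))) n
      where
      eq : ⊖ (i · x ⊕ ⊖ (j · x)) ≡ (j ∸ i) · x
      eq = trans (cong (λ u → ⊖ (i · x ⊕ ⊖ u)) (trans (cong (_· x) (sym (m+[n∸m]≡n i≤j))) (·-distribʳ i (j ∸ i) x)))
        (gsolve 2 (λ a b → :- (a :+ :- (a :+ b)) := b) refl (i · x) ((j ∸ i) · x))

  independent : ∀ {a x} → ¬ Line a x → ∀ i i' j j' → i · x ⊕ j · a ≡ i' · x ⊕ j' · a → i % p ≡ i' % p
  independent {a} {x} n i i' j j' e with ≤-total i i'
  ... | inj₁ le = difference i i' le (subst (Line a) (sym (diff i i' j j' e)) (line-⊕ (line-· j') (line-⊖ (line-· j)))) n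
    where
    diff : ∀ i i' j j' → i · x ⊕ j · a ≡ i' · x ⊕ j' · a → i · x ⊕ ⊖ (i' · x) ≡ j' · a ⊕ ⊖ (j · a)
    diff i i' j j' e = trans (gsolve 4 (λ a b c d → a :+ :- c := (a :+ b) :+ :- (b :+ c)) refl (i · x) (j · a) (i' · x) (j' · a))
      (trans (cong (_⊕ ⊖ (j · a ⊕ i' · x)) e) (gsolve 4 (λ a b c d → (c :+ d) :+ :- (b :+ c) := d :+ :- b) refl (i · x) (j · a) (i' · x) (j' · a)))
  ... | inj₂ le = sym (difference i' i le (subst (Line a) (sym (diff i' i j' j (sym e))) (line-⊕ (line-· j) (line-⊖ (line-· j')))) n)
    where
    diff : ∀ i i' j j' → i · x ⊕ j · a ≡ i' · x ⊕ j' · a → i · x ⊕ ⊖ (i' · x) ≡ j' · a ⊕ ⊖ (j · a)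
    diff i i' j j' e = trans (gsolve 4 (λ a b c d → a :+ :- c := (a :+ b) :+ :- (b :+ c)) refl (i · x) (j · a) (i' · x) (j' · a))
      (trans (cong (_⊕ ⊖ (j · a ⊕ i' · x)) e) (gsolve 4 (λ a b c d → (c :+ d) :+ :- (b :+ c) := d :+ :- b) refl (i · x) (j · a) (i' · x) (j' · a)))

  line-injective : ∀ {a} → a ≢ 𝟘 → ∀ (i j : Fin p) → toℕ i · a ≡ toℕ j · a → i ≡ j
  line-injective {a} ne i j e = toℕ-injective (trans (sym (m<n⇒m%n≡m (toℕ<n i))) (trans
    (independent {𝟘} {a} (λ { (k , q) → ne (trans q (·-𝟘 (toℕ k))) }) (toℕ i) (toℕ j) 0 0 (cong (_⊕ 𝟘) e)) (m<n⇒m%n≡m (toℕ<n j))))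

  line-size : ∀ {a} → a ≢ 𝟘 → count (λ x → ⌊ Line? a x ⌋) ≡ p
  line-size {a} ne = ≤-antisym
    (≤-trans (count-surj {A = λ (_ : Fin p) → true} (λ i → toℕ i · a) (λ x h → let (i , e) = fromYes (Line? a x) h in i , refl , sym e)) (≤-reflexive (count-all p)))
    (≤-trans (≤-reflexive (sym (count-all p))) (count-inj {A = λ (_ : Fin p) → true} (λ i → toℕ i · a) (λ i _ → toYes (Line? a _) (i , refl)) (λ i j _ _ → line-injective ne i j)))

  abstract
    -- Combinations of two independent elements with coefficients below `p` are distinct; there are
    -- p² of them, so they exhaust the group.
    coordinates : ∀ {a x} → a ≢ 𝟘 → ¬ Line a x → ∀ y → ∃₂ λ i j → y ≡ i · x ⊕ j · a
    coordinates {a} {x} a≢0 n y = let (k , e) = injective⇒onto′ N≡ f inj y in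
        toℕ (proj₁ (remQuot {p} p k)) , toℕ (proj₂ (remQuot {p} p k)) , sym e
      where
      f : Fin (p * p) → Fin N
      f k = toℕ (proj₁ (remQuot {p} p k)) · x ⊕ toℕ (proj₂ (remQuot {p} p k)) · a
      inj : ∀ k k' → f k ≡ f k' → k ≡ k'
      inj k k' e = trans (sym (combine-remQuot {p} p k)) (trans (cong₂ combine same-i same-j) (combine-remQuot {p} p k'))
        where
        i i' j j' : Fin p
        i = proj₁ (remQuot {p} p k)
        j = proj₂ (remQuot {p} p k)
        i' = proj₁ (remQuot {p} p k')
        j' = proj₂ (remQuot {p} p k')
        same-i : i ≡ i'
        same-i = toℕ-injective (trans (sym (m<n⇒m%n≡m (toℕ<n i))) (trans (independent n (toℕ i) (toℕ i') (toℕ j) (toℕ j') e) (m<n⇒m%n≡m (toℕ<n i'))))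
        same-j : j ≡ j'
        same-j = line-injective a≢0 j j' (⊕-cancelˡ (toℕ i · x) (trans e (cong (λ u → toℕ u · x ⊕ toℕ j' · a) (sym same-i))))

  off-line : ∀ a → a ≢ 𝟘 → 2 ≤ p → ∃ λ x → ¬ Line a x
  off-line a ne 2≤p with any? (λ x → ¬? (Line? a x))
  ... | yes h = h
  ... | no none = contradiction (≤-trans (≤-reflexive (trans N≡ (sym (count-all N)))) (≤-trans (count-mono {B = λ x → ⌊ Line? a x ⌋} all) (≤-reflexive (line-size ne))))
          (<⇒≱ (≤-trans (≤-reflexive (+-comm 1 p)) (≤-trans (+-monoʳ-≤ p (>-nonZero⁻¹ p)) (≤-trans (≤-reflexive (cong (p +_) (sym (+-identityʳ p)))) (*-monoˡ-≤ p 2≤p)))))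
    where
    all : ∀ x → true ≡ true → ⌊ Line? a x ⌋ ≡ true
    all x _ with Line? a x
    ... | yes _ = refl
    ... | no h = contradiction (x , h) none

module ElementaryCase {N : ℕ} (G : FinAbelianGroup N) (norm : RegularNorm G)
  (p : ℕ) .{{p≢0 : NonZero p}} (exponent : ∀ x → GroupTheory._·_ G p x ≡ FinAbelianGroup.𝟘 G) (p<N : p < N)
  (odd : p % 2 ≡ 1) (pp : Prime p) (p≥3 : 3 ≤ p) (N≡ : p * p ≡ N) where
  open MixedCase G norm p exponent p<N odd public
  open Plane G pp exponent N≡ public using (Line; Line?; line-⊕; line-⊖; line-·; line-multiple; line-𝟘; line-size; coprime-of; independent; coordinates; off-line; divide; reduce)

  module Swap {t : ℕ} (ct : Coprime t p) (t12 : ∀ {x} → cl x ≡ 1 → cl (t · x) ≡ 2) (t21 : ∀ {x} → cl x ≡ 2 → cl (t · x) ≡ 1) where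
    t' : ℕ
    t' = proj₁ (inverse-multiplier t ct)

    tt' : ∀ x → t · (t' · x) ≡ x
    tt' x = trans (·-comm t t' x) (proj₂ (proj₂ (inverse-multiplier t ct)) x)

    Small : Fin N → Set
    Small x = cl x ≡ 1 ⊎ cl x ≡ 2

    small : ∀ {x} → cl x ≤ 2 → x ≢ 𝟘 → Small x
    small = cl≡1or2

    small-nonzero : ∀ {x} → Small x → x ≢ 𝟘
    small-nonzero (inj₁ e) = cl>0⇒≢ e
    small-nonzero (inj₂ e) = cl>0⇒≢ e

    small≤2 : ∀ {x} → Small x → cl x ≤ 2
    small≤2 (inj₁ e) = ≤-trans (≤-reflexive e) (s≤s z≤n)
    small≤2 (inj₂ e) = ≤-reflexive e

    t-reflects-small : ∀ {x} → Small (t · x) → Small x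
    t-reflects-small {x} (inj₂ e) with exists-S (λ z → cl>0⇒≢ e (trans (cong (t ·_) z) (·-𝟘 t)))
    ... | s , es = inj₁ (trans (multiplier-reflects ct x s (trans e (sym (t12 es)))) es)
    t-reflects-small {x} (inj₁ e) with exists-S (λ z → cl>0⇒≢ e (trans (cong (t ·_) z) (·-𝟘 t)))
    ... | s , es = inj₂ (trans (multiplier-reflects ct x (t · s) (trans e (sym (t21 (t12 es))))) (t12 es))

    -- `t` carries the sum to a sum of two elements of class 1, and a multiplier that swaps the
    -- classes 1 and 2 reflects their union.
    D₂+D₂ : ∀ {x y} → cl x ≡ 2 → cl y ≡ 2 → cl (x ⊕ y) ≤ 2
    D₂+D₂ {x} {y} ex ey with x ⊕ y ≟F 𝟘
    ... | yes z = ≤-trans (≤-reflexive (trans (cong cl z) cl-𝟘)) z≤n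
    ... | no nz = small≤2 (t-reflects-small (small (≤-trans (≤-reflexive (cong cl (·-distribˡ t x y))) (sum≤2 (t21 ex) (t21 ey)))
                    (λ q → nz (multiplier-injective ct (trans q (sym (·-𝟘 t)))))))

    -- A geodesic of length 4 splits into two halves of class 2, whose sum has norm at most 2.
    no4 : ∀ x → cl x ≤ 3
    no4 x = ≮⇒≥ λ l → let (w , ew) = descend x 4 l
                          (y , s₄ , ey , es₄ , w≡) = geodesic w 3 ew
                          (z , s₃ , ez , es₃ , y≡) = geodesic y 2 ey
                          eq = trans w≡ (trans (cong (_⊕ s₄) y≡) (⊕-assoc z s₃ s₄))
                          e₂ = ≤-antisym (sum≤2 es₃ es₄) (+-cancelˡ-≤ 2 2 _ (≤-trans (≤-reflexive (sym ew)) (≤-trans (cl-≤ eq) (≤-reflexive (cong (_+ cl (s₃ ⊕ s₄)) ez)))))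
                      in <⇒≱ (≤-trans (n≤1+n 3) (≤-reflexive (sym ew))) (≤-trans (≤-reflexive (cong cl eq)) (D₂+D₂ ez e₂))

    level≤3 : ∀ x → x ≢ 𝟘 → Small x ⊎ cl x ≡ 3
    level≤3 x nx with m≤n⇒m<n∨m≡n (no4 x)
    ... | inj₂ e = inj₂ e
    ... | inj₁ l = inj₁ (small (≤-pred l) nx)

    unit-nonzero : ∀ {u x} → Coprime u p → x ≢ 𝟘 → u · x ≢ 𝟘
    unit-nonzero {u} cu nx q = nx (multiplier-injective cu (trans q (sym (·-𝟘 u))))

    -- t fixes the class 3, and commutes with u, so u cannot send the class 1 to the class 3
    unit-S : ∀ {u} → Coprime u p → ∀ {s} → cl s ≡ 1 → Small (u · s)
    unit-S {u} cu {s} es with level≤3 (u · s) (unit-nonzero cu (cl>0⇒≢ es))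
    ... | inj₁ h = h
    ... | inj₂ e₃ with level≤3 (t · (u · s)) (unit-nonzero ct (unit-nonzero cu (cl>0⇒≢ es)))
    ...   | inj₁ h = t-reflects-small h
    ...   | inj₂ e = case trans (sym es) (trans (multiplier-reflects cu s (t · s) (trans e₃ (trans (sym e) (cong cl (·-comm t u s))))) (t12 es)) of λ ()

    unit-small : ∀ {u} → Coprime u p → ∀ {x} → Small x → Small (u · x)
    unit-small cu (inj₁ e) = unit-S cu e
    unit-small {u} cu {x} (inj₂ e) = t-reflects-small (subst Small (·-comm u t x) (unit-S cu (t21 e)))

    -- A unit would carry an element of class 1 or 2 on the line to `a` itself, but units preserve
    -- the union of these classes.
    not-on-line : ∀ {a} → cl a ≡ 3 → ∀ {v} → Small v → ¬ Line a v
    not-on-line {a} ea {v} sv (i , e) = absurd (unit-small (proj₁ (proj₂ inv)) sv)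
      where
      i≢0 : toℕ i % p ≢ 0
      i≢0 z = small-nonzero sv (trans e (trans (reduce (toℕ i) a) (cong (_· a) z)))
      inv : ∃ λ j → Coprime j p × (∀ x → j · (toℕ i · x) ≡ x)
      inv = inverse-multiplier (toℕ i) (coprime-of (toℕ i) i≢0)
      absurd : ¬ Small (proj₁ inv · v)
      absurd h with subst Small (trans (cong (proj₁ inv ·_) e) (proj₂ (proj₂ inv) a)) h
      ... | inj₁ q = case trans (sym q) ea of λ ()
      ... | inj₂ q = case trans (sym q) ea of λ ()

    independent-S : ∀ {s} → cl s ≡ 1 → ∃ λ s' → cl s' ≡ 1 × ¬ Line s s'
    independent-S {s} es with any? (λ s' → (cl s' ≟ 1) ×-dec ¬? (Line? s s'))
    ... | yes h = h
    ... | no none = let (x , n) = off-line s (cl>0⇒≢ es) (≤-trans (s≤s (s≤s z≤n)) p≥3) in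
          contradiction (generated (Line s) line-𝟘 (λ _ _ → line-⊕) gens x) n
      where
      gens : ∀ s' → cl s' ≡ 1 → Line s s'
      gens s' e with Line? s s'
      ... | yes l = l
      ... | no l = contradiction (s' , e , l) none

    -- Three pairwise independent elements s, s', s ⊕ s' of the classes 1, 2 can be scaled into one
    -- coset of the line of a; two of them lie in one class, and their difference is on that line.
    module Scaling {a s s' : Fin N} (ea : cl a ≡ 3) (es : cl s ≡ 1) (es' : cl s' ≡ 1) (ind : ¬ Line s s') where
      a≢0 : a ≢ 𝟘
      a≢0 = cl>0⇒≢ ea
      abstract
        scale : ∀ v → Small v → ∃ λ i → Small (i · v) × Line a (i · v ⊕ ⊖ s) × i % p ≢ 0
        scale v sv with coordinates a≢0 (not-on-line ea (inj₁ es)) v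
        ... | i , j , e with i % p ≟ 0
        ...   | yes z = contradiction (subst (Line a) (sym (trans e (trans (cong (_⊕ j · a) (trans (reduce i s) (cong (_· s) z))) (⊕-identityˡ _)))) (line-· j)) (not-on-line ea sv)
        ...   | no nz with inverse-multiplier i (coprime-of i nz)
        ...     | i' , ci' , inv = i' , unit-small ci' sv , subst (Line a) (sym eq) (line-multiple i' (line-· j)) , λ z → 1≢p (ci' (m%n≡0⇒n∣m i' p z , ∣-refl))
          where
          1≢p : p ≢ 1
          1≢p q = <⇒≱ p≥3 (≤-trans (≤-reflexive q) (s≤s z≤n))
          eq : i' · v ⊕ ⊖ s ≡ i' · (j · a)
          eq = trans (cong (_⊕ ⊖ s) (trans (cong (i' ·_) e) (trans (·-distribˡ i' (i · s) (j · a)) (cong (_⊕ i' · (j · a)) (inv s)))))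
            (gsolve 2 (λ s b → (s :+ b) :+ :- s := b) refl s (i' · (j · a)))
      clash : ∀ {x y} → cl x ≡ cl y → Small x → Line a (x ⊕ ⊖ s) → Line a (y ⊕ ⊖ s) → x ≡ y
      clash {x} {y} e sx lx ly with x ⊕ ⊖ y ≟F 𝟘
      ... | yes z = ⊖≡𝟘⇒≡ z
      ... | no nz = ⊥-elim (not-on-line ea (small (bound sx) nz) (subst (Line a) (gsolve 3 (λ x y s → (x :+ :- s) :+ :- (y :+ :- s) := x :+ :- y) refl x y s) (line-⊕ lx (line-⊖ ly))))
        where
        bound : Small x → cl (x ⊕ ⊖ y) ≤ 2
        bound (inj₁ q) = diff≤2 q (trans (sym e) q)
        bound (inj₂ q) = D₂+D₂ q (trans (cl-⊖ y) (trans (sym e) q))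
      module _ (i₁ i₂ : ℕ) (n₁ : i₁ % p ≢ 0) (n₂ : i₂ % p ≢ 0) (l₁ : Line a (i₁ · s' ⊕ ⊖ s)) (l₂ : Line a (i₂ · (s' ⊕ s) ⊕ ⊖ s)) where
        l₀ : Line a (s ⊕ ⊖ s)
        l₀ = subst (Line a) (sym (⊕-inverseʳ s)) line-𝟘
        ne₀₁ : s ≢ i₁ · s'
        ne₀₁ q = n₁ (sym (trans (sym (m<n⇒m%n≡m (>-nonZero⁻¹ p))) (independent ind 0 i₁ 1 0
          (trans (⊕-identityˡ _) (trans (1· s) (trans q (sym (⊕-identityʳ _))))))))
        ne₀₂ : s ≢ i₂ · (s' ⊕ s)
        ne₀₂ q = n₂ (sym (trans (sym (m<n⇒m%n≡m (>-nonZero⁻¹ p))) (independent ind 0 i₂ 1 i₂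
          (trans (⊕-identityˡ _) (trans (1· s) (trans q (·-distribˡ i₂ s' s)))))))
        ne₁₂ : i₁ · s' ≢ i₂ · (s' ⊕ s)
        ne₁₂ q = n₂ (on-s (divide i₂ ))
          where
          on-s : (i₂ % p ≢ 0 → Line s' (i₂ · s) → Line s' s) → i₂ % p ≡ 0
          on-s d with i₂ % p ≟ 0
          ... | yes z = z
          ... | no nz = ⊥-elim (swap-line (d nz (subst (Line s') eq (line-⊕ (line-· i₁) (line-⊖ (line-· i₂))))))
            where
            eq : i₁ · s' ⊕ ⊖ (i₂ · s') ≡ i₂ · s
            eq = trans (cong (_⊕ ⊖ (i₂ · s')) (trans q (·-distribˡ i₂ s' s))) (gsolve 2 (λ x y → (x :+ y) :+ :- x := y) refl (i₂ · s') (i₂ · s))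
            swap-line : ¬ Line s' s
            swap-line (i , q) with toℕ i % p ≟ 0
            ... | yes z = cl>0⇒≢ es (trans q (trans (reduce (toℕ i) s') (cong (_· s') z)))
            ... | no nz = ind (divide (toℕ i) nz (subst (Line s) (trans (1· s) q) (line-· 1)))
        pigeon : Small (i₁ · s') → Small (i₂ · (s' ⊕ s)) → ⊥
        pigeon (inj₁ e₁) _ = ne₀₁ (clash (trans es (sym e₁)) (inj₁ es) l₀ l₁)
        pigeon (inj₂ e₁) (inj₁ e₂) = ne₀₂ (clash (trans es (sym e₂)) (inj₁ es) l₀ l₂)
        pigeon (inj₂ e₁) (inj₂ e₂) = ne₁₂ (clash (trans e₁ (sym e₂)) (inj₂ e₁) l₁ l₂)
      sum-small : Small (s' ⊕ s)
      sum-small = small (sum≤2 es' es) (λ z → ind (subst (Line s) (trans (sym (⊕-identityˡ _)) (trans (cong (_⊕ ⊖ s) (sym z)) (⊕-⊖ s' s))) (line-⊖ (subst (Line s) (1· s) (line-· 1)))))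
      impossible : ⊥
      impossible = let (i₁ , small₁ , l₁ , n₁) = scale s' (inj₁ es') ; (i₂ , small₂ , l₂ , n₂) = scale (s' ⊕ s) sum-small
                   in pigeon i₁ i₂ n₁ n₂ l₁ l₂ small₁ small₂

    no3 : ∀ a → cl a ≢ 3
    no3 a ea = let (s , es) = exists-S (cl>0⇒≢ ea) ; (s' , es' , ind) = independent-S es in Scaling.impossible ea es es' ind

    all-small : ∀ x → x ≢ 𝟘 → Small x
    all-small x nx with level≤3 x nx
    ... | inj₁ h = h
    ... | inj₂ e = contradiction e (no3 x)

private module ElementaryArithmetic where
  open +-*-Solver using (solve; _:+_; _:*_; _:=_; con)

  -- With p = 2h + 1, N = p² = 1 + 2k and the quadratic count below, v² + w² = p(h + 1)
  -- although v + w = p; this forces p ∣ v or p ∣ w, and then p(h + 1) = p².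
  quadratic-contradiction : ∀ p h k v w → Prime p → 3 ≤ p → p ≡ 1 + (h + h) → p * p ≡ 1 + (k + k) → v + w ≡ p →
    p * (k + h * (k ∸ 1)) + p * (k + h * (k ∸ 1)) ≡ p * (h * h + h * h) + (p * p ∸ p) * (v * v + w * w) → ⊥
  quadratic-contradiction p zero k v w _ p≥3 p≡ _ _ _ = <⇒≱ p≥3 (≤-trans (≤-reflexive p≡) (s≤s z≤n))
  quadratic-contradiction .(1 + (h + h)) h@(suc h-1) k v w pp p≥3 refl k≡ vw e = split (euclidsLemma 2 (v * w) pp p∣2vw)
    where
    p : ℕ
    p = 1 + (h + h)
    K : k ≡ 2 * (h * h) + 2 * h
    K = *-cancelˡ-≡ k (2 * (h * h) + 2 * h) 2 (+-cancelˡ-≡ 1 (2 * k) (2 * (2 * (h * h) + 2 * h)) (trans (cong (λ t → 1 + (k + t)) (+-identityʳ k)) (trans (sym k≡)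
      (solve 1 (λ h → (con 1 :+ (h :+ h)) :* (con 1 :+ (h :+ h)) := con 1 :+ con 2 :* (con 2 :* (h :* h) :+ con 2 :* h)) refl h))))
    k-1 : ℕ
    k-1 = k ∸ 1
    k≡1+ : 1 + k-1 ≡ 2 * (h * h) + 2 * h
    k≡1+ = trans (m+[n∸m]≡n (subst (1 ≤_) (sym K) (≤-trans (s≤s z≤n) (m≤n+m (2 * h) (2 * (h * h)))))) K
    Q : ℕ
    Q = v * v + w * w
    pp∸p : p * p ∸ p ≡ p * (h + h)
    pp∸p = trans (cong (_∸ p) (*-suc p (h + h))) (m+n∸m≡n p (p * (h + h)))
    e₁ : k + h * k-1 ≡ h * h + h * Q
    e₁ = *-cancelˡ-≡ _ _ (2 * p) {{m*n≢0 2 p}} (trans (solve 2 (λ p x → con 2 :* p :* x := p :* x :+ p :* x) refl p (k + h * k-1))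
      (trans e (trans (cong (λ t → p * (h * h + h * h) + t * Q) pp∸p)
        (solve 3 (λ p h q → p :* (h :* h :+ h :* h) :+ p :* (h :+ h) :* q := con 2 :* p :* (h :* h :+ h :* q)) refl p h Q))))
    e₂ : k + h * k-1 + h ≡ h * (h + (2 * (h * h) + 3 * h + 1)) + h
    e₂ = begin
      k + h * k-1 + h                        ≡⟨ solve 3 (λ k h j → k :+ h :* j :+ h := k :+ h :* (con 1 :+ j)) refl k h k-1 ⟩
      k + h * (1 + k-1)                      ≡⟨ cong₂ (λ a b → a + h * b) K k≡1+ ⟩
      2 * (h * h) + 2 * h + h * (2 * (h * h) + 2 * h)
        ≡⟨ solve 1 (λ h → con 2 :* (h :* h) :+ con 2 :* h :+ h :* (con 2 :* (h :* h) :+ con 2 :* h) := h :* (h :+ (con 2 :* (h :* h) :+ con 3 :* h :+ con 1)) :+ h) refl h ⟩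
      h * (h + (2 * (h * h) + 3 * h + 1)) + h ∎
      where open ≡-Reasoning
    Q≡ : Q ≡ p * (h + 1)
    Q≡ = trans (+-cancelˡ-≡ h Q (2 * (h * h) + 3 * h + 1) (*-cancelˡ-≡ (h + Q) (h + (2 * (h * h) + 3 * h + 1)) h (trans (*-distribˡ-+ h h Q) (trans (sym e₁) (+-cancelʳ-≡ h _ _ e₂)))))
      (solve 1 (λ h → con 2 :* (h :* h) :+ con 3 :* h :+ con 1 := (con 1 :+ (h :+ h)) :* (h :+ con 1)) refl h)
    square : p * p ≡ Q + 2 * (v * w)
    square = trans (cong₂ _*_ (sym vw) (sym vw)) (solve 2 (λ v w → (v :+ w) :* (v :+ w) := (v :* v :+ w :* w) :+ con 2 :* (v :* w)) refl v w)
    p∣2vw : p ∣ 2 * (v * w)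
    p∣2vw = ∣m+n∣m⇒∣n (subst (p ∣_) square (m∣m*n p)) (subst (p ∣_) (sym Q≡) (m∣m*n (h + 1)))
    finish : ∀ a b → a + b ≡ p → a * a + b * b ≡ p * (h + 1) → ¬ p ∣ a
    finish zero b ab q _ = <⇒≢ (s≤s (+-monoʳ-≤ h (s≤s z≤n)))
      (*-cancelˡ-≡ (h + 1) p p (trans (sym q) (cong (λ t → t * t) ab)))
    finish (suc a) zero ab q _ = finish zero (suc a) (trans (sym (+-identityʳ (suc a))) ab) (trans (sym (+-identityʳ _)) q) (p ∣0)
    finish (suc a) (suc b) ab q d = <⇒≱ (≤-trans (+-monoʳ-< (suc a) (s≤s z≤n)) (≤-reflexive ab)) (≤-trans (∣⇒≤ d) (≤-reflexive (sym (+-identityʳ (suc a)))))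
    split : p ∣ 2 ⊎ p ∣ v * w → ⊥
    split (inj₁ d) = <⇒≱ p≥3 (∣⇒≤ d)
    split (inj₂ d) with euclidsLemma v w pp d
    ... | inj₁ a = finish v w vw Q≡ a
    ... | inj₂ b = finish w v (trans (+-comm w v) vw) (trans (+-comm (w * w) (v * v)) Q≡) b
open ElementaryArithmetic

module UnitStable {N : ℕ} (G : FinAbelianGroup N) (norm : RegularNorm G)
  (p : ℕ) .{{p≢0 : NonZero p}} (exponent : ∀ x → GroupTheory._·_ G p x ≡ FinAbelianGroup.𝟘 G) (p<N : p < N)
  (odd : p % 2 ≡ 1) (pp : Prime p) (p≥3 : 3 ≤ p) (N≡ : p * p ≡ N) where
  open ElementaryCase G norm p exponent p<N odd pp p≥3 N≡ public

  module SwapCount {t : ℕ} (ct : Coprime t p) (t12 : ∀ {x} → cl x ≡ 1 → cl (t · x) ≡ 2) (t21 : ∀ {x} → cl x ≡ 2 → cl (t · x) ≡ 1)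
    {s : Fin N} (es : cl s ≡ 1) {x₁ : Fin N} (x₁∉ : ¬ Line s x₁) where
    open Swap ct t12 t21

    s≢0 : s ≢ 𝟘
    s≢0 = cl>0⇒≢ es

    L : Fin N → Bool
    L z = ⌊ Line? s z ⌋

    L-intro : ∀ {z} → Line s z → z ∈ L
    L-intro {z} = toYes (Line? s z)

    L-elim : ∀ {z} → z ∈ L → Line s z
    L-elim {z} = fromYes (Line? s z)

    L-shift : ∀ {l} → Line s l → ∀ z → L (z ⊕ l) ≡ L z
    L-shift {l} h z = bool-ext (λ q → L-intro (subst (Line s) (⊕-⊖ z l) (line-⊕ (L-elim q) (line-⊖ h)))) (λ q → L-intro (line-⊕ (L-elim q) h))

    cnt : ℕ → Fin N → ℕ
    cnt i x = count (λ z → L z ∧ D i (x ⊕ z))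

    cnt-shift : ∀ i x {l} → Line s l → cnt i (x ⊕ l) ≡ cnt i x
    cnt-shift i x {l} h = trans (sumF-cong (λ z → cong ⟦_⟧ (cong₂ _∧_ (sym (L-shift h z)) (cong (D i) (gsolve 3 (λ x l z → (x :+ l) :+ z := x :+ (z :+ l)) refl x l z)))))
      (sum-shift l (λ z → ⟦ L z ∧ D i (x ⊕ z) ⟧))

    cnt-unit : ∀ {u} → Coprime u p → ∀ i i' → (∀ y → D i (u · y) ≡ D i' y) → ∀ x → cnt i (u · x) ≡ cnt i' x
    cnt-unit {u} cu i i' same x = trans (sym (sumF-reindex (u ·_) (u' ·_) inv (λ y → trans (·-comm u u' y) (inv y)) (λ z → ⟦ L z ∧ D i (u · x ⊕ z) ⟧)))
      (sumF-cong (λ z → cong ⟦_⟧ (cong₂ _∧_ (bool-ext (λ q → L-intro (subst (Line s) (inv z) (line-multiple u' (L-elim q)))) (λ q → L-intro (line-multiple u (L-elim q))))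
        (trans (cong (D i) (sym (·-distribˡ u x z))) (same (x ⊕ z))))))
      where
      u' : ℕ
      u' = proj₁ (inverse-multiplier u cu)
      inv : ∀ y → u' · (u · y) ≡ y
      inv = proj₂ (proj₂ (inverse-multiplier u cu))

    level : ∀ x → cl x ≡ 0 ⊎ cl x ≡ 1 ⊎ cl x ≡ 2
    level x with x ≟F 𝟘
    ... | yes z = inj₁ (trans (cong cl z) cl-𝟘)
    ... | no nz = inj₂ (all-small x nz)

    tri : ∀ x → (𝟙 0 x + 𝟙 1 x) + 𝟙 2 x ≡ 1
    tri x with cl x | level x
    ... | _ | inj₁ refl        = refl
    ... | _ | inj₂ (inj₁ refl) = refl
    ... | _ | inj₂ (inj₂ refl) = refl

    nonzero-tri : ∀ x → x ≢ 𝟘 → 𝟙 1 x + 𝟙 2 x ≡ 1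
    nonzero-tri x nx with cl x | all-small x nx
    ... | _ | inj₁ refl = refl
    ... | _ | inj₂ refl = refl

    D-unit : ∀ {u} → Coprime u p → ∀ {j} → (∀ {x} → cl x ≡ 1 → cl (u · x) ≡ j) → ∀ {x} → cl (u · x) ≡ j → cl x ≡ 1
    D-unit cu f {x} e = trans (multiplier-reflects cu x s (trans e (sym (f es)))) es

    h k₁ : ℕ
    h = cnt 1 𝟘
    k₁ = k 1

    -- A unit either fixes the classes 1 and 2 or swaps them. Every coset of the line except the
    -- line itself contains a unit multiple of `x₁`, so all of them show the same two counts, up to
    -- order.
    same-class : ∀ {u} → Coprime u p → (cnt 1 (u · x₁) ≡ cnt 1 x₁ × cnt 2 (u · x₁) ≡ cnt 2 x₁) ⊎ (cnt 1 (u · x₁) ≡ cnt 2 x₁ × cnt 2 (u · x₁) ≡ cnt 1 x₁)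
    same-class {u} cu with unit-S cu es
    ... | inj₁ e = inj₁ (cnt-unit cu 1 1 (λ y → bool-ext (λ q → inD (to (fromD q))) (λ q → inD (trans (multiplier-class cu y s (trans (fromD q) (sym es))) e))) x₁
                        , cnt-unit cu 2 2 (λ y → bool-ext (λ q → inD (two (fromD q))) (λ q → inD (two′ (fromD q)))) x₁)
      where
      to : ∀ {y} → cl (u · y) ≡ 1 → cl y ≡ 1
      to {y} q = trans (multiplier-reflects cu y s (trans q (sym e))) es
      two : ∀ {y} → cl (u · y) ≡ 2 → cl y ≡ 2
      two {y} q with level y
      ... | inj₁ z = case trans (sym q) (trans (cong (λ w → cl (u · w)) (cl≡0 y z)) (trans (cong cl (·-𝟘 u)) cl-𝟘)) of λ ()
      ... | inj₂ (inj₁ z) = case trans (sym q) (trans (multiplier-class cu y s (trans z (sym es))) e) of λ ()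
      ... | inj₂ (inj₂ z) = z
      two′ : ∀ {y} → cl y ≡ 2 → cl (u · y) ≡ 2
      two′ {y} q with level (u · y)
      ... | inj₁ z = contradiction (cl≡0 _ z) (unit-nonzero cu (cl>0⇒≢ q))
      ... | inj₂ (inj₁ z) = case trans (sym q) (to z) of λ ()
      ... | inj₂ (inj₂ z) = z
    ... | inj₂ e = inj₂ (cnt-unit cu 1 2 (λ y → bool-ext (λ q → inD (one (fromD q))) (λ q → inD (one′ (fromD q)))) x₁
                        , cnt-unit cu 2 1 (λ y → bool-ext (λ q → inD (to (fromD q))) (λ q → inD (trans (multiplier-class cu y s (trans (fromD q) (sym es))) e))) x₁)
      where
      to : ∀ {y} → cl (u · y) ≡ 2 → cl y ≡ 1
      to {y} q = trans (multiplier-reflects cu y s (trans q (sym e))) es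
      one : ∀ {y} → cl (u · y) ≡ 1 → cl y ≡ 2
      one {y} q with level y
      ... | inj₁ z = case trans (sym q) (trans (cong (λ w → cl (u · w)) (cl≡0 y z)) (trans (cong cl (·-𝟘 u)) cl-𝟘)) of λ ()
      ... | inj₂ (inj₁ z) = case trans (sym q) (trans (multiplier-class cu y s (trans z (sym es))) e) of λ ()
      ... | inj₂ (inj₂ z) = z
      one′ : ∀ {y} → cl y ≡ 2 → cl (u · y) ≡ 1
      one′ {y} q with level (u · y)
      ... | inj₁ z = contradiction (cl≡0 _ z) (unit-nonzero cu (cl>0⇒≢ q))
      ... | inj₂ (inj₁ z) = z
      ... | inj₂ (inj₂ z) = case trans (sym q) (to z) of λ ()

    t-D : ∀ y → D 2 (t · y) ≡ D 1 y
    t-D y = bool-ext (λ q → inD (D-unit ct t12 (fromD q))) (λ q → inD (t12 (fromD q)))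

    t-cnt : ∀ x → cnt 2 (t · x) ≡ cnt 1 x
    t-cnt = cnt-unit ct 2 1 t-D

    h₂ : cnt 2 𝟘 ≡ h
    h₂ = trans (cong (cnt 2) (sym (·-𝟘 t))) (t-cnt 𝟘)

    p≡ : p ≡ 1 + (h + h)
    p≡ = begin
      p                                     ≡⟨ line-size s≢0 ⟨
      count L                               ≡⟨ sumF-cong pt ⟩
      sumF (λ z → ⟦ z ==F 𝟘 ⟧ + (⟦ L z ∧ D 1 (𝟘 ⊕ z) ⟧ + ⟦ L z ∧ D 2 (𝟘 ⊕ z) ⟧))
        ≡⟨ trans (sumF-+ (λ z → ⟦ z ==F 𝟘 ⟧) (λ z → ⟦ L z ∧ D 1 (𝟘 ⊕ z) ⟧ + ⟦ L z ∧ D 2 (𝟘 ⊕ z) ⟧)) (cong₂ _+_ (count-δ 𝟘) (sumF-+ (λ z → ⟦ L z ∧ D 1 (𝟘 ⊕ z) ⟧) (λ z → ⟦ L z ∧ D 2 (𝟘 ⊕ z) ⟧))) ⟩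
      1 + (h + cnt 2 𝟘)                     ≡⟨ cong (λ j → 1 + (h + j)) h₂ ⟩
      1 + (h + h)                           ∎
      where
      open ≡-Reasoning
      pt : ∀ z → ⟦ L z ⟧ ≡ ⟦ z ==F 𝟘 ⟧ + (⟦ L z ∧ D 1 (𝟘 ⊕ z) ⟧ + ⟦ L z ∧ D 2 (𝟘 ⊕ z) ⟧)
      pt z = trans (go (z ≟F 𝟘)) (cong (⟦ z ==F 𝟘 ⟧ +_) (cong₂ (λ a b → ⟦ L z ∧ D 1 a ⟧ + ⟦ L z ∧ D 2 b ⟧) (sym (⊕-identityˡ z)) (sym (⊕-identityˡ z))))
        where
        go : Dec (z ≡ 𝟘) → ⟦ L z ⟧ ≡ ⟦ z ==F 𝟘 ⟧ + (⟦ L z ∧ D 1 z ⟧ + ⟦ L z ∧ D 2 z ⟧)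
        go (yes q) = sym (trans (cong₂ _+_ (⟦⟧-true (toYes (z ≟F 𝟘) q)) (cong₂ _+_ (off 1 (λ ())) (off 2 (λ ())))) (sym (⟦⟧-true (L-intro (subst (Line s) (sym q) line-𝟘)))))
          where
          off : ∀ i → 0 ≢ i → ⟦ L z ∧ D i z ⟧ ≡ 0
          off i ni = ⟦⟧-false (¬true⇒false (λ m → ni (trans (sym cl-𝟘) (trans (cong cl (sym q)) (fromD (proj₂ (∧-elim {L z} m)))))))
        go (no nq) = sym (trans (cong₂ _+_ (⟦⟧-false (toNo (z ≟F 𝟘) nq)) (trans (cong₂ _+_ (⟦⟧-∧ (L z) (D 1 z)) (⟦⟧-∧ (L z) (D 2 z)))
          (trans (sym (*-distribˡ-+ ⟦ L z ⟧ (𝟙 1 z) (𝟙 2 z))) (trans (cong (⟦ L z ⟧ *_) (nonzero-tri z nq)) (*-identityʳ _))))) refl)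

    k₂≡k₁ : k 2 ≡ k₁
    k₂≡k₁ = trans (sym (sumF-reindex (t ·_) (t' ·_) (λ x → trans (·-comm t' t x) (tt' x)) tt' (𝟙 2)))
      (sumF-cong {f = λ x → 𝟙 2 (t · x)} {g = 𝟙 1} (λ x → cong ⟦_⟧ (t-D x)))

    N≡1+2k : p * p ≡ 1 + (k₁ + k₁)
    N≡1+2k = begin
      p * p                                    ≡⟨ N≡ ⟩
      N                                        ≡⟨ count-all N ⟨
      sumF {N} (λ _ → 1)                       ≡⟨ sumF-cong tri ⟨
      sumF (λ x → (𝟙 0 x + 𝟙 1 x) + 𝟙 2 x)     ≡⟨ trans (sumF-+ (λ x → 𝟙 0 x + 𝟙 1 x) (𝟙 2)) (cong (_+ k 2) (sumF-+ (𝟙 0) (𝟙 1))) ⟩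
      (k 0 + k₁) + k 2                         ≡⟨ cong₂ (λ a b → (a + k₁) + b) (count-unique≡1 (D 0) 𝟘 (inD cl-𝟘) (λ x m → cl≡0 x (fromD m))) k₂≡k₁ ⟩
      (1 + k₁) + k₁                            ≡⟨ +-assoc 1 k₁ k₁ ⟩
      1 + (k₁ + k₁)                            ∎
      where open ≡-Reasoning

    a₁ c : ℕ
    a₁ = nb 1 s
    c = nb 1 (t · s)

    -- `t` matches the classes 1 and 2, so they have equal size and edge counting gives b₁ = c₂.
    degree : 1 + (a₁ + c) ≡ k₁
    degree = begin
      1 + (a₁ + c)                 ≡⟨ cong₂ (λ a b → a + (a₁ + b)) (sym one) (sym b≡c) ⟩
      nb 0 s + (a₁ + nb 2 s)       ≡⟨ +-assoc (nb 0 s) a₁ (nb 2 s) ⟨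
      (nb 0 s + a₁) + nb 2 s       ≡⟨ trans (cong (_+ nb 2 s) (sym (sumF-+ (λ r → ⟦ D 1 r ∧ D 0 (s ⊕ r) ⟧) (λ r → ⟦ D 1 r ∧ D 1 (s ⊕ r) ⟧)))) (sym (sumF-+ (λ r → ⟦ D 1 r ∧ D 0 (s ⊕ r) ⟧ + ⟦ D 1 r ∧ D 1 (s ⊕ r) ⟧) (λ r → ⟦ D 1 r ∧ D 2 (s ⊕ r) ⟧))) ⟩
      sumF (λ r → (⟦ D 1 r ∧ D 0 (s ⊕ r) ⟧ + ⟦ D 1 r ∧ D 1 (s ⊕ r) ⟧) + ⟦ D 1 r ∧ D 2 (s ⊕ r) ⟧) ≡⟨ sumF-cong pt ⟩
      k₁                           ∎
      where
      open ≡-Reasoning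
      b≡c : nb 2 s ≡ c
      b≡c = *-cancelˡ-≡ (nb 2 s) c k₁ {{>-nonZero (count-pos (D 1) s (inD es))}} (trans (edge-count 1 2 es (t12 es)) (cong (_* c) k₂≡k₁))
      one : nb 0 s ≡ 1
      one = count-unique≡1 _ (⊖ s) (∧-intro (inD (trans (cl-⊖ s) es)) (inD (trans (cong cl (⊕-inverseʳ s)) cl-𝟘)))
        (λ r m → ⊕-cancelˡ s (trans (cl≡0 _ (fromD (proj₂ (∧-elim {D 1 r} m)))) (sym (⊕-inverseʳ s))))
      pt : ∀ r → (⟦ D 1 r ∧ D 0 (s ⊕ r) ⟧ + ⟦ D 1 r ∧ D 1 (s ⊕ r) ⟧) + ⟦ D 1 r ∧ D 2 (s ⊕ r) ⟧ ≡ ⟦ D 1 r ⟧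
      pt r with D 1 r
      ... | false = refl
      ... | true  = tri (s ⊕ r)

    W : ℕ
    W = sumF (λ x → 𝟙 1 x * cnt 1 x)

    -- `W` counts pairs in class 1 that differ by an element `z` of the line. For `z` zero there are
    -- k₁ of them, for `z` in class 1 or 2 there are a₁ or c₂, and the line has `h` members of
    -- either class.
    W≡ : W ≡ k₁ + h * (k₁ ∸ 1)
    W≡ = begin
      sumF (λ x → 𝟙 1 x * cnt 1 x)
        ≡⟨ sumF-cong (λ x → trans (sym (sumF-*ˡ (𝟙 1 x) (λ z → ⟦ L z ∧ D 1 (x ⊕ z) ⟧))) (sumF-cong (λ z → rearr x z))) ⟩
      sumF (λ x → sumF (λ z → ⟦ L z ⟧ * ⟦ D 1 x ∧ D 1 (z ⊕ x) ⟧))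
        ≡⟨ sumF-swap (λ x z → ⟦ L z ⟧ * ⟦ D 1 x ∧ D 1 (z ⊕ x) ⟧) ⟩
      sumF (λ z → sumF (λ x → ⟦ L z ⟧ * ⟦ D 1 x ∧ D 1 (z ⊕ x) ⟧))
        ≡⟨ sumF-cong (λ z → trans (sumF-*ˡ ⟦ L z ⟧ (λ x → ⟦ D 1 x ∧ D 1 (z ⊕ x) ⟧)) (pt z)) ⟩
      sumF (λ z → ⟦ z ==F 𝟘 ⟧ * k₁ + (⟦ L z ∧ D 1 (𝟘 ⊕ z) ⟧ * a₁ + ⟦ L z ∧ D 2 (𝟘 ⊕ z) ⟧ * c))
        ≡⟨ trans (sumF-+ (λ z → ⟦ z ==F 𝟘 ⟧ * k₁) (λ z → ⟦ L z ∧ D 1 (𝟘 ⊕ z) ⟧ * a₁ + ⟦ L z ∧ D 2 (𝟘 ⊕ z) ⟧ * c))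
             (cong₂ _+_ (sumF-δ (λ _ → k₁) 𝟘) (trans (sumF-+ (λ z → ⟦ L z ∧ D 1 (𝟘 ⊕ z) ⟧ * a₁) (λ z → ⟦ L z ∧ D 2 (𝟘 ⊕ z) ⟧ * c))
               (cong₂ _+_ (sumF-*ʳ a₁ (λ z → ⟦ L z ∧ D 1 (𝟘 ⊕ z) ⟧)) (trans (sumF-*ʳ c (λ z → ⟦ L z ∧ D 2 (𝟘 ⊕ z) ⟧)) (cong (_* c) h₂))))) ⟩
      k₁ + (h * a₁ + h * c)       ≡⟨ cong (k₁ +_) (sym (*-distribˡ-+ h a₁ c)) ⟩
      k₁ + h * (a₁ + c)           ≡⟨ cong (λ j → k₁ + h * j) (cong pred degree) ⟩
      k₁ + h * pred k₁            ≡⟨ cong (λ j → k₁ + h * j) (pred≡∸1 k₁) ⟩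
      k₁ + h * (k₁ ∸ 1)           ∎
      where
      open ≡-Reasoning
      pred≡∸1 : ∀ n → pred n ≡ n ∸ 1
      pred≡∸1 zero    = refl
      pred≡∸1 (suc n) = refl
      rearr : ∀ x z → 𝟙 1 x * ⟦ L z ∧ D 1 (x ⊕ z) ⟧ ≡ ⟦ L z ⟧ * ⟦ D 1 x ∧ D 1 (z ⊕ x) ⟧
      rearr x z with L z | D 1 x
      ... | true  | true  = trans (+-identityʳ _) (trans (cong (𝟙 1) (⊕-comm x z)) (sym (+-identityʳ _)))
      ... | true  | false = refl
      ... | false | true  = refl
      ... | false | false = refl
      nb-𝟘 : nb 1 𝟘 ≡ k₁
      nb-𝟘 = sumF-cong (λ r → cong ⟦_⟧ (bool-ext (λ m → proj₁ (∧-elim m)) (λ m → ∧-intro m (inD (trans (cong cl (⊕-identityˡ r)) (fromD m))))))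
      pt : ∀ z → ⟦ L z ⟧ * nb 1 z ≡ ⟦ z ==F 𝟘 ⟧ * k₁ + (⟦ L z ∧ D 1 (𝟘 ⊕ z) ⟧ * a₁ + ⟦ L z ∧ D 2 (𝟘 ⊕ z) ⟧ * c)
      pt z = trans (go (z ≟F 𝟘)) (cong (⟦ z ==F 𝟘 ⟧ * k₁ +_) (cong₂ (λ a b → ⟦ L z ∧ D 1 a ⟧ * a₁ + ⟦ L z ∧ D 2 b ⟧ * c) (sym (⊕-identityˡ z)) (sym (⊕-identityˡ z))))
        where
        go : Dec (z ≡ 𝟘) → ⟦ L z ⟧ * nb 1 z ≡ ⟦ z ==F 𝟘 ⟧ * k₁ + (⟦ L z ∧ D 1 z ⟧ * a₁ + ⟦ L z ∧ D 2 z ⟧ * c)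
        go (yes q) = trans (cong₂ _*_ (⟦⟧-true (L-intro (subst (Line s) (sym q) line-𝟘))) (trans (cong (nb 1) q) nb-𝟘))
          (trans (sym (+-identityʳ _)) (sym (cong₂ _+_ (cong (_* k₁) (⟦⟧-true (toYes (z ≟F 𝟘) q))) (cong₂ (λ a b → a * a₁ + b * c) (off 1 (λ ())) (off 2 (λ ()))))))
          where
          off : ∀ i → 0 ≢ i → ⟦ L z ∧ D i z ⟧ ≡ 0
          off i ni = ⟦⟧-false (¬true⇒false (λ m → ni (trans (sym cl-𝟘) (trans (cong cl (sym q)) (fromD (proj₂ (∧-elim {L z} m)))))))
        go (no nq) = trans (spread (all-small z nq)) (cong (λ b → b * k₁ + (⟦ L z ∧ D 1 z ⟧ * a₁ + ⟦ L z ∧ D 2 z ⟧ * c)) (sym (⟦⟧-false (toNo (z ≟F 𝟘) nq))))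
          where
          true∧ : ∀ b → ⟦ b ∧ true ⟧ ≡ ⟦ b ⟧
          true∧ true  = refl
          true∧ false = refl
          false∧ : ∀ b → ⟦ b ∧ false ⟧ ≡ 0
          false∧ true  = refl
          false∧ false = refl
          on : ∀ {i} → cl z ≡ i → ⟦ L z ∧ D i z ⟧ ≡ ⟦ L z ⟧
          on e = trans (cong (λ b → ⟦ L z ∧ b ⟧) (inD e)) (true∧ (L z))
          off : ∀ {i j} → cl z ≡ i → i ≢ j → ⟦ L z ∧ D j z ⟧ ≡ 0
          off {j = j} e ne = trans (cong (λ b → ⟦ L z ∧ b ⟧) (toNo (cl z ≟ j) (λ e' → ne (trans (sym e) e')))) (false∧ (L z))
          spread : cl z ≡ 1 ⊎ cl z ≡ 2 → ⟦ L z ⟧ * nb 1 z ≡ ⟦ L z ∧ D 1 z ⟧ * a₁ + ⟦ L z ∧ D 2 z ⟧ * c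
          spread (inj₁ e) = trans (cong (⟦ L z ⟧ *_) (nb-class 1 (trans e (sym es)))) (trans (sym (+-identityʳ _)) (sym (cong₂ _+_ (cong (_* a₁) (on e)) (cong (_* c) (off e (λ ()))))))
          spread (inj₂ e) = trans (cong (⟦ L z ⟧ *_) (nb-class 1 (trans e (sym (t12 es))))) (sym (cong₂ _+_ (cong (_* a₁) (off e (λ ()))) (cong (_* c) (on e))))

    -- Every member of class 1 in a coset of the line is seen from all `p` points of that coset.
    Σσσ : sumF (λ x → cnt 1 x * cnt 1 x) ≡ p * W
    Σσσ = begin
      sumF (λ x → cnt 1 x * cnt 1 x)
        ≡⟨ sumF-cong (λ x → trans (sym (sumF-*ʳ (cnt 1 x) (λ z → ⟦ L z ∧ D 1 (x ⊕ z) ⟧))) (sumF-cong (λ z → move x z))) ⟩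
      sumF (λ x → sumF (λ z → ⟦ L z ⟧ * (𝟙 1 (x ⊕ z) * cnt 1 (x ⊕ z))))
        ≡⟨ sumF-swap (λ x z → ⟦ L z ⟧ * (𝟙 1 (x ⊕ z) * cnt 1 (x ⊕ z))) ⟩
      sumF (λ z → sumF (λ x → ⟦ L z ⟧ * (𝟙 1 (x ⊕ z) * cnt 1 (x ⊕ z))))
        ≡⟨ sumF-cong (λ z → trans (sumF-*ˡ ⟦ L z ⟧ (λ x → 𝟙 1 (x ⊕ z) * cnt 1 (x ⊕ z))) (cong (⟦ L z ⟧ *_) (sum-shift z (λ x → 𝟙 1 x * cnt 1 x)))) ⟩
      sumF (λ z → ⟦ L z ⟧ * W)     ≡⟨ sumF-*ʳ W (λ z → ⟦ L z ⟧) ⟩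
      count L * W                  ≡⟨ cong (_* W) (line-size s≢0) ⟩
      p * W                        ∎
      where
      open ≡-Reasoning
      move : ∀ x z → ⟦ L z ∧ D 1 (x ⊕ z) ⟧ * cnt 1 x ≡ ⟦ L z ⟧ * (𝟙 1 (x ⊕ z) * cnt 1 (x ⊕ z))
      move x z = trans (cong (_* cnt 1 x) (⟦⟧-∧ (L z) (D 1 (x ⊕ z)))) (trans (*-assoc ⟦ L z ⟧ (𝟙 1 (x ⊕ z)) (cnt 1 x)) (step (Line? s z)))
        where
        step : Dec (Line s z) → ⟦ L z ⟧ * (𝟙 1 (x ⊕ z) * cnt 1 x) ≡ ⟦ L z ⟧ * (𝟙 1 (x ⊕ z) * cnt 1 (x ⊕ z))
        step (yes l) = cong (λ j → ⟦ L z ⟧ * (𝟙 1 (x ⊕ z) * j)) (sym (cnt-shift 1 x l))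
        step (no n) = trans (cong (_* (𝟙 1 (x ⊕ z) * cnt 1 x)) zr) (sym (cong (_* (𝟙 1 (x ⊕ z) * cnt 1 (x ⊕ z))) zr))
          where
          zr : ⟦ L z ⟧ ≡ 0
          zr = ⟦⟧-false (toNo (Line? s z) n)

    Σδδ : sumF (λ x → cnt 2 x * cnt 2 x) ≡ p * W
    Σδδ = trans (sym (sumF-reindex (t ·_) (t' ·_) (λ x → trans (·-comm t' t x) (tt' x)) tt' (λ x → cnt 2 x * cnt 2 x)))
      (trans (sumF-cong (λ x → cong₂ _*_ (t-cnt x) (t-cnt x))) Σσσ)

    v w Q : ℕ
    v = cnt 1 x₁
    w = cnt 2 x₁
    Q = v * v + w * w

    v+w : v + w ≡ p
    v+w = trans (sym (sumF-+ (λ z → ⟦ L z ∧ D 1 (x₁ ⊕ z) ⟧) (λ z → ⟦ L z ∧ D 2 (x₁ ⊕ z) ⟧))) (trans (sumF-cong pt) (line-size s≢0))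
      where
      pt : ∀ z → ⟦ L z ∧ D 1 (x₁ ⊕ z) ⟧ + ⟦ L z ∧ D 2 (x₁ ⊕ z) ⟧ ≡ ⟦ L z ⟧
      pt z with L z in eq
      ... | false = refl
      ... | true  = nonzero-tri (x₁ ⊕ z) (λ q → x₁∉ (subst (Line s) (trans (cong (_⊕ ⊖ z) (sym q)) (⊕-⊖ x₁ z))
                      (subst (Line s) (sym (⊕-identityˡ _)) (line-⊖ (L-elim eq)))))

    square : ∀ x → cnt 1 x * cnt 1 x + cnt 2 x * cnt 2 x ≡ ⟦ L x ⟧ * (h * h + h * h) + ⟦ not (L x) ⟧ * Q
    square x = go (Line? s x)
      where
      go : Dec (Line s x) → cnt 1 x * cnt 1 x + cnt 2 x * cnt 2 x ≡ ⟦ L x ⟧ * (h * h + h * h) + ⟦ not (L x) ⟧ * Q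
      go (yes l) = trans (cong₂ (λ a b → a * a + b * b) (on 1) (trans (on 2) h₂))
        (sym (trans (cong (λ b → ⟦ b ⟧ * (h * h + h * h) + ⟦ not b ⟧ * Q) (L-intro l)) (trans (+-identityʳ _) (+-identityʳ _))))
        where
        on : ∀ i → cnt i x ≡ cnt i 𝟘
        on i = trans (cong (cnt i) (sym (⊕-identityˡ x))) (cnt-shift i 𝟘 l)
      go (no n) = trans (off (coordinates s≢0 x₁∉ x)) (sym (trans (cong (λ b → ⟦ b ⟧ * (h * h + h * h) + ⟦ not b ⟧ * Q) (toNo (Line? s x) n)) (+-identityʳ Q)))
        where
        off : (∃₂ λ i j → x ≡ i · x₁ ⊕ j · s) → cnt 1 x * cnt 1 x + cnt 2 x * cnt 2 x ≡ Q
        off (i , j , e) = finish (same-class (coprime-of i i≢0))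
          where
          i≢0 : i % p ≢ 0
          i≢0 z = n (subst (Line s) (sym (trans e (trans (cong (_⊕ j · s) (trans (reduce i x₁) (cong (_· x₁) z))) (⊕-identityˡ _)))) (line-· j))
          to : ∀ l → cnt l x ≡ cnt l (i · x₁)
          to l = trans (cong (cnt l) e) (cnt-shift l (i · x₁) (line-· j))
          finish : (cnt 1 (i · x₁) ≡ v × cnt 2 (i · x₁) ≡ w) ⊎ (cnt 1 (i · x₁) ≡ w × cnt 2 (i · x₁) ≡ v) → cnt 1 x * cnt 1 x + cnt 2 x * cnt 2 x ≡ Q
          finish (inj₁ (a , b)) = cong₂ (λ a b → a * a + b * b) (trans (to 1) a) (trans (to 2) b)
          finish (inj₂ (a , b)) = trans (cong₂ (λ a b → a * a + b * b) (trans (to 1) a) (trans (to 2) b)) (+-comm (w * w) (v * v))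

    total : p * W + p * W ≡ p * (h * h + h * h) + (p * p ∸ p) * Q
    total = begin
      p * W + p * W
        ≡⟨ cong₂ _+_ Σσσ Σδδ ⟨
      sumF (λ x → cnt 1 x * cnt 1 x) + sumF (λ x → cnt 2 x * cnt 2 x)
        ≡⟨ sumF-+ (λ x → cnt 1 x * cnt 1 x) (λ x → cnt 2 x * cnt 2 x) ⟨
      sumF (λ x → cnt 1 x * cnt 1 x + cnt 2 x * cnt 2 x)
        ≡⟨ sumF-cong square ⟩
      sumF (λ x → ⟦ L x ⟧ * (h * h + h * h) + ⟦ not (L x) ⟧ * Q)
        ≡⟨ trans (sumF-+ (λ x → ⟦ L x ⟧ * (h * h + h * h)) (λ x → ⟦ not (L x) ⟧ * Q)) (cong₂ _+_ (sumF-*ʳ (h * h + h * h) (λ x → ⟦ L x ⟧)) (sumF-*ʳ Q (λ x → ⟦ not (L x) ⟧))) ⟩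
      count L * (h * h + h * h) + count (λ x → not (L x)) * Q
        ≡⟨ cong₂ (λ a b → a * (h * h + h * h) + b * Q) (line-size s≢0) complement ⟩
      p * (h * h + h * h) + (p * p ∸ p) * Q ∎
      where
      open ≡-Reasoning
      complement : count (λ x → not (L x)) ≡ p * p ∸ p
      complement = trans (sym (m+n∸m≡n p (count (λ x → not (L x))))) (cong (_∸ p) (trans (cong (_+ count (λ x → not (L x))) (sym (line-size s≢0)))
        (trans (sym (sumF-+ (λ x → ⟦ L x ⟧) (λ x → ⟦ not (L x) ⟧))) (trans (sumF-cong (λ x → comp (L x))) (trans (count-all N) (sym N≡))))))
        where
        comp : ∀ b → ⟦ b ⟧ + ⟦ not b ⟧ ≡ 1
        comp true  = refl
        comp false = refl

    absurd : ⊥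
    absurd = quadratic-contradiction p h k₁ v w pp p≥3 p≡ N≡1+2k v+w (trans (cong₂ (λ a b → p * a + p * b) (sym W≡) (sym W≡)) total)

  -- The least multiplier `t` that moves `s` out of class 1 sends it to class 2, since `t · s` is
  -- `s` plus an element of class 1. If `t` sends class 2 back to class 1, the counts of `SwapCount`
  -- apply. Otherwise `t · (t · s)` has norm at least 3, class 2 contains no edges, and the unique
  -- element of class 3 given by `antipode` would be an involution in a group of odd order.
  units-stable : ∀ u → Coprime u p → ∀ s → cl s ≡ 1 → cl (u · s) ≡ 1
  units-stable u cu s es with cl (u · s) ≟ 1
  ... | yes e = e
  ... | no ne = ⊥-elim (moved (least (λ i → cl (suc i · s) ≢ 1) (λ i → ¬? (cl (suc i · s) ≟ 1)) (pred (u % p)) bad))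
    where
    u≢0 : u % p ≢ 0
    u≢0 z = 1≢p (cu (m%n≡0⇒n∣m u p z , ∣-refl))
      where
      1≢p : p ≢ 1
      1≢p q = <⇒≱ p≥3 (≤-trans (≤-reflexive q) (s≤s z≤n))
    suc-u : suc (pred (u % p)) ≡ u % p
    suc-u = suc-pred (u % p) {{≢-nonZero u≢0}}
    bad : cl (suc (pred (u % p)) · s) ≢ 1
    bad e = ne (trans (cong cl (trans (reduce u s) (cong (_· s) (sym suc-u)))) e)
    moved : (∃ λ i → cl (suc i · s) ≢ 1 × i ≤ pred (u % p) × (∀ j → j < i → ¬ (cl (suc j · s) ≢ 1))) → ⊥
    moved (zero  , n1 , _ , _) = n1 (trans (cong cl (1· s)) es)
    moved (suc i , n1 , le , min) = split (cl (t · (t · s)) ≟ 1)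
      where
      t : ℕ
      t = suc (suc i)
      t<p : t < p
      t<p = ≤-trans (s≤s (≤-trans (s≤s le) (≤-reflexive suc-u))) (m%n<n u p)
      ct : Coprime t p
      ct = coprime-of t (λ z → case trans (sym (m<n⇒m%n≡m t<p)) z of λ ())
      ei : cl (suc i · s) ≡ 1
      ei with cl (suc i · s) ≟ 1
      ... | yes e = e
      ... | no n = contradiction n (min i ≤-refl)
      unit≢0 : ∀ {x} → x ≢ 𝟘 → t · x ≢ 𝟘
      unit≢0 nx q = nx (multiplier-injective ct (trans q (sym (·-𝟘 t))))
      ts : cl (t · s) ≡ 2
      ts = cl≢1⇒2 (sum≤2 es ei) (unit≢0 (cl>0⇒≢ es)) n1
      t12 : ∀ {x} → cl x ≡ 1 → cl (t · x) ≡ 2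
      t12 {x} e = trans (multiplier-class ct x s (trans e (sym es))) ts
      inv : ∃ λ t' → Coprime t' p × (∀ x → t' · (t · x) ≡ x)
      inv = inverse-multiplier t ct
      tt' : ∀ x → t · (proj₁ inv · x) ≡ x
      tt' x = trans (·-comm t (proj₁ inv) x) (proj₂ (proj₂ inv) x)
      from2 : ∀ {x} → cl x ≡ 2 → cl (proj₁ inv · x) ≡ 1
      from2 {x} e = trans (multiplier-class (proj₁ (proj₂ inv)) x (t · s) (trans e (sym ts))) (trans (cong cl (proj₂ (proj₂ inv) s)) es)
      k₂≤k₁ : k 2 ≤ k 1
      k₂≤k₁ = count-inj (proj₁ inv ·_) (λ x m → inD (from2 (fromD m))) (λ _ _ _ _ → multiplier-injective (proj₁ (proj₂ inv)))
      split : Dec (cl (t · (t · s)) ≡ 1) → ⊥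
      split (yes e) = let (x₁ , n) = off-line s (cl>0⇒≢ es) (≤-trans (s≤s (s≤s z≤n)) p≥3) in
        SwapCount.absurd ct t12 (λ {x} e2 → trans (multiplier-class ct x (t · s) (trans e2 (sym ts))) e) es n
      split (no nσ) = cl>0⇒≢ ez (no-involution (trans (cong (z ⊕_) (sym (only (⊖ z) (trans (cl-⊖ z) ez)))) (⊕-inverseʳ z)))
        where
        σ≥3 : 3 ≤ cl (t · (t · s))
        σ≥3 with cl≡1or2 {t · (t · s)}
        ... | f = ≰⇒> (λ h → case f h (unit≢0 (unit≢0 (cl>0⇒≢ es))) of λ
              { (inj₁ e) → nσ e
              ; (inj₂ e) → case trans (sym es) (trans (sym (multiplier-reflects ct (t · s) s (trans e (sym ts)))) ts) of λ () })
        z-data : ∃ λ z → cl z ≡ 3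
        z-data = descend (t · (t · s)) 3 σ≥3
        z : Fin N
        z = proj₁ z-data
        ez : cl z ≡ 3
        ez = proj₂ z-data
        -- Undoing `t` turns such a difference into one between elements of class 1, of norm 1 or 2;
        -- but `t` takes class 1 to class 2 and takes class 2 away from class 1.
        a₂ : ∀ u v → cl u ≡ 2 → cl v ≡ 2 → cl (u ⊕ ⊖ v) ≢ 1
        a₂ u v eu ev e1 = absurd (cl≡1or2 (diff≤2 (from2 eu) (from2 ev)) (λ q → cl>0⇒≢ e1 (trans (sym td) (trans (cong (t ·_) q) (·-𝟘 t)))))
          where
          x y : Fin N
          x = proj₁ inv · u
          y = proj₁ inv · v
          td : t · (x ⊕ ⊖ y) ≡ u ⊕ ⊖ v
          td = trans (·-distribˡ t x (⊖ y)) (cong₂ _⊕_ (tt' u) (trans (·-⊖ t y) (cong ⊖_ (tt' v))))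
          absurd : cl (x ⊕ ⊖ y) ≡ 1 ⊎ cl (x ⊕ ⊖ y) ≡ 2 → ⊥
          absurd (inj₁ e) = case trans (sym e1) (trans (cong cl (sym td)) (t12 e)) of λ ()
          absurd (inj₂ e) = nσ (trans (multiplier-class ct (t · s) (x ⊕ ⊖ y) (trans ts (sym e))) (trans (cong cl td) e1))
        involution : ∀ x y → 2 · x ≡ 𝟘 → 2 · y ≡ 𝟘 → x ≢ 𝟘 → y ≢ 𝟘 → x ≡ y
        involution x y hx _ nx _ = contradiction (no-involution (trans (cong (x ⊕_) (sym (1· x))) hx)) nx
        only : ∀ w → cl w ≡ 3 → w ≡ z
        only = proj₁ (antipode ez (triangle-free ez a₂) k₂≤k₁ (degree≥3 involution es))

-- Coprimality, and the concrete group ℤₙ ⊕ ℤₚ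

prime-∤⇒coprime : ∀ {q t} → Prime q → ¬ q ∣ t → Coprime t q
prime-∤⇒coprime pq n {d} (d∣t , d∣q) with prime⇒irreducible pq d∣q
... | inj₁ e    = e
... | inj₂ refl = contradiction d∣t n

coprime-* : ∀ {t a b} → Coprime t a → Coprime t b → Coprime t (a * b)
coprime-* ca cb {d} (d∣t , d∣ab) = cb (d∣t , Cop.coprime-divisor (λ { (e∣d , e∣a) → ca (∣-trans e∣d d∣t , e∣a) }) d∣ab)

coprime-^ : ∀ {t q} → Coprime t q → ∀ s → Coprime t (q ^ s)
coprime-^ c zero    (_ , d∣1) = ∣1⇒≡1 d∣1
coprime-^ c (suc s) = coprime-* c (coprime-^ c s)

coprime-1+ : ∀ j m → Coprime (1 + j * m) m
coprime-1+ j m {d} (d∣ , d∣m) = ∣1⇒≡1 (∣m+n∣m⇒∣n (subst (d ∣_) (+-comm 1 (j * m)) d∣) (∣-trans d∣m (n∣m*n j)))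

prime-part : ∀ {q} → Prime q → ∀ n → n ≢ 0 → ∃₂ λ a m → n ≡ q ^ a * m × ¬ q ∣ m
prime-part {q} pq = <-rec (λ n → n ≢ 0 → ∃₂ λ a m → n ≡ q ^ a * m × ¬ q ∣ m) step
  where
  step : ∀ n → (∀ {m} → m < n → m ≢ 0 → ∃₂ λ a r → m ≡ q ^ a * r × ¬ q ∣ r) → n ≢ 0 → ∃₂ λ a m → n ≡ q ^ a * m × ¬ q ∣ m
  step n rec n≢0 with q ∣? n
  ... | no h = 0 , n , sym (+-identityʳ n) , h
  ... | yes (divides r e) =
    let (a , m , eq , h) = rec r<n r≢0
    in suc a , m , trans e (trans (*-comm r q) (trans (cong (q *_) eq) (sym (*-assoc q (q ^ a) m)))) , h
    where
    r≢0 : r ≢ 0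
    r≢0 z = n≢0 (trans e (cong (_* q) z))
    r<n : r < n
    r<n = ≤-trans (m<m*n r q {{≢-nonZero r≢0}} (nonTrivial⇒n>1 q {{prime⇒nonTrivial pq}})) (≤-reflexive (sym e))

inverse-mod : ∀ {i n} → 2 ≤ n → Coprime i n → ∃₂ λ i' c → i' * i ≡ 1 + c * n
inverse-mod {i} {n} 2≤n c with Cop.coprime-Bézout c
... | Bézout.+- x y e = x , y , sym e
-- Now `x * i` is -1 modulo `n`, so its square is 1. Naming the product lets it be matched as a
-- successor.
... | Bézout.-+ x y e = go (x * i) e refl
  where
  go : ∀ w → 1 + w ≡ y * n → w ≡ x * i → ∃₂ λ i' c → i' * i ≡ 1 + c * n
  go zero e' _ = contradiction (∣1⇒≡1 (divides y e')) (λ q → <⇒≢ 2≤n (sym q))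
  go (suc w) e' eq = x * i * x , w * y , (begin
    x * i * x * i              ≡⟨ *-assoc (x * i) x i ⟩
    (x * i) * (x * i)          ≡⟨ cong₂ _*_ (sym eq) (sym eq) ⟩
    suc w * suc w              ≡⟨ solve 1 (λ w → (con 1 :+ w) :* (con 1 :+ w) := con 1 :+ w :* (con 1 :+ (con 1 :+ w))) refl w ⟩
    1 + w * (1 + suc w)        ≡⟨ cong (λ t → 1 + w * t) e' ⟩
    1 + w * (y * n)            ≡⟨ cong suc (sym (*-assoc w y n)) ⟩
    1 + w * y * n              ∎)
    where
    open ≡-Reasoning
    open +-*-Solver using (solve; _:+_; _:*_; _:=_; con)

∣-mod : ∀ {d m n} .{{_ : NonZero n}} → d ∣ n → d ∣ m % n → d ∣ m
∣-mod {d} {m} {n} d∣n h = subst (d ∣_) (sym (m≡m%n+[m/n]*n m n)) (∣m∣n⇒∣m+n h (∣-trans d∣n (n∣m*n (m / n))))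

-- Chinese remainder: t ≡ t₀ modulo q and t ≡ 1 modulo the q-free part of n.
lift-coprime : ∀ {q} → Prime q → ∀ n → n ≢ 0 → ∀ t₀ → ¬ q ∣ t₀ → ∃ λ t → Coprime t n × ∃ λ y → t ≡ t₀ + q * y
lift-coprime {q} pq n n≢0 t₀ q∤t₀ with prime-part pq n n≢0
... | a , m , n≡ , q∤m with m ≟ 1
...   | yes m≡1 = t₀ , subst (Coprime t₀) (sym (trans n≡ (trans (cong (q ^ a *_) m≡1) (*-identityʳ _)))) (coprime-^ (prime-∤⇒coprime pq q∤t₀) a) , 0 , sym (trans (cong (t₀ +_) (*-zeroʳ q)) (+-identityʳ t₀))
...   | no m≢1 with inverse-mod {q} {m} (≤∧≢⇒< (n≢0⇒n>0 (λ z → n≢0 (trans n≡ (trans (cong (q ^ a *_) z) (*-zeroʳ (q ^ a)))))) (λ e → m≢1 (sym e))) (Cop.sym (prime-∤⇒coprime pq q∤m))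
...     | x , c , e = t , subst (Coprime t) (sym n≡) (coprime-* (coprime-^ (prime-∤⇒coprime pq q∤t) a) (subst (λ u → Coprime u m) (sym t≡1) (coprime-1+ z m))) , y , refl
  where
  open +-*-Solver using (solve; _:+_; _:*_; _:=_; con)
  y z t : ℕ
  -- `x` inverts `q` modulo `m` and `m ∸ 1` stands for -1, so `q * y` is congruent to 1 - t₀.
  y = x * (1 + (m ∸ 1) * t₀)
  z = t₀ + c * (1 + (m ∸ 1) * t₀)
  t = t₀ + q * y
  q∤t : ¬ q ∣ t
  q∤t d = q∤t₀ (∣m+n∣m⇒∣n (subst (q ∣_) (+-comm t₀ (q * y)) d) (m∣m*n y))
  m≡ : m ≡ 1 + (m ∸ 1)
  m≡ = sym (m+[n∸m]≡n (n≢0⇒n>0 (λ z → n≢0 (trans n≡ (trans (cong (q ^ a *_) z) (*-zeroʳ (q ^ a)))))))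
  t≡1 : t ≡ 1 + z * m
  t≡1 = begin
    t₀ + q * (x * (1 + (m ∸ 1) * t₀))            ≡⟨ solve 4 (λ t q x r → t :+ q :* (x :* r) := t :+ (x :* q) :* r) refl t₀ q x (1 + (m ∸ 1) * t₀) ⟩
    t₀ + (x * q) * (1 + (m ∸ 1) * t₀)            ≡⟨ cong (λ u → t₀ + u * (1 + (m ∸ 1) * t₀)) e ⟩
    t₀ + (1 + c * m) * (1 + (m ∸ 1) * t₀)        ≡⟨ solve 4 (λ t c m k → t :+ (con 1 :+ c :* m) :* (con 1 :+ k :* t) := con 1 :+ ((con 1 :+ k) :* t :+ c :* (con 1 :+ k :* t) :* m)) refl t₀ c m (m ∸ 1) ⟩
    1 + ((1 + (m ∸ 1)) * t₀ + c * (1 + (m ∸ 1) * t₀) * m) ≡⟨ cong (λ u → 1 + (u * t₀ + c * (1 + (m ∸ 1) * t₀) * m)) (sym m≡) ⟩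
    1 + (m * t₀ + c * (1 + (m ∸ 1) * t₀) * m)    ≡⟨ cong suc (solve 3 (λ m t r → m :* t :+ r :* m := (t :+ r) :* m) refl m t₀ (c * (1 + (m ∸ 1) * t₀))) ⟩
    1 + z * m                                    ∎
    where open ≡-Reasoning

module Regroup where
  open +-*-Solver using (solve; _:+_; _:*_; _:=_; con)
  numerator : ∀ i' i j q y → (i' * j + q * y) * i ≡ j * (i' * i) + y * i * q
  numerator = solve 5 (λ i' i j q y → (i' :* j :+ q :* y) :* i := j :* (i' :* i) :+ y :* i :* q) refl
  remainder : ∀ j c q z → j * (1 + c * q) + z * q ≡ j + (j * c + z) * q
  remainder = solve 4 (λ j c q z → j :* (con 1 :+ c :* q) :+ z :* q := j :+ (j :* c :+ z) :* q) refl

module Torus (n p : ℕ) .{{n≢0 : NonZero n}} .{{p≢0 : NonZero p}} where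
  -- Elements are given by arbitrary natural representatives, so sums and multiples are computed
  -- without tracking remainders.
  el : ℕ → ℕ → Fin (n * p)
  el a b = combine (a mod n) (b mod p)

  pack : Zsum n p → Fin (n * p)
  pack (a , b) = combine a b

  unpack : Fin (n * p) → Zsum n p
  unpack = remQuot p

  π₁ π₂ : Fin (n * p) → ℕ
  π₁ x = toℕ (proj₁ (unpack x))
  π₂ x = toℕ (proj₂ (unpack x))

  toℕ-mod : ∀ a m .{{_ : NonZero m}} → toℕ (a mod m) ≡ a % m
  toℕ-mod a m = toℕ-fromℕ< (m%n<n a m)

  mod-cong : ∀ {a b} m .{{_ : NonZero m}} → a % m ≡ b % m → a mod m ≡ b mod m
  mod-cong {a} {b} m e = toℕ-injective (trans (toℕ-mod a m) (trans e (sym (toℕ-mod b m))))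

  mod-toℕ : ∀ m .{{_ : NonZero m}} (x : Fin m) → toℕ x mod m ≡ x
  mod-toℕ m x = toℕ-injective (trans (toℕ-mod (toℕ x) m) (m<n⇒m%n≡m (toℕ<n x)))

  abstract
    el-cong : ∀ {a a' b b'} → a % n ≡ a' % n → b % p ≡ b' % p → el a b ≡ el a' b'
    el-cong e e' = cong₂ combine (mod-cong n e) (mod-cong p e')

    el-injective : ∀ {a a' b b'} → el a b ≡ el a' b' → a % n ≡ a' % n × b % p ≡ b' % p
    el-injective {a} {a'} {b} {b'} e = let (q , r) = FP.combine-injective (a mod n) (b mod p) (a' mod n) (b' mod p) e in
      trans (sym (toℕ-mod a n)) (trans (cong toℕ q) (toℕ-mod a' n)) , trans (sym (toℕ-mod b p)) (trans (cong toℕ r) (toℕ-mod b' p))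

    el-π : ∀ x → x ≡ el (π₁ x) (π₂ x)
    el-π x = sym (trans (cong₂ combine (mod-toℕ n _) (mod-toℕ p _)) (combine-remQuot {n} p x))

    unpack-el : ∀ a b → unpack (el a b) ≡ (a mod n , b mod p)
    unpack-el a b = remQuot-combine (a mod n) (b mod p)

    mod-+ : ∀ a b m .{{_ : NonZero m}} → (toℕ (a mod m) + toℕ (b mod m)) % m ≡ (a + b) % m
    mod-+ a b m = trans (cong₂ (λ u v → (u + v) % m) (toℕ-mod a m) (toℕ-mod b m)) (sym (%-distribˡ-+ a b m))

    add-el : ∀ a b a' b' → pack (addZ n p (unpack (el a b)) (unpack (el a' b'))) ≡ el (a + a') (b + b')
    add-el a b a' b' = trans (cong₂ (λ u v → pack (addZ n p u v)) (unpack-el a b) (unpack-el a' b'))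
      (cong₂ combine (mod-cong n (mod-+ a a' n)) (mod-cong p (mod-+ b b' p)))

  torus : FinAbelianGroup (n * p)
  torus = record
    { _⊕_ = add
    ; 𝟘 = el 0 0
    ; ⊖_ = λ x → pack (negZ n p (unpack x))
    ; ⊕-assoc = assoc
    ; ⊕-comm = comm
    ; ⊕-identityˡ = λ x → trans (cong (add (el 0 0)) (el-π x)) (trans (add-el 0 0 (π₁ x) (π₂ x)) (sym (el-π x)))
    ; ⊕-inverseˡ = λ x → trans (cong (add (pack (negZ n p (unpack x)))) (el-π x)) (trans (add-el (n ∸ π₁ x) (p ∸ π₂ x) (π₁ x) (π₂ x))
        (el-cong (cong′ n (proj₁ (unpack x))) (cong′ p (proj₂ (unpack x))))) }
    where
    add : Fin (n * p) → Fin (n * p) → Fin (n * p)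
    add x y = pack (addZ n p (unpack x) (unpack y))
    cong′ : ∀ m .{{_ : NonZero m}} (i : Fin m) → (m ∸ toℕ i + toℕ i) % m ≡ 0 % m
    cong′ m i = trans (cong (_% m) (m∸n+n≡m (<⇒≤ (toℕ<n i)))) (trans (n%n≡0 m) (sym (m<n⇒m%n≡m (>-nonZero⁻¹ m))))
    expand : ∀ x y → add x y ≡ el (π₁ x + π₁ y) (π₂ x + π₂ y)
    expand x y = trans (cong₂ add (el-π x) (el-π y)) (add-el (π₁ x) (π₂ x) (π₁ y) (π₂ y))
    comm : ∀ x y → add x y ≡ add y x
    comm x y = trans (expand x y) (trans (cong₂ el (+-comm (π₁ x) (π₁ y)) (+-comm (π₂ x) (π₂ y))) (sym (expand y x)))
    assoc : ∀ x y z → add (add x y) z ≡ add x (add y z)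
    assoc x y z = trans (cong₂ add (expand x y) (el-π z)) (trans (add-el (π₁ x + π₁ y) (π₂ x + π₂ y) (π₁ z) (π₂ z)) (trans (cong₂ el (+-assoc (π₁ x) (π₁ y) (π₁ z)) (+-assoc (π₂ x) (π₂ y) (π₂ z)))
      (sym (trans (cong₂ add (el-π x) (expand y z)) (add-el (π₁ x) (π₂ x) (π₁ y + π₁ z) (π₂ y + π₂ z))))))

  open GroupTheory torus

  abstract
    el-⊕ : ∀ a b a' b' → el a b ⊕ el a' b' ≡ el (a + a') (b + b')
    el-⊕ = add-el

    el-· : ∀ k a b → k · el a b ≡ el (k * a) (k * b)
    el-· zero    a b = refl
    el-· (suc k) a b = trans (cong (el a b ⊕_) (el-· k a b)) (el-⊕ a b (k * a) (k * b))

    el≡𝟘 : ∀ {a b} → n ∣ a → p ∣ b → el a b ≡ 𝟘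
    el≡𝟘 {a} {b} d e = el-cong (trans (n∣m⇒m%n≡0 a n d) (sym (m<n⇒m%n≡m (>-nonZero⁻¹ n)))) (trans (n∣m⇒m%n≡0 b p e) (sym (m<n⇒m%n≡m (>-nonZero⁻¹ p))))

    𝟘≡el : ∀ {a b} → el a b ≡ 𝟘 → n ∣ a × p ∣ b
    𝟘≡el {a} {b} e = let (q , r) = el-injective {a} {0} {b} {0} e in m%n≡0⇒n∣m a n (trans q (m<n⇒m%n≡m (>-nonZero⁻¹ n))) , m%n≡0⇒n∣m b p (trans r (m<n⇒m%n≡m (>-nonZero⁻¹ p)))

    el-surjective : ∀ x → ∃₂ λ a b → x ≡ el a b
    el-surjective x = π₁ x , π₂ x , el-π x

    torus-exponent : p ∣ n → ∀ x → n · x ≡ 𝟘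
    torus-exponent d x = trans (cong (n ·_) (el-π x)) (trans (el-· n (π₁ x) (π₂ x)) (el≡𝟘 (m∣m*n (π₁ x)) (∣-trans d (m∣m*n (π₂ x)))))

  module PrimeFactor {q : ℕ} (pp : Prime p) (pq : Prime q) (p≢q : p ≢ q) {r : ℕ} (n≡ : n ≡ q * r) where
    private instance
      q≢0 : NonZero q
      q≢0 = prime⇒nonZero pq

    e₀ : Fin (n * p)
    e₀ = el r 0

    q∤p : ¬ q ∣ p
    q∤p d with prime⇒irreducible pp d
    ... | inj₁ e    = <⇒≢ (nonTrivial⇒n>1 q {{prime⇒nonTrivial pq}}) (sym e)
    ... | inj₂ refl = p≢q refl

    coprime-qp : Coprime q p
    coprime-qp = Cop.sym (prime-∤⇒coprime pq q∤p)

    r≢0 : r ≢ 0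
    r≢0 z = ≢-nonZero⁻¹ n (trans n≡ (trans (cong (q *_) z) (*-zeroʳ q)))

    multiple-small : ∀ (i : Fin q) → toℕ i * r < n
    multiple-small i = ≤-trans (*-monoˡ-< r {{≢-nonZero r≢0}} (toℕ<n i)) (≤-reflexive (sym n≡))

    e₀-· : ∀ j → j · e₀ ≡ el (j * r) 0
    e₀-· j = trans (el-· j r 0) (cong (el (j * r)) (*-zeroʳ j))

    qe₀ : q · e₀ ≡ 𝟘
    qe₀ = trans (e₀-· q) (el≡𝟘 (∣-reflexive n≡) (p ∣0))

    order : ∀ (i j : Fin q) → toℕ i · e₀ ≡ toℕ j · e₀ → i ≡ j
    order i j e = toℕ-injective (*-cancelʳ-≡ (toℕ i) (toℕ j) r {{≢-nonZero r≢0}} (trans (sym (m<n⇒m%n≡m (multiple-small i)))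
      (trans (proj₁ (el-injective {toℕ i * r} {toℕ j * r} {0} {0} (trans (sym (e₀-· (toℕ i))) (trans e (e₀-· (toℕ j)))))) (m<n⇒m%n≡m (multiple-small j)))))

    torsion : ∀ x → q · x ≡ 𝟘 → ∃ λ (j : Fin q) → x ≡ toℕ j · e₀
    torsion x h with el-surjective x
    ... | a , b , refl with 𝟘≡el (trans (sym (el-· q a b)) h)
    ...   | n∣qa , p∣qb with *-cancelˡ-∣ q (subst (_∣ q * a) n≡ n∣qa)
    ...     | divides j refl = j mod q , trans (el-cong (mod-eq j) (trans (n∣m⇒m%n≡0 b p p∣b) (sym (m<n⇒m%n≡m (>-nonZero⁻¹ p))))) (sym (e₀-· (toℕ (j mod q))))
      where
      p∣b : p ∣ b
      p∣b = Cop.coprime-divisor (Cop.sym coprime-qp) p∣qb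
      mod-eq : ∀ j → (j * r) % n ≡ (toℕ (j mod q) * r) % n
      mod-eq j = trans (cong (_% n) (trans (cong (_* r) (m≡m%n+[m/n]*n j q)) (trans (*-distribʳ-+ r (j % q) (j / q * q)) (cong (j % q * r +_) (trans (*-assoc (j / q) q r) (cong (j / q *_) (sym n≡)))))))
        (trans ([m+kn]%n≡m%n (j % q * r) (j / q) n) (cong (λ u → (u * r) % n) (sym (toℕ-mod j q))))

    e₀≢0 : e₀ ≢ 𝟘
    e₀≢0 e = <⇒≱ (≤-trans (m<m*n r q {{≢-nonZero r≢0}} (nonTrivial⇒n>1 q {{prime⇒nonTrivial pq}})) (≤-reflexive (sym (trans n≡ (*-comm q r))))) (∣⇒≤ {{≢-nonZero r≢0}} (proj₁ (𝟘≡el {r} {0} e)))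

    not-multiple : ∀ x → q · x ≢ el 1 0
    not-multiple x e with el-surjective x
    ... | a , b , refl = <⇒≢ (nonTrivial⇒n>1 q {{prime⇒nonTrivial pq}}) (sym (∣1⇒≡1 (∣-mod {q} {1} {n} q∣n
          (subst (q ∣_) (proj₁ (el-injective {q * a} {1} {q * b} {0} (trans (sym (el-· q a b)) e))) (%-presˡ-∣′ (m∣m*n a) q∣n)))))
      where
      q∣n : q ∣ n
      q∣n = divides r (trans n≡ (*-comm q r))
      %-presˡ-∣′ : ∀ {m} → q ∣ m → q ∣ n → q ∣ m % n
      %-presˡ-∣′ {m} d d' = ∣m+n∣m⇒∣n (subst (q ∣_) (trans (m≡m%n+[m/n]*n m n) (+-comm (m % n) _)) d) (∣-trans d' (n∣m*n (m / n)))

    -- Dividing the coordinates along `e₀` gives the multiplier modulo `q`. `lift-coprime` alters it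
    -- by a multiple of `q`, which torsion does not notice, to make it coprime to `n`.
    transitive : ∀ e e' → q · e ≡ 𝟘 → q · e' ≡ 𝟘 → e ≢ 𝟘 → e' ≢ 𝟘 → ∃ λ t → Coprime t n × t · e ≡ e'
    transitive e e' he he' ne ne' with torsion e he | torsion e' he'
    ... | i , ei | j , ej =
      let (i' , c , inv) = inverse-mod {toℕ i} {q} (nonTrivial⇒n>1 q {{prime⇒nonTrivial pq}}) (prime-∤⇒coprime pq q∤i)
          (t , ct , y , t≡) = lift-coprime pq n (≢-nonZero⁻¹ n) (i' * toℕ j) (q∤ i' c inv)
      in t , ct , final i' c inv t y t≡
      where
      nonzero : ∀ (l : Fin q) {x} → x ≡ toℕ l · e₀ → x ≢ 𝟘 → ¬ q ∣ toℕ l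
      nonzero l ex nx d = nx (trans ex (cong (_· e₀) (trans (sym (m<n⇒m%n≡m (toℕ<n l))) (n∣m⇒m%n≡0 (toℕ l) q d))))
      q∤i : ¬ q ∣ toℕ i
      q∤i = nonzero i ei ne
      q∤ : ∀ i' c → i' * toℕ i ≡ 1 + c * q → ¬ q ∣ i' * toℕ j
      q∤ i' c inv d with euclidsLemma i' (toℕ j) pq d
      ... | inj₂ d' = nonzero j ej ne' d'
      ... | inj₁ d' = <⇒≢ (nonTrivial⇒n>1 q {{prime⇒nonTrivial pq}}) (sym (∣1⇒≡1 (∣m+n∣m⇒∣n (subst (q ∣_) (trans inv (+-comm 1 (c * q))) (∣-trans d' (m∣m*n (toℕ i)))) (n∣m*n c))))
      kill : ∀ m → (m * q) · e₀ ≡ 𝟘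
      kill m = trans (·-assoc m q e₀) (trans (cong (m ·_) qe₀) (·-𝟘 m))
      final : ∀ i' c → i' * toℕ i ≡ 1 + c * q → ∀ t y → t ≡ i' * toℕ j + q * y → t · e ≡ e'
      final i' c inv t y t≡ = begin
        t · e                                           ≡⟨ cong (t ·_) ei ⟩
        t · (toℕ i · e₀)                                ≡⟨ ·-assoc t (toℕ i) e₀ ⟨
        (t * toℕ i) · e₀                                ≡⟨ cong (_· e₀) arith ⟩
        (toℕ j + (toℕ j * c + y * toℕ i) * q) · e₀      ≡⟨ ·-distribʳ (toℕ j) _ e₀ ⟩
        toℕ j · e₀ ⊕ ((toℕ j * c + y * toℕ i) * q) · e₀ ≡⟨ cong (toℕ j · e₀ ⊕_) (kill (toℕ j * c + y * toℕ i)) ⟩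
        toℕ j · e₀ ⊕ 𝟘                                  ≡⟨ ⊕-identityʳ _ ⟩
        toℕ j · e₀                                      ≡⟨ ej ⟨
        e'                                              ∎
        where
        open ≡-Reasoning
        arith : t * toℕ i ≡ toℕ j + (toℕ j * c + y * toℕ i) * q
        arith = trans (cong (_* toℕ i) t≡) (trans (Regroup.numerator i' (toℕ i) (toℕ j) q y) (trans (cong (λ u → toℕ j * u + y * toℕ i * q) inv) (Regroup.remainder (toℕ j) c q (y * toℕ i))))

    p-torsion : p · el 0 1 ≡ 𝟘
    p-torsion = trans (el-· p 0 1) (el≡𝟘 (subst (n ∣_) (sym (*-zeroʳ p)) (n ∣0)) (m∣m*n 1))

    el01≢0 : el 0 1 ≢ 𝟘
    el01≢0 e = <⇒≢ (nonTrivial⇒n>1 p {{prime⇒nonTrivial pp}}) (sym (∣1⇒≡1 (proj₂ (𝟘≡el {0} {1} e))))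

    el01∉ : ∀ x → p · x ≢ el 0 1
    el01∉ x e with el-surjective x
    ... | a , b , refl = case trans (sym (n∣m⇒m%n≡0 (p * b) p (m∣m*n b))) (trans (proj₂ (el-injective {p * a} {0} {p * b} {1} (trans (sym (el-· p a b)) e))) (m<n⇒m%n≡m (nonTrivial⇒n>1 p {{prime⇒nonTrivial pp}}))) of λ ()

  module PrimePower {s : ℕ} (pp : Prime p) (n≡p^ : n ≡ p ^ suc (suc s)) where
    m : ℕ
    m = p ^ suc s

    n≡ : n ≡ p * m
    n≡ = n≡p^

    p∣m : p ∣ m
    p∣m = m∣m*n (p ^ s)

    1<p : 1 < p
    1<p = nonTrivial⇒n>1 p {{prime⇒nonTrivial pp}}

    m≢0 : NonZero m
    m≢0 = m^n≢0 p (suc s)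

    2≤n : 2 ≤ n
    2≤n = ≤-trans 1<p (≤-trans (m≤m*n p m {{m≢0}}) (≤-reflexive (sym n≡)))

    coprime-n : ∀ {t} → ¬ p ∣ t → Coprime t n
    coprime-n h = subst (Coprime _) (sym n≡p^) (coprime-^ (prime-∤⇒coprime pp h) (suc (suc s)))

    τ-coprime : ∀ i → Coprime (1 + i * m) n
    τ-coprime i = coprime-n (λ d → <⇒≢ 1<p (sym (∣1⇒≡1 (∣m+n∣m⇒∣n (subst (p ∣_) (+-comm 1 (i * m)) d) (∣-trans p∣m (n∣m*n i))))))

    c₀ : Fin (n * p)
    c₀ = el m 0

    -- `p` divides `m`, so the second coordinate dies and the image of multiplication by `m` is
    -- generated by `c₀`.
    ψ-el : ∀ a b → m · el a b ≡ a · c₀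
    ψ-el a b = trans (el-· m a b) (trans (el-cong (cong (_% n) (*-comm m a)) (trans (n∣m⇒m%n≡0 (m * b) p (∣-trans p∣m (m∣m*n b)))
      (sym (n∣m⇒m%n≡0 (a * 0) p (subst (p ∣_) (sym (*-zeroʳ a)) (p ∣0)))))) (sym (el-· a m 0)))

    c₀-order : ∀ (i j : Fin p) → toℕ i · c₀ ≡ toℕ j · c₀ → i ≡ j
    c₀-order i j e = toℕ-injective (*-cancelʳ-≡ (toℕ i) (toℕ j) m {{m≢0}} (trans (sym (m<n⇒m%n≡m (lt i)))
      (trans (proj₁ (el-injective {toℕ i * m} {toℕ j * m} {toℕ i * 0} {toℕ j * 0} (trans (sym (el-· (toℕ i) m 0)) (trans e (el-· (toℕ j) m 0))))) (m<n⇒m%n≡m (lt j)))))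
      where
      lt : ∀ (i : Fin p) → toℕ i * m < n
      lt i = ≤-trans (*-monoˡ-< m {{m≢0}} (toℕ<n i)) (≤-reflexive (sym n≡))

    pc₀ : p · c₀ ≡ 𝟘
    pc₀ = trans (el-· p m 0) (el≡𝟘 (∣-reflexive n≡) (subst (p ∣_) (sym (*-zeroʳ p)) (p ∣0)))

    nonzero : ∀ {a b} → m · el a b ≢ 𝟘 → ¬ p ∣ a
    nonzero {a} {b} ne (divides r refl) = ne (trans (ψ-el a b) (trans (·-assoc r p c₀) (trans (cong (r ·_) pc₀) (·-𝟘 r))))

    scale : ∀ x → m · x ≢ 𝟘 → ∃ λ i → ¬ p ∣ i × i · (m · x) ≡ c₀
    scale x ne with el-surjective x
    ... | a , b , refl = let (i , c , e) = inverse-mod {a} {p} 1<p (prime-∤⇒coprime pp (nonzero ne)) in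
        i , (λ d → <⇒≢ 1<p (sym (∣1⇒≡1 (∣m+n∣m⇒∣n (subst (p ∣_) (trans e (+-comm 1 (c * p))) (∣-trans d (m∣m*n a))) (n∣m*n c))))) ,
        trans (cong (i ·_) (ψ-el a b)) (trans (sym (·-assoc i a c₀)) (trans (cong (_· c₀) e) (trans (cong (c₀ ⊕_) (trans (·-assoc c p c₀) (trans (cong (c ·_) pc₀) (·-𝟘 c)))) (⊕-identityʳ c₀))))

    outside : ∃ λ x → m · x ≢ 𝟘
    outside = el 1 0 , λ e → <⇒≱ (≤-trans (m<m*n m p {{m≢0}} 1<p) (≤-reflexive (trans (*-comm m p) (sym n≡)))) (∣⇒≤ {{m≢0}} (subst (n ∣_) (*-identityʳ m) (proj₁ (𝟘≡el {m * 1} {m * 0} (trans (sym (el-· m 1 0)) e)))))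

    line : ∀ x w → m · x ≢ 𝟘 → ∃ λ i → m · w ≡ i · (m · x)
    line x w ne with el-surjective w
    ... | a , b , refl = let (i , _ , e) = scale x ne in a * i , trans (ψ-el a b) (trans (cong (a ·_) (sym e)) (sym (·-assoc a i (m · x))))

    line-order : ∀ x → m · x ≢ 𝟘 → ∀ (i j : Fin p) → toℕ i · (m · x) ≡ toℕ j · (m · x) → i ≡ j
    line-order x ne i j e = let (l , _ , q) = scale x ne in
      c₀-order i j (trans (cong (toℕ i ·_) (sym q)) (trans (·-comm (toℕ i) l (m · x)) (trans (cong (l ·_) e) (trans (·-comm l (toℕ j) (m · x)) (cong (toℕ j ·_) q)))))

    line-unit : ∀ x w → m · x ≢ 𝟘 → m · w ≢ 𝟘 → ∃ λ t → Coprime t n × t · (m · x) ≡ m · w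
    line-unit x w nx nw with el-surjective w
    ... | a , b , refl = let (i , p∤i , e) = scale x nx in a * i , coprime-n (λ d → case euclidsLemma a i pp d of λ { (inj₁ d') → nonzero nw d' ; (inj₂ d') → p∤i d' }) ,
          trans (·-assoc a i (m · x)) (trans (cong (a ·_) e) (sym (ψ-el a b)))

    -- Outside the kernel the first coordinate is prime to `p`, hence invertible modulo `n`, and
    -- multiples can be read off from it.
    full-order : ∀ x → m · x ≢ 𝟘 → ∀ (i j : Fin n) → toℕ i · x ≡ toℕ j · x → i ≡ j
    full-order x ne i j e with el-surjective x
    ... | a , b , refl = let (l , c , inv) = inverse-mod {a} {n} 2≤n (coprime-n (nonzero ne)) in
        toℕ-injective (trans (sym (first l c inv i)) (trans (proj₁ (el-injective {toℕ i * (l * a)} {toℕ j * (l * a)} {toℕ i * (l * b)} {toℕ j * (l * b)}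
          (trans (sym (expand l i)) (trans (cong (l ·_) e) (expand l j))))) (first l c inv j)))
      where
      expand : ∀ l (i : Fin n) → l · (toℕ i · el a b) ≡ el (toℕ i * (l * a)) (toℕ i * (l * b))
      expand l i = trans (·-comm l (toℕ i) (el a b)) (trans (cong (toℕ i ·_) (el-· l a b)) (el-· (toℕ i) (l * a) (l * b)))
      first : ∀ l c → l * a ≡ 1 + c * n → ∀ (i : Fin n) → (toℕ i * (l * a)) % n ≡ toℕ i
      first l c inv i = trans (cong (_% n) (trans (cong (toℕ i *_) inv) (trans (*-suc (toℕ i) (c * n)) (cong (toℕ i +_) (sym (*-assoc (toℕ i) c n))))))
        (trans ([m+kn]%n≡m%n (toℕ i) (toℕ i * c) n) (m<n⇒m%n≡m (toℕ<n i)))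

-- Walks, graph distance and the norm of a Cayley graph

anyF-intro : ∀ {N} (f : Fin N → Bool) i → f i ≡ true → anyF f ≡ true
anyF-intro f fzero    h = ∨-introˡ h
anyF-intro f (fsuc i) h = ∨-introʳ {f fzero} (anyF-intro (f ∘ fsuc) i h)

anyF-elim : ∀ {N} (f : Fin N → Bool) → anyF f ≡ true → ∃ λ i → f i ≡ true
anyF-elim {suc N} f h with ∨-elim {f fzero} h
... | inj₁ e = fzero , e
... | inj₂ e = let (i , q) = anyF-elim (f ∘ fsuc) e in fsuc i , q

module Walks (Γ : Graph) where
  private V = Fin (Graph.N Γ)

  R : ℕ → V → V → Set
  R k x y = reach Γ k x y ≡ true

  R-refl : ∀ x → R 0 x x
  R-refl = ==F-refl

  R-0 : ∀ {x y} → R 0 x y → x ≡ y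
  R-0 = ==F-sound

  R-step : ∀ {k x y z} → R k x z → adj Γ z y ≡ true → R (suc k) x y
  R-step {k} {x} {y} {z} r a = ∨-introʳ {reach Γ k x y} (anyF-intro (λ z → reach Γ k x z ∧ adj Γ z y) z (∧-intro r a))

  R-weaken : ∀ {k x y} → R k x y → R (suc k) x y
  R-weaken = ∨-introˡ

  R-cases : ∀ {k x y} → R (suc k) x y → R k x y ⊎ ∃ λ z → R k x z × adj Γ z y ≡ true
  R-cases {k} {x} {y} h with ∨-elim {reach Γ k x y} h
  ... | inj₁ e = inj₁ e
  ... | inj₂ e = let (z , q) = anyF-elim (λ z → reach Γ k x z ∧ adj Γ z y) e in inj₂ (z , ∧-elim q)

  R-mono : ∀ {j k x y} → j ≤ k → R j x y → R k x y
  R-mono {j} {k} {x} {y} le h = subst (λ i → R i x y) (trans (+-comm (k ∸ j) j) (m+[n∸m]≡n le)) (go (k ∸ j))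
    where
    go : ∀ i → R (i + j) x y
    go zero    = h
    go (suc i) = R-weaken {i + j} (go i)

  -- These properties characterise the graph distance, so intersection numbers of a concrete graph
  -- can be computed from an explicit formula.
  module _ (δ : V → V → ℕ) (δ-refl : ∀ x → δ x x ≡ 0) (δ-0 : ∀ x y → δ x y ≡ 0 → x ≡ y)
    (δ-step : ∀ x y z → adj Γ y z ≡ true → δ x z ≤ suc (δ x y))
    (δ-pred : ∀ x z i → δ x z ≡ suc i → ∃ λ y → δ x y ≡ i × adj Γ y z ≡ true) where

    R⇒δ≤ : ∀ k {x y} → R k x y → δ x y ≤ k
    R⇒δ≤ zero {x} h with R-0 h
    ... | refl = ≤-reflexive (δ-refl x)
    R⇒δ≤ (suc k) {x} {y} h with R-cases {k} h
    ... | inj₁ r = m≤n⇒m≤1+n (R⇒δ≤ k r)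
    ... | inj₂ (z , r , a) = ≤-trans (δ-step x z y a) (s≤s (R⇒δ≤ k r))

    δ⇒R : ∀ k {x y} → δ x y ≡ k → R k x y
    δ⇒R zero    {x} {y} e = subst (R 0 x) (δ-0 x y e) (R-refl x)
    δ⇒R (suc k) {x} {y} e = let (z , ez , a) = δ-pred x y k e in R-step {k} (δ⇒R k ez) a

    distIs-δ : ∀ d x y → distIs Γ d x y ≡ ⌊ δ x y ≟ d ⌋
    distIs-δ zero x y = bool-ext (λ h → toYes (_ ≟ _) (n≤0⇒n≡0 (R⇒δ≤ 0 h))) (λ h → δ⇒R 0 (fromYes (_ ≟ _) h))
    distIs-δ (suc d) x y = bool-ext
      (λ h → let (a , b) = ∧-elim {reach Γ (suc d) x y} h in toYes (_ ≟ _) (≤-antisym (R⇒δ≤ (suc d) a)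
         (≰⇒> (λ le → true≢false (R-mono le (δ⇒R _ refl)) (not-elim b)))))
      (λ h → let e = fromYes (δ x y ≟ suc d) h in ∧-intro (δ⇒R (suc d) e) (not-intro (¬true⇒false (λ r → <⇒≱ (≤-reflexive (sym e)) (R⇒δ≤ d r)))))

    δ-connected : Connected Γ
    δ-connected x y = δ x y , δ⇒R _ refl

    nbrsAt-δ : ∀ x y j → nbrsAt Γ x y j ≡ count (λ z → adj Γ y z ∧ ⌊ δ x z ≟ j ⌋)
    nbrsAt-δ x y j = count-cong (λ z → cong (adj Γ y z ∧_) (distIs-δ j x z))

module CayleyNorm {N : ℕ} (G : FinAbelianGroup N) (S : Fin N → Bool)
  (S-⊖ : ∀ x → S (FinAbelianGroup.⊖_ G x) ≡ S x) (S-𝟘 : S (FinAbelianGroup.𝟘 G) ≡ false)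
  (adjacent : Fin N → Fin N → Bool) (adjacent≡ : ∀ x y → adjacent x y ≡ S (FinAbelianGroup._⊕_ G (FinAbelianGroup.⊖_ G x) y)) where
  open GroupTheory G

  Γ : Graph
  Γ = record { N = N ; adj = adjacent }

  open Walks Γ

  adj-intro : ∀ {x y} → S (⊖ x ⊕ y) ≡ true → adjacent x y ≡ true
  adj-intro {x} {y} = trans (adjacent≡ x y)

  adj-elim : ∀ {x y} → adjacent x y ≡ true → S (⊖ x ⊕ y) ≡ true
  adj-elim {x} {y} = trans (sym (adjacent≡ x y))

  module _ (dr : DistanceRegular Γ) where
    private
      level : ∀ y → ∃ λ d → R d 𝟘 y × d ≤ proj₁ (proj₁ dr 𝟘 y) × (∀ k → k < d → ¬ R k 𝟘 y)
      level y = least (λ d → R d 𝟘 y) (λ d → ∈? (λ y → reach Γ d 𝟘 y) y) (proj₁ (proj₁ dr 𝟘 y)) (proj₂ (proj₁ dr 𝟘 y))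

    abstract
      cl : Fin N → ℕ
      cl y = proj₁ (level y)

      R-cl : ∀ y → R (cl y) 𝟘 y
      R-cl y = proj₁ (proj₂ (level y))

      cl≤ : ∀ {y d} → R d 𝟘 y → cl y ≤ d
      cl≤ {y} {d} r = ≮⇒≥ (λ l → proj₂ (proj₂ (proj₂ (level y))) d l r)

    R-at : ∀ {y d} → cl y ≤ d → R d 𝟘 y
    R-at le = R-mono le (R-cl _)

    cl-𝟘 : cl 𝟘 ≡ 0
    cl-𝟘 = n≤0⇒n≡0 (cl≤ (R-refl 𝟘))

    cl≡0 : ∀ x → cl x ≡ 0 → x ≡ 𝟘
    cl≡0 x e = sym (R-0 (R-at (≤-reflexive e)))

    R-⊕ : ∀ {i} j {x y} → R i 𝟘 x → R j 𝟘 y → R (j + i) 𝟘 (x ⊕ y)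
    R-⊕ {i} zero {x} r r' = subst (R i 𝟘) (trans (sym (⊕-identityʳ x)) (cong (x ⊕_) (R-0 r'))) r
    R-⊕ {i} (suc j) {x} {y} r r' with R-cases {j} r'
    ... | inj₁ h = R-weaken {j + i} (R-⊕ j r h)
    ... | inj₂ (z , h , a) = R-step {j + i} (R-⊕ j r h) (adj-intro (subst (λ u → S u ≡ true)
          (gsolve 3 (λ x y z → :- z :+ y := :- (x :+ z) :+ (x :+ y)) refl x y z) (adj-elim a)))

    R-⊖ : ∀ i {x} → R i 𝟘 x → R i 𝟘 (⊖ x)
    R-⊖ zero {x} r = subst (R 0 𝟘) (trans (sym ⊖-𝟘) (cong ⊖_ (R-0 r))) (R-refl 𝟘)
    R-⊖ (suc i) {x} r with R-cases {i} r
    ... | inj₁ h = R-weaken {i} (R-⊖ i h)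
    ... | inj₂ (z , h , a) = R-step {i} (R-⊖ i h) (adj-intro (trans (cong S (gsolve 2 (λ x z → :- :- z :+ :- x := :- (:- z :+ x)) refl x z)) (trans (S-⊖ _) (adj-elim a))))

    cl-⊕ : ∀ x y → cl (x ⊕ y) ≤ cl x + cl y
    cl-⊕ x y = ≤-trans (cl≤ (R-⊕ (cl y) (R-cl x) (R-cl y))) (≤-reflexive (+-comm (cl y) (cl x)))

    cl-⊖ : ∀ x → cl (⊖ x) ≡ cl x
    cl-⊖ x = ≤-antisym (cl≤ (R-⊖ (cl x) (R-cl x))) (≤-trans (≤-reflexive (cong cl (sym (⊖-involutive x)))) (cl≤ (R-⊖ (cl (⊖ x)) (R-cl (⊖ x)))))

    from-𝟘 : ∀ x → ⊖ 𝟘 ⊕ x ≡ x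
    from-𝟘 = gsolve 1 (λ x → :- :0 :+ x := x) refl

    S⇒cl : ∀ {s} → S s ≡ true → cl s ≡ 1
    S⇒cl {s} h = ≤-antisym (cl≤ (R-step {0} (R-refl 𝟘) (adj-intro (trans (cong S (from-𝟘 s)) h))))
      (n≢0⇒n>0 (λ e → true≢false h (trans (cong S (cl≡0 s e)) S-𝟘)))

    cl⇒S : ∀ {s} → cl s ≡ 1 → S s ≡ true
    cl⇒S {s} e with R-cases {0} (R-at (≤-reflexive e))
    ... | inj₁ r = contradiction (trans (sym e) (trans (cong cl (sym (R-0 r))) cl-𝟘)) (λ ())
    ... | inj₂ (z , r , a) = trans (cong S (sym (trans (cong (λ u → ⊖ u ⊕ s) (sym (R-0 r))) (from-𝟘 s)))) (adj-elim a)

    geodesic : ∀ x i → cl x ≡ suc i → ∃₂ λ y s → cl y ≡ i × cl s ≡ 1 × x ≡ y ⊕ s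
    geodesic x i e with R-cases {i} (R-at (≤-reflexive e))
    ... | inj₁ r = contradiction (cl≤ r) (<⇒≱ (≤-reflexive (sym e)))
    ... | inj₂ (z , r , a) = z , ⊖ z ⊕ x , ≤-antisym (cl≤ r) (≤-pred (≤-trans (≤-reflexive (sym e)) (≤-trans (≤-reflexive (cong cl eq))
            (≤-trans (cl-⊕ z (⊖ z ⊕ x)) (≤-reflexive (trans (cong (cl z +_) es) (+-comm (cl z) 1))))))) , es , eq
      where
      es : cl (⊖ z ⊕ x) ≡ 1
      es = S⇒cl (adj-elim a)
      eq : x ≡ z ⊕ (⊖ z ⊕ x)
      eq = gsolve 2 (λ x z → x := z :+ (:- z :+ x)) refl x z

    dist-cl : ∀ d x → distIs Γ d 𝟘 x ≡ ⌊ cl x ≟ d ⌋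
    dist-cl zero x = bool-ext (λ h → toYes (_ ≟ _) (n≤0⇒n≡0 (cl≤ h))) (λ h → R-at (≤-reflexive (fromYes (_ ≟ _) h)))
    dist-cl (suc d) x = bool-ext
      (λ h → let (a , b) = ∧-elim {reach Γ (suc d) 𝟘 x} h in toYes (_ ≟ _) (≤-antisym (cl≤ a) (≰⇒> (λ le → true≢false (R-at le) (not-elim b)))))
      (λ h → let e = fromYes (cl x ≟ suc d) h in ∧-intro (R-at (≤-reflexive e)) (not-intro (¬true⇒false (λ r → <⇒≱ (≤-reflexive (sym e)) (cl≤ r)))))

    nb : ℕ → Fin N → ℕ
    nb j x = count (λ s → ⌊ cl s ≟ 1 ⌋ ∧ ⌊ cl (x ⊕ s) ≟ j ⌋)

    nbrsAt-nb : ∀ j x → nbrsAt Γ 𝟘 x j ≡ nb j x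
    nbrsAt-nb j x = trans (sym (sumF-reindex (x ⊕_) (⊖ x ⊕_) (λ s → gsolve 2 (λ x s → :- x :+ (x :+ s) := s) refl x s) (λ s → gsolve 2 (λ x s → x :+ (:- x :+ s) := s) refl x s)
        (λ z → ⟦ adjacent x z ∧ distIs Γ j 𝟘 z ⟧)))
      (sumF-cong (λ s → cong ⟦_⟧ (cong₂ _∧_ (trans (adjacent≡ x (x ⊕ s)) (trans (cong S (gsolve 2 (λ x s → :- x :+ (x :+ s) := s) refl x s))
        (bool-ext (λ h → toYes (_ ≟ _) (S⇒cl h)) (λ h → cl⇒S (fromYes (_ ≟ _) h))))) (dist-cl j (x ⊕ s)))))

    far : ∀ j x → suc j < cl x ⊎ suc (cl x) < j → nb j x ≡ 0
    far j x f = count-empty _ (λ s h → absurd f (fromYes (_ ≟ _) (proj₁ (∧-elim {⌊ cl s ≟ 1 ⌋} h))) (fromYes (_ ≟ _) (proj₂ (∧-elim {⌊ cl s ≟ 1 ⌋} h))))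
      where
      absurd : suc j < cl x ⊎ suc (cl x) < j → ∀ {s} → cl s ≡ 1 → cl (x ⊕ s) ≡ j → ⊥
      absurd (inj₁ l) {s} es e = <⇒≱ l (≤-trans (≤-reflexive (cong cl (sym (⊕-⊖ x s)))) (≤-trans (cl-⊕ (x ⊕ s) (⊖ s)) (≤-reflexive (trans (cong₂ _+_ e (trans (cl-⊖ s) es)) (+-comm j 1)))))
      absurd (inj₂ l) {s} es e = <⇒≱ l (≤-trans (≤-reflexive (sym e)) (≤-trans (cl-⊕ x s) (≤-reflexive (trans (cong (cl x +_) es) (+-comm (cl x) 1)))))

    -- The intersection array covers the class of `x` and its two neighbours; a single step cannot
    -- reach any other class.
    regular : ∀ j x y → cl x ≡ cl y → nb j x ≡ nb j y
    regular j x y e = go (<-cmp j (cl x))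
      where
      arrays = proj₂ (proj₂ (proj₂ (proj₂ dr)))
      at : ∀ z {i} → cl z ≡ i → Dist Γ 𝟘 z i
      at z {i} q = trans (dist-cl i z) (toYes (_ ≟ _) q)
      via : ∀ {c} → nbrsAt Γ 𝟘 x j ≡ c → nbrsAt Γ 𝟘 y j ≡ c → nb j x ≡ nb j y
      via p q = trans (sym (nbrsAt-nb j x)) (trans p (trans (sym q) (nbrsAt-nb j y)))
      go : _ → nb j x ≡ nb j y
      go (tri≈ _ refl _) = via (proj₁ (proj₂ (arrays 𝟘 x (cl x) (at x refl)))) (proj₁ (proj₂ (arrays 𝟘 y (cl x) (at y (sym e)))))
      go (tri< l _ _) with m≤n⇒m<n∨m≡n l
      ... | inj₂ q = via (proj₁ (arrays 𝟘 x (cl x) (at x refl)) j (sym q)) (proj₁ (arrays 𝟘 y (cl x) (at y (sym e))) j (sym q))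
      ... | inj₁ l' = trans (far j x (inj₁ l')) (sym (far j y (inj₁ (≤-trans l' (≤-reflexive e)))))
      go (tri> _ _ l) with m≤n⇒m<n∨m≡n l
      ... | inj₂ refl = via (proj₂ (proj₂ (arrays 𝟘 x (cl x) (at x refl)))) (proj₂ (proj₂ (arrays 𝟘 y (cl x) (at y (sym e)))))
      ... | inj₁ l' = trans (far j x (inj₂ l')) (sym (far j y (inj₂ (≤-trans (≤-reflexive (cong (suc ∘ suc) (sym e))) l'))))

    norm : RegularNorm G
    norm = record { cl = cl ; cl-𝟘 = cl-𝟘 ; cl≡0 = cl≡0 ; cl-⊖ = cl-⊖ ; cl-⊕ = cl-⊕ ; geodesic = geodesic ; regular = regular }

-- Case distinction on n

module Classification (p : ℕ) .{{p≢0 : NonZero p}} (pp : Prime p) (p-odd : p % 2 ≡ 1) where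
  1<p : 1 < p
  1<p = nonTrivial⇒n>1 p {{prime⇒nonTrivial pp}}

  p≢2 : p ≢ 2
  p≢2 refl = case p-odd of λ ()

  p≥3 : 3 ≤ p
  p≥3 = ≤∧≢⇒< 1<p (λ e → p≢2 (sym e))

  UnitsStable : (n : ℕ) .{{_ : NonZero n}} → RegularNorm (Torus.torus n p) → Set
  UnitsStable n norm = ∀ u → Coprime u p → ∀ s → cl s ≡ 1 → cl (u · s) ≡ 1
    where open Structure (Torus.torus n p) norm

  module _ (n : ℕ) .{{n≢0 : NonZero n}} (p∣n : p ∣ n) (norm : RegularNorm (Torus.torus n p)) where
    open Torus n p
    private
      n<N : n < n * p
      n<N = m<m*n n p 1<p

    module C = CaseAnalysis torus norm n (torus-exponent p∣n) n<N
    open C using (Multi; CrownData)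

    even : n % 2 ≡ 0 → Multi ⊎ (n % 4 ≡ 2 × CrownData)
    even h = finish (C.even-case e₀≢0 qe₀ tor not-multiple)
      where
      r : ℕ
      r = n / 2
      n≡2r : n ≡ 2 * r
      n≡2r = trans (m≡m%n+[m/n]*n n 2) (trans (cong (_+ n / 2 * 2) h) (*-comm (n / 2) 2))
      open PrimeFactor pp prime[2] p≢2 {n / 2} n≡2r
      open GroupTheory torus using (_·_; 𝟘; _⊕_; 1·)
      tor : ∀ x → 2 · x ≡ 𝟘 → x ≡ 𝟘 ⊎ x ≡ e₀
      tor x q with torsion x q
      ... | fzero , e      = inj₁ e
      ... | fsuc fzero , e = inj₂ (trans e (1· e₀))
      mod4 : CrownData → n % 4 ≡ 2
      mod4 c with r % 2 in eq
      -- The only involution is (r, 0), so it is `z`; for even `r` it would be a double, which the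
      -- crown data exclude.
      ... | zero = contradiction (trans (el-· 2 w 0) (cong (λ u → el u 0) (sym r≡))) (λ q → C.CrownData.z-odd c (el w 0) (trans q z≡e₀))
        where
        w : ℕ
        w = r / 2
        r≡ : r ≡ 2 * w
        r≡ = trans (m≡m%n+[m/n]*n r 2) (trans (cong (_+ r / 2 * 2) eq) (*-comm (r / 2) 2))
        z≡e₀ : e₀ ≡ C.CrownData.z c
        z≡e₀ with tor (C.CrownData.z c) (trans (cong (C.CrownData.z c ⊕_) (1· _)) (C.CrownData.z⊕z c))
        ... | inj₁ z0 = contradiction z0 (C.cl>0⇒≢ (C.CrownData.cl-z c))
        ... | inj₂ ze = sym ze
      ... | suc zero = trans (cong (_% 4) n≡') ([m+kn]%n≡m%n 2 (r / 2) 4)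
        where
        n≡' : n ≡ 2 + r / 2 * 4
        n≡' = trans n≡2r (trans (cong (2 *_) (trans (m≡m%n+[m/n]*n r 2) (cong (_+ r / 2 * 2) eq))) (trans (*-distribˡ-+ 2 1 (r / 2 * 2)) (cong (2 +_) (trans (*-comm 2 (r / 2 * 2)) (*-assoc (r / 2) 2 2)))))
      ... | suc (suc _) = contradiction (m%n<n r 2) (λ l → <⇒≱ (subst (_< 2) eq l) (s≤s (s≤s z≤n)))
      finish : Multi ⊎ CrownData → Multi ⊎ (n % 4 ≡ 2 × CrownData)
      finish (inj₁ mu) = inj₁ mu
      finish (inj₂ c) = inj₂ (mod4 c , c)

    mixed : n % 2 ≡ 1 → ∀ {q} → Prime q → p ≢ q → q ∣ n → Multi
    mixed odd {q} pq p≢q (divides r e) = MixedCase.mixed-case torus norm n (torus-exponent p∣n) n<N odd pp pq coprime-qp qe₀ e₀≢0 torsion order transitive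
        {g = el 1 0} not-multiple p-torsion el01≢0 el01∉
      where open PrimeFactor pp pq p≢q {r} (trans e (*-comm r q))

    power : n % 2 ≡ 1 → ∀ s → n ≡ p ^ suc (suc s) → Multi
    power odd s e = PrimePowerCase.prime-power-case torus norm n (torus-exponent p∣n) n<N odd p≥3 n≡ p∣m refl τ-coprime
        (coprime-n (λ d → <⇒≱ p≥3 (∣⇒≤ d))) outside line line-order line-unit full-order
      where open PrimePower {s} pp e

  elementary : (p∣p : p ∣ p) (norm : RegularNorm (Torus.torus p p)) → UnitsStable p norm
  elementary p∣p norm = UnitStable.units-stable (Torus.torus p p) norm p (Torus.torus-exponent p p p∣p) (m<m*n p p 1<p) p-odd pp p≥3 refl

  Outcome : (n : ℕ) .{{_ : NonZero n}} (p∣n : p ∣ n) → RegularNorm (Torus.torus n p) → Set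
  Outcome n p∣n norm = C.Multi n p∣n norm ⊎ (n % 4 ≡ 2 × C.CrownData n p∣n norm) ⊎ (n ≡ p × UnitsStable n norm)

  classify : (n : ℕ) .{{_ : NonZero n}} (p∣n : p ∣ n) (norm : RegularNorm (Torus.torus n p)) → Outcome n p∣n norm
  classify n p∣n norm with n % 2 in eq
  ... | zero with even n p∣n norm eq
  ...   | inj₁ mu = inj₁ mu
  ...   | inj₂ c  = inj₂ (inj₁ c)
  classify n p∣n norm | suc (suc _) = contradiction (m%n<n n 2) (λ l → <⇒≱ (subst (_< 2) eq l) (s≤s (s≤s z≤n)))
  classify n p∣n norm | suc zero with prime-part pp n (≢-nonZero⁻¹ n)
  ... | a , m , n≡ , p∤m with m ≟ 1
  ...   | no m≢1 = inj₁ (by-factor (factorise m {{≢-nonZero m≢0}}))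
    where
    m≢0 : m ≢ 0
    m≢0 z = p∤m (subst (p ∣_) (sym z) (p ∣0))
    by-factor : PrimeFactorisation m → C.Multi n p∣n norm
    by-factor record { factors = [] ; isFactorisation = e } = contradiction e m≢1
    by-factor record { factors = q ∷ qs ; isFactorisation = e ; factorsPrime = pq ∷ _ } =
      mixed n p∣n norm eq pq (λ { refl → p∤m q∣m }) (subst (q ∣_) (sym n≡) (∣-trans q∣m (n∣m*n (p ^ a))))
      where
      q∣m : q ∣ m
      q∣m = subst (q ∣_) (sym e) (m∣m*n (NL.product qs))
  ...   | yes m≡1 = by-exponent a (trans n≡ (trans (cong (p ^ a *_) m≡1) (*-identityʳ _)))
    where
    by-exponent : ∀ a → n ≡ p ^ a → Outcome n p∣n norm
    by-exponent zero          e = contradiction (∣1⇒≡1 (subst (p ∣_) e p∣n)) (λ q → <⇒≢ 1<p (sym q))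
    by-exponent (suc (suc s)) e = inj₁ (power n p∣n norm eq s e)
    by-exponent (suc zero)    e = go n p∣n norm (trans e (*-identityʳ p))
      where
      -- Generalising over everything that depends on `n` allows the equation with `p` to be
      -- matched.
      go : (n : ℕ) .{{_ : NonZero n}} (p∣n : p ∣ n) (norm : RegularNorm (Torus.torus n p)) → n ≡ p → Outcome n p∣n norm
      go n p∣n norm refl = inj₂ (inj₂ (refl , elementary p∣n norm))

-- Coset labellings and recognition of the listed graphs

sumF-++ : ∀ m n (f : Fin (m + n) → ℕ) → sumF f ≡ sumF (λ i → f (i F.↑ˡ n)) + sumF (λ j → f (m F.↑ʳ j))
sumF-++ zero    n f = refl
sumF-++ (suc m) n f = trans (cong (f fzero +_) (sumF-++ m n (f ∘ fsuc))) (sym (+-assoc (f fzero) _ _))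

sumF-combine : ∀ a b (f : Fin (a * b) → ℕ) → sumF f ≡ sumF (λ i → sumF (λ j → f (combine {a} {b} i j)))
sumF-combine zero    b f = refl
sumF-combine (suc a) b f = trans (sumF-++ b (a * b) f) (cong (sumF (λ j → f (j F.↑ˡ (a * b))) +_) (sumF-combine a b (f ∘ (b F.↑ʳ_))))

record Listing {N : ℕ} (A : Fin N → Bool) (c : ℕ) : Set where
  field
    at           : Fin c → Fin N
    at-∈         : ∀ i → at i ∈ A
    at-injective : ∀ i j → at i ≡ at j → i ≡ j
    index        : ∀ x → x ∈ A → ∃ λ i → at i ≡ x

listing : ∀ {N} (A : Fin N → Bool) → Listing A (count A)
listing {zero}  A = record { at = λ () ; at-∈ = λ () ; at-injective = λ () ; index = λ () }
listing {suc N} A with A fzero in eq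
... | true = record
  { at = λ { fzero → fzero ; (fsuc i) → fsuc (at i) }
  ; at-∈ = λ { fzero → eq ; (fsuc i) → at-∈ i }
  ; at-injective = λ { fzero fzero _ → refl ; (fsuc i) (fsuc j) e → cong fsuc (at-injective i j (FP.suc-injective e)) }
  ; index = λ { fzero _ → fzero , refl ; (fsuc x) h → let (i , e) = index x h in fsuc i , cong fsuc e } }
  where open Listing (listing (A ∘ fsuc))
... | false = record
  { at = λ i → fsuc (at i)
  ; at-∈ = at-∈
  ; at-injective = λ i j e → at-injective i j (FP.suc-injective e)
  ; index = λ { fzero h → ⊥-elim (true≢false h eq) ; (fsuc x) h → let (i , e) = index x h in i , cong fsuc e } }
  where open Listing (listing (A ∘ fsuc))

module Representative {N : ℕ} (_~_ : Fin N → Fin N → Set) (_~?_ : ∀ x y → Dec (x ~ y)) where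
  private
    P : Fin N → ℕ → Set
    P x k = ∃ λ y → toℕ y ≡ k × x ~ y

    P? : ∀ x k → Dec (P x k)
    P? x k = any? (λ y → (toℕ y ≟ k) ×-dec (x ~? y))

  abstract
    rep-data : ∀ x → x ~ x → ∃ λ y → x ~ y × (∀ z → x ~ z → toℕ y ≤ toℕ z)
    rep-data x h with least (P x) (P? x) (toℕ x) (x , refl , h)
    ... | k , (y , refl , q) , _ , min = y , q , λ z r → ≮⇒≥ (λ l → min (toℕ z) l (z , refl , r))

  rep : ∀ x → x ~ x → Fin N
  rep x h = proj₁ (rep-data x h)

  rep-~ : ∀ x h → x ~ rep x h
  rep-~ x h = proj₁ (proj₂ (rep-data x h))

  rep-unique : ∀ {x x'} h h' → (∀ z → x ~ z → x' ~ z) → (∀ z → x' ~ z → x ~ z) → rep x h ≡ rep x' h'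
  rep-unique {x} {x'} h h' f g = toℕ-injective (≤-antisym
    (proj₂ (proj₂ (rep-data x h)) _ (g _ (rep-~ x' h'))) (proj₂ (proj₂ (rep-data x' h')) _ (f _ (rep-~ x h))))

module Cosets {N : ℕ} (G : FinAbelianGroup N) (M : Fin N → Bool) (M-𝟘 : FinAbelianGroup.𝟘 G ∈ M)
  (M-⊕ : ∀ x y → x ∈ M → y ∈ M → FinAbelianGroup._⊕_ G x y ∈ M) (M-⊖ : ∀ x → x ∈ M → FinAbelianGroup.⊖_ G x ∈ M) where
  open GroupTheory G

  -- The representatives stay a parameter: the crown graph needs the pair `𝟘`, `z`, whereas a
  -- multipartite graph is content with the least element of each coset.
  module Labelling {t : ℕ} (ρ : Fin t → Fin N) (β : Fin N → Fin t)
    (β-coset : ∀ x → ⊖ ρ (β x) ⊕ x ∈ M) (β-unique : ∀ x i → ⊖ ρ i ⊕ x ∈ M → β x ≡ i) where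
    m : ℕ
    m = count M

    open Listing (listing M)

    offset : ∀ x → Fin m
    offset x = proj₁ (index (⊖ ρ (β x) ⊕ x) (β-coset x))

    at-offset : ∀ x → at (offset x) ≡ ⊖ ρ (β x) ⊕ x
    at-offset x = proj₂ (index (⊖ ρ (β x) ⊕ x) (β-coset x))

    to : Fin N → Fin (t * m)
    to x = combine (β x) (offset x)

    place : Fin t → Fin m → Fin N
    place i j = ρ i ⊕ at j

    from : Fin (t * m) → Fin N
    from k = place (proj₁ (remQuot {t} m k)) (proj₂ (remQuot {t} m k))

    place-offset : ∀ x → place (β x) (offset x) ≡ x
    place-offset x = trans (cong (ρ (β x) ⊕_) (at-offset x)) (gsolve 2 (λ r x → r :+ (:- r :+ x) := x) refl (ρ (β x)) x)

    β-place : ∀ i j → β (place i j) ≡ i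
    β-place i j = β-unique _ i (subst (_∈ M) (gsolve 2 (λ r a → a := :- r :+ (r :+ a)) refl (ρ i) (at j)) (at-∈ j))

    offset-place : ∀ i j → offset (place i j) ≡ j
    offset-place i j = at-injective _ _ (trans (at-offset (place i j)) (trans (cong (λ k → ⊖ ρ k ⊕ place i j) (β-place i j))
      (gsolve 2 (λ r a → :- r :+ (r :+ a) := a) refl (ρ i) (at j))))

    bijection : Fin N ↔ Fin (t * m)
    bijection = mk↔ₛ′ to from
      (λ k → trans (cong₂ combine (β-place _ _) (offset-place _ _)) (combine-remQuot {t} m k))
      (λ x → trans (cong (λ u → place (proj₁ u) (proj₂ u)) (remQuot-combine (β x) (offset x))) (place-offset x))

    remQuot-to : ∀ x → remQuot {t} m (to x) ≡ (β x , offset x)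
    remQuot-to x = remQuot-combine (β x) (offset x)

    size : t * m ≡ N
    size = sym (↔⇒≡ bijection)
      where open import Data.Fin.Permutation using (↔⇒≡)

    same-coset : ∀ x y → β x ≡ β y → ⊖ x ⊕ y ∈ M
    same-coset x y e = subst (_∈ M) (gsolve 3 (λ x y r → :- (:- r :+ x) :+ (:- r :+ y) := :- x :+ y) refl x y (ρ (β x)))
      (M-⊕ _ _ (M-⊖ _ (β-coset x)) (subst (λ i → ⊖ ρ i ⊕ y ∈ M) (sym e) (β-coset y)))

    coset-same : ∀ x y → ⊖ x ⊕ y ∈ M → β x ≡ β y
    coset-same x y h = sym (β-unique y (β x) (subst (_∈ M) (gsolve 3 (λ x y r → (:- r :+ x) :+ (:- x :+ y) := :- r :+ y) refl x y (ρ (β x))) (M-⊕ _ _ (β-coset x) h)))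

  _~_ : Fin N → Fin N → Set
  x ~ y = ⊖ x ⊕ y ∈ M

  ~-refl : ∀ x → x ~ x
  ~-refl x = subst (_∈ M) (sym (⊕-inverseˡ x)) M-𝟘

  ~-trans : ∀ {x y z} → x ~ y → y ~ z → x ~ z
  ~-trans {x} {y} {z} h h' = subst (_∈ M) (gsolve 3 (λ x y z → (:- x :+ y) :+ (:- y :+ z) := :- x :+ z) refl x y z) (M-⊕ _ _ h h')

  ~-sym : ∀ {x y} → x ~ y → y ~ x
  ~-sym {x} {y} h = subst (_∈ M) (gsolve 2 (λ x y → :- (:- x :+ y) := :- y :+ x) refl x y) (M-⊖ _ h)

  open Representative _~_ (λ x y → ∈? M (⊖ x ⊕ y))

  Rb : Fin N → Bool
  Rb x = rep x (~-refl x) ==F x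

  module Reps = Listing (listing Rb)

  rep-∈ : ∀ x → rep x (~-refl x) ∈ Rb
  rep-∈ x = toYes (_ ≟F _) (rep-unique _ _ (λ z h → ~-trans (rep-~ x (~-refl x)) h) (λ z h → ~-trans (~-sym (rep-~ x (~-refl x))) h))

  label : Fin N → Fin (count Rb)
  label x = proj₁ (Reps.index _ (rep-∈ x))

  at-label : ∀ x → Reps.at (label x) ≡ rep x (~-refl x)
  at-label x = proj₂ (Reps.index _ (rep-∈ x))

  module Canonical = Labelling Reps.at label
    (λ x → ~-sym (subst (x ~_) (sym (at-label x)) (rep-~ x (~-refl x))))
    (λ x i h → Reps.at-injective _ _ (trans (at-label x) (trans (rep-unique _ _ (λ z q → ~-trans h q) (λ z q → ~-trans (~-sym h) q)) (==F-sound (Reps.at-∈ i)))))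

module Forms {N : ℕ} (G : FinAbelianGroup N) (norm : RegularNorm G) (S : Fin N → Bool)
  (adjacent : Fin N → Fin N → Bool) (adjacent≡ : ∀ x y → adjacent x y ≡ S (FinAbelianGroup._⊕_ G (FinAbelianGroup.⊖_ G x) y))
  (S⇒cl : ∀ {x} → x ∈ S → RegularNorm.cl norm x ≡ 1) (cl⇒S : ∀ {x} → RegularNorm.cl norm x ≡ 1 → x ∈ S) where
  open Structure G norm

  Γ : Graph
  Γ = record { N = N ; adj = adjacent }

  -- `Multi` makes the complement of the connection set a subgroup; its cosets are the parts.
  multipartite : Multi → ∀ {e} → e ≢ 𝟘 → ∃ λ t → ∃ λ m → 2 ≤ t × t * m ≡ N × Iso Γ (CompleteMultipartite t m)
  multipartite mu e≢0 = count Rb , m , t≥2 , size , bijection , adj-to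
    where
    M : Fin N → Bool
    M x = not (S x)
    M-elim : ∀ {x} → x ∈ M → cl x ≢ 1
    M-elim h e = true≢false (cl⇒S e) (not-elim h)
    M-intro : ∀ {x} → cl x ≢ 1 → x ∈ M
    M-intro n = not-intro (¬true⇒false (λ h → n (S⇒cl h)))
    open Cosets G M (M-intro (λ e → case trans (sym cl-𝟘) e of λ ())) (λ x y a b → M-intro (mu x y (M-elim a) (M-elim b)))
      (λ x a → M-intro (λ e → M-elim a (trans (sym (cl-⊖ x)) e)))
    open Canonical
    s : Fin N
    s = proj₁ (exists-S e≢0)
    t≥2 : 2 ≤ count Rb
    t≥2 = ≤-trans (count-two (λ _ → true) {label 𝟘} {label s} refl refl (λ e → M-elim (same-coset 𝟘 s e)
      (trans (cong cl (gsolve 1 (λ s → :- :0 :+ s := s) refl s)) (proj₂ (exists-S e≢0))))) (≤-reflexive (count-all (count Rb)))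
    adj-to : ∀ x y → adjacent x y ≡ adj (CompleteMultipartite (count Rb) m) (to x) (to y)
    adj-to x y = trans (adjacent≡ x y) (trans (not-not (S (⊖ x ⊕ y))) (cong not (trans
      (bool-ext (λ h → toYes (_ ≟F _) (coset-same x y h)) (λ h → same-coset x y (==F-sound h)))
      (sym (cong₂ (λ a b → proj₁ a ==F proj₁ b) (remQuot-to x) (remQuot-to y))))))
      where
      not-not : ∀ b → b ≡ not (not b)
      not-not true  = refl
      not-not false = refl

  module _ {z : Fin N} (cl-z : cl z ≡ 3) (only-z : ∀ w → cl w ≡ 3 → w ≡ z) (diameter : ∀ w → cl w ≤ 3) (z⊕z : z ⊕ z ≡ 𝟘)
    (nbr-in : ∀ w → cl (z ⊕ ⊖ w) ≡ 1 → cl w ≡ 2) (in-nbr : ∀ w → cl w ≡ 2 → cl (z ⊕ ⊖ w) ≡ 1)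
    (closed : ∀ x y → cl x ≡ 0 ⊎ cl x ≡ 2 → cl y ≡ 0 ⊎ cl y ≡ 2 → cl (x ⊕ y) ≡ 0 ⊎ cl (x ⊕ y) ≡ 2) where
    private
      In : Fin N → Set
      In x = cl x ≡ 0 ⊎ cl x ≡ 2

      In? : ∀ x → Dec (In x)
      In? x = (cl x ≟ 0) ⊎-dec (cl x ≟ 2)

      M : Fin N → Bool
      M x = ⌊ In? x ⌋

      M-elim : ∀ {x} → x ∈ M → In x
      M-elim {x} = fromYes (In? x)

      M-intro : ∀ {x} → In x → x ∈ M
      M-intro {x} = toYes (In? x)

      open Cosets G M (M-intro (inj₁ cl-𝟘)) (λ x y a b → M-intro (closed x y (M-elim a) (M-elim b)))
        (λ x a → M-intro (subst (λ c → c ≡ 0 ⊎ c ≡ 2) (sym (cl-⊖ x)) (M-elim a)))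

      ⊖z : ⊖ z ≡ z
      ⊖z = ⊕-cancelʳ z (trans (⊕-inverseˡ z) (sym z⊕z))

      ρ : Fin 2 → Fin N
      ρ fzero    = 𝟘
      ρ (fsuc _) = z

      other : ∀ {x} → ¬ In x → In (⊖ z ⊕ x)
      other {x} nx with m≤n⇒m<n∨m≡n (diameter x)
      ... | inj₂ e = inj₁ (trans (cong cl (trans (cong (⊖ z ⊕_) (only-z x e)) (⊕-inverseˡ z))) cl-𝟘)
      ... | inj₁ l with cl≡1or2 {x} (≤-pred l) (λ { refl → nx (inj₁ cl-𝟘) })
      ...   | inj₂ e = contradiction (inj₂ e) nx
      ...   | inj₁ e = inj₂ (nbr-in (⊖ z ⊕ x) (trans (cong cl (trans (cong (λ u → z ⊕ ⊖ (u ⊕ x)) ⊖z) (gsolve 2 (λ z x → z :+ :- (z :+ x) := :- x) refl z x))) (trans (cl-⊖ x) e)))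

      β : Fin N → Fin 2
      β x with In? x
      ... | yes _ = fzero
      ... | no _  = fsuc fzero

      β-coset : ∀ x → ⊖ ρ (β x) ⊕ x ∈ M
      β-coset x with In? x
      ... | yes h = M-intro (subst In (gsolve 1 (λ x → x := :- :0 :+ x) refl x) h)
      ... | no h  = M-intro (other h)

      z∉ : ¬ In z
      z∉ (inj₁ e) = case trans (sym cl-z) e of λ ()
      z∉ (inj₂ e) = case trans (sym cl-z) e of λ ()

      β-unique : ∀ x i → ⊖ ρ i ⊕ x ∈ M → β x ≡ i
      β-unique x i h with In? x
      β-unique x fzero        h | yes _ = refl
      β-unique x (fsuc fzero) h | yes a = ⊥-elim (z∉ (subst In (gsolve 2 (λ z x → x :+ :- (:- z :+ x) := z) refl z x)
        (closed x _ a (subst (λ c → c ≡ 0 ⊎ c ≡ 2) (sym (cl-⊖ _)) (M-elim h)))))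
      β-unique x fzero        h | no a = contradiction (subst In (gsolve 1 (λ x → :- :0 :+ x := x) refl x) (M-elim h)) a
      β-unique x (fsuc fzero) h | no _ = refl

      open Labelling ρ β β-coset β-unique

      cross : ∀ i j → i ≢ j → ⊖ ρ i ⊕ ρ j ≡ z
      cross fzero        fzero        ne = contradiction refl ne
      cross fzero        (fsuc fzero) _  = gsolve 1 (λ z → :- :0 :+ z := z) refl z
      cross (fsuc fzero) fzero        _  = trans (⊕-identityʳ _) ⊖z
      cross (fsuc fzero) (fsuc fzero) ne = contradiction refl ne

      M∌S : ∀ {x} → x ∈ M → S x ≡ false
      M∌S {x} h = ¬true⇒false (λ q → absurd (M-elim h) (S⇒cl q))
        where
        absurd : In x → cl x ≡ 1 → ⊥
        absurd (inj₁ e) e' = case trans (sym e) e' of λ ()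
        absurd (inj₂ e) e' = case trans (sym e) e' of λ ()

      -- With representatives `𝟘` and `z`, elements on different sides differ by `z ⊕ ⊖ d`, where
      -- `d` is the difference of their offsets. This has class 1 exactly when `d` has class 2,
      -- which for `d` of class 0 or 2 means that the offsets differ.
      S-to : ∀ x y → S (⊖ x ⊕ y) ≡ not (β x ==F β y) ∧ not (offset x ==F offset y)
      S-to x y = go (β x ≟F β y)
        where
        open Listing (listing M) using (at)
        go : Dec (β x ≡ β y) → S (⊖ x ⊕ y) ≡ not (β x ==F β y) ∧ not (offset x ==F offset y)
        go (yes e) = trans (M∌S (same-coset x y e)) (sym (cong (λ b → not b ∧ not (offset x ==F offset y)) (toYes (β x ≟F β y) e)))
        go (no ne) = trans (bool-ext fwd bwd) (sym (cong (λ b → not b ∧ not (offset x ==F offset y)) (toNo (β x ≟F β y) ne)))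
          where
          d : Fin N
          d = (⊖ ρ (β x) ⊕ x) ⊕ ⊖ (⊖ ρ (β y) ⊕ y)
          eq : ⊖ x ⊕ y ≡ z ⊕ ⊖ d
          eq = trans (gsolve 4 (λ x y a b → :- x :+ y := (:- a :+ b) :+ :- ((:- a :+ x) :+ :- (:- b :+ y))) refl x y (ρ (β x)) (ρ (β y))) (cong (_⊕ ⊖ d) (cross (β x) (β y) ne))
          In-d : In d
          In-d = closed _ _ (M-elim (β-coset x)) (subst (λ c → c ≡ 0 ⊎ c ≡ 2) (sym (cl-⊖ _)) (M-elim (β-coset y)))
          fwd : ⊖ x ⊕ y ∈ S → not (offset x ==F offset y) ≡ true
          fwd h = not-intro (toNo (_ ≟F _) (λ e → case trans (sym (nbr-in d (trans (cong cl (sym eq)) (S⇒cl h)))) (trans (cong cl (d≡𝟘 e)) cl-𝟘) of λ ()))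
            where
            d≡𝟘 : offset x ≡ offset y → d ≡ 𝟘
            d≡𝟘 e = trans (cong (_⊕ ⊖ (⊖ ρ (β y) ⊕ y)) (trans (sym (at-offset x)) (trans (cong at e) (at-offset y)))) (⊕-inverseʳ _)
          bwd : not (offset x ==F offset y) ≡ true → ⊖ x ⊕ y ∈ S
          bwd h = cl⇒S (trans (cong cl eq) (in-nbr d (two In-d)))
            where
            two : In d → cl d ≡ 2
            two (inj₂ e) = e
            two (inj₁ e) = contradiction (Listing.at-injective (listing M) _ _ (trans (at-offset x) (trans (⊖≡𝟘⇒≡ (cl≡0 d e)) (sym (at-offset y))))) (fromNo (offset x ≟F offset y) (not-elim h))

    crown : ∃ λ m → 2 * m ≡ N × Iso Γ (CrownGraph m)
    crown = m , size , bijection , λ x y → trans (adjacent≡ x y) (trans (S-to x y)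
      (sym (cong₂ (λ a b → not (proj₁ a ==F proj₁ b) ∧ not (proj₂ a ==F proj₂ b)) (remQuot-to x) (remQuot-to y))))

square-pred : ∀ q → suc q * suc q ≡ (suc q + 1) * q + 1
square-pred = solve 1 (λ q → (con 1 :+ q) :* (con 1 :+ q) := (con 1 :+ q :+ con 1) :* q :+ con 1) refl
  where open +-*-Solver

module LineForm {N : ℕ} (G : FinAbelianGroup N) (norm : RegularNorm G) (p : ℕ) .{{p≢0 : NonZero p}} (pp : Prime p)
  (exponent : ∀ x → GroupTheory._·_ G p x ≡ FinAbelianGroup.𝟘 G) (N≡ : p * p ≡ N)
  (units : ∀ u → Coprime u p → ∀ s → RegularNorm.cl norm s ≡ 1 → RegularNorm.cl norm (GroupTheory._·_ G u s) ≡ 1) where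
  open Structure G norm
  open Plane G pp exponent N≡

  1<p : 1 < p
  1<p = nonTrivial⇒n>1 p {{prime⇒nonTrivial pp}}

  S≢0 : ∀ {x} → cl x ≡ 1 → x ≢ 𝟘
  S≢0 = cl>0⇒≢

  line-self : ∀ x → Line x x
  line-self x = subst (Line x) (1· x) (line-· 1)

  coefficient≢0 : ∀ {a x} (i : Fin p) → x ≡ toℕ i · a → x ≢ 𝟘 → toℕ i % p ≢ 0
  coefficient≢0 {a} i e nx z = nx (trans e (trans (reduce (toℕ i) a) (cong (_· a) z)))

  line-S : ∀ {a x} → cl a ≡ 1 → Line a x → x ≢ 𝟘 → cl x ≡ 1
  line-S {a} ea (i , e) nx = trans (cong cl e) (units (toℕ i) (coprime-of (toℕ i) (coefficient≢0 i e nx)) a ea)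

  line-sym : ∀ {a x} → x ≢ 𝟘 → Line a x → Line x a
  line-sym {a} {x} nx (i , e) = divide (toℕ i) (coefficient≢0 i e nx) (subst (Line x) e (line-self x))

  line-trans : ∀ {a x y} → Line a x → Line x y → Line a y
  line-trans l (i , refl) = line-multiple (toℕ i) l

  _~_ : Fin N → Fin N → Set
  x ~ y = y ≢ 𝟘 × Line x y

  _~?_ : ∀ x y → Dec (x ~ y)
  x ~? y = ¬? (y ≟F 𝟘) ×-dec Line? x y

  open Representative _~_ _~?_

  -- Picks one generator on each line of the connection set, the one of least index.
  Minimal : Fin N → Set
  Minimal x = cl x ≡ 1 × (∀ z → x ~ z → toℕ x ≤ toℕ z)

  Minimal? : ∀ x → Dec (Minimal x)
  Minimal? x = (cl x ≟ 1) ×-dec all? (λ z → (x ~? z) →-dec (toℕ x ≤? toℕ z))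

  A : Fin N → Bool
  A x = ⌊ Minimal? x ⌋

  r : ℕ
  r = count A

  open Listing (listing A) public

  minimal : ∀ i → Minimal (at i)
  minimal i = fromYes (Minimal? (at i)) (at-∈ i)

  at≢0 : ∀ i → at i ≢ 𝟘
  at≢0 i = cl>0⇒≢ (proj₁ (minimal i))

  independent-at : ∀ {i j} → Line (at i) (at j) → i ≡ j
  independent-at {i} {j} l = at-injective i j (toℕ-injective (≤-antisym
    (proj₂ (minimal i) (at j) (at≢0 j , l)) (proj₂ (minimal j) (at i) (at≢0 i , line-sym (at≢0 j) l))))

  abstract
    cover : ∀ x → cl x ≡ 1 → ∃ λ i → Line (at i) x
    cover x ex = let (y , (ny , l) , min) = rep-data x (cl>0⇒≢ ex , line-self x)
                     (i , e) = index y (toYes (Minimal? y) (line-S ex l ny , λ { z (nz , l') → min z (nz , line-trans l l') }))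
                 in i , line-sym (at≢0 i) (subst (Line x) (sym e) l)

  r≥2 : 2 ≤ r
  r≥2 = ≤-trans (count-two (λ (_ : Fin r) → true) {i₀} {proj₁ second} refl refl (proj₂ second)) (≤-reflexive (count-all r))
    where
    e≢0 : ∃ λ x → ¬ Line 𝟘 x
    e≢0 with any? (λ x → ¬? (Line? 𝟘 x))
    ... | yes h = h
    ... | no none = contradiction (≤-trans (≤-reflexive (trans N≡ (sym (count-all N)))) (count-unique (λ _ → true) (λ x y _ _ → trans (all-zero x) (sym (all-zero y)))))
            (<⇒≱ (≤-trans 1<p (m≤m*n p p)))
      where
      all-zero : ∀ x → x ≡ 𝟘
      all-zero x with Line? 𝟘 x
      ... | yes (i , e) = trans e (·-𝟘 (toℕ i))
      ... | no n = contradiction (x , n) none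
    s : ∃ λ s → cl s ≡ 1
    s = exists-S {proj₁ e≢0} (λ z → proj₂ e≢0 (subst (Line 𝟘) (sym z) line-𝟘))
    i₀ : Fin r
    i₀ = proj₁ (cover (proj₁ s) (proj₂ s))
    second : ∃ λ i → i₀ ≢ i
    second with any? (λ i → ¬? (i₀ ≟F i))
    ... | yes h = h
    ... | no none = let (x , n) = off-line (at i₀) (at≢0 i₀) 1<p in contradiction (generated (Line (at i₀)) line-𝟘 (λ _ _ → line-⊕) gens x) n
      where
      gens : ∀ s → cl s ≡ 1 → Line (at i₀) s
      gens s es with cover s es
      ... | i , l with i₀ ≟F i
      ...   | yes e = subst (λ j → Line (at j) s) (sym e) l
      ...   | no ne = contradiction (i , ne) none

  -- Lines in independent directions share only `𝟘`, so they occupy `R * (p ∸ 1) + 1` of the p²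
  -- elements, and p² - 1 = (p + 1)(p - 1).
  directions : ∀ {R} (w : Fin R → Fin N) → (∀ i → w i ≢ 𝟘) → (∀ i j → i ≢ j → ¬ Line (w i) (w j)) → R ≤ p + 1
  directions {R} w nz ind = *-cancelʳ-≤ R (p + 1) (p ∸ 1) {{>-nonZero (∸-monoˡ-≤ 1 1<p)}} (+-cancelʳ-≤ 1 _ _ (≤-trans total (≤-reflexive (square p (>-nonZero⁻¹ p)))))
    where
    square : ∀ p → 1 ≤ p → p * p ≡ (p + 1) * (p ∸ 1) + 1
    square (suc q) _ = square-pred q
    q : ℕ
    q = p ∸ 1
    small : ∀ (j : Fin q) → suc (toℕ j) < p
    small j = ≤-trans (s≤s (toℕ<n j)) (≤-reflexive (m+[n∸m]≡n (>-nonZero⁻¹ p)))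
    nonzero : ∀ (j : Fin q) → suc (toℕ j) % p ≢ 0
    nonzero j z = case trans (sym (m<n⇒m%n≡m (small j))) z of λ ()
    f : Fin (R * q) → Fin N
    f k = suc (toℕ (proj₂ (remQuot {R} q k))) · w (proj₁ (remQuot {R} q k))
    f-inj : ∀ i i' (j j' : Fin q) → suc (toℕ j) · w i ≡ suc (toℕ j') · w i' → i ≡ i' × j ≡ j'
    f-inj i i' j j' e with i ≟F i'
    ... | no ne = ⊥-elim (ind i i' ne (divide (suc (toℕ j')) (nonzero j') (subst (Line (w i)) e (line-· (suc (toℕ j))))))
    ... | yes refl = refl , toℕ-injective (cong pred (trans (sym (m<n⇒m%n≡m (small j))) (trans
          (independent {𝟘} {w i} (λ { (k , q) → nz i (trans q (·-𝟘 (toℕ k))) }) (suc (toℕ j)) (suc (toℕ j')) 0 0 (cong (_⊕ 𝟘) e)) (m<n⇒m%n≡m (small j')))))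
    total : R * q + 1 ≤ p * p
    total = ≤-trans (+-mono-≤ (≤-trans (≤-reflexive (sym (count-all (R * q)))) (count-inj {A = λ _ → true} {B = λ x → not (x ==F 𝟘)} f
        (λ k _ → not-intro (toNo (f k ≟F 𝟘) (λ e → nz _ (unit-zero (proj₂ (remQuot {R} q k)) (proj₁ (remQuot {R} q k)) e))))
        (λ k k' _ _ e → let (a , b) = f-inj (proj₁ (remQuot {R} q k)) (proj₁ (remQuot {R} q k')) (proj₂ (remQuot {R} q k)) (proj₂ (remQuot {R} q k')) e in trans (sym (combine-remQuot {R} q k)) (trans (cong₂ combine a b) (combine-remQuot {R} q k')))))
      (≤-reflexive (sym (count-δ 𝟘)))) (≤-trans (count-⊎ {A = λ x → not (x ==F 𝟘)} {B = _==F 𝟘} {C = λ _ → true} (λ _ _ → refl) (λ _ _ → refl) (λ x a b → true≢false b (not-elim a)))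
      (≤-reflexive (trans (count-all N) (sym N≡))))
      where
      unit-zero : ∀ (j : Fin q) i → suc (toℕ j) · w i ≡ 𝟘 → w i ≡ 𝟘
      unit-zero j i e with divide {𝟘} (suc (toℕ j)) (nonzero j) (subst (Line 𝟘) (sym e) line-𝟘)
      ... | k , e' = trans e' (·-𝟘 (toℕ k))

  not-multi : Fin N → Fin N → Set
  not-multi x y = cl x ≢ 1 × cl y ≢ 1 × cl (x ⊕ y) ≡ 1

  -- `x` and `y` span two further lines. These are distinct, since otherwise the line would contain
  -- `x ⊕ y` and lie in the connection set. Together with the `r` chosen lines there are at most p +
  -- 1.
  few-lines : ∀ {x y} → not-multi x y → r ≤ p ∸ 1
  few-lines {x} {y} (nx , ny , exy) = ≤-trans (≤-reflexive (sym (m+n∸m≡n 2 r))) (≤-trans (∸-monoˡ-≤ 2 (directions w w≢0 w-ind)) (≤-reflexive (cong (_∸ 2) (+-comm p 1))))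
    where
    x≢0 : x ≢ 𝟘
    x≢0 z = ny (trans (cong cl (sym (trans (cong (_⊕ y) z) (⊕-identityˡ y)))) exy)
    y≢0 : y ≢ 𝟘
    y≢0 z = nx (trans (cong cl (sym (trans (cong (x ⊕_) z) (⊕-identityʳ x)))) exy)
    off : ∀ {v} → cl v ≢ 1 → ∀ i → v ≢ 𝟘 → ¬ Line (at i) v
    off nv i v≢0 l = nv (line-S (proj₁ (minimal i)) l v≢0)
    xy : ¬ Line x y
    xy l = nx (line-S exy (line-sym (cl>0⇒≢ exy) (line-⊕ (line-self x) l)) x≢0)
    w : Fin (suc (suc r)) → Fin N
    w fzero           = x
    w (fsuc fzero)    = y
    w (fsuc (fsuc i)) = at i
    w≢0 : ∀ i → w i ≢ 𝟘
    w≢0 fzero           = x≢0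
    w≢0 (fsuc fzero)    = y≢0
    w≢0 (fsuc (fsuc i)) = at≢0 i
    w-ind : ∀ i j → i ≢ j → ¬ Line (w i) (w j)
    w-ind fzero fzero ne = contradiction refl ne
    w-ind fzero (fsuc fzero) _ = xy
    w-ind fzero (fsuc (fsuc j)) _ l = off nx j x≢0 (line-sym (at≢0 j) l)
    w-ind (fsuc fzero) fzero _ l = xy (line-sym x≢0 l)
    w-ind (fsuc fzero) (fsuc fzero) ne = contradiction refl ne
    w-ind (fsuc fzero) (fsuc (fsuc j)) _ l = off ny j y≢0 (line-sym (at≢0 j) l)
    w-ind (fsuc (fsuc i)) fzero _ = off nx i x≢0
    w-ind (fsuc (fsuc i)) (fsuc fzero) _ = off ny i y≢0
    w-ind (fsuc (fsuc i)) (fsuc (fsuc j)) ne l = ne (cong (fsuc ∘ fsuc) (independent-at l))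

  multi-or-few : Multi ⊎ r ≤ p ∸ 1
  multi-or-few with any? (λ x → any? (λ y → ¬? (cl x ≟ 1) ×-dec (¬? (cl y ≟ 1) ×-dec (cl (x ⊕ y) ≟ 1))))
  ... | yes (x , y , h) = inj₂ (few-lines h)
  ... | no none = inj₁ (λ x y nx ny e → none (x , y , nx , ny , e))

-- The forward implication

module TorusSet (n p : ℕ) .{{n≢0 : NonZero n}} .{{p≢0 : NonZero p}} (S : Zsum n p → Bool) where
  open Torus n p
  open GroupTheory torus

  S′ : Fin (n * p) → Bool
  S′ x = S (unpack x)

  unpack-pack : ∀ g → unpack (pack g) ≡ g
  unpack-pack (a , b) = remQuot-combine a b

  unpack-⊕ : ∀ x y → unpack (x ⊕ y) ≡ addZ n p (unpack x) (unpack y)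
  unpack-⊕ x y = unpack-pack _

  unpack-⊖ : ∀ x → unpack (⊖ x) ≡ negZ n p (unpack x)
  unpack-⊖ x = unpack-pack _

  pack-add : ∀ g h → pack (addZ n p g h) ≡ pack g ⊕ pack h
  pack-add g h = cong₂ (λ a b → pack (addZ n p a b)) (sym (unpack-pack g)) (sym (unpack-pack h))

  pack-neg : ∀ g → pack (negZ n p g) ≡ ⊖ pack g
  pack-neg g = cong (λ a → pack (negZ n p a)) (sym (unpack-pack g))

  diff : ∀ x y → unpack (⊖ x ⊕ y) ≡ diffZ n p (unpack x) (unpack y)
  diff x y = trans (unpack-⊕ (⊖ x) y) (cong (λ a → addZ n p a (unpack y)) (unpack-⊖ x))

  adjacent≡ : ∀ x y → adj (Cay n p S) x y ≡ S′ (⊖ x ⊕ y)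
  adjacent≡ x y = cong S (sym (diff x y))

  module _ (closed : InverseClosed n p S) (S-0 : S (zeroZ n p) ≡ false) where
    S-⊖ : ∀ x → S′ (⊖ x) ≡ S′ x
    S-⊖ x = trans (cong S (unpack-⊖ x)) (closed (unpack x))

    S-𝟘 : S′ 𝟘 ≡ false
    S-𝟘 = trans (cong S (unpack-pack (zeroZ n p))) S-0

identity-iso : ∀ {N} (f g : Fin N → Fin N → Bool) → (∀ x y → f x y ≡ g x y) → Iso (record { N = N ; adj = f }) (record { N = N ; adj = g })
identity-iso f g h = mk↔ₛ′ id id (λ _ → refl) (λ _ → refl) , h

module Forward (p : ℕ) .{{p≢0 : NonZero p}} (pp : Prime p) (p-odd : p % 2 ≡ 1) where
  open Classification p pp p-odd

  module _ (n : ℕ) .{{n≢0 : NonZero n}} (p∣n : p ∣ n) (S : Zsum n p → Bool) (closed : InverseClosed n p S)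
    (S-0 : S (zeroZ n p) ≡ false) (dr : DistanceRegular (Cay n p S)) where
    open Torus n p
    open TorusSet n p S
    module K = CayleyNorm torus S′ (S-⊖ closed S-0) (S-𝟘 closed S-0) (adj (Cay n p S)) adjacent≡
    norm : RegularNorm torus
    norm = K.norm dr
    open Forms torus norm S′ (adj (Cay n p S)) adjacent≡ (K.S⇒cl dr) (K.cl⇒S dr)
    open GroupTheory torus using (𝟘)

    from-multi : C.Multi n p∣n norm → InList n p (Cay n p S)
    from-multi mu = inj₂ (inj₁ (multipartite mu {el 0 1} e≢0))
      where
      e≢0 : el 0 1 ≢ 𝟘
      e≢0 e = <⇒≢ 1<p (sym (∣1⇒≡1 (proj₂ (𝟘≡el {0} {1} e))))

    from-crown : n % 4 ≡ 2 × C.CrownData n p∣n norm → InList n p (Cay n p S)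
    from-crown (h , c) = inj₂ (inj₂ (inj₁ (h , crown cl-z only-z diameter z⊕z nbr-in in-nbr closed′)))
      where open C.CrownData n p∣n norm c renaming (closed to closed′)

  from-units : (p∣p : p ∣ p) (S : Zsum p p → Bool) (closed : InverseClosed p p S) (S-0 : S (zeroZ p p) ≡ false)
    (dr : DistanceRegular (Cay p p S)) → UnitsStable p (norm p p∣p S closed S-0 dr) → InList p p (Cay p p S)
  from-units p∣p S closed S-0 dr units = finish LF.multi-or-few
    where
    open Torus p p
    open TorusSet p p S
    open GroupTheory torus
    nrm : RegularNorm torus
    nrm = norm p p∣p S closed S-0 dr
    module LF = LineForm torus nrm p pp (torus-exponent p∣p) refl units
    module PL = Plane torus pp (torus-exponent p∣p) refl
    module K′ = CayleyNorm torus S′ (S-⊖ closed S-0) (S-𝟘 closed S-0) (adj (Cay p p S)) adjacent≡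
    H : Fin LF.r → Zsum p p → Bool
    H i g = ⌊ PL.Line? (LF.at i) (pack g) ⌋
    subgroup : ∀ i → SubgroupOfOrder p p p (H i)
    subgroup i = toYes (PL.Line? _ _) PL.line-𝟘
      , (λ g h a b → toYes (PL.Line? _ _) (subst (PL.Line (LF.at i)) (sym (pack-add g h)) (PL.line-⊕ (fromYes (PL.Line? _ _) a) (fromYes (PL.Line? _ _) b))))
      , (λ g a → toYes (PL.Line? _ _) (subst (PL.Line (LF.at i)) (sym (pack-neg g)) (PL.line-⊖ (fromYes (PL.Line? _ _) a))))
      , trans (sym (sumF-combine p p (λ x → ⟦ ⌊ PL.Line? (LF.at i) x ⌋ ⟧))) (PL.line-size (LF.at≢0 i))
    distinct : ∀ i j → i ≢ j → ¬ (∀ g → H i g ≡ H j g)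
    distinct i j ne h = ne (LF.independent-at (fromYes (PL.Line? _ _) (subst (λ x → ⌊ PL.Line? (LF.at i) x ⌋ ≡ true) pu
        (trans (h (unpack (LF.at j))) (toYes (PL.Line? _ _) (subst (PL.Line (LF.at j)) (sym pu) (LF.line-self (LF.at j))))))))
      where
      pu : pack (unpack (LF.at j)) ≡ LF.at j
      pu = combine-remQuot {p} p (LF.at j)
    union : ∀ g → S g ≡ unionMinusZero p H g
    union g = bool-ext to from
      where
      S-pack : S′ (pack g) ≡ S g
      S-pack = cong S (unpack-pack g)
      to : S g ≡ true → unionMinusZero p H g ≡ true
      to h = let e = K′.S⇒cl dr (trans S-pack h) ; (i , l) = LF.cover (pack g) e in
        ∧-intro (anyF-intro (λ i → H i g) i (toYes (PL.Line? _ _) l)) (not-intro (¬true⇒false (λ z → LF.S≢0 e (pack-zero g z))))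
        where
        pack-zero : ∀ g → (g ==P zeroZ p p) ≡ true → pack g ≡ 𝟘
        pack-zero (a , b) z = let (q , q') = ∧-elim {a ==F _} z in cong₂ combine (==F-sound q) (==F-sound q')
      from : unionMinusZero p H g ≡ true → S g ≡ true
      from h = let (a , b) = ∧-elim {anyF (λ i → H i g)} h ; (i , l) = anyF-elim (λ i → H i g) a in
        trans (sym S-pack) (K′.cl⇒S dr (LF.line-S (proj₁ (LF.minimal i)) (fromYes (PL.Line? _ _) l) (λ z → true≢false (pack-zero g z) (not-elim b))))
        where
        pack-zero : ∀ g → pack g ≡ 𝟘 → (g ==P zeroZ p p) ≡ true
        pack-zero (a , b) z = let (q , q') = FP.combine-injective a b (0 mod p) (0 mod p) z in ∧-intro (toYes (_ ≟F _) q) (toYes (_ ≟F _) q')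
    finish : _ → InList p p (Cay p p S)
    finish (inj₁ mu) = from-multi p p∣p S closed S-0 dr mu
    finish (inj₂ le) = inj₂ (inj₂ (inj₂ (LF.r , H , (LF.r≥2 , le , subgroup , distinct) , identity-iso _ _ (λ x y → union _))))

  forward : (n : ℕ) .{{n≢0 : NonZero n}} (p∣n : p ∣ n) (S : Zsum n p → Bool) → InverseClosed n p S → S (zeroZ n p) ≡ false →
    DistanceRegular (Cay n p S) → InList n p (Cay n p S)
  forward n p∣n S closed S-0 dr with classify n p∣n (norm n p∣n S closed S-0 dr)
  ... | inj₁ mu = from-multi n p∣n S closed S-0 dr mu
  ... | inj₂ (inj₁ c) = from-crown n p∣n S closed S-0 dr c
  ... | inj₂ (inj₂ (e , units)) = go n p∣n S closed S-0 dr e units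
    where
    go : (n : ℕ) .{{n≢0 : NonZero n}} (p∣n : p ∣ n) (S : Zsum n p → Bool) (closed : InverseClosed n p S) (S-0 : S (zeroZ n p) ≡ false) (dr : DistanceRegular (Cay n p S)) →
      n ≡ p → UnitsStable n (norm n p∣n S closed S-0 dr) → InList n p (Cay n p S)
    go n p∣n S closed S-0 dr refl units = from-units p∣n S closed S-0 dr units

-- Distance-regularity of the listed graphs

module _ {Γ Δ : Graph} (iso : Iso Γ Δ) where
  private
    f = Inverse.to (proj₁ iso)
    g = Inverse.from (proj₁ iso)

    fg : ∀ y → f (g y) ≡ y
    fg y = Inverse.inverseˡ (proj₁ iso) refl

    gf : ∀ x → g (f x) ≡ x
    gf x = Inverse.inverseʳ (proj₁ iso) refl

    module W = Walks Γ
    module W′ = Walks Δ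

    reach-to : ∀ k {x y} → W.R k x y → W′.R k (f x) (f y)
    reach-to zero {x} r = subst (λ u → W′.R 0 (f x) (f u)) (W.R-0 r) (W′.R-refl (f x))
    reach-to (suc k) {x} {y} r with W.R-cases {k} r
    ... | inj₁ h = W′.R-weaken {k} (reach-to k h)
    ... | inj₂ (z , h , a) = W′.R-step {k} (reach-to k h) (trans (sym (proj₂ iso z y)) a)

    reach-from : ∀ k {x y} → W′.R k (f x) (f y) → W.R k x y
    reach-from zero {x} {y} r = subst (W.R 0 x) (trans (sym (gf x)) (trans (cong g (W′.R-0 r)) (gf y))) (W.R-refl x)
    reach-from (suc k) {x} {y} r with W′.R-cases {k} r
    ... | inj₁ h = W.R-weaken {k} (reach-from k h)
    ... | inj₂ (z , h , a) = W.R-step {k} {z = g z} (reach-from k (subst (W′.R k (f x)) (sym (fg z)) h))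
          (trans (proj₂ iso (g z) y) (trans (cong (λ u → adj Δ u (f y)) (fg z)) a))

    reach-≡ : ∀ k x y → reach Γ k x y ≡ reach Δ k (f x) (f y)
    reach-≡ k x y = bool-ext (reach-to k) (reach-from k)

    distIs-≡ : ∀ d x y → distIs Γ d x y ≡ distIs Δ d (f x) (f y)
    distIs-≡ zero    x y = reach-≡ 0 x y
    distIs-≡ (suc d) x y = cong₂ (λ a b → a ∧ not b) (reach-≡ (suc d) x y) (reach-≡ d x y)

    nbrsAt-≡ : ∀ x y j → nbrsAt Γ x y j ≡ nbrsAt Δ (f x) (f y) j
    nbrsAt-≡ x y j = trans (sumF-cong (λ z → cong ⟦_⟧ (cong₂ _∧_ (proj₂ iso y z) (distIs-≡ j x z))))
      (sumF-reindex f g gf fg (λ z → ⟦ adj Δ (f y) z ∧ distIs Δ j (f x) z ⟧))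

  iso-distanceRegular : DistanceRegular Δ → DistanceRegular Γ
  iso-distanceRegular (conn , c , a , b , h) =
    (λ x y → let (d , r) = conn (f x) (f y) in d , reach-from d r) , c , a , b , λ x y i dist →
      let (h₁ , h₂ , h₃) = h (f x) (f y) i (trans (sym (distIs-≡ i x y)) dist)
      in (λ j e → trans (nbrsAt-≡ x y j) (h₁ j e)) , trans (nbrsAt-≡ x y i) h₂ , trans (nbrsAt-≡ x y (suc i)) h₃

-- Paths between non-adjacent vertices are assumed directly and not through a positive μ, so that
-- complete graphs, which have no such pairs, are covered.
module DiameterTwo (Γ : Graph) (k l μ : ℕ) (simple : IsSimple Γ) (degree : ∀ x → count (adj Γ x) ≡ k)
  (adjacent-common : ∀ x y → x ≢ y → adj Γ x y ≡ true → commonNbrs Γ x y ≡ l)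
  (nonadjacent-common : ∀ x y → x ≢ y → adj Γ x y ≡ false → commonNbrs Γ x y ≡ μ)
  (connect : ∀ x y → x ≢ y → adj Γ x y ≡ false → ∃ λ z → adj Γ x z ≡ true × adj Γ z y ≡ true) where
  private
    V = Fin (Graph.N Γ)

    dist : Bool → Bool → ℕ
    dist true  _     = 0
    dist false true  = 1
    dist false false = 2

    δ : V → V → ℕ
    δ x y = dist (x ==F y) (adj Γ x y)

    δ≤2 : ∀ x y → δ x y ≤ 2
    δ≤2 x y with x ==F y | adj Γ x y
    ... | true  | _     = z≤n
    ... | false | true  = s≤s z≤n
    ... | false | false = ≤-refl

    δ-refl : ∀ x → δ x x ≡ 0
    δ-refl x = cong (λ b → dist b (adj Γ x x)) (==F-refl {Graph.N Γ} x)

    dist≡0 : ∀ a b → dist a b ≡ 0 → a ≡ true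
    dist≡0 true  _     _ = refl
    dist≡0 false true  ()
    dist≡0 false false ()

    dist≡1 : ∀ a b → dist a b ≡ 1 → a ≡ false × b ≡ true
    dist≡1 false true  _ = refl , refl
    dist≡1 true  _     ()
    dist≡1 false false ()

    dist≡2 : ∀ a b → dist a b ≡ 2 → a ≡ false × b ≡ false
    dist≡2 false false _ = refl , refl
    dist≡2 true  _     ()
    dist≡2 false true  ()

    δ-0 : ∀ x y → δ x y ≡ 0 → x ≡ y
    δ-0 x y e = ==F-sound {Graph.N Γ} (dist≡0 _ _ e)

    distinct : ∀ {x y} → (x ==F y) ≡ false → x ≢ y
    distinct {x} h refl = true≢false (==F-refl {Graph.N Γ} x) h

    adj≢ : ∀ {x y} → adj Γ x y ≡ true → (x ==F y) ≡ false
    adj≢ {x} {y} a = ¬true⇒false (λ e → true≢false (subst (λ u → adj Γ x u ≡ true) (sym (==F-sound {Graph.N Γ} e)) a) (proj₁ simple x))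

    δ-adj : ∀ {x y} → adj Γ x y ≡ true → δ x y ≡ 1
    δ-adj a = cong₂ dist (adj≢ a) a

    δ-step : ∀ x y z → adj Γ y z ≡ true → δ x z ≤ suc (δ x y)
    δ-step x y z a with δ x y in e
    ... | suc _ = ≤-trans (δ≤2 x z) (s≤s (s≤s z≤n))
    ... | zero  = ≤-reflexive (δ-adj (subst (λ u → adj Γ u z ≡ true) (sym (δ-0 x y e)) a))

    δ-pred : ∀ x z i → δ x z ≡ suc i → ∃ λ y → δ x y ≡ i × adj Γ y z ≡ true
    δ-pred x z zero e = x , δ-refl x , proj₂ (dist≡1 _ _ e)
    δ-pred x z (suc zero) e = let (a , b) = dist≡2 _ _ e ; (y , p , q) = connect x z (distinct a) b in y , δ-adj p , q
    δ-pred x z (suc (suc i)) e = contradiction (≤-trans (≤-reflexive (sym e)) (δ≤2 x z)) (<⇒≱ (s≤s (s≤s (s≤s z≤n))))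

    open Walks Γ

    nb : V → V → ℕ → ℕ
    nb x y j = count (λ z → adj Γ y z ∧ ⌊ δ x z ≟ j ⌋)

    nb-0 : ∀ x y → nb x y 0 ≡ ⟦ adj Γ y x ⟧
    nb-0 x y = trans (sumF-cong pt) (sumF-δ (λ z → ⟦ adj Γ y z ⟧) x)
      where
      pt : ∀ z → ⟦ adj Γ y z ∧ ⌊ δ x z ≟ 0 ⌋ ⟧ ≡ ⟦ z ==F x ⟧ * ⟦ adj Γ y z ⟧
      pt z = trans (⟦⟧-∧ (adj Γ y z) _) (trans (*-comm ⟦ adj Γ y z ⟧ _) (cong (λ b → ⟦ b ⟧ * ⟦ adj Γ y z ⟧) (trans
        (bool-ext (λ h → dist≡0 _ _ (fromYes (δ x z ≟ 0) h)) (λ h → toYes (δ x z ≟ 0) (cong (λ b → dist b (adj Γ x z)) h))) (==F-sym {Graph.N Γ} x z))))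

    nb-1 : ∀ x y → nb x y 1 ≡ commonNbrs Γ x y
    nb-1 x y = sumF-cong (λ z → cong ⟦_⟧ (trans (cong (adj Γ y z ∧_) (bool-ext (λ h → proj₂ (dist≡1 _ _ (fromYes (δ x z ≟ 1) h))) (λ h → toYes (δ x z ≟ 1) (δ-adj h))))
      (∧-comm (adj Γ y z) (adj Γ x z))))

    nb-total : ∀ x y → (nb x y 0 + nb x y 1) + nb x y 2 ≡ k
    nb-total x y = trans (cong (_+ nb x y 2) (sym (sumF-+ (λ z → ⟦ adj Γ y z ∧ ⌊ δ x z ≟ 0 ⌋ ⟧) (λ z → ⟦ adj Γ y z ∧ ⌊ δ x z ≟ 1 ⌋ ⟧))))
      (trans (sym (sumF-+ (λ z → ⟦ adj Γ y z ∧ ⌊ δ x z ≟ 0 ⌋ ⟧ + ⟦ adj Γ y z ∧ ⌊ δ x z ≟ 1 ⌋ ⟧) (λ z → ⟦ adj Γ y z ∧ ⌊ δ x z ≟ 2 ⌋ ⟧)))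
        (trans (sumF-cong pt) (degree y)))
      where
      pt : ∀ z → (⟦ adj Γ y z ∧ ⌊ δ x z ≟ 0 ⌋ ⟧ + ⟦ adj Γ y z ∧ ⌊ δ x z ≟ 1 ⌋ ⟧) + ⟦ adj Γ y z ∧ ⌊ δ x z ≟ 2 ⌋ ⟧ ≡ ⟦ adj Γ y z ⟧
      pt z with adj Γ y z
      ... | false = refl
      ... | true with x ==F z | adj Γ x z
      ...   | true  | _     = refl
      ...   | false | true  = refl
      ...   | false | false = refl

    nb-2 : ∀ x y {u v} → nb x y 0 ≡ u → nb x y 1 ≡ v → nb x y 2 ≡ k ∸ (u + v)
    nb-2 x y refl refl = trans (sym (m+n∸m≡n (nb x y 0 + nb x y 1) (nb x y 2))) (cong (_∸ (nb x y 0 + nb x y 1)) (nb-total x y))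

    nb-3 : ∀ x y → nb x y 3 ≡ 0
    nb-3 x y = count-empty _ (λ z h → <⇒≱ (≤-reflexive (sym (fromYes (δ x z ≟ 3) (proj₂ (∧-elim {adj Γ y z} h))))) (δ≤2 x z))

    -- The catch-all clauses give the values for distance 2, the largest that occurs.
    c a b : ℕ → ℕ
    c 1 = 1
    c _ = μ
    a 0 = 0
    a 1 = l
    a _ = k ∸ μ
    b 0 = k
    b 1 = k ∸ (1 + l)
    b _ = 0

    at : ∀ x y j → nbrsAt Γ x y j ≡ nb x y j
    at = nbrsAt-δ δ δ-refl δ-0 δ-step δ-pred

    arrays : ∀ x y i → δ x y ≡ i → (∀ j → i ≡ suc j → nbrsAt Γ x y j ≡ c i) × nbrsAt Γ x y i ≡ a i × nbrsAt Γ x y (suc i) ≡ b i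
    arrays x y 0 e with δ-0 x y e
    ... | refl = (λ _ ()) , trans (at x x 0) (trans (nb-0 x x) (⟦⟧-false (proj₁ simple x)))
               , trans (at x x 1) (trans (nb-1 x x) (trans (sumF-cong (λ z → cong ⟦_⟧ (∧-idem (adj Γ x z)))) (degree x)))
      where
      ∧-idem : ∀ b → b ∧ b ≡ b
      ∧-idem true  = refl
      ∧-idem false = refl
    arrays x y 1 e = let (d , ad) = dist≡1 _ _ e
                         n0 = trans (nb-0 x y) (⟦⟧-true (trans (proj₂ simple y x) ad))
                         n1 = trans (nb-1 x y) (adjacent-common x y (distinct d) ad)
      in (λ { zero refl → trans (at x y 0) n0 }) , trans (at x y 1) n1 , trans (at x y 2) (nb-2 x y n0 n1)
    arrays x y 2 e = let (d , na) = dist≡2 _ _ e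
                         n0 = trans (nb-0 x y) (⟦⟧-false (trans (proj₂ simple y x) na))
                         n1 = trans (nb-1 x y) (nonadjacent-common x y (distinct d) na)
      in (λ { (suc zero) refl → trans (at x y 1) n1 }) , trans (at x y 2) (nb-2 x y n0 n1) , trans (at x y 3) (nb-3 x y)
    arrays x y (suc (suc (suc i))) e = contradiction (≤-trans (≤-reflexive (sym e)) (δ≤2 x y)) (<⇒≱ (s≤s (s≤s (s≤s z≤n))))

  distanceRegular : DistanceRegular Γ
  distanceRegular = δ-connected δ δ-refl δ-0 δ-step δ-pred , c , a , b ,
    λ x y i h → arrays x y i (fromYes (δ x y ≟ i) (trans (sym (distIs-δ δ δ-refl δ-0 δ-step δ-pred i x y)) h))

count-not : ∀ {N} (A : Fin N → Bool) → count (λ x → not (A x)) ≡ N ∸ count A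
count-not {N} A = trans (sym (m+n∸m≡n (count A) _)) (cong (_∸ count A) (trans (sym (sumF-+ (λ x → ⟦ A x ⟧) (λ x → ⟦ not (A x) ⟧)))
  (trans (sumF-cong (λ x → comp (A x))) (count-all N))))
  where
  comp : ∀ b → ⟦ b ⟧ + ⟦ not b ⟧ ≡ 1
  comp true  = refl
  comp false = refl

-- Complete graphs are the case of singleton fibres, so they and the multipartite graphs are handled
-- together.
module PartitionGraph {N t : ℕ} (π : Fin N → Fin t) (m : ℕ) (fibre-size : ∀ x → count (λ z → π x ==F π z) ≡ m)
  (connect : ∀ x y → x ≢ y → π x ≡ π y → ∃ λ z → π x ≢ π z) where
  Γ : Graph
  Γ = record { N = N ; adj = λ x y → not (π x ==F π y) }

  private
    common : ∀ x y → (∀ z → (π x ==F π z) ≡ true → (π y ==F π z) ≡ true → ⊥) → commonNbrs Γ x y ≡ N ∸ (m + m)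
    common x y d = trans (sumF-cong (λ z → cong ⟦_⟧ (de-morgan (π x ==F π z) (π y ==F π z)))) (trans (count-not (λ z → (π x ==F π z) ∨ (π y ==F π z))) (cong (N ∸_)
      (trans (sumF-cong (λ z → disjoint _ _ (d z))) (trans (sumF-+ (λ z → ⟦ π x ==F π z ⟧) (λ z → ⟦ π y ==F π z ⟧)) (cong₂ _+_ (fibre-size x) (fibre-size y))))))
      where
      de-morgan : ∀ a b → not a ∧ not b ≡ not (a ∨ b)
      de-morgan true  _ = refl
      de-morgan false _ = refl
      disjoint : ∀ a b → (a ≡ true → b ≡ true → ⊥) → ⟦ a ∨ b ⟧ ≡ ⟦ a ⟧ + ⟦ b ⟧
      disjoint true  true  h = ⊥-elim (h refl refl)
      disjoint true  false _ = refl
      disjoint false _     _ = refl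

    same : ∀ x y → π x ≡ π y → ∀ z → not (π x ==F π z) ∧ not (π y ==F π z) ≡ not (π x ==F π z)
    same x y e z = trans (cong (λ u → not (π x ==F π z) ∧ not (u ==F π z)) (sym e)) (idem (not (π x ==F π z)))
      where
      idem : ∀ b → b ∧ b ≡ b
      idem true  = refl
      idem false = refl

    simple : IsSimple Γ
    simple = (λ x → cong not (==F-refl (π x))) , (λ x y → cong not (==F-sym (π x) (π y)))

    degree : ∀ x → count (adj Γ x) ≡ N ∸ m
    degree x = trans (count-not (λ z → π x ==F π z)) (cong (N ∸_) (fibre-size x))

    adjacent-common : ∀ x y → x ≢ y → adj Γ x y ≡ true → commonNbrs Γ x y ≡ N ∸ (m + m)
    adjacent-common x y _ a = common x y (λ z p q → true≢false (toYes (_ ≟F _) (trans (==F-sound p) (sym (==F-sound q)))) (not-elim a))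

    nonadjacent-common : ∀ x y → x ≢ y → adj Γ x y ≡ false → commonNbrs Γ x y ≡ N ∸ m
    nonadjacent-common x y _ na = trans (sumF-cong (λ z → cong ⟦_⟧ (same x y (==F-sound (not-injective na)) z))) (degree x)

    path : ∀ x y → x ≢ y → adj Γ x y ≡ false → ∃ λ z → adj Γ x z ≡ true × adj Γ z y ≡ true
    path x y ne na = let e = ==F-sound (not-injective na) ; (z , n) = connect x y ne e in
      z , not-intro (toNo (_ ≟F _) n) , not-intro (toNo (_ ≟F _) (λ q → n (trans e (sym q))))

  distanceRegular : DistanceRegular Γ
  distanceRegular = DiameterTwo.distanceRegular Γ (N ∸ m) (N ∸ (m + m)) (N ∸ m) simple degree adjacent-common nonadjacent-common path

complete-distanceRegular : ∀ N → DistanceRegular (Complete N)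
complete-distanceRegular N = PartitionGraph.distanceRegular {N} {N} id 1
  (λ x → trans (sumF-cong (λ z → cong ⟦_⟧ (==F-sym x z))) (count-δ x)) (λ x y ne e → contradiction e ne)

multipartite-distanceRegular : ∀ t m → 2 ≤ t → DistanceRegular (CompleteMultipartite t m)
multipartite-distanceRegular t m t≥2 = PartitionGraph.distanceRegular {t * m} {t} part m size other
  where
  part : Fin (t * m) → Fin t
  part x = proj₁ (remQuot {t} m x)
  size : ∀ x → count (λ z → part x ==F part z) ≡ m
  size x = begin
    count (λ z → part x ==F part z)                                   ≡⟨ sumF-combine t m (λ z → ⟦ part x ==F part z ⟧) ⟩
    sumF (λ i → sumF (λ j → ⟦ part x ==F part (combine {t} {m} i j) ⟧)) ≡⟨ sumF-cong (λ i → trans (sumF-cong {m} (λ j → cong (λ u → ⟦ part x ==F proj₁ u ⟧) (remQuot-combine {t} {m} i j))) (sumF-const m ⟦ part x ==F i ⟧)) ⟩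
    sumF (λ i → m * ⟦ part x ==F i ⟧)                                 ≡⟨ sumF-cong (λ i → trans (*-comm m _) (cong (λ b → ⟦ b ⟧ * m) (==F-sym (part x) i))) ⟩
    sumF (λ i → ⟦ i ==F part x ⟧ * m)                                 ≡⟨ sumF-δ (λ _ → m) (part x) ⟩
    m                                                                 ∎
    where open ≡-Reasoning
  other : ∀ x y → x ≢ y → part x ≡ part y → ∃ λ z → part x ≢ part z
  other x y _ _ = let (i , _ , ne) = count-≥2 (λ _ → true) (≤-trans t≥2 (≤-reflexive (sym (count-all t)))) (part x) in
    combine i (proj₂ (remQuot {t} m x)) , λ e → ne (sym (trans e (cong proj₁ (remQuot-combine {t} {m} i (proj₂ (remQuot {t} m x))))))

module Crown (m : ℕ) (m≥3 : 3 ≤ m) where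
  private
    Γ = CrownGraph m
    V = Fin (2 * m)

    side : V → Fin 2
    side x = proj₁ (remQuot {2} m x)

    idx : V → Fin m
    idx x = proj₂ (remQuot {2} m x)

    -- The arguments say whether the sides and the indices agree. Equal indices on opposite sides
    -- mark a removed matching edge, whose ends are at distance 3.
    d : Bool → Bool → ℕ
    d true  true  = 0
    d false false = 1
    d true  false = 2
    d false true  = 3

    δ : V → V → ℕ
    δ x y = d (side x ==F side y) (idx x ==F idx y)

    flip : Fin 2 → Fin 2
    flip fzero    = fsuc fzero
    flip (fsuc _) = fzero

    flip≢ : ∀ a → (flip a ==F a) ≡ false
    flip≢ fzero        = refl
    flip≢ (fsuc fzero) = refl

    ≢flip : ∀ a → (a ==F flip a) ≡ false
    ≢flip fzero        = refl
    ≢flip (fsuc fzero) = refl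

    opposite : ∀ (a b c : Fin 2) → (b ==F c) ≡ false → (a ==F c) ≡ not (a ==F b)
    opposite fzero        fzero        (fsuc fzero) _ = refl
    opposite fzero        (fsuc fzero) fzero        _ = refl
    opposite (fsuc fzero) fzero        (fsuc fzero) _ = refl
    opposite (fsuc fzero) (fsuc fzero) fzero        _ = refl
    opposite _ fzero fzero ()
    opposite _ (fsuc fzero) (fsuc fzero) ()

    side-combine : ∀ a i → side (combine {2} {m} a i) ≡ a
    side-combine a i = cong proj₁ (remQuot-combine {2} {m} a i)

    idx-combine : ∀ a i → idx (combine {2} {m} a i) ≡ i
    idx-combine a i = cong proj₂ (remQuot-combine {2} {m} a i)

    -- The bound `3 ≤ m` enters here: a path between non-adjacent vertices turns at an index
    -- different from both of theirs.
    third : ∀ (i j : Fin m) → ∃ λ l → l ≢ i × l ≢ j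
    third i j with count-≥2 (λ l → not (l ==F i)) (≤-trans (∸-monoˡ-≤ 1 m≥3) (≤-reflexive (trans (cong (m ∸_) (sym (count-δ i))) (sym (count-not (_==F i)))))) j
    ... | l , h , ne = l , fromNo (l ≟F i) (not-elim h) , ne

    δ-refl : ∀ x → δ x x ≡ 0
    δ-refl x = cong₂ d (==F-refl (side x)) (==F-refl (idx x))

    d≡0 : ∀ a b → d a b ≡ 0 → a ≡ true × b ≡ true
    d≡0 true  true  _ = refl , refl
    d≡0 true  false ()
    d≡0 false true  ()
    d≡0 false false ()

    δ-0 : ∀ x y → δ x y ≡ 0 → x ≡ y
    δ-0 x y e = let (a , b) = d≡0 (side x ==F side y) (idx x ==F idx y) e in
      trans (sym (combine-remQuot {2} m x)) (trans (cong₂ combine (==F-sound a) (==F-sound b)) (combine-remQuot {2} m y))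

    step : ∀ s i i' → ¬ (i ≡ true × i' ≡ true) → d (not s) i' ≤ suc (d s i)
    step true  true  true  h = ⊥-elim (h (refl , refl))
    step true  true  false _ = ≤-refl
    step true  false true  _ = ≤-refl
    step true  false false _ = s≤s z≤n
    step false true  true  h = ⊥-elim (h (refl , refl))
    step false true  false _ = s≤s (s≤s z≤n)
    step false false true  _ = z≤n
    step false false false _ = ≤-refl

    δ-step : ∀ x y z → adj Γ y z ≡ true → δ x z ≤ suc (δ x y)
    δ-step x y z h = let (a , b) = ∧-elim {not (side y ==F side z)} h in
      ≤-trans (≤-reflexive (cong (λ s → d s (idx x ==F idx z)) (opposite (side x) (side y) (side z) (not-elim a))))
        (step (side x ==F side y) (idx x ==F idx y) (idx x ==F idx z)
          (λ { (p , q) → true≢false (toYes (idx y ≟F idx z) (trans (sym (==F-sound p)) (==F-sound q))) (not-elim b) }))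

    δ-pred : ∀ x z i → δ x z ≡ suc i → ∃ λ y → δ x y ≡ i × adj Γ y z ≡ true
    δ-pred x z i e = go (side x ==F side z) (idx x ==F idx z) refl refl e
      where
      at : ∀ a l → idx x ≢ l → δ x (combine a l) ≡ d (side x ==F a) false
      at a l ne = cong₂ d (cong (side x ==F_) (side-combine a l)) (trans (cong (idx x ==F_) (idx-combine a l)) (toNo (idx x ≟F l) ne))
      link : ∀ a l → (a ==F side z) ≡ false → l ≢ idx z → adj Γ (combine a l) z ≡ true
      link a l h ne = ∧-intro (not-intro (trans (cong (_==F side z) (side-combine a l)) h)) (not-intro (trans (cong (_==F idx z) (idx-combine a l)) (toNo (l ≟F idx z) ne)))
      go : ∀ s j → (side x ==F side z) ≡ s → (idx x ==F idx z) ≡ j → d s j ≡ suc i → ∃ λ y → δ x y ≡ i × adj Γ y z ≡ true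
      go true true _ _ ()
      go false false es ej refl = x , δ-refl x , ∧-intro (not-intro es) (not-intro ej)
      go true false es _ refl = let (l , n₁ , n₂) = third (idx x) (idx z) in combine (flip (side x)) l ,
        trans (at (flip (side x)) l (λ q → n₁ (sym q))) (cong (λ b → d b false) (≢flip (side x))) ,
        link (flip (side x)) l (subst (λ u → (flip (side x) ==F u) ≡ false) (==F-sound es) (flip≢ (side x))) n₂
      go false true es _ refl = let (l , n₁ , n₂) = third (idx x) (idx z) in combine (side x) l ,
        trans (at (side x) l (λ q → n₁ (sym q))) (cong (λ b → d b false) (==F-refl (side x))) , link (side x) l es n₂

    weight : (Bool → Bool) → ℕ
    weight B = ⟦ B true ⟧ + (m ∸ 1) * ⟦ B false ⟧

    -- `weight` sums over all indices, exactly one of which equals `i`; leaving out `j` subtracts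
    -- its own term.
    count-weight : ∀ (B : Bool → Bool) (i j : Fin m) → count (λ l → not (j ==F l) ∧ B (i ==F l)) ≡ weight B ∸ ⟦ B (i ==F j) ⟧
    count-weight B i j = trans (sym (m+n∸m≡n ⟦ B (i ==F j) ⟧ _)) (cong (_∸ ⟦ B (i ==F j) ⟧) (trans
        (cong (_+ count (λ l → not (j ==F l) ∧ B (i ==F l))) (sym (sumF-δ (λ l → ⟦ B (i ==F l) ⟧) j)))
        (trans (sym (sumF-+ (λ l → ⟦ l ==F j ⟧ * ⟦ B (i ==F l) ⟧) (λ l → ⟦ not (j ==F l) ∧ B (i ==F l) ⟧))) (trans (sumF-cong split) total))))
      where
      split : ∀ l → ⟦ l ==F j ⟧ * ⟦ B (i ==F l) ⟧ + ⟦ not (j ==F l) ∧ B (i ==F l) ⟧ ≡ ⟦ B (i ==F l) ⟧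
      split l = trans (cong (λ b → ⟦ b ⟧ * ⟦ B (i ==F l) ⟧ + ⟦ not (j ==F l) ∧ B (i ==F l) ⟧) (==F-sym l j)) (bool (j ==F l) (B (i ==F l)))
        where
        bool : ∀ a b → ⟦ a ⟧ * ⟦ b ⟧ + ⟦ not a ∧ b ⟧ ≡ ⟦ b ⟧
        bool true  true  = refl
        bool true  false = refl
        bool false b     = refl
      total : sumF (λ l → ⟦ B (i ==F l) ⟧) ≡ weight B
      total = trans (sumF-cong (λ l → trans (bool (i ==F l)) (cong (λ b → ⟦ b ⟧ * ⟦ B true ⟧ + ⟦ not b ⟧ * ⟦ B false ⟧) (==F-sym i l))))
        (trans (sumF-+ (λ l → ⟦ l ==F i ⟧ * ⟦ B true ⟧) (λ l → ⟦ not (l ==F i) ⟧ * ⟦ B false ⟧)) (cong₂ _+_ (sumF-δ (λ _ → ⟦ B true ⟧) i)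
          (trans (sumF-*ʳ ⟦ B false ⟧ (λ l → ⟦ not (l ==F i) ⟧)) (cong (_* ⟦ B false ⟧) (trans (count-not (_==F i)) (cong (m ∸_) (count-δ i)))))))
        where
        bool : ∀ a → ⟦ B a ⟧ ≡ ⟦ a ⟧ * ⟦ B true ⟧ + ⟦ not a ⟧ * ⟦ B false ⟧
        bool true  = sym (trans (+-identityʳ _) (+-identityʳ _))
        bool false = sym (+-identityʳ _)

    open Walks Γ

    level : ℕ → Bool → Bool → Bool
    level j s i = ⌊ d (not s) i ≟ j ⌋

    value : Bool → Bool → ℕ → ℕ
    value s i j = weight (level j s) ∸ ⟦ level j s i ⟧

    nbrs-value : ∀ x y j → nbrsAt Γ x y j ≡ value (side x ==F side y) (idx x ==F idx y) j
    nbrs-value x y j = begin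
      nbrsAt Γ x y j
        ≡⟨ nbrsAt-δ δ δ-refl δ-0 δ-step δ-pred x y j ⟩
      count (λ z → adj Γ y z ∧ ⌊ δ x z ≟ j ⌋)
        ≡⟨ sumF-combine 2 m (λ z → ⟦ adj Γ y z ∧ ⌊ δ x z ≟ j ⌋ ⟧) ⟩
      sumF (λ a → sumF (λ l → ⟦ adj Γ y (combine {2} {m} a l) ∧ ⌊ δ x (combine {2} {m} a l) ≟ j ⌋ ⟧))
        ≡⟨ sumF-cong {2} (λ a → sumF-cong {m} (λ l → cong ⟦_⟧ (cong₂ (λ s i → (not (side y ==F s) ∧ not (idx y ==F i)) ∧ ⌊ d (side x ==F s) (idx x ==F i) ≟ j ⌋) (side-combine a l) (idx-combine a l)))) ⟩
      sumF {2} F′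
        ≡⟨ only (side y) F′ (trans (sumF-cong {m} (λ l → cong (λ b → ⟦ (not b ∧ not (idx y ==F l)) ∧ ⌊ d (side x ==F side y) (idx x ==F l) ≟ j ⌋ ⟧) (==F-refl (side y)))) (sumF-0 m)) ⟩
      F′ (flip (side y))
        ≡⟨ sumF-cong {m} (λ l → cong₂ (λ b c → ⟦ (not b ∧ not (idx y ==F l)) ∧ ⌊ d c (idx x ==F l) ≟ j ⌋ ⟧) (≢flip (side y)) (opposite (side x) (side y) (flip (side y)) (≢flip (side y)))) ⟩
      count (λ l → not (idx y ==F l) ∧ level j (side x ==F side y) (idx x ==F l))
        ≡⟨ count-weight (level j (side x ==F side y)) (idx x) (idx y) ⟩
      value (side x ==F side y) (idx x ==F idx y) j ∎
      where
      open ≡-Reasoning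
      F′ : Fin 2 → ℕ
      F′ a = sumF (λ l → ⟦ (not (side y ==F a) ∧ not (idx y ==F l)) ∧ ⌊ d (side x ==F a) (idx x ==F l) ≟ j ⌋ ⟧)
      only : ∀ b (F : Fin 2 → ℕ) → F b ≡ 0 → sumF F ≡ F (flip b)
      only fzero        F e = trans (cong (_+ (F (fsuc fzero) + 0)) e) (+-identityʳ _)
      only (fsuc fzero) F e = trans (cong (λ t → F fzero + (t + 0)) e) (+-identityʳ _)

    -- inverse of d, extended arbitrarily
    decode : ℕ → Bool × Bool
    decode 0 = true , true
    decode 1 = false , false
    decode 2 = true , false
    decode _ = false , true

    decode-d : ∀ s i → decode (d s i) ≡ (s , i)
    decode-d true  true  = refl
    decode-d false false = refl
    decode-d true  false = refl
    decode-d false true  = refl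

    array : ℕ → ℕ → ℕ
    array i j = value (proj₁ (decode i)) (proj₂ (decode i)) j

    nbrs-array : ∀ x y i j → δ x y ≡ i → nbrsAt Γ x y j ≡ array i j
    nbrs-array x y i j refl = trans (nbrs-value x y j) (sym (cong (λ u → value (proj₁ u) (proj₂ u) j) (decode-d (side x ==F side y) (idx x ==F idx y))))

  crown-distanceRegular : DistanceRegular (CrownGraph m)
  crown-distanceRegular = δ-connected δ δ-refl δ-0 δ-step δ-pred , (λ i → array i (pred i)) , (λ i → array i i) , (λ i → array i (suc i)) ,
    λ x y i h → let e = fromYes (δ x y ≟ i) (trans (sym (distIs-δ δ δ-refl δ-0 δ-step δ-pred i x y)) h) in
      (λ { j refl → nbrs-array x y (suc j) j e }) , nbrs-array x y i i e , nbrs-array x y i (suc i) e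

-- Unions of lines: strongly regular parameters and the transversal design

private module ParameterArithmetic where
  open +-*-Solver using (solve; _:+_; _:*_; _:=_; con)

  expand : ∀ a b u v r → (a + r * u) * (b + r * v) ≡ ((a * b + r * (v * a)) + r * (u * b)) + r * r * (u * v)
  expand = solve 5 (λ a b u v r → (a :+ r :* u) :* (b :+ r :* v) := ((a :* b :+ r :* (v :* a)) :+ r :* (u :* b)) :+ r :* r :* (u :* v)) refl

  adjacent-parameter : ∀ c p r → 1 ≤ r → c + r * 1 + r * 1 ≡ p * 1 + r * (r ∸ 1) → c ≡ (p + r * r) ∸ 3 * r
  adjacent-parameter c p (suc q) _ e = trans (sym (m+n∸n≡m c (3 * suc q))) (cong (_∸ 3 * suc q) (begin
    c + 3 * suc q                              ≡⟨ solve 2 (λ c r → c :+ con 3 :* r := (c :+ r :* con 1 :+ r :* con 1) :+ r) refl c (suc q) ⟩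
    (c + suc q * 1 + suc q * 1) + suc q        ≡⟨ cong (_+ suc q) e ⟩
    (p * 1 + suc q * q) + suc q                ≡⟨ solve 2 (λ p q → (p :* con 1 :+ (con 1 :+ q) :* q) :+ (con 1 :+ q) := p :+ (con 1 :+ q) :* (con 1 :+ q)) refl p q ⟩
    p + suc q * suc q                          ∎))
    where open ≡-Reasoning

  nonadjacent-parameter : ∀ c p r → c + r * 0 + r * 0 ≡ p * 0 + r * (r ∸ 1) → c ≡ r * r ∸ r
  nonadjacent-parameter c p r e = begin
    c                      ≡⟨ solve 2 (λ c r → c := c :+ r :* con 0 :+ r :* con 0) refl c r ⟩
    c + r * 0 + r * 0      ≡⟨ e ⟩
    p * 0 + r * (r ∸ 1)    ≡⟨ cong (_+ r * (r ∸ 1)) (*-zeroʳ p) ⟩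
    r * (r ∸ 1)            ≡⟨ *-distribˡ-∸ r r 1 ⟩
    r * r ∸ r * 1          ≡⟨ cong (r * r ∸_) (*-identityʳ r) ⟩
    r * r ∸ r              ∎
    where open ≡-Reasoning
open ParameterArithmetic

module LineUnion (p : ℕ) .{{p≢0 : NonZero p}} (pp : Prime p) (r : ℕ) (H : Fin r → Zsum p p → Bool) (data-IV : ItemIVData p r H) where
  open Torus p p
  open GroupTheory torus
  open TorusSet p p (unionMinusZero p H)
  module PL = Plane torus pp (torus-exponent ∣-refl) refl

  private
    N = p * p
    V = Fin (p * p)

    Γ : Graph
    Γ = Cay p p (unionMinusZero p H)

    r≥2 : 2 ≤ r
    r≥2 = proj₁ data-IV

    subgroup : ∀ i → SubgroupOfOrder p p p (H i)
    subgroup = proj₁ (proj₂ (proj₂ data-IV))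

    distinct : ∀ i j → i ≢ j → ¬ (∀ g → H i g ≡ H j g)
    distinct = proj₂ (proj₂ (proj₂ data-IV))

    H′ : Fin r → V → Bool
    H′ i x = H i (unpack x)

    H-𝟘 : ∀ i → 𝟘 ∈ H′ i
    H-𝟘 i = trans (cong (H i) (unpack-pack (zeroZ p p))) (proj₁ (subgroup i))

    H-⊕ : ∀ i x y → x ∈ H′ i → y ∈ H′ i → x ⊕ y ∈ H′ i
    H-⊕ i x y a b = trans (cong (H i) (unpack-⊕ x y)) (proj₁ (proj₂ (subgroup i)) _ _ a b)

    H-⊖ : ∀ i x → x ∈ H′ i → ⊖ x ∈ H′ i
    H-⊖ i x a = trans (cong (H i) (unpack-⊖ x)) (proj₁ (proj₂ (proj₂ (subgroup i))) _ a)

    H-size : ∀ i → count (H′ i) ≡ p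
    H-size i = trans (sumF-combine p p (λ x → ⟦ H′ i x ⟧)) (trans (sumF-cong {p} (λ a → sumF-cong {p} (λ b → cong (λ g → ⟦ H i g ⟧) (remQuot-combine {p} {p} a b))))
      (proj₂ (proj₂ (proj₂ (subgroup i)))))

    line⊆H : ∀ i {a} → a ∈ H′ i → ∀ {x} → PL.Line a x → x ∈ H′ i
    line⊆H i {a} ha (j , e) = subst (_∈ H′ i) (sym e) (go (toℕ j))
      where
      go : ∀ k → k · a ∈ H′ i
      go zero    = H-𝟘 i
      go (suc k) = H-⊕ i a (k · a) ha (go k)

    -- A subgroup of order `p` contains the line of each of its nonzero elements, and such a line
    -- already has `p` elements.
    H-line : ∀ i {a} → a ≢ 𝟘 → a ∈ H′ i → ∀ x → H′ i x ≡ ⌊ PL.Line? a x ⌋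
    H-line i {a} na ha x = bool-ext
      (count-⊆-≥ {A = λ x → ⌊ PL.Line? a x ⌋} {B = H′ i} (λ x l → line⊆H i ha (fromYes (PL.Line? a x) l)) (≤-reflexive (trans (H-size i) (sym (PL.line-size na)))) x)
      (λ l → line⊆H i ha (fromYes (PL.Line? a x) l))

    H∩H : ∀ {i j} → i ≢ j → ∀ x → x ∈ H′ i → x ∈ H′ j → x ≡ 𝟘
    H∩H {i} {j} ne x a b with x ≟F 𝟘
    ... | yes e = e
    ... | no nx = contradiction (λ g → trans (cong (H i) (sym (unpack-pack g))) (trans (trans (H-line i nx a (pack g)) (sym (H-line j nx b (pack g)))) (cong (H j) (unpack-pack g)))) (distinct i j ne)

    abstract
      -- Cosets are numbered by `Fin p`: their number times `p` is p². The labels become the points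
      -- of the `i`-th group of the design.
      labelling : ∀ i → Σ (V → Fin p) λ β → (∀ x y → β x ≡ β y → ⊖ x ⊕ y ∈ H′ i) × (∀ x y → ⊖ x ⊕ y ∈ H′ i → β x ≡ β y)
      labelling i = (λ x → F.cast t≡p (label x)) , (λ x y e → same-coset x y (cast-injective (label x) (label y) e)) , (λ x y h → cong (F.cast t≡p) (coset-same x y h))
        where
        open Cosets torus (H′ i) (H-𝟘 i) (H-⊕ i) (H-⊖ i)
        open Canonical
        t≡p : count Rb ≡ p
        t≡p = *-cancelʳ-≡ (count Rb) p p (trans (cong (count Rb *_) (sym (H-size i))) size)
        cast-injective : ∀ a b → F.cast t≡p a ≡ F.cast t≡p b → a ≡ b
        cast-injective a b e = toℕ-injective (trans (sym (FP.toℕ-cast t≡p a)) (trans (cong toℕ e) (FP.toℕ-cast t≡p b)))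

    β : Fin r → V → Fin p
    β i = proj₁ (labelling i)

    β-same : ∀ i x y → β i x ≡ β i y → ⊖ x ⊕ y ∈ H′ i
    β-same i = proj₁ (proj₂ (labelling i))

    same-β : ∀ i x y → ⊖ x ⊕ y ∈ H′ i → β i x ≡ β i y
    same-β i = proj₂ (proj₂ (labelling i))

    E : Fin r → V → V → Bool
    E i x y = β i x ==F β i y

    E-H : ∀ i x y → E i x y ≡ H′ i (⊖ x ⊕ y)
    E-H i x y = bool-ext (λ h → β-same i x y (==F-sound h)) (λ h → toYes (_ ≟F _) (same-β i x y h))

    E-fibre : ∀ i x → count (E i x) ≡ p
    E-fibre i x = trans (sumF-cong (λ z → cong ⟦_⟧ (E-H i x z))) (trans (count-shift (⊖ x ⊕_) (x ⊕_)
      (gsolve 2 (λ x z → x :+ (:- x :+ z) := z) refl x) (gsolve 2 (λ x z → :- x :+ (x :+ z) := z) refl x) (H′ i)) (H-size i))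

    difference : ∀ {x y} → ⊖ x ⊕ y ≡ 𝟘 → x ≡ y
    difference {x} {y} e = sym (⊖≡𝟘⇒≡ (trans (⊕-comm y (⊖ x)) e))

    separate : ∀ {i j} → i ≢ j → ∀ {x y} → β i x ≡ β i y → β j x ≡ β j y → x ≡ y
    separate {i} {j} ne {x} {y} a b = difference (H∩H {i} {j} ne (⊖ x ⊕ y) (β-same i x y a) (β-same j x y b))

    abstract
      -- Distinct subgroups of order `p` meet trivially, so two labels determine the element; since
      -- there are as many pairs of labels as elements, every pair occurs.
      meet : ∀ {i j} → i ≢ j → ∀ a b → count (λ x → (β i x ==F a) ∧ (β j x ==F b)) ≡ 1
      meet {i} {j} ne a b = finish (injective⇒onto f f-injective (combine a b))
        where
        f : V → V
        f x = combine (β i x) (β j x)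
        f-injective : ∀ x y → f x ≡ f y → x ≡ y
        f-injective x y e = let (q , q') = FP.combine-injective (β i x) (β j x) (β i y) (β j y) e in separate {i} {j} ne q q'
        finish : (∃ λ x → f x ≡ combine a b) → count (λ x → (β i x ==F a) ∧ (β j x ==F b)) ≡ 1
        finish (x , e) = count-unique≡1 (λ x → (β i x ==F a) ∧ (β j x ==F b)) x (∧-intro (toYes (β i x ≟F a) xa) (toYes (β j x ≟F b) xb))
          (λ y h → let (ya , yb) = ∧-elim {β i y ==F a} h in separate {i} {j} ne {y} {x} (trans (==F-sound ya) (sym xa)) (trans (==F-sound yb) (sym xb)))
          where
          xa : β i x ≡ a
          xa = FP.combine-injectiveˡ (β i x) (β j x) a b e
          xb : β j x ≡ b
          xb = FP.combine-injectiveʳ (β i x) (β j x) a b e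

    zero-test : ∀ x y → (diffZ p p (unpack x) (unpack y) ==P zeroZ p p) ≡ (x ==F y)
    zero-test x y = trans (cong (_==P zeroZ p p) (sym (diff x y))) (bool-ext
      (λ h → toYes (x ≟F y) (difference (trans (sym (combine-remQuot {p} p (⊖ x ⊕ y))) (to (unpack (⊖ x ⊕ y)) h))))
      (λ h → trans (cong (λ u → unpack (⊖ x ⊕ u) ==P zeroZ p p) (sym (==F-sound h))) (trans (cong (λ u → unpack u ==P zeroZ p p) (⊕-inverseˡ x)) (trans (cong (_==P zeroZ p p) (unpack-pack (zeroZ p p))) (∧-intro (==F-refl (0 mod p)) (==F-refl (0 mod p)))))))
      where
      to : ∀ g → (g ==P zeroZ p p) ≡ true → pack g ≡ 𝟘
      to (a , b) h = let (q , q') = ∧-elim {a ==F (0 mod p)} h in cong₂ combine (==F-sound q) (==F-sound q')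

    adj≡ : ∀ x y → adj Γ x y ≡ not (x ==F y) ∧ anyF (λ i → E i x y)
    adj≡ x y = trans (∧-comm (anyF (λ i → H i (diffZ p p (unpack x) (unpack y)))) (not (diffZ p p (unpack x) (unpack y) ==P zeroZ p p))) (cong₂ (λ a b → not a ∧ b) (zero-test x y) (bool-ext
      (λ h → let (i , e) = anyF-elim (λ i → H i (diffZ p p (unpack x) (unpack y))) h in anyF-intro (λ i → E i x y) i (trans (E-diff i) e))
      (λ h → let (i , e) = anyF-elim (λ i → E i x y) h in anyF-intro (λ i → H i (diffZ p p (unpack x) (unpack y))) i (trans (sym (E-diff i)) e))))
      where
      E-diff : ∀ i → E i x y ≡ H i (diffZ p p (unpack x) (unpack y))
      E-diff i = trans (E-H i x y) (cong (H i) (diff x y))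

    -- Distinct elements share at most one label, while an element shares all `r` labels with
    -- itself. Adjacency becomes a sum over `i` with a diagonal correction, a form in which products
    -- can be expanded.
    adj-E : ∀ x y → ⟦ adj Γ x y ⟧ + r * ⟦ x ==F y ⟧ ≡ count (λ i → E i x y)
    adj-E x y = trans (cong (λ a → ⟦ a ⟧ + r * ⟦ x ==F y ⟧) (adj≡ x y)) (go (x ≟F y))
      where
      go : Dec (x ≡ y) → ⟦ not (x ==F y) ∧ anyF (λ i → E i x y) ⟧ + r * ⟦ x ==F y ⟧ ≡ count (λ i → E i x y)
      go (yes e) = trans (cong (λ b → ⟦ not b ∧ anyF (λ i → E i x y) ⟧ + r * ⟦ b ⟧) (toYes (x ≟F y) e)) (trans (*-identityʳ r)
        (sym (trans (sumF-cong (λ i → ⟦⟧-true (toYes (β i x ≟F β i y) (cong (β i) e)))) (count-all r))))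
      go (no ne) = trans (cong (λ b → ⟦ not b ∧ anyF (λ i → E i x y) ⟧ + r * ⟦ b ⟧) (toNo (x ≟F y) ne)) (trans (cong (⟦ anyF (λ i → E i x y) ⟧ +_) (*-zeroʳ r))
        (trans (+-identityʳ _) (one (any? (λ i → ∈? (λ i → E i x y) i)))))
        where
        one : Dec (∃ λ i → E i x y ≡ true) → ⟦ anyF (λ i → E i x y) ⟧ ≡ count (λ i → E i x y)
        one (yes (i , h)) = trans (⟦⟧-true (anyF-intro (λ i → E i x y) i h)) (sym (count-unique≡1 (λ i → E i x y) i h (λ j h' → uniq j h')))
          where
          uniq : ∀ j → E j x y ≡ true → j ≡ i
          uniq j h' with j ≟F i
          ... | yes e = e
          ... | no n = contradiction (separate {j} {i} n (==F-sound h') (==F-sound h)) ne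
        one (no none) = trans (⟦⟧-false (¬true⇒false (λ h → none (anyF-elim (λ i → E i x y) h)))) (sym (count-empty (λ i → E i x y) (λ i h → none (i , h))))

    E-sum : ∀ {x y} → x ≢ y → count (λ i → E i x y) ≡ ⟦ adj Γ x y ⟧
    E-sum {x} {y} ne = trans (sym (adj-E x y)) (trans (cong (λ b → ⟦ adj Γ x y ⟧ + r * ⟦ b ⟧) (toNo (x ≟F y) ne)) (trans (cong (⟦ adj Γ x y ⟧ +_) (*-zeroʳ r)) (+-identityʳ _)))

    simple : IsSimple Γ
    simple = (λ x → trans (adj≡ x x) (cong (λ b → not b ∧ anyF (λ i → E i x x)) (==F-refl x)))
      , λ x y → trans (adj≡ x y) (trans (cong₂ (λ a b → not a ∧ b) (==F-sym x y) (anyF-cong (λ i → ==F-sym (β i x) (β i y)))) (sym (adj≡ y x)))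
      where
      anyF-cong : ∀ {M} {f g : Fin M → Bool} → (∀ i → f i ≡ g i) → anyF f ≡ anyF g
      anyF-cong {zero}  h = refl
      anyF-cong {suc M} h = cong₂ _∨_ (h fzero) (anyF-cong (λ i → h (fsuc i)))

    degree : ∀ x → count (adj Γ x) ≡ r * (p ∸ 1)
    degree x = begin
      count (adj Γ x)                ≡⟨ m+n∸n≡m (count (adj Γ x)) r ⟨
      (count (adj Γ x) + r) ∸ r      ≡⟨ cong (_∸ r) total ⟩
      r * p ∸ r                      ≡⟨ cong (r * p ∸_) (*-identityʳ r) ⟨
      r * p ∸ r * 1                  ≡⟨ *-distribˡ-∸ r p 1 ⟨
      r * (p ∸ 1)                    ∎
      where
      open ≡-Reasoning
      total : count (adj Γ x) + r ≡ r * p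
      total = begin
        count (adj Γ x) + r
          ≡⟨ cong (count (adj Γ x) +_) (trans (sumF-*ˡ {N} r (λ z → ⟦ x ==F z ⟧)) (trans (cong (r *_) (trans (sumF-cong {N} (λ z → cong ⟦_⟧ (==F-sym x z))) (count-δ x))) (*-identityʳ r))) ⟨
        count (adj Γ x) + sumF {N} (λ z → r * ⟦ x ==F z ⟧)
          ≡⟨ sumF-+ (λ z → ⟦ adj Γ x z ⟧) (λ z → r * ⟦ x ==F z ⟧) ⟨
        sumF {N} (λ z → ⟦ adj Γ x z ⟧ + r * ⟦ x ==F z ⟧)  ≡⟨ sumF-cong (adj-E x) ⟩
        sumF {N} (λ z → sumF {r} (λ i → ⟦ E i x z ⟧))     ≡⟨ sumF-swap {N} {r} (λ z i → ⟦ E i x z ⟧) ⟩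
        sumF {r} (λ i → count (E i x))                    ≡⟨ sumF-cong {r} (λ i → E-fibre i x) ⟩
        sumF {r} (λ _ → p)                                ≡⟨ sumF-const r p ⟩
        r * p                                             ∎

    -- Cosets of the same subgroup are equal or disjoint; cosets of different ones meet in a single
    -- element.
    pairs : ∀ x y i j → sumF {N} (λ z → ⟦ E i x z ⟧ * ⟦ E j y z ⟧) ≡ ⟦ j ==F i ⟧ * (p * ⟦ E i x y ⟧) + ⟦ not (j ==F i) ⟧
    pairs x y i j = go (j ≟F i)
      where
      go : Dec (j ≡ i) → sumF {N} (λ z → ⟦ E i x z ⟧ * ⟦ E j y z ⟧) ≡ ⟦ j ==F i ⟧ * (p * ⟦ E i x y ⟧) + ⟦ not (j ==F i) ⟧
      go (no ne) = trans (trans (sumF-cong {N} (λ z → trans (sym (⟦⟧-∧ (E i x z) (E j y z))) (cong₂ (λ a b → ⟦ a ∧ b ⟧) (==F-sym (β i x) (β i z)) (==F-sym (β j y) (β j z)))))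
          (meet (λ e → ne (sym e)) (β i x) (β j y)))
        (cong (λ b → ⟦ b ⟧ * (p * ⟦ E i x y ⟧) + ⟦ not b ⟧) (sym (toNo (j ≟F i) ne)))
      go (yes refl) = trans (diag (E i x y) refl) (trans (sym (trans (+-identityʳ _) (+-identityʳ _))) (cong (λ b → ⟦ b ⟧ * (p * ⟦ E i x y ⟧) + ⟦ not b ⟧) (sym (==F-refl i))))
        where
        diag : ∀ b → E i x y ≡ b → sumF {N} (λ z → ⟦ E i x z ⟧ * ⟦ E i y z ⟧) ≡ p * ⟦ E i x y ⟧
        diag true e = trans (sumF-cong {N} (λ z → trans (cong (λ u → ⟦ E i x z ⟧ * ⟦ u ==F β i z ⟧) (sym (==F-sound e))) (idem (E i x z))))
          (trans (E-fibre i x) (sym (trans (cong (p *_) (⟦⟧-true e)) (*-identityʳ p))))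
          where
          idem : ∀ b → ⟦ b ⟧ * ⟦ b ⟧ ≡ ⟦ b ⟧
          idem true  = refl
          idem false = refl
        diag false e = trans (sumF-cong {N} (λ z → trans (sym (⟦⟧-∧ (E i x z) (E i y z))) (⟦⟧-false (¬true⇒false (λ h → let (a , b) = ∧-elim {E i x z} h in
            true≢false (toYes (β i x ≟F β i y) (trans (==F-sound a) (sym (==F-sound b)))) e)))))
          (trans (sumF-0 N) (sym (trans (cong (p *_) (⟦⟧-false e)) (*-zeroʳ p))))

    -- Both sides count ∑_z ∑_{i,j} E_i(x,z) E_j(y,z).
    common : ∀ {x y} → x ≢ y → commonNbrs Γ x y + r * ⟦ adj Γ x y ⟧ + r * ⟦ adj Γ x y ⟧ ≡ p * ⟦ adj Γ x y ⟧ + r * (r ∸ 1)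
    common {x} {y} ne = trans (sym left) right
      where
      open ≡-Reasoning
      Σ′ : ℕ
      Σ′ = sumF {N} (λ z → count (λ i → E i x z) * count (λ j → E j y z))
      a b u v : V → ℕ
      a z = ⟦ adj Γ x z ⟧
      b z = ⟦ adj Γ y z ⟧
      u z = ⟦ x ==F z ⟧
      v z = ⟦ y ==F z ⟧
      select : ∀ w (f : V → ℕ) → sumF {N} (λ z → ⟦ w ==F z ⟧ * f z) ≡ f w
      select w f = trans (sumF-cong {N} (λ z → cong (λ t → ⟦ t ⟧ * f z) (==F-sym w z))) (sumF-δ f w)
      left : Σ′ ≡ commonNbrs Γ x y + r * ⟦ adj Γ x y ⟧ + r * ⟦ adj Γ x y ⟧
      left = begin
        Σ′ ≡⟨ sumF-cong {N} (λ z → trans (cong₂ _*_ (sym (adj-E x z)) (sym (adj-E y z))) (expand (a z) (b z) (u z) (v z) r)) ⟩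
        sumF {N} (λ z → ((a z * b z + r * (v z * a z)) + r * (u z * b z)) + r * r * (u z * v z))
          ≡⟨ sumF-+ (λ z → (a z * b z + r * (v z * a z)) + r * (u z * b z)) (λ z → r * r * (u z * v z)) ⟩
        sumF {N} (λ z → (a z * b z + r * (v z * a z)) + r * (u z * b z)) + sumF {N} (λ z → r * r * (u z * v z))
          ≡⟨ cong₂ _+_ (trans (sumF-+ (λ z → a z * b z + r * (v z * a z)) (λ z → r * (u z * b z))) (cong (_+ sumF {N} (λ z → r * (u z * b z))) (sumF-+ (λ z → a z * b z) (λ z → r * (v z * a z)))))
               (trans (sumF-*ˡ {N} (r * r) (λ z → u z * v z)) (trans (cong (r * r *_) (trans (select x v) (⟦⟧-false (toNo (y ≟F x) (λ e → ne (sym e)))))) (*-zeroʳ (r * r)))) ⟩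
        ((sumF {N} (λ z → a z * b z) + sumF {N} (λ z → r * (v z * a z))) + sumF {N} (λ z → r * (u z * b z))) + 0
          ≡⟨ +-identityʳ _ ⟩
        (sumF {N} (λ z → a z * b z) + sumF {N} (λ z → r * (v z * a z))) + sumF {N} (λ z → r * (u z * b z))
          ≡⟨ cong₂ _+_ (cong₂ _+_ (sumF-cong {N} (λ z → sym (⟦⟧-∧ (adj Γ x z) (adj Γ y z)))) (trans (sumF-*ˡ {N} r (λ z → v z * a z)) (cong (r *_) (select y a))))
               (trans (sumF-*ˡ {N} r (λ z → u z * b z)) (cong (r *_) (trans (select x b) (cong ⟦_⟧ (proj₂ simple y x))))) ⟩
        commonNbrs Γ x y + r * ⟦ adj Γ x y ⟧ + r * ⟦ adj Γ x y ⟧ ∎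
      right : Σ′ ≡ p * ⟦ adj Γ x y ⟧ + r * (r ∸ 1)
      right = begin
        Σ′ ≡⟨ sumF-cong {N} (λ z → trans (sym (sumF-*ʳ {r} (count (λ j → E j y z)) (λ i → ⟦ E i x z ⟧))) (sumF-cong {r} (λ i → sym (sumF-*ˡ {r} ⟦ E i x z ⟧ (λ j → ⟦ E j y z ⟧))))) ⟩
        sumF {N} (λ z → sumF {r} (λ i → sumF {r} (λ j → ⟦ E i x z ⟧ * ⟦ E j y z ⟧)))
          ≡⟨ sumF-swap {N} {r} (λ z i → sumF {r} (λ j → ⟦ E i x z ⟧ * ⟦ E j y z ⟧)) ⟩
        sumF {r} (λ i → sumF {N} (λ z → sumF {r} (λ j → ⟦ E i x z ⟧ * ⟦ E j y z ⟧)))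
          ≡⟨ sumF-cong {r} (λ i → trans (sumF-swap {N} {r} (λ z j → ⟦ E i x z ⟧ * ⟦ E j y z ⟧)) (sumF-cong {r} (pairs x y i))) ⟩
        sumF {r} (λ i → sumF {r} (λ j → ⟦ j ==F i ⟧ * (p * ⟦ E i x y ⟧) + ⟦ not (j ==F i) ⟧))
          ≡⟨ sumF-cong {r} (λ i → trans (sumF-+ {r} (λ j → ⟦ j ==F i ⟧ * (p * ⟦ E i x y ⟧)) (λ j → ⟦ not (j ==F i) ⟧))
               (cong₂ _+_ (sumF-δ (λ _ → p * ⟦ E i x y ⟧) i) (trans (count-not (_==F i)) (cong (r ∸_) (count-δ i))))) ⟩
        sumF {r} (λ i → p * ⟦ E i x y ⟧ + (r ∸ 1))
          ≡⟨ trans (sumF-+ {r} (λ i → p * ⟦ E i x y ⟧) (λ _ → r ∸ 1)) (cong₂ _+_ (trans (sumF-*ˡ {r} p (λ i → ⟦ E i x y ⟧)) (cong (p *_) (E-sum ne))) (sumF-const r (r ∸ 1))) ⟩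
        p * ⟦ adj Γ x y ⟧ + r * (r ∸ 1) ∎

    common-adjacent : ∀ x y → x ≢ y → adj Γ x y ≡ true → commonNbrs Γ x y ≡ (p + r * r) ∸ (3 * r)
    common-adjacent x y ne e = adjacent-parameter (commonNbrs Γ x y) p r (≤-trans (s≤s z≤n) r≥2)
      (subst (λ t → commonNbrs Γ x y + r * t + r * t ≡ p * t + r * (r ∸ 1)) (⟦⟧-true e) (common ne))

    common-nonadjacent : ∀ x y → x ≢ y → adj Γ x y ≡ false → commonNbrs Γ x y ≡ r * r ∸ r
    common-nonadjacent x y ne e = nonadjacent-parameter (commonNbrs Γ x y) p r
      (subst (λ t → commonNbrs Γ x y + r * t + r * t ≡ p * t + r * (r ∸ 1)) (⟦⟧-false e) (common ne))

  stronglyRegular : StronglyRegular Γ (p * p) (r * (p ∸ 1)) ((p + r * r) ∸ (3 * r)) (r * r ∸ r)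
  stronglyRegular = refl , simple , degree , common-adjacent , common-nonadjacent

  union-distanceRegular : DistanceRegular Γ
  union-distanceRegular = DiameterTwo.distanceRegular Γ (r * (p ∸ 1)) ((p + r * r) ∸ (3 * r)) (r * r ∸ r) simple degree common-adjacent common-nonadjacent
    (λ x y ne e → let (z , h) = count-∃ (λ z → adj Γ x z ∧ adj Γ y z) (≤-trans μ>0 (≤-reflexive (sym (common-nonadjacent x y ne e))))
                      (h₁ , h₂) = ∧-elim {adj Γ x z} h in z , h₁ , trans (proj₂ simple z y) h₂)
    where
    μ>0 : 1 ≤ r * r ∸ r
    μ>0 = m<n⇒0<n∸m (m<m*n r r {{>-nonZero (≤-trans (s≤s z≤n) r≥2)}} r≥2)

  -- Group elements serve as lines and cosets as points: an element lies on the cosets that contain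
  -- it, and the cosets of one subgroup form a group of points.
  transversalDesign : TransversalDesign r p
  transversalDesign = record
    { L = p * p
    ; line = λ { l (i , a) → β i l ==F a }
    ; lineSize = λ l → trans (sumF-cong {r} (λ i → trans (sumF-cong {p} (λ a → cong ⟦_⟧ (==F-sym (β i l) a))) (count-δ (β i l)))) (trans (sumF-const r 1) (*-identityʳ r))
    ; distinctGroups = λ { (i , a) (j , b) _ ne → meet ne a b }
    ; sameGroup = λ { (i , a) (.i , b) ne refl → count-empty _ (λ l h → let (q , q') = ∧-elim {β i l ==F a} h in
        ne (cong (i ,_) (trans (sym (==F-sound q)) (==F-sound q')))) } }

  lineGraph-iso : Iso Γ (LineGraph transversalDesign)
  lineGraph-iso = identity-iso _ _ (λ x y → trans (adj≡ x y) (cong (not (x ==F y) ∧_) (bool-ext (to x y) (from x y))))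
    where
    meets : V → V → Fin r × Fin p → Bool
    meets x y (i , a) = (β i x ==F a) ∧ (β i y ==F a)
    to : ∀ x y → anyF (λ i → E i x y) ≡ true → anyP (λ g → TransversalDesign.line transversalDesign x g ∧ TransversalDesign.line transversalDesign y g) ≡ true
    to x y h = let (i , e) = anyF-elim (λ i → E i x y) h in
      anyF-intro (λ i → anyF (λ a → meets x y (i , a))) i (anyF-intro (λ a → meets x y (i , a)) (β i x) (∧-intro (==F-refl (β i x)) (toYes (_ ≟F _) (sym (==F-sound e)))))
    from : ∀ x y → anyP (λ g → TransversalDesign.line transversalDesign x g ∧ TransversalDesign.line transversalDesign y g) ≡ true → anyF (λ i → E i x y) ≡ true
    from x y h = let (i , e) = anyF-elim (λ i → anyF (λ a → meets x y (i , a))) h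
                     (a , e') = anyF-elim (λ a → meets x y (i , a)) e
                     (q , q') = ∧-elim {β i x ==F a} e'
                 in anyF-intro (λ i → E i x y) i (toYes (_ ≟F _) (trans (==F-sound q) (sym (==F-sound q'))))

-- The converse and the assembled result

module Backward (p : ℕ) .{{p≢0 : NonZero p}} (pp : Prime p) (p≥3 : 3 ≤ p) where
  backward : ∀ n .{{_ : NonZero n}} {Γ} → InList n p Γ → DistanceRegular Γ
  backward n (inj₁ iso) = iso-distanceRegular iso (complete-distanceRegular (n * p))
  backward n (inj₂ (inj₁ (t , m , t≥2 , _ , iso))) = iso-distanceRegular iso (multipartite-distanceRegular t m t≥2)
  backward n (inj₂ (inj₂ (inj₁ (n%4 , m , 2m≡np , iso)))) = iso-distanceRegular iso (Crown.crown-distanceRegular m m≥3)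
    where
    -- `2 * m` equals `n * p` and is at least 6, so the crown graph has the three indices its
    -- distance formula requires.
    n≥2 : 2 ≤ n
    n≥2 = ≤-trans (≤-reflexive (sym n%4)) (m%n≤m n 4)
    m≥3 : 3 ≤ m
    m≥3 = *-cancelˡ-≤ 2 (≤-trans (*-mono-≤ n≥2 p≥3) (≤-reflexive (sym 2m≡np)))
  backward n (inj₂ (inj₂ (inj₂ (r , H , d , iso)))) = iso-distanceRegular iso (LineUnion.union-distanceRegular p pp r H d)

theorem1p4 : (p : ℕ) .{{_ : NonZero p}} → Prime p → p % 2 ≡ 1 →
    ((n : ℕ) .{{_ : NonZero n}} → p ∣ n →
    (S : Zsum n p → Bool) → InverseClosed n p S → S (zeroZ n p) ≡ false →
    (DistanceRegular (Cay n p S) ⇔ InList n p (Cay n p S)))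
    × ((r : ℕ) (H : Fin r → Zsum p p → Bool) → ItemIVData p r H →
    (∃ λ (T : TransversalDesign r p) → Iso (Cay p p (unionMinusZero p H)) (LineGraph T))
    × StronglyRegular (Cay p p (unionMinusZero p H))
    (p * p) (r * (p ∸ 1)) ((p + r * r) ∸ (3 * r)) (r * r ∸ r))
theorem1p4 p pp odd =
  (λ n p∣n S closed S-0 → mk⇔ (Forward.forward p pp odd n p∣n S closed S-0) (Backward.backward p pp (Classification.p≥3 p pp odd) n)) ,
  (λ r H d → let open LineUnion p pp r H d in (transversalDesign , lineGraph-iso) , stronglyRegular)
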